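{- Let $W$ be the affine Weyl group of type $\tilde B_2$ and let $u,w\in c_2$ with $u<w$, $u\sim_L w$ and $u\sim_R w$. (i) If $s\notin\mathcal{L}(u)\cup\mathcal{R}(u)$, then $\mu(u,w)=1$ if $l(w)-l(u)=3$ and $0$ otherwise. (ii) If $s\in\mathcal{L}(u)\setminus\mathcal{R}(u)$ or $s\in\mathcal{R}(u)\setminus\mathcal{L}(u)$, then $\mu(u,w)=2$ if $l(w)-l(u)=3$ and $0$ otherwise. (iii) If $s\in\mathcal{L}(u)\cap\mathcal{R}(u)$, then $\mu(u,w)=3$ if $l(w)-l(u)=3$ and $0$ otherwise.
   Context: $W$ is the Coxeter group with simple reflections $S=\{r,s,t\}$ and relations $r^2=s^2=t^2=e$, $rt=tr$, $(rs)^4=(st)^4=e$; $l$ is the length and $\le$ the Bruhat order. $\mathcal{L}(w)=\{s'\in S\mid s'w<w\}$, $\mathcal{R}(w)=\{s'\in S\mid ws'<w\}$. $\sim_L,\sim_R$ are the Kazhdan–Lusztig left and right cell equivalences. $c_2=\{w\in W\mid a(w)=2\}$ for Lusztig's $a$-function; explicitly $c_2=\{u\,rt(srt)^m\,v\mid u\in\{e,s,ts,rs\},\ v\in\{e,s,st,sr\},\ m\in\mathbb{N}\}$. $P_{u,w}$ are the Kazhdan–Lusztig polynomials and, for $u\le w$, $\mu(u,w)$ is the coefficient of $q^{\frac12(l(w)-l(u)-1)}$ in $P_{u,w}$ (zero if the exponent is not an integer). -}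

module Defs where

-- The affine Weyl group W of type B~2 (= C~2) with simple reflections
-- S = {r, s, t}, r t = t r, (r s)^4 = (s t)^4 = e, realised faithfully as
-- the group of affine maps of Z^2 of the form  p |-> L p + (a , b)  with
-- L a signed permutation matrix (the hyperoctahedral group B2) and
-- (a , b) in Z^2.  The simple reflections are
--   s : (x , y) |-> (y , x)        t : (x , y) |-> (x , - y)
--   r : (x , y) |-> (1 - x , y)
-- (reflections in the walls y = x, y = 0, x = 1/2 of the alcove
--  0 <= y <= x <= 1/2).  Every element of this group is a product of
-- r, s, t, and this is exactly the Coxeter group with the given
-- presentation.

open import Data.Bool using (Bool; true; false; if_then_else_; _xor_; not; _∧_; _∨_)
open import Data.Nat using (ℕ; zero; suc; _<_; _∸_; _≡ᵇ_; _<ᵇ_; _+_)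
open import Data.Nat.DivMod using (_/_; _%_)
open import Data.Integer using (ℤ; +_; -_) renaming (_+_ to _+ℤ_; _*_ to _*ℤ_; _≟_ to _≟ℤ_)
open import Data.List using (List; []; _∷_; _++_; map; length; concat; replicate; concatMap; foldr)
open import Data.List.Membership.Propositional using (_∈_)
open import Data.Product using (_×_; _,_; proj₁; proj₂; Σ)
open import Data.Sum using (_⊎_)
open import Data.Empty using (⊥)
open import Relation.Nullary using (Dec; yes; no; ¬_)
open import Relation.Nullary.Decidable using (⌊_⌋)
open import Relation.Binary.PropositionalEquality using (_≡_; _≢_)
import Data.Bool.Properties as BoolP

data Gen : Set where
  r s t : Gen

record W : Set where
  constructor mkW
  field
    sw : Bool   -- swap the two coordinates first
    n₁ : Bool   -- then negate the first coordinate
    n₂ : Bool   -- and/or the second coordinate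
    a  : ℤ      -- then translate by (a , b)
    b  : ℤ

open W public

sgn : Bool → ℤ → ℤ
sgn true  x = - x
sgn false x = x

linApp : Bool → Bool → Bool → ℤ × ℤ → ℤ × ℤ
linApp sw n₁ n₂ (x , y) =
  if sw then (sgn n₁ y , sgn n₂ x) else (sgn n₁ x , sgn n₂ y)

-- multiplication = composition of maps: (u · v) p = u (v p)
infixl 7 _·_
_·_ : W → W → W
mkW sw n₁ n₂ a b · mkW sw' m₁ m₂ c d =
  mkW (sw xor sw')
      (n₁ xor (if sw then m₂ else m₁))
      (n₂ xor (if sw then m₁ else m₂))
      (proj₁ (linApp sw n₁ n₂ (c , d)) +ℤ a)
      (proj₂ (linApp sw n₁ n₂ (c , d)) +ℤ b)

e : W
e = mkW false false false (+ 0) (+ 0)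

gen : Gen → W
gen r = mkW false true  false (+ 1) (+ 0)
gen s = mkW true  false false (+ 0) (+ 0)
gen t = mkW false false true  (+ 0) (+ 0)

eval : List Gen → W
eval []       = e
eval (g ∷ gs) = gen g · eval gs

_≟W_ : (u v : W) → Dec (u ≡ v)
mkW a₁ a₂ a₃ a₄ a₅ ≟W mkW b₁ b₂ b₃ b₄ b₅
  with a₁ BoolP.≟ b₁ | a₂ BoolP.≟ b₂ | a₃ BoolP.≟ b₃ | a₄ ≟ℤ b₄ | a₅ ≟ℤ b₅
... | yes _≡_.refl | yes _≡_.refl | yes _≡_.refl | yes _≡_.refl | yes _≡_.refl = yes _≡_.refl
... | no p | _ | _ | _ | _ = no λ { _≡_.refl → p _≡_.refl }
... | yes _ | no p | _ | _ | _ = no λ { _≡_.refl → p _≡_.refl }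
... | yes _ | yes _ | no p | _ | _ = no λ { _≡_.refl → p _≡_.refl }
... | yes _ | yes _ | yes _ | no p | _ = no λ { _≡_.refl → p _≡_.refl }
... | yes _ | yes _ | yes _ | yes _ | no p = no λ { _≡_.refl → p _≡_.refl }

_==_ : W → W → Bool
u == v = ⌊ u ≟W v ⌋

-- An explicit (not necessarily reduced) word for every element; it is
-- only used as an upper bound for the search for a reduced word.

-- translation by (1,0) is r s t s, by (-1,0) is s t s r,
-- by (0,1) is s r s t, by (0,-1) is t s r s
transWord : ℤ → List Gen → List Gen → List Gen
transWord (+ n)      pos neg = concat (replicate n pos)
transWord (ℤ.negsuc n) pos neg = concat (replicate (suc n) neg)

diagWord : Bool → Bool → List Gen
diagWord false false = []
diagWord false true  = t ∷ []
diagWord true  false = s ∷ t ∷ s ∷ []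
diagWord true  true  = t ∷ s ∷ t ∷ s ∷ []

someWord : W → List Gen
someWord (mkW sw n₁ n₂ a b) =
  transWord a (r ∷ s ∷ t ∷ s ∷ []) (s ∷ t ∷ s ∷ r ∷ [])
  ++ transWord b (s ∷ r ∷ s ∷ t ∷ []) (t ∷ s ∷ r ∷ s ∷ [])
  ++ diagWord n₁ n₂
  ++ (if sw then s ∷ [] else [])

-- Length and a reduced word, by breadth-first search:
-- ball n lists every element of W expressible by a word of length ≤ n,
-- each together with a word of minimal length representing it.

gens : List Gen
gens = r ∷ s ∷ t ∷ []

memW : W → List (W × List Gen) → Bool
memW x []             = false
memW x ((y , _) ∷ ys) = (x == y) ∨ memW x ys

addNew : List (W × List Gen) → List (W × List Gen) → List (W × List Gen)
addNew acc []       = acc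
addNew acc (p ∷ ps) =
  if memW (proj₁ p) acc then addNew acc ps else addNew (acc ++ p ∷ []) ps

ball : ℕ → List (W × List Gen)
ball zero    = (e , []) ∷ []
ball (suc n) =
  addNew (ball n)
    (concatMap (λ p → map (λ g → (proj₁ p · gen g , proj₂ p ++ g ∷ [])) gens)
               (ball n))

findWord : W → List (W × List Gen) → List Gen
findWord x []             = []
findWord x ((y , ws) ∷ ys) = if x == y then ws else findWord x ys

redWord : W → List Gen
redWord w = findWord w (ball (length (someWord w)))

len : W → ℕ
len w = length (redWord w)

InL : Gen → W → Set
InL g w = len (gen g · w) < len w

InR : Gen → W → Set
InR g w = len (w · gen g) < len w

inLᵇ : Gen → W → Bool
inLᵇ g w = len (gen g · w) <ᵇ len w

-- Bruhat order: x ≤ w iff x is the value of a subword of a (fixed)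
-- reduced expression of w (subword property).

subwords : List Gen → List (List Gen)
subwords []       = [] ∷ []
subwords (g ∷ gs) = let xs = subwords gs in map (g ∷_) xs ++ xs

belowList : W → List W
belowList w = map eval (subwords (redWord w))

_≤B_ : W → W → Set
x ≤B w = x ∈ belowList w

_<B_ : W → W → Set
x <B w = x ≤B w × x ≢ w

memᵇ : W → List W → Bool
memᵇ x []       = false
memᵇ x (y ∷ ys) = (x == y) ∨ memᵇ x ys

dedup : List W → List W
dedup []       = []
dedup (x ∷ xs) = let ys = dedup xs in if memᵇ x ys then ys else x ∷ ys

interval : W → List W
interval w = dedup (belowList w)

-- Integer polynomials in q, as coefficient lists (constant term first)

Poly : Set
Poly = List ℤ

_⊕_ : Poly → Poly → Poly
[]       ⊕ q        = q
(x ∷ p)  ⊕ []       = x ∷ p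
(x ∷ p)  ⊕ (y ∷ q)  = (x +ℤ y) ∷ (p ⊕ q)

shiftP : ℕ → Poly → Poly
shiftP zero    p = p
shiftP (suc k) p = + 0 ∷ shiftP k p

scaleP : ℤ → Poly → Poly
scaleP c p = map (c *ℤ_) p

coeff : Poly → ℕ → ℤ
coeff []      _       = + 0
coeff (x ∷ p) zero    = x
coeff (x ∷ p) (suc i) = coeff p i

-- Kazhdan–Lusztig polynomials, by the standard recursion
-- (Kazhdan–Lusztig 1979, (2.2.c)):  for w ≠ e pick s with sw < w
-- (the first letter of the reduced word of w), v = sw, c = 1 if sx < x
-- and c = 0 otherwise; then
--   P_{x,w} = q^{1-c} P_{sx,v} + q^c P_{x,v}
--             - Σ_{z < v, sz < z} μ(z,v) q^{(l(w)-l(z))/2} P_{x,z},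
-- with P_{x,w} = 0 unless x ≤ w, and P_{x,e} = δ_{x,e}.
-- The first argument is fuel (any value > l(w) gives the true value).

muFrom : Poly → W → W → ℤ
muFrom p z v =
  if (memᵇ z (belowList v) ∧ not (z == v)) ∧ ((len v ∸ len z) % 2 ≡ᵇ 1)
  then coeff p ((len v ∸ len z ∸ 1) / 2)
  else + 0

KLf : ℕ → W → W → Poly
KLf zero    x w = []
KLf (suc n) x w with redWord w
... | []     = if x == e then + 1 ∷ [] else []
... | g ∷ gs =
  if memᵇ x (belowList w)
  then (term₁ ⊕ term₂) ⊕ sumTerm
  else []
  where
    v  = eval gs
    sx = gen g · x
    c  = inLᵇ g x
    term₁ = if c then KLf n sx v else shiftP 1 (KLf n sx v)
    term₂ = if c then shiftP 1 (KLf n x v) else KLf n x v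
    summand : W → Poly
    summand z =
      if not (z == v) ∧ inLᵇ g z
      then scaleP (- muFrom (KLf n z v) z v)
                  (shiftP ((len w ∸ len z) / 2) (KLf n x z))
      else []
    sumTerm = foldr (λ z acc → summand z ⊕ acc) [] (interval v)

P : W → W → Poly
P x w = KLf (suc (len w)) x w

-- μ(x,w): for x < w the coefficient of q^{(l(w)-l(x)-1)/2} in P_{x,w}
-- (zero when l(w)-l(x) is even); we also set it to 0 when x ≮ w.
μ : W → W → ℤ
μ x w = muFrom (P x w) x w

-- Kazhdan–Lusztig preorders and cells (Kazhdan–Lusztig 1979, §2):
-- x — y  iff  μ(x,y) ≠ 0 or μ(y,x) ≠ 0;
-- x ≤_L y iff there is a chain x = x₀, …, xₙ = y with x_{i-1} — x_i and
-- 𝓛(x_{i-1}) ⊄ 𝓛(x_i); similarly ≤_R with 𝓡.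

Edge : W → W → Set
Edge x y = (μ x y ≢ + 0) ⊎ (μ y x ≢ + 0)

NotSubL : W → W → Set
NotSubL x y = Σ Gen λ g → InL g x × ¬ InL g y

NotSubR : W → W → Set
NotSubR x y = Σ Gen λ g → InR g x × ¬ InR g y

data _≤L_ : W → W → Set where
  ≤L-refl : ∀ {x} → x ≤L x
  ≤L-step : ∀ {x y z} → Edge x y → NotSubL x y → y ≤L z → x ≤L z

data _≤R_ : W → W → Set where
  ≤R-refl : ∀ {x} → x ≤R x
  ≤R-step : ∀ {x y z} → Edge x y → NotSubR x y → y ≤R z → x ≤R z

_∼L_ : W → W → Set
x ∼L y = x ≤L y × y ≤L x

_∼R_ : W → W → Set
x ∼R y = x ≤R y × y ≤R x

-- The two-sided cell c₂ = { u · rt(srt)^m · v | u ∈ {e,s,ts,rs},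
--                           v ∈ {e,s,st,sr}, m ∈ ℕ }

leftFactors : List (List Gen)
leftFactors = [] ∷ (s ∷ []) ∷ (t ∷ s ∷ []) ∷ (r ∷ s ∷ []) ∷ []

rightFactors : List (List Gen)
rightFactors = [] ∷ (s ∷ []) ∷ (s ∷ t ∷ []) ∷ (s ∷ r ∷ []) ∷ []

c2word : List Gen → ℕ → List Gen → List Gen
c2word u m v = u ++ (r ∷ t ∷ concat (replicate m (s ∷ r ∷ t ∷ []))) ++ v

InC2 : W → Set
InC2 w = Σ (List Gen) λ u → Σ (List Gen) λ v → Σ ℕ λ m →
           u ∈ leftFactors × v ∈ rightFactors × w ≡ eval (c2word u m v)

{-# OPTIONS --safe #-}
module Submission where

-- Write x_n = r t (s r t)^n, so that the elements of c_2 are the a x_n b.  If x ≤_L y then R(y) ⊆ R(x), and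
-- symmetrically for ≤_R; hence u ~_L w and u ~_R w force u = a x_m b and w = a x_n b with the same a and b.
-- Comparing coefficients of v^-1 in C_s C_y and C_g C_(sy), g = r or t, reduces μ(a x_m b , a x_n b) to μ(x_m , x_n):
-- each of a = s and b = s adds 1 when n = m + 1, and nothing else changes.
-- Finally C_(x_n) is explicit.  The cosets z ⟨r,t⟩ are the points (X , Y) of a plane lattice with X ≡ Y mod 2, on which
-- r, t, s act by X ↦ -X, Y ↦ -Y and (X , Y) ↦ (Y - 1 , X + 1).  If I_A is the sum of v^l(z) T_z over z in a set A closed
-- under descending by g, then C_g I_A = v I_(A ∩ gA) + v^-1 I_(A ∪ gA), and for a rectangle A both sets are rectangles.
-- With I_n the case of the square |X| , |Y| ≤ n, the elements d_n = Σ_i v^(-i - 3(n-i) - 2) I_(n-i) satisfy a recursion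
-- with bar-invariant coefficients; they are therefore bar-invariant, and d_n = C_(x_n), that is
-- P_(x_m , x_n) = 1 + q + ... + q^(n-m), whence μ(x_m , x_n) = 1 if n = m + 1 and 0 if n > m + 1.

open import Defs
open import Data.Nat using (ℕ; _+_)
open import Data.Integer using (+_)
open import Data.Product using (_×_)
open import Data.Sum using (_⊎_)
open import Relation.Nullary using (¬_)
open import Relation.Binary.PropositionalEquality using (_≡_; _≢_)

open import Data.Bool using (Bool; true; false; if_then_else_; _xor_; not; _∧_; _∨_; T)
import Data.Bool.Properties as 𝔹ₚ
open import Data.Empty using (⊥; ⊥-elim)
open import Data.Integer as ℤ using (ℤ; -[1+_]; -_; +≤+; -≤-) renaming (_+_ to _+ℤ_; _*_ to _*ℤ_; suc to sucℤ; pred to predℤ; _≤_ to _≤ℤ_; _<_ to _<ℤ_; _≟_ to _≟ℤ_)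
import Data.Integer.Properties as ℤₚ
open import Data.Integer.Tactic.RingSolver using (solve-∀)
open import Data.List using (List; []; _∷_; _++_; map; length; concat; replicate; concatMap; foldr; reverse; initLast; _∷ʳ′_)
import Data.List.Properties as Listₚ
open import Data.List.Membership.Propositional using (_∈_; find)
open import Data.List.Membership.Propositional.Properties using (∈-++⁺ˡ; ∈-++⁺ʳ; ∈-++⁻; ∈-map⁺; ∈-map⁻; ∈-concatMap⁺; ∈-concatMap⁻)
import Data.List.Relation.Unary.Any as Any
open import Data.List.Relation.Unary.Any using (here; there)
open import Data.Nat as ℕ using (zero; suc; _≤_; _<_; _<ᵇ_; _≡ᵇ_; _∸_; _⊔_; z≤n; s≤s)
open import Data.Nat.DivMod using (_/_; _%_; m≡m%n+[m/n]*n; [m+kn]%n≡m%n; m*n/n≡m)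
import Data.Nat.Properties as ℕₚ
open import Data.Product using (_,_; proj₁; proj₂; Σ; ∃)
open import Data.Sum using (inj₁; inj₂)
import Data.Sum
open import Relation.Binary.Definitions using (tri<; tri≈; tri>)
open import Relation.Binary.PropositionalEquality using (refl; sym; trans; cong; cong₂; subst; subst₂; module ≡-Reasoning)
open import Relation.Nullary using (Dec; yes; no)
open ≡-Reasoning

-- The group W

-- With q = v^2, C_w is the sum of v^(l(x)-l(w)) P_(x,w)(v^2) T_x, so μ(x,w) is the coefficient of
-- v^-1 T_x in C_w. The given `μ` runs through a breadth-first search, lists of subwords and a
-- recursion with fuel, which cannot be evaluated at a variable element. The bridge is uniqueness:
-- what the recursion computes is the only bar-invariant element with coefficient 1 at w and only
-- negative powers of v elsewhere, so C_(x_n) may be guessed and then recognised. The obstacle is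
-- the bar-invariance of the guess. C_t C_r C_s d_n is d_(n+1) + (v + v^-1) d_n + d_(n-1) plus an
-- error C_r b_n + C_t b'_n, where b_n and b'_n are the analogous sums over squares centred at the
-- vertices fixed by <s,t> and <s,r>. They are reached from d_n by κ_g = C_s C_g C_s - 2 C_s for g =
-- t and g = r. This operator satisfies κ_g C_g = C_(sgsg), and its result is stable under both s
-- and g. Hence three families of squares share one induction.

+-interchange : ∀ p q u v → p +ℤ q +ℤ (u +ℤ v) ≡ p +ℤ u +ℤ (q +ℤ v)
+-interchange = solve-∀

+-swapʳ : ∀ n k j → n +ℤ k +ℤ j ≡ n +ℤ j +ℤ k
+-swapʳ = solve-∀

+-cancel : ∀ n k → n +ℤ k +ℤ - k ≡ n
+-cancel = solve-∀

+-cancel₁ : ∀ p q → p +ℤ q +ℤ - (+ 1) *ℤ q ≡ p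
+-cancel₁ = solve-∀

≡W : ∀ {b₁ b₂ b₃ a b a' b'} → a ≡ a' → b ≡ b' → mkW b₁ b₂ b₃ a b ≡ mkW b₁ b₂ b₃ a' b'
≡W refl refl = refl

+0 : ∀ x → x +ℤ + 0 ≡ x
+0 = ℤₚ.+-identityʳ

neg-+ : ∀ x y → - x +ℤ - y ≡ - (x +ℤ y)
neg-+ x y = sym (ℤₚ.neg-distrib-+ x y)

1-+ : ∀ x y → - (x +ℤ y) +ℤ + 1 ≡ - x +ℤ (- y +ℤ + 1)
1-+ = solve-∀

≡W₅ : ∀ {b₁ b₂ b₃ c₁ c₂ c₃ a b a' b'} → b₁ ≡ c₁ → b₂ ≡ c₂ → b₃ ≡ c₃ → a ≡ a' → b ≡ b' →
      mkW b₁ b₂ b₃ a b ≡ mkW c₁ c₂ c₃ a' b'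
≡W₅ refl refl refl refl refl = refl

not-xor : ∀ b x → not b xor x ≡ not (b xor x)
not-xor true x = sym (𝔹ₚ.not-involutive x)
not-xor false x = refl

sgn-not : ∀ b x → sgn (not b) x ≡ - sgn b x
sgn-not true x = sym (ℤₚ.neg-involutive x)
sgn-not false x = refl

-- The only case of associativity that is checked component by component; `word-induction` extends
-- it to all left factors.
gen-assoc : ∀ g u v → gen g · (u · v) ≡ gen g · u · v
gen-assoc r (mkW false u₂ u₃ a b) (mkW v₁ v₂ v₃ c d) =
  ≡W₅ refl (sym (not-xor u₂ v₂)) refl
    (trans (1-+ (sgn u₂ c) a) (cong (_+ℤ _) (sym (sgn-not u₂ c)))) (trans (+0 _) (cong (sgn u₃ d +ℤ_) (sym (+0 _))))
gen-assoc r (mkW true u₂ u₃ a b) (mkW v₁ v₂ v₃ c d) =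
  ≡W₅ refl (sym (not-xor u₂ v₃)) refl
    (trans (1-+ (sgn u₂ d) a) (cong (_+ℤ _) (sym (sgn-not u₂ d)))) (trans (+0 _) (cong (sgn u₃ c +ℤ_) (sym (+0 _))))
gen-assoc s (mkW false u₂ u₃ a b) (mkW v₁ v₂ v₃ c d) =
  ≡W₅ refl refl refl (trans (+0 _) (cong (sgn u₃ d +ℤ_) (sym (+0 _)))) (trans (+0 _) (cong (sgn u₂ c +ℤ_) (sym (+0 _))))
gen-assoc s (mkW true u₂ u₃ a b) (mkW v₁ v₂ v₃ c d) =
  ≡W₅ (𝔹ₚ.not-involutive v₁) refl refl (trans (+0 _) (cong (sgn u₃ c +ℤ_) (sym (+0 _)))) (trans (+0 _) (cong (sgn u₂ d +ℤ_) (sym (+0 _))))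
gen-assoc t (mkW false u₂ u₃ a b) (mkW v₁ v₂ v₃ c d) =
  ≡W₅ refl refl (sym (not-xor u₃ v₃)) (trans (+0 _) (cong (sgn u₂ c +ℤ_) (sym (+0 _))))
    (trans (+0 _) (trans (sym (neg-+ (sgn u₃ d) b)) (cong₂ _+ℤ_ (sym (sgn-not u₃ d)) (sym (+0 _)))))
gen-assoc t (mkW true u₂ u₃ a b) (mkW v₁ v₂ v₃ c d) =
  ≡W₅ refl refl (sym (not-xor u₃ v₂)) (trans (+0 _) (cong (sgn u₂ d +ℤ_) (sym (+0 _))))
    (trans (+0 _) (trans (sym (neg-+ (sgn u₃ c) b)) (cong₂ _+ℤ_ (sym (sgn-not u₃ c)) (sym (+0 _)))))

·-identityˡ : ∀ w → e · w ≡ w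
·-identityˡ (mkW _ _ _ _ _) = ≡W (+0 _) (+0 _)

gen² : ∀ g → gen g · gen g ≡ e
gen² r = refl
gen² s = refl
gen² t = refl

gen-inv : ∀ g w → gen g · (gen g · w) ≡ w
gen-inv g w = trans (gen-assoc g (gen g) w) (trans (cong (_· w) (gen² g)) (·-identityˡ w))

eval-++ : ∀ A B → eval (A ++ B) ≡ eval A · eval B
eval-++ [] B = sym (·-identityˡ _)
eval-++ (g ∷ A) B = trans (cong (gen g ·_) (eval-++ A B)) (gen-assoc g (eval A) (eval B))

private
  trans-mul : ∀ a c w → mkW false false false a (+ 0) · (mkW false false false (+ 0) c · w)
              ≡ mkW (W.sw w) (W.n₁ w) (W.n₂ w) (W.a w +ℤ a) (W.b w +ℤ c)
  trans-mul a c (mkW _ _ _ x y) = ≡W (cong (_+ℤ a) (+0 x)) (trans (+0 (y +ℤ c)) refl)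

  tx⁺ : ∀ n → eval (concat (replicate n (r ∷ s ∷ t ∷ s ∷ []))) ≡ mkW false false false (+ n) (+ 0)
  tx⁺ zero = refl
  tx⁺ (suc n) rewrite tx⁺ n = ≡W (lem (+ n)) refl
    where lem : ∀ x → - (- (x +ℤ + 0) +ℤ + 0 +ℤ + 0) +ℤ + 1 ≡ + 1 +ℤ x
          lem = solve-∀

  tx⁻ : ∀ n → eval (concat (replicate n (s ∷ t ∷ s ∷ r ∷ []))) ≡ mkW false false false (- (+ n)) (+ 0)
  tx⁻ zero = refl
  tx⁻ (suc n) rewrite tx⁻ n = ≡W (trans (lem (- (+ n))) (sym (ℤₚ.neg-distrib-+ (+ 1) (+ n)))) refl
    where lem : ∀ x → - (- x +ℤ + 1 +ℤ + 0) +ℤ + 0 +ℤ + 0 ≡ - (+ 1) +ℤ x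
          lem = solve-∀

  ty⁺ : ∀ n → eval (concat (replicate n (s ∷ r ∷ s ∷ t ∷ []))) ≡ mkW false false false (+ 0) (+ n)
  ty⁺ zero = refl
  ty⁺ (suc n) rewrite ty⁺ n = ≡W refl (lem (+ n))
    where lem : ∀ x → - (- x +ℤ + 0 +ℤ + 0) +ℤ + 1 +ℤ + 0 ≡ + 1 +ℤ x
          lem = solve-∀

  ty⁻ : ∀ n → eval (concat (replicate n (t ∷ s ∷ r ∷ s ∷ []))) ≡ mkW false false false (+ 0) (- (+ n))
  ty⁻ zero = refl
  ty⁻ (suc n) rewrite ty⁻ n = ≡W refl (trans (lem (- (+ n))) (sym (ℤₚ.neg-distrib-+ (+ 1) (+ n))))
    where lem : ∀ x → - (- (x +ℤ + 0) +ℤ + 1 +ℤ + 0) +ℤ + 0 ≡ - (+ 1) +ℤ x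
          lem = solve-∀

  transWord-x : ∀ a → eval (transWord a (r ∷ s ∷ t ∷ s ∷ []) (s ∷ t ∷ s ∷ r ∷ [])) ≡ mkW false false false a (+ 0)
  transWord-x (+ n) = tx⁺ n
  transWord-x -[1+ n ] = tx⁻ (suc n)

  transWord-y : ∀ b → eval (transWord b (s ∷ r ∷ s ∷ t ∷ []) (t ∷ s ∷ r ∷ s ∷ [])) ≡ mkW false false false (+ 0) b
  transWord-y (+ n) = ty⁺ n
  transWord-y -[1+ n ] = ty⁻ (suc n)

  linear-part : ∀ sw n₁ n₂ → eval (diagWord n₁ n₂ ++ (if sw then s ∷ [] else [])) ≡ mkW sw n₁ n₂ (+ 0) (+ 0)
  linear-part false false false = refl
  linear-part false false true = refl
  linear-part false true false = refl
  linear-part false true true = refl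
  linear-part true false false = refl
  linear-part true false true = refl
  linear-part true true false = refl
  linear-part true true true = refl

eval-someWord : ∀ w → eval (someWord w) ≡ w
eval-someWord (mkW sw n₁ n₂ a b) = begin
  eval (X ++ Y ++ D)
    ≡⟨ eval-++ X (Y ++ D) ⟩
  eval X · eval (Y ++ D)
    ≡⟨ cong (eval X ·_) (eval-++ Y D) ⟩
  eval X · (eval Y · eval D)
    ≡⟨ cong₂ _·_ (transWord-x a) (cong₂ _·_ (transWord-y b) (linear-part sw n₁ n₂)) ⟩
  mkW false false false a (+ 0) · (mkW false false false (+ 0) b · mkW sw n₁ n₂ (+ 0) (+ 0))
    ≡⟨ trans-mul a b (mkW sw n₁ n₂ (+ 0) (+ 0)) ⟩
  mkW sw n₁ n₂ (+ 0 +ℤ a) (+ 0 +ℤ b)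
    ≡⟨ ≡W (ℤₚ.+-identityˡ a) (ℤₚ.+-identityˡ b) ⟩
  mkW sw n₁ n₂ a b ∎
  where
  X = transWord a (r ∷ s ∷ t ∷ s ∷ []) (s ∷ t ∷ s ∷ r ∷ [])
  Y = transWord b (s ∷ r ∷ s ∷ t ∷ []) (t ∷ s ∷ r ∷ s ∷ [])
  D = diagWord n₁ n₂ ++ (if sw then s ∷ [] else [])

-- `someWord` shows that r, s, t generate all of W, so a property may be propagated one left factor
-- at a time.
word-induction : (Q : W → Set) → Q e → (∀ g w → Q w → Q (gen g · w)) → ∀ w → Q w
word-induction Q base step w = subst Q (eval-someWord w) (go (someWord w))
  where
  go : ∀ A → Q (eval A)
  go [] = base
  go (g ∷ A) = step g (eval A) (go A)

·-assoc : ∀ u v w → u · (v · w) ≡ u · v · w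
·-assoc u v w = word-induction (λ u → u · (v · w) ≡ u · v · w) base step u
  where
  base : e · (v · w) ≡ e · v · w
  base = trans (·-identityˡ _) (cong (_· w) (sym (·-identityˡ v)))
  step : ∀ g u → u · (v · w) ≡ u · v · w → gen g · u · (v · w) ≡ gen g · u · v · w
  step g u ih = begin
    gen g · u · (v · w)     ≡⟨ sym (gen-assoc g u (v · w)) ⟩
    gen g · (u · (v · w))   ≡⟨ cong (gen g ·_) ih ⟩
    gen g · (u · v · w)     ≡⟨ gen-assoc g (u · v) w ⟩
    gen g · (u · v) · w     ≡⟨ cong (_· w) (gen-assoc g u v) ⟩
    gen g · u · v · w ∎

·-identityʳ : ∀ w → w · e ≡ w
·-identityʳ = word-induction (λ w → w · e ≡ w) refl (λ g w ih → trans (sym (gen-assoc g w e)) (cong (gen g ·_) ih))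

gen-invʳ : ∀ w g → w · gen g · gen g ≡ w
gen-invʳ w g = trans (sym (·-assoc w (gen g) (gen g))) (trans (cong (w ·_) (gen² g)) (·-identityʳ w))

opaque
  -- Read off from a reversed word; `inv-unique` makes it independent of the word that is chosen.
  inv : W → W
  inv w = eval (reverse (someWord w))

eval-reverse : ∀ A → eval (reverse A) · eval A ≡ e
eval-reverse [] = refl
eval-reverse (g ∷ A) = begin
  eval (reverse (g ∷ A)) · (gen g · eval A)
    ≡⟨ cong (λ X → eval X · (gen g · eval A)) (Listₚ.unfold-reverse g A) ⟩
  eval (reverse A ++ g ∷ []) · (gen g · eval A)
    ≡⟨ cong (_· (gen g · eval A)) (eval-++ (reverse A) (g ∷ [])) ⟩
  eval (reverse A) · (gen g · e) · (gen g · eval A)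
    ≡⟨ cong (λ h → eval (reverse A) · h · (gen g · eval A)) (·-identityʳ (gen g)) ⟩
  eval (reverse A) · gen g · (gen g · eval A)
    ≡⟨ sym (·-assoc (eval (reverse A)) (gen g) _) ⟩
  eval (reverse A) · (gen g · (gen g · eval A))
    ≡⟨ cong (eval (reverse A) ·_) (gen-inv g (eval A)) ⟩
  eval (reverse A) · eval A
    ≡⟨ eval-reverse A ⟩
  e ∎

opaque
  unfolding inv
  inv-left : ∀ w → inv w · w ≡ e
  inv-left w = trans (cong (inv w ·_) (sym (eval-someWord w))) (eval-reverse (someWord w))

inv-unique : ∀ {x y w} → x · w ≡ e → y · w ≡ e → x ≡ y
inv-unique {x} {y} {w} p q = begin
  x                       ≡⟨ sym (·-identityʳ x) ⟩
  x · e                   ≡⟨ cong (x ·_) (sym right) ⟩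
  x · (w · inv w)         ≡⟨ ·-assoc x w (inv w) ⟩
  x · w · inv w           ≡⟨ cong (_· inv w) (trans p (sym q)) ⟩
  y · w · inv w           ≡⟨ sym (·-assoc y w (inv w)) ⟩
  y · (w · inv w)         ≡⟨ cong (y ·_) right ⟩
  y · e                   ≡⟨ ·-identityʳ y ⟩
  y ∎
  where
  right : w · inv w ≡ e
  right = begin
    w · inv w                               ≡⟨ sym (·-identityˡ _) ⟩
    e · (w · inv w)                         ≡⟨ cong (_· (w · inv w)) (sym (inv-left (inv w))) ⟩
    inv (inv w) · inv w · (w · inv w)       ≡⟨ sym (·-assoc (inv (inv w)) (inv w) (w · inv w)) ⟩
    inv (inv w) · (inv w · (w · inv w))     ≡⟨ cong (inv (inv w) ·_) (·-assoc (inv w) w (inv w)) ⟩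
    inv (inv w) · (inv w · w · inv w)       ≡⟨ cong (λ z → inv (inv w) · (z · inv w)) (inv-left w) ⟩
    inv (inv w) · (e · inv w)               ≡⟨ cong (inv (inv w) ·_) (·-identityˡ (inv w)) ⟩
    inv (inv w) · inv w                     ≡⟨ inv-left (inv w) ⟩
    e ∎

inv-eval : ∀ A → inv (eval A) ≡ eval (reverse A)
inv-eval A = inv-unique (inv-left (eval A)) (eval-reverse A)

opaque
  unfolding inv
  inv-inv : ∀ w → inv (inv w) ≡ w
  inv-inv w = trans (inv-eval (reverse (someWord w))) (trans (cong eval (Listₚ.reverse-involutive (someWord w))) (eval-someWord w))

-- Length and reduced words

true≢false : true ≢ false
true≢false ()

∧-elim : ∀ {a b : Bool} → a ∧ b ≡ true → a ≡ true × b ≡ true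
∧-elim {true} {true} refl = refl , refl

∨-elim : ∀ {a b : Bool} → a ∨ b ≡ true → a ≡ true ⊎ b ≡ true
∨-elim {true} q = inj₁ refl
∨-elim {false} q = inj₂ q

==-refl : ∀ x → (x == x) ≡ true
==-refl x with x ≟W x
... | yes _ = refl
... | no ¬p = ⊥-elim (¬p refl)

==⇒≡ : ∀ {x y} → (x == y) ≡ true → x ≡ y
==⇒≡ {x} {y} q with x ≟W y
... | yes p = p

≢⇒==false : ∀ {x y} → x ≢ y → (x == y) ≡ false
≢⇒==false {x} {y} ¬p with x ≟W y
... | yes p = ⊥-elim (¬p p)
... | no _ = refl

memW⁺ : ∀ {x A B} → (x , A) ∈ B → memW x B ≡ true
memW⁺ {x} (here refl) rewrite ==-refl x = refl
memW⁺ {x} (there {y , _} p) rewrite memW⁺ p = 𝔹ₚ.∨-zeroʳ (x == y)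

find-∈ : ∀ x B → memW x B ≡ true → (x , findWord x B) ∈ B
find-∈ x ((y , A) ∷ B) m with x ≟W y
... | yes refl = here refl
... | no _ = there (find-∈ x B m)

-- The absence of a new entry from `acc` is recorded because it is the source of the minimality of
-- its word.
addNew-entry : ∀ acc ps {p} → p ∈ addNew acc ps → p ∈ acc ⊎ (p ∈ ps × memW (proj₁ p) acc ≡ false)
addNew-entry acc [] h = inj₁ h
addNew-entry acc (q ∷ ps) {p} h with memW (proj₁ q) acc in eq
... | true with addNew-entry acc ps h
...   | inj₁ i = inj₁ i
...   | inj₂ (i , m) = inj₂ (there i , m)
addNew-entry acc (q ∷ ps) {p} h | false with addNew-entry (acc ++ q ∷ []) ps h
...   | inj₁ i with ∈-++⁻ acc i
...     | inj₁ j = inj₁ j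
...     | inj₂ (here refl) = inj₂ (here refl , eq)
addNew-entry acc (q ∷ ps) {p} h | false | inj₂ (i , m) with memW (proj₁ p) acc in eq'
...     | false = inj₂ (there i , refl)
...     | true = ⊥-elim (true≢false (trans (sym (memW⁺ (∈-++⁺ˡ (find-∈ (proj₁ p) acc eq')))) m))

addNew-acc : ∀ acc ps {x} → memW x acc ≡ true → memW x (addNew acc ps) ≡ true
addNew-acc acc [] m = m
addNew-acc acc (q ∷ ps) {x} m with memW (proj₁ q) acc
... | true = addNew-acc acc ps m
... | false = addNew-acc (acc ++ q ∷ []) ps (memW⁺ (∈-++⁺ˡ (find-∈ x acc m)))

addNew-new : ∀ acc ps {x A} → (x , A) ∈ ps → memW x (addNew acc ps) ≡ true
addNew-new acc ((x , A) ∷ ps) (here refl) with memW x acc in eq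
... | true = addNew-acc acc ps eq
... | false = addNew-acc (acc ++ (x , A) ∷ []) ps (memW⁺ (∈-++⁺ʳ acc (here refl)))
addNew-new acc (q ∷ ps) (there i) with memW (proj₁ q) acc
... | true = addNew-new acc ps i
... | false = addNew-new (acc ++ q ∷ []) ps i

Minimal : W → List Gen → Set
Minimal x A = eval A ≡ x × (∀ B → eval B ≡ x → length A ≤ length B)

eval-snoc : ∀ A g → eval (A ++ g ∷ []) ≡ eval A · gen g
eval-snoc A g = trans (eval-++ A (g ∷ [])) (cong (eval A ·_) (·-identityʳ (gen g)))

length-snoc : ∀ (A : List Gen) g → length (A ++ g ∷ []) ≡ suc (length A)
length-snoc A g = trans (Listₚ.length-++ A) (ℕₚ.+-comm (length A) 1)

private
  extend : W × List Gen → List (W × List Gen)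
  extend p = map (λ g → (proj₁ p · gen g , proj₂ p ++ g ∷ [])) gens

  gens-complete : ∀ g → g ∈ gens
  gens-complete r = here refl
  gens-complete s = there (here refl)
  gens-complete t = there (there (here refl))

  ball-complete : ∀ n A → length A ≤ n → memW (eval A) (ball n) ≡ true
  ball-complete zero [] _ = refl
  ball-complete (suc n) A le with initLast A
  ... | [] = addNew-acc (ball n) (concatMap extend (ball n)) (ball-complete n [] z≤n)
  ... | B ∷ʳ′ g =
    subst (λ x → memW x (ball (suc n)) ≡ true) (sym (eval-snoc B g))
      (addNew-new (ball n) (concatMap extend (ball n)) {A = findWord (eval B) (ball n) ++ g ∷ []}
        (∈-concatMap⁺ extend {xs = ball n} (Any.map (λ { refl → ∈-map⁺ (λ h → (eval B · gen h , findWord (eval B) (ball n) ++ h ∷ [])) (gens-complete g) })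
           (find-∈ (eval B) (ball n) (ball-complete n B (ℕₚ.≤-pred (subst (_≤ suc n) (length-snoc B g) le)))))))

  -- An element that enters at stage n + 1 is absent from `ball n`, so by `ball-complete` it has no
  -- word of length at most n.
  ball-sound : ∀ n {x A} → (x , A) ∈ ball n → Minimal x A × length A ≤ n
  ball-sound zero (here refl) = (refl , λ _ _ → z≤n) , z≤n
  ball-sound (suc n) {x} {A} h with addNew-entry (ball n) (concatMap extend (ball n)) h
  ... | inj₁ i = proj₁ (ball-sound n i) , ℕₚ.m≤n⇒m≤1+n (proj₂ (ball-sound n i))
  ... | inj₂ (i , m) = new (find (∈-concatMap⁻ extend {xs = ball n} i))
    where
    new : (∃ λ q → q ∈ ball n × (x , A) ∈ extend q) → Minimal x A × length A ≤ suc n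
    new ((y , B) , j , k) with ∈-map⁻ (λ g → (y · gen g , B ++ g ∷ [])) k
    ... | g , _ , refl =
      ( trans (eval-snoc B g) (cong (_· gen g) (proj₁ (proj₁ (ball-sound n j))))
      , minimal) , len≤
      where
      len≤ : length (B ++ g ∷ []) ≤ suc n
      len≤ = subst (_≤ suc n) (sym (length-snoc B g)) (s≤s (proj₂ (ball-sound n j)))
      minimal : ∀ C → eval C ≡ y · gen g → length (B ++ g ∷ []) ≤ length C
      minimal C eq with length C ℕₚ.≤? n
      ... | yes le = ⊥-elim (true≢false (trans (sym (ball-complete n C le)) (trans (cong (λ z → memW z (ball n)) eq) m)))
      ... | no gt = ℕₚ.≤-trans len≤ (ℕₚ.≰⇒> gt)

  redWord-minimal : ∀ w → Minimal w (redWord w)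
  redWord-minimal w =
    proj₁ (ball-sound N (find-∈ w (ball N)
      (subst (λ x → memW x (ball N) ≡ true) (eval-someWord w) (ball-complete N (someWord w) ℕₚ.≤-refl))))
    where N = length (someWord w)

abstract
  -- The search enters the rest of the proof only through this fact and `len-minimal`.
  eval-redWord : ∀ w → eval (redWord w) ≡ w
  eval-redWord w = proj₁ (redWord-minimal w)

  len-minimal : ∀ A → len (eval A) ≤ length A
  len-minimal A = proj₂ (redWord-minimal (eval A)) A refl

len-minimal′ : ∀ {w} A → eval A ≡ w → len w ≤ length A
len-minimal′ A refl = len-minimal A

-- `true` when the linear part has determinant -1. The determinant is the parity of the length, so a
-- generator always changes the length.
sign : W → Bool
sign w = W.sw w xor (W.n₁ w xor W.n₂ w)

private
  sign-gen : ∀ g w → sign (gen g · w) ≡ not (sign w)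
  sign-gen r (mkW false false _ _ _) = refl
  sign-gen r (mkW false true _ _ _) = sym (𝔹ₚ.not-involutive _)
  sign-gen r (mkW true false _ _ _) = refl
  sign-gen r (mkW true true b _ _) = cong not (sym (𝔹ₚ.not-involutive b))
  sign-gen s (mkW false false false _ _) = refl
  sign-gen s (mkW false false true _ _) = refl
  sign-gen s (mkW false true false _ _) = refl
  sign-gen s (mkW false true true _ _) = refl
  sign-gen s (mkW true false false _ _) = refl
  sign-gen s (mkW true false true _ _) = refl
  sign-gen s (mkW true true false _ _) = refl
  sign-gen s (mkW true true true _ _) = refl
  sign-gen t (mkW false false false _ _) = refl
  sign-gen t (mkW false false true _ _) = refl
  sign-gen t (mkW false true false _ _) = refl
  sign-gen t (mkW false true true _ _) = refl
  sign-gen t (mkW true false false _ _) = refl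
  sign-gen t (mkW true false true _ _) = refl
  sign-gen t (mkW true true false _ _) = refl
  sign-gen t (mkW true true true _ _) = refl

parity : ℕ → Bool
parity zero = false
parity (suc n) = not (parity n)

sign-eval : ∀ A → sign (eval A) ≡ parity (length A)
sign-eval [] = refl
sign-eval (g ∷ A) = trans (sign-gen g (eval A)) (cong not (sign-eval A))

sign-len : ∀ w → sign w ≡ parity (len w)
sign-len w = trans (cong sign (sym (eval-redWord w))) (sign-eval (redWord w))

parity-gen : ∀ g w → parity (len (gen g · w)) ≡ not (parity (len w))
parity-gen g w = trans (sym (sign-len (gen g · w))) (trans (sign-gen g w) (cong not (sign-len w)))

b≢not : ∀ b → b ≢ not b
b≢not true ()
b≢not false ()

len-gen≢ : ∀ g w → len (gen g · w) ≢ len w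
len-gen≢ g w q = b≢not _ (trans (sym (cong parity q)) (parity-gen g w))

len-gen≤ : ∀ g w → len (gen g · w) ≤ suc (len w)
len-gen≤ g w = len-minimal′ (g ∷ redWord w) (cong (gen g ·_) (eval-redWord w))

len-gen≥ : ∀ g w → len w ≤ suc (len (gen g · w))
len-gen≥ g w = subst (λ x → len x ≤ suc (len (gen g · w))) (gen-inv g w) (len-gen≤ g (gen g · w))

len-e : len e ≡ 0
len-e = ℕₚ.n≤0⇒n≡0 (len-minimal [])

len-inv : ∀ w → len (inv w) ≡ len w
len-inv w = ℕₚ.≤-antisym (le w) (subst (λ x → len x ≤ len (inv w)) (inv-inv w) (le (inv w)))
  where
  le : ∀ w → len (inv w) ≤ len w
  le w = ℕₚ.≤-trans
    (len-minimal′ (reverse (redWord w)) (trans (sym (inv-eval (redWord w))) (cong inv (eval-redWord w))))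
    (ℕₚ.≤-reflexive (Listₚ.length-reverse (redWord w)))

inv-gen-mul : ∀ g w → inv (gen g · w) ≡ inv w · gen g
inv-gen-mul g w = inv-unique (inv-left (gen g · w)) (begin
  inv w · gen g · (gen g · w)    ≡⟨ sym (·-assoc (inv w) (gen g) (gen g · w)) ⟩
  inv w · (gen g · (gen g · w))  ≡⟨ cong (inv w ·_) (gen-inv g w) ⟩
  inv w · w                      ≡⟨ inv-left w ⟩
  e ∎)

inv-mul-gen : ∀ w g → inv (w · gen g) ≡ gen g · inv w
inv-mul-gen w g = begin
  inv (w · gen g)              ≡⟨ cong (λ z → inv (z · gen g)) (sym (inv-inv w)) ⟩
  inv (inv (inv w) · gen g)    ≡⟨ cong inv (sym (inv-gen-mul g (inv w))) ⟩
  inv (inv (gen g · inv w))    ≡⟨ inv-inv (gen g · inv w) ⟩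
  gen g · inv w ∎

-- Affine roots and reflections

-- The directions of the affine roots: 2x, 2y, x + y, x - y and their negatives.
data Dir : Set where
  x⁺ x⁻ y⁺ y⁻ d⁺ d⁻ e⁺ e⁻ : Dir

-- (d , k) is the affine function with linear part d and constant term k if d is x⁺, y⁺, d⁺ or e⁺,
-- and k + 1 otherwise; with this normalisation it is positive on the fundamental alcove iff k ≥ 0.
Root : Set
Root = Dir × ℤ

nonneg : ℤ → Bool
nonneg (+ _) = true
nonneg -[1+ _ ] = false

pos : Root → Bool
pos (_ , k) = nonneg k

-- The affine function composed with the map g. The shifts of k come from g moving the origin and
-- from the different normalisation of positive and negative directions.
pull : Root → Gen → Root
pull (x⁺ , k) r = x⁻ , sucℤ k
pull (x⁻ , k) r = x⁺ , predℤ k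
pull (y⁺ , k) r = y⁺ , k
pull (y⁻ , k) r = y⁻ , k
pull (d⁺ , k) r = e⁻ , k
pull (d⁻ , k) r = e⁺ , k
pull (e⁺ , k) r = d⁻ , k
pull (e⁻ , k) r = d⁺ , k
pull (x⁺ , k) s = y⁺ , k
pull (x⁻ , k) s = y⁻ , k
pull (y⁺ , k) s = x⁺ , k
pull (y⁻ , k) s = x⁻ , k
pull (d⁺ , k) s = d⁺ , k
pull (d⁻ , k) s = d⁻ , k
pull (e⁺ , k) s = e⁻ , predℤ k
pull (e⁻ , k) s = e⁺ , sucℤ k
pull (x⁺ , k) t = x⁺ , k
pull (x⁻ , k) t = x⁻ , k
pull (y⁺ , k) t = y⁻ , predℤ k
pull (y⁻ , k) t = y⁺ , sucℤ k
pull (d⁺ , k) t = e⁺ , k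
pull (d⁻ , k) t = e⁻ , k
pull (e⁺ , k) t = d⁺ , k
pull (e⁻ , k) t = d⁻ , k

pulls : Root → List Gen → Root
pulls β [] = β
pulls β (g ∷ A) = pulls (pull β g) A

simple : Gen → Root
simple r = x⁻ , + 0
simple s = e⁺ , + 0
simple t = y⁺ , + 0

refl-of : Root → W
refl-of (x⁺ , k) = mkW false true false (- k) (+ 0)
refl-of (x⁻ , k) = mkW false true false (sucℤ k) (+ 0)
refl-of (y⁺ , k) = mkW false false true (+ 0) (- k)
refl-of (y⁻ , k) = mkW false false true (+ 0) (sucℤ k)
refl-of (d⁺ , k) = mkW true true true (- k) (- k)
refl-of (d⁻ , k) = mkW true true true (sucℤ k) (sucℤ k)
refl-of (e⁺ , k) = mkW true false false (- k) k
refl-of (e⁻ , k) = mkW true false false (sucℤ k) (- (sucℤ k))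

private
  rx⁺ : ∀ k → + 1 +ℤ (+ 1 +ℤ k) ≡ - (- (+ 1) +ℤ - k) +ℤ + 1
  rx⁺ = solve-∀
  rx⁻ : ∀ k → - (- (+ 1) +ℤ k) ≡ - (- (+ 1) +ℤ (+ 1 +ℤ k)) +ℤ + 1
  rx⁻ = solve-∀
  ry : ∀ k → k ≡ + 0 +ℤ k +ℤ + 0
  ry = solve-∀
  c1 : ∀ k → (+ 1 +ℤ k) ≡ - (+ 0 +ℤ - k) +ℤ + 1
  c1 = solve-∀
  c2 : ∀ k → - ((+ 1 +ℤ k)) ≡ - (+ 1) +ℤ - k +ℤ + 0
  c2 = solve-∀
  c3 : ∀ k → - k ≡ - (+ 0 +ℤ (+ 1 +ℤ k)) +ℤ + 1
  c3 = solve-∀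
  c4 : ∀ k → k ≡ - (+ 1) +ℤ (+ 1 +ℤ k) +ℤ + 0
  c4 = solve-∀
  c5 : ∀ k → (+ 1 +ℤ k) ≡ + 1 +ℤ k +ℤ + 0
  c5 = solve-∀
  c6 : ∀ k → - k ≡ - (+ 0 +ℤ (+ 1 +ℤ k)) +ℤ + 1
  c6 = solve-∀
  c7 : ∀ k → - k ≡ + 1 +ℤ - ((+ 1 +ℤ k)) +ℤ + 0
  c7 = solve-∀
  e1 : ∀ k → + 1 +ℤ (- (+ 1) +ℤ k) ≡ + 0 +ℤ k +ℤ + 0
  e1 = solve-∀
  e2 : ∀ k → - (+ 1 +ℤ (- (+ 1) +ℤ k)) ≡ + 0 +ℤ - k +ℤ + 0
  e2 = solve-∀
  t1 : ∀ k → + 1 +ℤ (- (+ 1) +ℤ k) ≡ - (+ 0 +ℤ - k) +ℤ + 0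
  t1 = solve-∀
  t2 : ∀ k → - ((+ 1 +ℤ k)) ≡ - (+ 0 +ℤ (+ 1 +ℤ k)) +ℤ + 0
  t2 = solve-∀
  t3 : ∀ k → k ≡ - (+ 0 +ℤ - k) +ℤ + 0
  t3 = solve-∀

refl-conj : ∀ β g → refl-of (pull β g) ≡ gen g · (refl-of β · gen g)
refl-conj (x⁺ , k) r = ≡W (rx⁺ k) refl
refl-conj (x⁻ , k) r = ≡W (rx⁻ k) refl
refl-conj (y⁺ , k) r = ≡W refl (ry (- k))
refl-conj (y⁻ , k) r = ≡W refl (ry (sucℤ k))
refl-conj (d⁺ , k) r = ≡W (c1 k) (c2 k)
refl-conj (d⁻ , k) r = ≡W (c3 k) (c4 k)
refl-conj (e⁺ , k) r = ≡W (c1 k) (c5 k)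
refl-conj (e⁻ , k) r = ≡W (c6 k) (c7 k)
refl-conj (x⁺ , k) s = ≡W refl (ry (- k))
refl-conj (x⁻ , k) s = ≡W refl (ry (sucℤ k))
refl-conj (y⁺ , k) s = ≡W (ry (- k)) refl
refl-conj (y⁻ , k) s = ≡W (ry (sucℤ k)) refl
refl-conj (d⁺ , k) s = ≡W (ry (- k)) (ry (- k))
refl-conj (d⁻ , k) s = ≡W (ry (sucℤ k)) (ry (sucℤ k))
refl-conj (e⁺ , k) s = ≡W (e1 k) (e2 k)
refl-conj (e⁻ , k) s = ≡W (ry (- (sucℤ k))) (ry (sucℤ k))
refl-conj (x⁺ , k) t = ≡W (ry (- k)) refl
refl-conj (x⁻ , k) t = ≡W (ry (sucℤ k)) refl
refl-conj (y⁺ , k) t = ≡W refl (t1 k)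
refl-conj (y⁻ , k) t = ≡W refl (t2 k)
refl-conj (d⁺ , k) t = ≡W (ry (- k)) (t3 k)
refl-conj (d⁻ , k) t = ≡W (ry (sucℤ k)) (t2 k)
refl-conj (e⁺ , k) t = ≡W (ry (- k)) (c8 k)
  where c8 : ∀ k → - k ≡ - (+ 0 +ℤ k) +ℤ + 0
        c8 = solve-∀
refl-conj (e⁻ , k) t = ≡W (ry (sucℤ k)) (c9 k)
  where c9 : ∀ k → (+ 1 +ℤ k) ≡ - (+ 0 +ℤ - (+ 1 +ℤ k)) +ℤ + 0
        c9 = solve-∀

refl-simple : ∀ g → refl-of (simple g) ≡ gen g
refl-simple r = refl
refl-simple s = refl
refl-simple t = refl

private
  flip-suc : ∀ k → nonneg k ≢ nonneg (sucℤ k) → k ≡ -[1+ 0 ]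
  flip-suc (+ n) p = ⊥-elim (p refl)
  flip-suc -[1+ zero ] p = refl
  flip-suc -[1+ suc n ] p = ⊥-elim (p refl)

  flip-pred : ∀ k → nonneg k ≢ nonneg (predℤ k) → k ≡ + 0
  flip-pred (+ zero) p = refl
  flip-pred (+ suc n) p = ⊥-elim (p refl)
  flip-pred -[1+ n ] p = ⊥-elim (p refl)

-- The wall of g is the only one between the fundamental alcove and its image under g.
sign-change : ∀ β g → pos β ≢ pos (pull β g) → refl-of β ≡ gen g
sign-change (x⁺ , k) r p rewrite flip-suc k p = refl
sign-change (x⁻ , k) r p rewrite flip-pred k p = refl
sign-change (y⁺ , k) r p = ⊥-elim (p refl)
sign-change (y⁻ , k) r p = ⊥-elim (p refl)
sign-change (d⁺ , k) r p = ⊥-elim (p refl)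
sign-change (d⁻ , k) r p = ⊥-elim (p refl)
sign-change (e⁺ , k) r p = ⊥-elim (p refl)
sign-change (e⁻ , k) r p = ⊥-elim (p refl)
sign-change (x⁺ , k) s p = ⊥-elim (p refl)
sign-change (x⁻ , k) s p = ⊥-elim (p refl)
sign-change (y⁺ , k) s p = ⊥-elim (p refl)
sign-change (y⁻ , k) s p = ⊥-elim (p refl)
sign-change (d⁺ , k) s p = ⊥-elim (p refl)
sign-change (d⁻ , k) s p = ⊥-elim (p refl)
sign-change (e⁺ , k) s p rewrite flip-pred k p = refl
sign-change (e⁻ , k) s p rewrite flip-suc k p = refl
sign-change (x⁺ , k) t p = ⊥-elim (p refl)
sign-change (x⁻ , k) t p = ⊥-elim (p refl)
sign-change (y⁺ , k) t p rewrite flip-pred k p = refl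
sign-change (y⁻ , k) t p rewrite flip-suc k p = refl
sign-change (d⁺ , k) t p = ⊥-elim (p refl)
sign-change (d⁻ , k) t p = ⊥-elim (p refl)
sign-change (e⁺ , k) t p = ⊥-elim (p refl)
sign-change (e⁻ , k) t p = ⊥-elim (p refl)

data Del : List Gen → List Gen → Set where
  here : ∀ {g A} → Del (g ∷ A) A
  there : ∀ {g A B} → Del A B → Del (g ∷ A) (g ∷ B)

Del-length : ∀ {A B} → Del A B → length A ≡ suc (length B)
Del-length here = refl
Del-length (there d) = cong suc (Del-length d)

-- While β is pulled back along the word its sign changes at some letter. There the pulled-back root
-- defines the reflection in that letter, and conjugating back turns the deletion of the letter into
-- multiplication by `refl-of β`.
exchange : ∀ A β → pos β ≢ pos (pulls β A) → ∃ λ B → Del A B × eval B ≡ refl-of β · eval A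
exchange [] β p = ⊥-elim (p refl)
exchange (g ∷ A) β p with pos β 𝔹ₚ.≟ pos (pull β g)
... | no q = A , here , trans (sym (gen-inv g (eval A))) (cong (_· (gen g · eval A)) (sym (sign-change β g q)))
... | yes q with exchange A (pull β g) (λ h → p (trans q h))
...   | B , d , eq = g ∷ B , there d , (begin
  gen g · eval B                                      ≡⟨ cong (gen g ·_) eq ⟩
  gen g · (refl-of (pull β g) · eval A)               ≡⟨ cong (λ z → gen g · (z · eval A)) (refl-conj β g) ⟩
  gen g · (gen g · (refl-of β · gen g) · eval A)      ≡⟨ cong (gen g ·_) (sym (gen-assoc g (refl-of β · gen g) (eval A))) ⟩
  gen g · (gen g · (refl-of β · gen g · eval A))      ≡⟨ gen-inv g _ ⟩
  refl-of β · gen g · eval A                          ≡⟨ sym (·-assoc (refl-of β) (gen g) (eval A)) ⟩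
  refl-of β · (gen g · eval A) ∎)

-- Values of affine roots at rational points

Point : Set
Point = ℤ × ℤ

-- The value of a root, multiplied by N, at the point p / N.
value : ℤ → Root → Point → ℤ
value N (x⁺ , k) (x , y) = x +ℤ x +ℤ N *ℤ k
value N (x⁻ , k) (x , y) = - x +ℤ - x +ℤ (N +ℤ N *ℤ k)
value N (y⁺ , k) (x , y) = y +ℤ y +ℤ N *ℤ k
value N (y⁻ , k) (x , y) = - y +ℤ - y +ℤ (N +ℤ N *ℤ k)
value N (d⁺ , k) (x , y) = x +ℤ y +ℤ N *ℤ k
value N (d⁻ , k) (x , y) = - x +ℤ - y +ℤ (N +ℤ N *ℤ k)
value N (e⁺ , k) (x , y) = x +ℤ - y +ℤ N *ℤ k
value N (e⁻ , k) (x , y) = y +ℤ - x +ℤ (N +ℤ N *ℤ k)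

infixr 6 _⊙_
-- The action on points multiplied by N, which keeps rational points integral: N = 6 serves an
-- interior point of the alcove, N = 2 a vertex.
_⊙_ : ℤ → W → Point → Point
(N ⊙ mkW sw n₁ n₂ a b) p = proj₁ (linApp sw n₁ n₂ p) +ℤ N *ℤ a , proj₂ (linApp sw n₁ n₂ p) +ℤ N *ℤ b

genAct : ℤ → Gen → Point → Point
genAct N r (x , y) = N +ℤ - x , y
genAct N s (x , y) = y , x
genAct N t (x , y) = x , - y

private
  v0₁ : ∀ x n a → - x +ℤ n *ℤ (- a +ℤ + 1) ≡ n +ℤ - (x +ℤ n *ℤ a)
  v0₁ = solve-∀
  v0₂ : ∀ x n a → x +ℤ n *ℤ (a +ℤ + 0) ≡ x +ℤ n *ℤ a
  v0₂ = solve-∀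
  v0₃ : ∀ x n a → - x +ℤ n *ℤ (- a +ℤ + 0) ≡ - (x +ℤ n *ℤ a)
  v0₃ = solve-∀

⊙-gen : ∀ N g w p → (N ⊙ (gen g · w)) p ≡ genAct N g ((N ⊙ w) p)
⊙-gen N r (mkW false n₁ n₂ a b) (x , y) rewrite sgn-not n₁ x = cong₂ _,_ (v0₁ (sgn n₁ x) N a) (v0₂ (sgn n₂ y) N b)
⊙-gen N r (mkW true n₁ n₂ a b) (x , y) rewrite sgn-not n₁ y = cong₂ _,_ (v0₁ (sgn n₁ y) N a) (v0₂ (sgn n₂ x) N b)
⊙-gen N s (mkW false n₁ n₂ a b) (x , y) = cong₂ _,_ (v0₂ (sgn n₂ y) N b) (v0₂ (sgn n₁ x) N a)
⊙-gen N s (mkW true n₁ n₂ a b) (x , y) = cong₂ _,_ (v0₂ (sgn n₂ x) N b) (v0₂ (sgn n₁ y) N a)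
⊙-gen N t (mkW false n₁ n₂ a b) (x , y) rewrite sgn-not n₂ y = cong₂ _,_ (v0₂ (sgn n₁ x) N a) (v0₃ (sgn n₂ y) N b)
⊙-gen N t (mkW true n₁ n₂ a b) (x , y) rewrite sgn-not n₂ x = cong₂ _,_ (v0₂ (sgn n₁ y) N a) (v0₃ (sgn n₂ x) N b)

private
  v1 : ∀ n k x → - x +ℤ - x +ℤ (n +ℤ n *ℤ (+ 1 +ℤ k)) ≡ (n +ℤ - x) +ℤ (n +ℤ - x) +ℤ n *ℤ k
  v1 = solve-∀
  v2 : ∀ n k x → x +ℤ x +ℤ n *ℤ (- (+ 1) +ℤ k) ≡ - (n +ℤ - x) +ℤ - (n +ℤ - x) +ℤ (n +ℤ n *ℤ k)
  v2 = solve-∀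
  v3 : ∀ n k x y → y +ℤ - x +ℤ (n +ℤ n *ℤ k) ≡ (n +ℤ - x) +ℤ y +ℤ n *ℤ k
  v3 = solve-∀
  v4 : ∀ n k x y → x +ℤ - y +ℤ n *ℤ k ≡ - (n +ℤ - x) +ℤ - y +ℤ (n +ℤ n *ℤ k)
  v4 = solve-∀
  v5 : ∀ n k x y → - x +ℤ - y +ℤ (n +ℤ n *ℤ k) ≡ n +ℤ - x +ℤ - y +ℤ n *ℤ k
  v5 = solve-∀
  v6 : ∀ n k x y → x +ℤ y +ℤ n *ℤ k ≡ y +ℤ - (n +ℤ - x) +ℤ (n +ℤ n *ℤ k)
  v6 = solve-∀
  v7 : ∀ n k x y → x +ℤ y +ℤ n *ℤ k ≡ y +ℤ x +ℤ n *ℤ k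
  v7 = solve-∀
  v8 : ∀ n k x y → - x +ℤ - y +ℤ (n +ℤ n *ℤ k) ≡ - y +ℤ - x +ℤ (n +ℤ n *ℤ k)
  v8 = solve-∀
  v9 : ∀ n k x y → y +ℤ - x +ℤ (n +ℤ n *ℤ (- (+ 1) +ℤ k)) ≡ y +ℤ - x +ℤ n *ℤ k
  v9 = solve-∀
  v10 : ∀ n k x y → x +ℤ - y +ℤ n *ℤ (+ 1 +ℤ k) ≡ x +ℤ - y +ℤ (n +ℤ n *ℤ k)
  v10 = solve-∀
  v11 : ∀ n k y → - y +ℤ - y +ℤ (n +ℤ n *ℤ (- (+ 1) +ℤ k)) ≡ - y +ℤ - y +ℤ n *ℤ k
  v11 = solve-∀
  v12 : ∀ n k y → y +ℤ y +ℤ n *ℤ (+ 1 +ℤ k) ≡ - - y +ℤ - - y +ℤ (n +ℤ n *ℤ k)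
  v12 = solve-∀
  v13 : ∀ n k x y → x +ℤ y +ℤ n *ℤ k ≡ x +ℤ - - y +ℤ n *ℤ k
  v13 = solve-∀
  v14 : ∀ n k x y → y +ℤ - x +ℤ (n +ℤ n *ℤ k) ≡ - x +ℤ - - y +ℤ (n +ℤ n *ℤ k)
  v14 = solve-∀
  v15 : ∀ n k x y → - x +ℤ - y +ℤ (n +ℤ n *ℤ k) ≡ - y +ℤ - x +ℤ (n +ℤ n *ℤ k)
  v15 = solve-∀

value-pull : ∀ N β g p → value N (pull β g) p ≡ value N β (genAct N g p)
value-pull N (x⁺ , k) r (x , y) = v1 N k x
value-pull N (x⁻ , k) r (x , y) = v2 N k x
value-pull N (y⁺ , k) r (x , y) = refl
value-pull N (y⁻ , k) r (x , y) = refl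
value-pull N (d⁺ , k) r (x , y) = v3 N k x y
value-pull N (d⁻ , k) r (x , y) = v4 N k x y
value-pull N (e⁺ , k) r (x , y) = v5 N k x y
value-pull N (e⁻ , k) r (x , y) = v6 N k x y
value-pull N (x⁺ , k) s (x , y) = refl
value-pull N (x⁻ , k) s (x , y) = refl
value-pull N (y⁺ , k) s (x , y) = refl
value-pull N (y⁻ , k) s (x , y) = refl
value-pull N (d⁺ , k) s (x , y) = v7 N k x y
value-pull N (d⁻ , k) s (x , y) = v8 N k x y
value-pull N (e⁺ , k) s (x , y) = v9 N k x y
value-pull N (e⁻ , k) s (x , y) = v10 N k x y
value-pull N (x⁺ , k) t (x , y) = refl
value-pull N (x⁻ , k) t (x , y) = refl
value-pull N (y⁺ , k) t (x , y) = v11 N k y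
value-pull N (y⁻ , k) t (x , y) = v12 N k y
value-pull N (d⁺ , k) t (x , y) = refl
value-pull N (d⁻ , k) t (x , y) = v14 N k x y
value-pull N (e⁺ , k) t (x , y) = v13 N k x y
value-pull N (e⁻ , k) t (x , y) = v15 N k x y

⊙-e : ∀ N p → (N ⊙ e) p ≡ p
⊙-e N (x , y) = cong₂ _,_ (lem x N) (lem y N)
  where lem : ∀ x n → x +ℤ n *ℤ + 0 ≡ x
        lem = solve-∀

value-pulls : ∀ N A β p → value N (pulls β A) p ≡ value N β ((N ⊙ eval A) p)
value-pulls N [] β p = cong (value N β) (sym (⊙-e N p))
value-pulls N (g ∷ A) β p = begin
  value N (pulls (pull β g) A) p           ≡⟨ value-pulls N A (pull β g) p ⟩
  value N (pull β g) ((N ⊙ eval A) p)      ≡⟨ value-pull N β g _ ⟩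
  value N β (genAct N g ((N ⊙ eval A) p))  ≡⟨ cong (value N β) (sym (⊙-gen N g (eval A) p)) ⟩
  value N β ((N ⊙ (gen g · eval A)) p) ∎

-- Exchange and the Bruhat order

≤⇒nonneg : ∀ {k} → + 0 ≤ℤ k → nonneg k ≡ true
≤⇒nonneg (+≤+ _) = refl

<⇒nonneg : ∀ {k} → k <ℤ + 0 → nonneg k ≡ false
<⇒nonneg ℤ.-<+ = refl
<⇒nonneg (ℤ.+<+ ())

-- A remainder between 0 and 5 does not affect the sign, so the sign of a root at `base` is that of
-- its constant.
nonneg-6 : ∀ c k → + 0 ≤ℤ c → c <ℤ + 6 → nonneg (c +ℤ + 6 *ℤ k) ≡ nonneg k
nonneg-6 c (+ n) c≥0 c<6 = ≤⇒nonneg (ℤₚ.+-mono-≤ c≥0 (ℤₚ.*-monoˡ-≤-nonNeg (+ 6) (+≤+ (z≤n {n}))))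
nonneg-6 c -[1+ n ] c≥0 c<6 =
  <⇒nonneg (ℤₚ.+-mono-<-≤ c<6 (ℤₚ.*-monoˡ-≤-nonNeg (+ 6) (-≤- (z≤n {n}))))

private
  -- Six times the value of the root (d , 0) at (1/3 , 1/6). All entries lie strictly between 0 and
  -- 6, which is what makes this point interior to the alcove.
  offset : Dir → ℤ
  offset x⁺ = + 4
  offset x⁻ = + 2
  offset y⁺ = + 2
  offset y⁻ = + 4
  offset d⁺ = + 3
  offset d⁻ = + 3
  offset e⁺ = + 1
  offset e⁻ = + 5

-- Six times the interior point (1/3 , 1/6) of the fundamental alcove.
base : Point
base = + 2 , + 1

private
  value-base : ∀ d k → value (+ 6) (d , k) base ≡ offset d +ℤ + 6 *ℤ k
  value-base x⁺ k = refl
  value-base x⁻ k = sym (ℤₚ.+-assoc (- (+ 4)) (+ 6) (+ 6 *ℤ k))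
  value-base y⁺ k = refl
  value-base y⁻ k = sym (ℤₚ.+-assoc (- (+ 2)) (+ 6) (+ 6 *ℤ k))
  value-base d⁺ k = refl
  value-base d⁻ k = sym (ℤₚ.+-assoc (- (+ 3)) (+ 6) (+ 6 *ℤ k))
  value-base e⁺ k = refl
  value-base e⁻ k = sym (ℤₚ.+-assoc (- (+ 1)) (+ 6) (+ 6 *ℤ k))

  ≤4 : ∀ {m} → m < 6 → + m <ℤ + 6
  ≤4 = ℤ.+<+

  offset-bounds : ∀ d → (+ 0 ≤ℤ offset d × offset d <ℤ + 6) × (+ 0 ≤ℤ + 6 +ℤ - offset d × + 6 +ℤ - offset d <ℤ + 6)
  offset-bounds x⁺ = (+≤+ z≤n , ≤4 (ℕₚ.≤ᵇ⇒≤ _ _ _)) , (+≤+ z≤n , ≤4 (ℕₚ.≤ᵇ⇒≤ _ _ _))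
  offset-bounds x⁻ = (+≤+ z≤n , ≤4 (ℕₚ.≤ᵇ⇒≤ _ _ _)) , (+≤+ z≤n , ≤4 (ℕₚ.≤ᵇ⇒≤ _ _ _))
  offset-bounds y⁺ = (+≤+ z≤n , ≤4 (ℕₚ.≤ᵇ⇒≤ _ _ _)) , (+≤+ z≤n , ≤4 (ℕₚ.≤ᵇ⇒≤ _ _ _))
  offset-bounds y⁻ = (+≤+ z≤n , ≤4 (ℕₚ.≤ᵇ⇒≤ _ _ _)) , (+≤+ z≤n , ≤4 (ℕₚ.≤ᵇ⇒≤ _ _ _))
  offset-bounds d⁺ = (+≤+ z≤n , ≤4 (ℕₚ.≤ᵇ⇒≤ _ _ _)) , (+≤+ z≤n , ≤4 (ℕₚ.≤ᵇ⇒≤ _ _ _))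
  offset-bounds d⁻ = (+≤+ z≤n , ≤4 (ℕₚ.≤ᵇ⇒≤ _ _ _)) , (+≤+ z≤n , ≤4 (ℕₚ.≤ᵇ⇒≤ _ _ _))
  offset-bounds e⁺ = (+≤+ z≤n , ≤4 (ℕₚ.≤ᵇ⇒≤ _ _ _)) , (+≤+ z≤n , ≤4 (ℕₚ.≤ᵇ⇒≤ _ _ _))
  offset-bounds e⁻ = (+≤+ z≤n , ≤4 (ℕₚ.≤ᵇ⇒≤ _ _ _)) , (+≤+ z≤n , ≤4 (ℕₚ.≤ᵇ⇒≤ _ _ _))

  pos-value : ∀ β → nonneg (value (+ 6) β base) ≡ pos β
  pos-value (d , k) = trans (cong nonneg (value-base d k))
    (nonneg-6 (offset d) k (proj₁ (proj₁ (offset-bounds d))) (proj₂ (proj₁ (offset-bounds d))))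

  nonneg-complement : ∀ k → nonneg (- (+ 1) +ℤ - k) ≡ not (nonneg k)
  nonneg-complement (+ zero) = refl
  nonneg-complement (+ suc n) = refl
  nonneg-complement -[1+ n ] = refl

  -- The value at `base` is nonzero modulo 6, hence never 0, so negation really flips `nonneg`.
  neg-value : ∀ β → nonneg (- value (+ 6) β base) ≡ not (pos β)
  neg-value (d , k) = begin
    nonneg (- value (+ 6) (d , k) base)                          ≡⟨ cong (λ v → nonneg (- v)) (value-base d k) ⟩
    nonneg (- (offset d +ℤ + 6 *ℤ k))                            ≡⟨ cong nonneg (lem (offset d) k) ⟩
    nonneg (+ 6 +ℤ - offset d +ℤ + 6 *ℤ (- (+ 1) +ℤ - k))
      ≡⟨ nonneg-6 _ (- (+ 1) +ℤ - k) (proj₁ (proj₂ (offset-bounds d))) (proj₂ (proj₂ (offset-bounds d))) ⟩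
    nonneg (- (+ 1) +ℤ - k)                                      ≡⟨ nonneg-complement k ⟩
    not (nonneg k) ∎
    where
    lem : ∀ c k → - (c +ℤ + 6 *ℤ k) ≡ + 6 +ℤ - c +ℤ + 6 *ℤ (- (+ 1) +ℤ - k)
    lem = solve-∀

-- Whether the alcove of w lies on the positive side of the wall of β.
posAt : Root → W → Bool
posAt β w = nonneg (value (+ 6) β ((+ 6 ⊙ w) base))

pos-pulls : ∀ A β → pos (pulls β A) ≡ posAt β (eval A)
pos-pulls A β = trans (sym (pos-value (pulls β A))) (cong nonneg (value-pulls (+ 6) A β base))

private
  value-refl : ∀ N β p → value N β ((N ⊙ refl-of β) p) ≡ - value N β p
  value-refl N (x⁺ , k) (x , y) = lem N k x
    where lem : ∀ N k x → - x +ℤ N *ℤ - k +ℤ (- x +ℤ N *ℤ - k) +ℤ N *ℤ k ≡ - (x +ℤ x +ℤ N *ℤ k)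
          lem = solve-∀
  value-refl N (x⁻ , k) (x , y) = lem N k x
    where lem : ∀ N k x → - (- x +ℤ N *ℤ (+ 1 +ℤ k)) +ℤ - (- x +ℤ N *ℤ (+ 1 +ℤ k)) +ℤ (N +ℤ N *ℤ k) ≡ - (- x +ℤ - x +ℤ (N +ℤ N *ℤ k))
          lem = solve-∀
  value-refl N (y⁺ , k) (y , x) = lem N k x
    where lem : ∀ N k x → - x +ℤ N *ℤ - k +ℤ (- x +ℤ N *ℤ - k) +ℤ N *ℤ k ≡ - (x +ℤ x +ℤ N *ℤ k)
          lem = solve-∀
  value-refl N (y⁻ , k) (y , x) = lem N k x
    where lem : ∀ N k x → - (- x +ℤ N *ℤ (+ 1 +ℤ k)) +ℤ - (- x +ℤ N *ℤ (+ 1 +ℤ k)) +ℤ (N +ℤ N *ℤ k) ≡ - (- x +ℤ - x +ℤ (N +ℤ N *ℤ k))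
          lem = solve-∀
  value-refl N (d⁺ , k) (x , y) = lem N k x y
    where lem : ∀ N k x y → - y +ℤ N *ℤ - k +ℤ (- x +ℤ N *ℤ - k) +ℤ N *ℤ k ≡ - (x +ℤ y +ℤ N *ℤ k)
          lem = solve-∀
  value-refl N (d⁻ , k) (x , y) = lem N k x y
    where lem : ∀ N k x y → - (- y +ℤ N *ℤ (+ 1 +ℤ k)) +ℤ - (- x +ℤ N *ℤ (+ 1 +ℤ k)) +ℤ (N +ℤ N *ℤ k) ≡ - (- x +ℤ - y +ℤ (N +ℤ N *ℤ k))
          lem = solve-∀
  value-refl N (e⁺ , k) (x , y) = lem N k x y
    where lem : ∀ N k x y → y +ℤ N *ℤ - k +ℤ - (x +ℤ N *ℤ k) +ℤ N *ℤ k ≡ - (x +ℤ - y +ℤ N *ℤ k)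
          lem = solve-∀
  value-refl N (e⁻ , k) (x , y) = lem N k x y
    where lem : ∀ N k x y → x +ℤ N *ℤ - (+ 1 +ℤ k) +ℤ - (y +ℤ N *ℤ (+ 1 +ℤ k)) +ℤ (N +ℤ N *ℤ k) ≡ - (y +ℤ - x +ℤ (N +ℤ N *ℤ k))
          lem = solve-∀

⊙-· : ∀ N u v p → (N ⊙ (u · v)) p ≡ (N ⊙ u) ((N ⊙ v) p)
⊙-· N u v p = word-induction (λ u → (N ⊙ (u · v)) p ≡ (N ⊙ u) ((N ⊙ v) p)) bas st u
  where
  bas : (N ⊙ (e · v)) p ≡ (N ⊙ e) ((N ⊙ v) p)
  bas = trans (cong (λ w → (N ⊙ w) p) (·-identityˡ v)) (sym (⊙-e N _))
  st : ∀ g u → (N ⊙ (u · v)) p ≡ (N ⊙ u) ((N ⊙ v) p) → (N ⊙ (gen g · u · v)) p ≡ (N ⊙ (gen g · u)) ((N ⊙ v) p)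
  st g u ih = begin
    (N ⊙ (gen g · u · v)) p           ≡⟨ cong (λ w → (N ⊙ w) p) (sym (gen-assoc g u v)) ⟩
    (N ⊙ (gen g · (u · v))) p         ≡⟨ ⊙-gen N g (u · v) p ⟩
    genAct N g ((N ⊙ (u · v)) p)      ≡⟨ cong (genAct N g) ih ⟩
    genAct N g ((N ⊙ u) ((N ⊙ v) p))  ≡⟨ sym (⊙-gen N g u ((N ⊙ v) p)) ⟩
    (N ⊙ (gen g · u)) ((N ⊙ v) p) ∎

posAt-refl : ∀ β w → posAt β (refl-of β · w) ≡ not (posAt β w)
posAt-refl β w = begin
  nonneg (value (+ 6) β ((+ 6 ⊙ (refl-of β · w)) base))         ≡⟨ cong (λ q → nonneg (value (+ 6) β q)) (⊙-· (+ 6) (refl-of β) w base) ⟩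
  nonneg (value (+ 6) β ((+ 6 ⊙ refl-of β) ((+ 6 ⊙ w) base)))   ≡⟨ cong nonneg (value-refl (+ 6) β _) ⟩
  nonneg (- value (+ 6) β ((+ 6 ⊙ w) base))                     ≡⟨ cong (λ u → nonneg (- value (+ 6) β ((+ 6 ⊙ u) base))) (sym (eval-someWord w)) ⟩
  nonneg (- value (+ 6) β ((+ 6 ⊙ eval A) base))                ≡⟨ cong (λ v → nonneg (- v)) (sym (value-pulls (+ 6) A β base)) ⟩
  nonneg (- value (+ 6) (pulls β A) base)                       ≡⟨ neg-value (pulls β A) ⟩
  not (pos (pulls β A))                                         ≡⟨ cong not (pos-pulls A β) ⟩
  not (posAt β (eval A))                                        ≡⟨ cong (λ u → not (posAt β u)) (eval-someWord w) ⟩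
  not (posAt β w) ∎
  where A = someWord w

refl-of² : ∀ β → refl-of β · refl-of β ≡ e
refl-of² (x⁺ , k) = ≡W (ℤₚ.+-inverseˡ (- k)) refl
refl-of² (x⁻ , k) = ≡W (ℤₚ.+-inverseˡ (sucℤ k)) refl
refl-of² (y⁺ , k) = ≡W refl (ℤₚ.+-inverseˡ (- k))
refl-of² (y⁻ , k) = ≡W refl (ℤₚ.+-inverseˡ (sucℤ k))
refl-of² (d⁺ , k) = ≡W (ℤₚ.+-inverseˡ (- k)) (ℤₚ.+-inverseˡ (- k))
refl-of² (d⁻ , k) = ≡W (ℤₚ.+-inverseˡ (sucℤ k)) (ℤₚ.+-inverseˡ (sucℤ k))
refl-of² (e⁺ , k) = ≡W (ℤₚ.+-inverseʳ k) (ℤₚ.+-inverseˡ k)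
refl-of² (e⁻ , k) = ≡W (ℤₚ.+-inverseˡ (sucℤ k)) (ℤₚ.+-inverseʳ (sucℤ k))

refl-inv : ∀ β w → refl-of β · (refl-of β · w) ≡ w
refl-inv β w = trans (·-assoc (refl-of β) (refl-of β) w) (trans (cong (_· w) (refl-of² β)) (·-identityˡ w))

delete : ∀ A β → pos β ≢ posAt β (eval A) → ∃ λ B → Del A B × eval B ≡ refl-of β · eval A
delete A β p = exchange A β (λ h → p (trans h (pos-pulls A β)))

separated⇒shorter : ∀ β w → pos β ≢ posAt β w → len (refl-of β · w) < len w
separated⇒shorter β w p with delete (redWord w) β (λ h → p (trans h (cong (posAt β) (eval-redWord w))))
... | B , d , eq = ℕₚ.≤-trans (s≤s (len-minimal′ B (trans eq (cong (refl-of β ·_) (eval-redWord w))))) (ℕₚ.≤-reflexive (sym (Del-length d)))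

unseparated⇒longer : ∀ β w → pos β ≡ posAt β w → len w < len (refl-of β · w)
unseparated⇒longer β w p =
  subst (λ z → len z < len (refl-of β · w)) (refl-inv β w)
    (separated⇒shorter β (refl-of β · w) (λ h → b≢not (posAt β w) (trans (sym p) (trans h (posAt-refl β w)))))

strong-exchange : ∀ A β → len (refl-of β · eval A) < len (eval A) → ∃ λ B → Del A B × eval B ≡ refl-of β · eval A
strong-exchange A β lt = delete A β (λ h → ℕₚ.<-asym lt (unseparated⇒longer β (eval A) h))

pos-simple : ∀ g → pos (simple g) ≡ true
pos-simple r = refl
pos-simple s = refl
pos-simple t = refl

InL⇒posAt : ∀ g w → InL g w → posAt (simple g) w ≡ false
InL⇒posAt g w lt with posAt (simple g) w in eq
... | false = refl
... | true = ⊥-elim (ℕₚ.<-asym lt (subst (λ z → len w < len (z · w)) (refl-simple g)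
                (unseparated⇒longer (simple g) w (trans (pos-simple g) (sym eq)))))

posAt⇒InL : ∀ g w → posAt (simple g) w ≡ false → InL g w
posAt⇒InL g w eq = subst (λ z → len (z · w) < len w) (refl-simple g)
  (separated⇒shorter (simple g) w (λ h → true≢false (trans (sym (pos-simple g)) (trans h eq))))

-- The Bruhat order by chains of reflections

infix 4 _◁_ _≼_

-- Chains of reflections do not refer to a word, which makes the lifting property accessible;
-- `≼⇒Sub` and `Sub⇒≼` identify them with subwords.
_◁_ : W → W → Set
x ◁ y = Σ Root λ β → y ≡ refl-of β · x × len x < len y

data _≼_ : W → W → Set where
  ≼-refl : ∀ {x} → x ≼ x
  ≼-step : ∀ {x y z} → x ◁ y → y ≼ z → x ≼ z

≼-trans : ∀ {x y z} → x ≼ y → y ≼ z → x ≼ z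
≼-trans ≼-refl q = q
≼-trans (≼-step h p) q = ≼-step h (≼-trans p q)

≼-len : ∀ {x y} → x ≼ y → len x ≤ len y
≼-len ≼-refl = ℕₚ.≤-refl
≼-len (≼-step (_ , _ , lt) p) = ℕₚ.≤-trans (ℕₚ.<⇒≤ lt) (≼-len p)

◁-gen : ∀ g w → len w < len (gen g · w) → w ◁ gen g · w
◁-gen g w lt = simple g , cong (_· w) (sym (refl-simple g)) , lt

-- If gy is not longer than gx, then gy arises from the word g, `redWord x` by deleting a letter.
-- Deleting a later letter would leave y with a word shorter than x, against l(x) < l(y); so g
-- itself is deleted and gy = x.
◁-lift : ∀ g {x y} → x ◁ y → gen g · x ◁ gen g · y ⊎ gen g · x ≡ y
◁-lift g {x} {y} (β , y≡ , lt) with len (gen g · x) ℕₚ.<? len (gen g · y)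
... | yes l = inj₁ (pull β g , conj , l)
  where
  conj : gen g · y ≡ refl-of (pull β g) · (gen g · x)
  conj = begin
    gen g · y                                             ≡⟨ cong (gen g ·_) y≡ ⟩
    gen g · (refl-of β · x)                               ≡⟨ cong (λ z → gen g · (refl-of β · z)) (sym (gen-inv g x)) ⟩
    gen g · (refl-of β · (gen g · (gen g · x)))           ≡⟨ cong (gen g ·_) (·-assoc (refl-of β) (gen g) (gen g · x)) ⟩
    gen g · (refl-of β · gen g · (gen g · x))             ≡⟨ gen-assoc g (refl-of β · gen g) (gen g · x) ⟩
    gen g · (refl-of β · gen g) · (gen g · x)             ≡⟨ cong (_· (gen g · x)) (sym (refl-conj β g)) ⟩
    refl-of (pull β g) · (gen g · x) ∎
... | no l = inj₂ (sym y≡gx)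
  where
  γ : Root
  γ = pull β g
  A : List Gen
  A = g ∷ redWord x
  eval-A : eval A ≡ gen g · x
  eval-A = cong (gen g ·_) (eval-redWord x)
  γ-eq : refl-of γ · (gen g · x) ≡ gen g · y
  γ-eq = begin
    refl-of γ · (gen g · x)                               ≡⟨ cong (_· (gen g · x)) (refl-conj β g) ⟩
    gen g · (refl-of β · gen g) · (gen g · x)             ≡⟨ sym (gen-assoc g (refl-of β · gen g) (gen g · x)) ⟩
    gen g · (refl-of β · gen g · (gen g · x))             ≡⟨ cong (gen g ·_) (sym (·-assoc (refl-of β) (gen g) (gen g · x))) ⟩
    gen g · (refl-of β · (gen g · (gen g · x)))           ≡⟨ cong (λ z → gen g · (refl-of β · z)) (gen-inv g x) ⟩
    gen g · (refl-of β · x)                               ≡⟨ cong (gen g ·_) (sym y≡) ⟩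
    gen g · y ∎
  distinct : pos γ ≢ posAt γ (gen g · x)
  distinct h = l (subst (λ z → len (gen g · x) < len z) γ-eq (unseparated⇒longer γ (gen g · x) h))
  y≡gx : y ≡ gen g · x
  y≡gx = go (delete A γ (λ h → distinct (trans h (cong (posAt γ) eval-A))))
    where
    target : refl-of γ · eval A ≡ gen g · y
    target = trans (cong (refl-of γ ·_) eval-A) γ-eq
    go : (∃ λ B → Del A B × eval B ≡ refl-of γ · eval A) → y ≡ gen g · x
    go (_ , here , eq) = trans (sym (gen-inv g y)) (cong (gen g ·_) (sym (trans (sym (eval-redWord x)) (trans eq target))))
    go (_ ∷ B , there d , eq) = ⊥-elim (ℕₚ.<-irrefl refl (ℕₚ.<-≤-trans lt (ℕₚ.≤-trans (len-minimal′ B B-eq)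
            (ℕₚ.≤-trans (ℕₚ.n≤1+n (length B)) (ℕₚ.≤-reflexive (sym (Del-length d)))))))
      where
      B-eq : eval B ≡ y
      B-eq = trans (sym (gen-inv g (eval B))) (trans (cong (gen g ·_) (trans eq target)) (gen-inv g y))

≼-lift : ∀ g {x w} → x ≼ w → len w < len (gen g · w) → gen g · x ≼ gen g · w
≼-lift g ≼-refl lt = ≼-refl
≼-lift g {x} {w} (≼-step h p) lt with ◁-lift g h
... | inj₁ h' = ≼-step h' (≼-lift g p lt)
... | inj₂ refl = ≼-trans p (≼-step (◁-gen g w lt) ≼-refl)

data Sub : List Gen → List Gen → Set where
  [] : Sub [] []
  keep : ∀ {g A B} → Sub A B → Sub (g ∷ A) (g ∷ B)
  drop : ∀ {g A B} → Sub A B → Sub A (g ∷ B)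

Sub-refl : ∀ A → Sub A A
Sub-refl [] = []
Sub-refl (g ∷ A) = keep (Sub-refl A)

Sub-Del : ∀ {A B C} → Sub A B → Del A C → Sub C B
Sub-Del (keep p) here = drop p
Sub-Del (keep p) (there d) = keep (Sub-Del p d)
Sub-Del (drop p) d = drop (Sub-Del p d)

Sub⇒∈ : ∀ {A B} → Sub A B → A ∈ subwords B
Sub⇒∈ [] = here refl
Sub⇒∈ (keep p) = ∈-++⁺ˡ (∈-map⁺ _ (Sub⇒∈ p))
Sub⇒∈ {B = g ∷ B} (drop p) = ∈-++⁺ʳ (map (g ∷_) (subwords B)) (Sub⇒∈ p)

∈⇒Sub : ∀ {A} B → A ∈ subwords B → Sub A B
∈⇒Sub [] (here refl) = []
∈⇒Sub (g ∷ B) i with ∈-++⁻ (map (g ∷_) (subwords B)) i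
... | inj₂ j = drop (∈⇒Sub B j)
... | inj₁ j with ∈-map⁻ (g ∷_) j
...   | A , k , refl = keep (∈⇒Sub B k)

-- Strong exchange applies to arbitrary words, so each reflection of the chain deletes one letter
-- from the subword found so far.
≼⇒Sub : ∀ {x w} → x ≼ w → ∀ A → eval A ≡ w → ∃ λ B → Sub B A × eval B ≡ x
≼⇒Sub ≼-refl A eq = A , Sub-refl A , eq
≼⇒Sub {x} (≼-step {y = y} (β , y≡ , lt) p) A eq = go (≼⇒Sub p A eq)
  where
  x≡ : x ≡ refl-of β · y
  x≡ = trans (sym (refl-inv β x)) (cong (refl-of β ·_) (sym y≡))
  go : (∃ λ B → Sub B A × eval B ≡ y) → ∃ λ C → Sub C A × eval C ≡ x
  go (B , sub , eqB) = go′ (strong-exchange B β lt′)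
    where
    lt′ : len (refl-of β · eval B) < len (eval B)
    lt′ = subst₂ (λ u v → len u < len v) (trans x≡ (cong (refl-of β ·_) (sym eqB))) (sym eqB) lt
    go′ : (∃ λ C → Del B C × eval C ≡ refl-of β · eval B) → ∃ λ C → Sub C A × eval C ≡ x
    go′ (C , d , eq′) = C , Sub-Del sub d , trans eq′ (trans (cong (refl-of β ·_) eqB) (sym x≡))

Reduced : List Gen → Set
Reduced A = len (eval A) ≡ length A

Reduced-tail : ∀ g A → Reduced (g ∷ A) → Reduced A
Reduced-tail g A red = ℕₚ.≤-antisym (len-minimal A)
  (ℕₚ.≤-pred (ℕₚ.≤-trans (ℕₚ.≤-reflexive (sym red)) (len-gen≤ g (eval A))))

Reduced-up : ∀ g A → Reduced (g ∷ A) → len (eval A) < len (gen g · eval A)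
Reduced-up g A red = ℕₚ.≤-trans (s≤s (len-minimal A)) (ℕₚ.≤-reflexive (sym red))

redWord-reduced : ∀ w → Reduced (redWord w)
redWord-reduced w = cong len (eval-redWord w)

Sub⇒≼ : ∀ B A → Sub B A → Reduced A → eval B ≼ eval A
Sub⇒≼ _ _ [] red = ≼-refl
Sub⇒≼ (g ∷ B) (g ∷ A) (keep p) red = ≼-lift g (Sub⇒≼ B A p (Reduced-tail g A red)) (Reduced-up g A red)
Sub⇒≼ B (g ∷ A) (drop p) red =
  ≼-trans (Sub⇒≼ B A p (Reduced-tail g A red)) (≼-step (◁-gen g (eval A) (Reduced-up g A red)) ≼-refl)

≤B⇒≼ : ∀ {x w} → x ≤B w → x ≼ w
≤B⇒≼ {x} {w} i = go (∈-map⁻ eval {xs = subwords (redWord w)} i)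
  where
  go : (∃ λ A → A ∈ subwords (redWord w) × x ≡ eval A) → x ≼ w
  go (A , j , eq) = subst₂ _≼_ (sym eq) (eval-redWord w) (Sub⇒≼ A (redWord w) (∈⇒Sub (redWord w) j) (redWord-reduced w))

≼⇒≤B : ∀ {x w} → x ≼ w → x ≤B w
≼⇒≤B {x} {w} p = go (≼⇒Sub p (redWord w) (eval-redWord w))
  where
  go : (∃ λ B → Sub B (redWord w) × eval B ≡ x) → x ≤B w
  go (B , sub , eq) = subst (_∈ belowList w) eq (∈-map⁺ eval {xs = subwords (redWord w)} (Sub⇒∈ sub))

-- Left and right multiplication by generators

data Side : Set where
  left right : Side

Op : Set
Op = Side × Gen

opaque
  -- Left and right multiplication form one family, so that each later statement covers both sides;
  -- `inv` carries the left case to the right.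
  act : Op → W → W
  act (left , g) w = gen g · w
  act (right , g) w = w · gen g

  act-left : ∀ g w → act (left , g) w ≡ gen g · w
  act-left g w = refl

  act² : ∀ σ w → act σ (act σ w) ≡ w
  act² (left , g) w = gen-inv g w
  act² (right , g) w = gen-invʳ w g

  act-comm : ∀ g h w → act (left , g) (act (right , h) w) ≡ act (right , h) (act (left , g) w)
  act-comm g h w = gen-assoc g w (gen h)

  act-e : ∀ g → act (left , g) e ≡ act (right , g) e
  act-e g = trans (·-identityʳ (gen g)) (sym (·-identityˡ (gen g)))

  inv-act-left : ∀ g w → inv (act (left , g) w) ≡ act (right , g) (inv w)
  inv-act-left g w = inv-gen-mul g w

  inv-act-right : ∀ g w → inv (act (right , g) w) ≡ act (left , g) (inv w)
  inv-act-right g w = inv-mul-gen w g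

  private
    len-step-left : ∀ g w → len (act (left , g) w) ≡ suc (len w) ⊎ len w ≡ suc (len (act (left , g) w))
    len-step-left g w with ℕₚ.<-cmp (len (gen g · w)) (len w)
    ... | tri< l _ _ = inj₂ (ℕₚ.≤-antisym (len-gen≥ g w) l)
    ... | tri≈ _ q _ = ⊥-elim (len-gen≢ g w q)
    ... | tri> _ _ l = inj₁ (ℕₚ.≤-antisym (len-gen≤ g w) l)

len-act-inv : ∀ g w → len (act (right , g) w) ≡ len (act (left , g) (inv w))
len-act-inv g w = trans (sym (len-inv (act (right , g) w))) (cong len (inv-act-right g w))

len-step : ∀ σ w → len (act σ w) ≡ suc (len w) ⊎ len w ≡ suc (len (act σ w))
len-step (left , g) w = len-step-left g w
len-step (right , g) w = subst₂ (λ m n → m ≡ suc n ⊎ n ≡ suc m) (sym (len-act-inv g w)) (len-inv w) (len-step-left g (inv w))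

opaque
  dn : Op → W → Bool
  dn σ w = len (act σ w) <ᵇ len w

data Step (σ : Op) (w : W) : Set where
  up : dn σ w ≡ false → dn σ (act σ w) ≡ true → len (act σ w) ≡ suc (len w) → Step σ w
  down : dn σ w ≡ true → dn σ (act σ w) ≡ false → len w ≡ suc (len (act σ w)) → Step σ w

private
  <ᵇ-true : ∀ {m n} → n ≡ suc m → (m <ᵇ n) ≡ true
  <ᵇ-true {zero} refl = refl
  <ᵇ-true {suc m} refl = <ᵇ-true {m} refl

  <ᵇ-false : ∀ {m n} → m ≡ suc n → (m <ᵇ n) ≡ false
  <ᵇ-false {n = zero} refl = refl
  <ᵇ-false {n = suc n} refl = <ᵇ-false {n = n} refl

opaque
  unfolding dn
  step : ∀ σ w → Step σ w
  step σ w with len-step σ w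
  ... | inj₁ q = up (<ᵇ-false q) (<ᵇ-true (trans q (cong (λ z → suc (len z)) (sym (act² σ w))))) q
  ... | inj₂ q = down (<ᵇ-true q) (<ᵇ-false (trans (cong len (act² σ w)) q)) q

  dn-cong : ∀ {σ τ x} → act σ x ≡ act τ x → dn σ x ≡ dn τ x
  dn-cong {x = x} q = cong (λ z → len z <ᵇ len x) q

  dn-right-inv : ∀ g w → dn (right , g) w ≡ dn (left , g) (inv w)
  dn-right-inv g w = cong₂ _<ᵇ_ (len-act-inv g w) (sym (len-inv w))

dn⇒len : ∀ σ w → dn σ w ≡ true → len w ≡ suc (len (act σ w))
dn⇒len σ w d with step σ w
... | up d' _ _ = ⊥-elim (true≢false (trans (sym d) d'))
... | down _ _ q = q

up⇒len : ∀ σ w → dn σ w ≡ false → len (act σ w) ≡ suc (len w)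
up⇒len σ w d with step σ w
... | up _ _ q = q
... | down d' _ _ = ⊥-elim (true≢false (trans (sym d') d))

dn-act : ∀ σ w → dn σ (act σ w) ≡ not (dn σ w)
dn-act σ w with step σ w
... | up p q _ = trans q (cong not (sym p))
... | down p q _ = trans q (cong not (sym p))

act-injective : ∀ σ {u v} → act σ u ≡ act σ v → u ≡ v
act-injective σ {u} {v} q = trans (sym (act² σ u)) (trans (cong (act σ) q) (act² σ v))

act-swap : ∀ σ {u v} → act σ u ≡ v → u ≡ act σ v
act-swap σ {u} {v} q = trans (sym (act² σ u)) (cong (act σ) q)

len<⇒dn : ∀ σ w → len (act σ w) < len w → dn σ w ≡ true
len<⇒dn σ w l with step σ w
... | up _ _ q = ⊥-elim (ℕₚ.<-asym l (ℕₚ.≤-reflexive (sym q)))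
... | down p _ _ = p

dn⇒len< : ∀ σ w → dn σ w ≡ true → len (act σ w) < len w
dn⇒len< σ w d = ℕₚ.≤-reflexive (sym (dn⇒len σ w d))

opaque
  unfolding act dn
  InL⇒dn : ∀ g w → InL g w → dn (left , g) w ≡ true
  InL⇒dn g w = len<⇒dn (left , g) w

  dn⇒InL : ∀ g w → dn (left , g) w ≡ true → InL g w
  dn⇒InL g w = dn⇒len< (left , g) w

  InR⇒dn : ∀ g w → InR g w → dn (right , g) w ≡ true
  InR⇒dn g w = len<⇒dn (right , g) w

  dn⇒InR : ∀ g w → dn (right , g) w ≡ true → InR g w
  dn⇒InR g w = dn⇒len< (right , g) w

  inLᵇ-dn : ∀ g w → inLᵇ g w ≡ dn (left , g) w
  inLᵇ-dn g w = refl

dn-posAt : ∀ g w → dn (left , g) w ≡ not (posAt (simple g) w)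
dn-posAt g w with dn (left , g) w in eq
... | true = cong not (sym (InL⇒posAt g w (dn⇒InL g w eq)))
... | false with posAt (simple g) w in eq'
...   | true = refl
...   | false = ⊥-elim (true≢false (trans (sym (InL⇒dn g w (posAt⇒InL g w eq'))) eq))

pulls-++ : ∀ A B β → pulls β (A ++ B) ≡ pulls (pulls β A) B
pulls-++ [] B β = refl
pulls-++ (g ∷ A) B β = pulls-++ A B (pull β g)

eval-refl-pulls : ∀ A β → eval A · refl-of (pulls β A) ≡ refl-of β · eval A
eval-refl-pulls [] β = trans (·-identityˡ (refl-of β)) (sym (·-identityʳ (refl-of β)))
eval-refl-pulls (g ∷ A) β = begin
  gen g · eval A · refl-of (pulls (pull β g) A)        ≡⟨ sym (gen-assoc g (eval A) _) ⟩
  gen g · (eval A · refl-of (pulls (pull β g) A))      ≡⟨ cong (gen g ·_) (eval-refl-pulls A (pull β g)) ⟩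
  gen g · (refl-of (pull β g) · eval A)                ≡⟨ cong (λ z → gen g · (z · eval A)) (refl-conj β g) ⟩
  gen g · (gen g · (refl-of β · gen g) · eval A)       ≡⟨ cong (gen g ·_) (sym (gen-assoc g (refl-of β · gen g) (eval A))) ⟩
  gen g · (gen g · (refl-of β · gen g · eval A))       ≡⟨ gen-inv g (refl-of β · gen g · eval A) ⟩
  refl-of β · gen g · eval A                           ≡⟨ sym (·-assoc (refl-of β) (gen g) (eval A)) ⟩
  refl-of β · (gen g · eval A) ∎

opaque
  unfolding act
  -- The alcoves of w and wh share a wall. If the wall of g lies between them it is that shared
  -- wall, and reflecting w in it gives wh.
  crossˡ : ∀ g h w → dn (left , g) (act (right , h) w) ≢ dn (left , g) w → act (left , g) w ≡ act (right , h) w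
  crossˡ g h w ne = sym (begin
    w · gen h                            ≡⟨ cong₂ _·_ (sym (eval-someWord w)) (sym refl≡h) ⟩
    eval A · refl-of (pulls (simple g) A) ≡⟨ eval-refl-pulls A (simple g) ⟩
    refl-of (simple g) · eval A          ≡⟨ cong₂ _·_ (refl-simple g) (eval-someWord w) ⟩
    gen g · w ∎)
    where
    A : List Gen
    A = someWord w
    before : posAt (simple g) w ≡ pos (pulls (simple g) A)
    before = trans (cong (posAt (simple g)) (sym (eval-someWord w))) (sym (pos-pulls A (simple g)))
    after : posAt (simple g) (w · gen h) ≡ pos (pull (pulls (simple g) A) h)
    after = begin
      posAt (simple g) (w · gen h)           ≡⟨ cong (λ z → posAt (simple g) (z · gen h)) (sym (eval-someWord w)) ⟩
      posAt (simple g) (eval A · gen h)      ≡⟨ cong (posAt (simple g)) (sym (eval-snoc A h)) ⟩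
      posAt (simple g) (eval (A ++ h ∷ []))  ≡⟨ sym (pos-pulls (A ++ h ∷ []) (simple g)) ⟩
      pos (pulls (simple g) (A ++ h ∷ []))   ≡⟨ cong pos (pulls-++ A (h ∷ []) (simple g)) ⟩
      pos (pull (pulls (simple g) A) h) ∎
    refl≡h : refl-of (pulls (simple g) A) ≡ gen h
    refl≡h = sign-change (pulls (simple g) A) h (λ q → ne (begin
      dn (left , g) (w · gen h)              ≡⟨ dn-posAt g (w · gen h) ⟩
      not (posAt (simple g) (w · gen h))     ≡⟨ cong not (trans after (trans (sym q) (sym before))) ⟩
      not (posAt (simple g) w)               ≡⟨ sym (dn-posAt g w) ⟩
      dn (left , g) w ∎))

crossʳ : ∀ g h w → dn (right , h) (act (left , g) w) ≢ dn (right , h) w → act (left , g) w ≡ act (right , h) w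
crossʳ g h w ne = sym (begin
  act (right , h) w                  ≡⟨ sym (inv-inv (act (right , h) w)) ⟩
  inv (inv (act (right , h) w))      ≡⟨ cong inv (inv-act-right h w) ⟩
  inv (act (left , h) (inv w))       ≡⟨ cong inv (crossˡ h g (inv w) ne′) ⟩
  inv (act (right , g) (inv w))      ≡⟨ inv-act-right g (inv w) ⟩
  act (left , g) (inv (inv w))       ≡⟨ cong (act (left , g)) (inv-inv w) ⟩
  act (left , g) w ∎)
  where
  ne′ : dn (left , h) (act (right , g) (inv w)) ≢ dn (left , h) (inv w)
  ne′ q = ne (begin
    dn (right , h) (act (left , g) w)         ≡⟨ dn-right-inv h (act (left , g) w) ⟩
    dn (left , h) (inv (act (left , g) w))    ≡⟨ cong (dn (left , h)) (inv-act-left g w) ⟩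
    dn (left , h) (act (right , g) (inv w))   ≡⟨ q ⟩
    dn (left , h) (inv w)                     ≡⟨ sym (dn-right-inv h w) ⟩
    dn (right , h) w ∎)

opaque
  unfolding act
  ≼-act : ∀ g {x w} → x ≼ w → dn (left , g) w ≡ false → x ≼ act (left , g) w × act (left , g) x ≼ act (left , g) w
  ≼-act g {x} {w} p d = ≼-trans p (≼-step (◁-gen g w lt) ≼-refl) , ≼-lift g p lt
    where
    lt : len w < len (gen g · w)
    lt = ℕₚ.≤-reflexive (sym (up⇒len (left , g) w d))

-- Sums over Bruhat intervals

memᵇ⇒∈ : ∀ {x} L → memᵇ x L ≡ true → x ∈ L
memᵇ⇒∈ {x} (y ∷ L) m with x ≟W y
... | yes q = here q
... | no _ = there (memᵇ⇒∈ L m)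

∈⇒memᵇ : ∀ {x L} → x ∈ L → memᵇ x L ≡ true
∈⇒memᵇ {x} (here refl) rewrite ==-refl x = refl
∈⇒memᵇ {x} {y ∷ L} (there i) rewrite ∈⇒memᵇ i = 𝔹ₚ.∨-zeroʳ (x == y)

memᵇ-dedup : ∀ x L → memᵇ x (dedup L) ≡ memᵇ x L
memᵇ-dedup x [] = refl
memᵇ-dedup x (y ∷ L) with memᵇ y (dedup L) in eq
... | false = cong ((x == y) ∨_) (memᵇ-dedup x L)
... | true with x ≟W y
...   | yes refl = eq
...   | no _ = memᵇ-dedup x L

≼⇒memᵇ : ∀ {x w} → x ≼ w → memᵇ x (belowList w) ≡ true
≼⇒memᵇ p = ∈⇒memᵇ (≼⇒≤B p)

memᵇ⇒≼ : ∀ {x w} → memᵇ x (belowList w) ≡ true → x ≼ w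
memᵇ⇒≼ {x} {w} m = ≤B⇒≼ (memᵇ⇒∈ (belowList w) m)

Σ[_] : List W → (W → ℤ) → ℤ
Σ[ [] ] f = + 0
Σ[ z ∷ L ] f = f z +ℤ Σ[ L ] f

Σ-cong∈ : ∀ L {f g : W → ℤ} → (∀ z → z ∈ L → f z ≡ g z) → Σ[ L ] f ≡ Σ[ L ] g
Σ-cong∈ [] h = refl
Σ-cong∈ (z ∷ L) h = cong₂ _+ℤ_ (h z (here refl)) (Σ-cong∈ L (λ y i → h y (there i)))

Σ-zero : ∀ L {f : W → ℤ} → (∀ z → z ∈ L → f z ≡ + 0) → Σ[ L ] f ≡ + 0
Σ-zero [] h = refl
Σ-zero (z ∷ L) h = cong₂ _+ℤ_ (h z (here refl)) (Σ-zero L (λ y i → h y (there i)))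

∈-interval⇒≼ : ∀ {z} v → z ∈ interval v → z ≼ v
∈-interval⇒≼ {z} v i = memᵇ⇒≼ (trans (sym (memᵇ-dedup z (belowList v))) (∈⇒memᵇ i))

Σ-dedup-single : ∀ L x (f : W → ℤ) → (∀ z → z ∈ dedup L → z ≢ x → f z ≡ + 0) → memᵇ x L ≡ true → Σ[ dedup L ] f ≡ f x
Σ-dedup-single (y ∷ L) x f h m with memᵇ y (dedup L) in eq
... | true = Σ-dedup-single L x f h (rest m)
  where
  rest : (x == y) ∨ memᵇ x L ≡ true → memᵇ x L ≡ true
  rest m with x ≟W y
  ... | yes refl = trans (sym (memᵇ-dedup x L)) eq
  ... | no _ = m
... | false with x ≟W y
...   | yes refl = trans (cong (f x +ℤ_) (Σ-zero (dedup L) (λ z i → h z (there i) (λ { refl → true≢false (trans (sym (∈⇒memᵇ i)) eq) })))) (ℤₚ.+-identityʳ (f x))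
...   | no ne = trans (cong₂ _+ℤ_ (h y (here refl) (λ q → ne (sym q))) (Σ-dedup-single L x f (λ z i → h z (there i)) m)) (ℤₚ.+-identityˡ (f x))

-- `dedup` ensures that x is counted once; the last hypothesis covers an x outside the interval.
Σ-interval-single : ∀ v x (f : W → ℤ) → (∀ z → z ≼ v → z ≢ x → f z ≡ + 0) → (¬ x ≼ v → f x ≡ + 0) → Σ[ interval v ] f ≡ f x
Σ-interval-single v x f h z with memᵇ x (belowList v) in eq
... | true = Σ-dedup-single (belowList v) x f (λ y i → h y (∈-interval⇒≼ v i)) eq
... | false = trans (Σ-zero (interval v) van) (sym fx)
  where
  fx : f x ≡ + 0
  fx = z (λ p → true≢false (trans (sym (≼⇒memᵇ p)) eq))
  van : ∀ y → y ∈ interval v → f y ≡ + 0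
  van y i with y ≟W x
  ... | yes refl = fx
  ... | no ne = h y (∈-interval⇒≼ v i) ne

Σ-+ : ∀ L (f g : W → ℤ) → Σ[ L ] (λ z → f z +ℤ g z) ≡ Σ[ L ] f +ℤ Σ[ L ] g
Σ-+ [] f g = refl
Σ-+ (z ∷ L) f g = trans (cong (f z +ℤ g z +ℤ_) (Σ-+ L f g)) (+-interchange (f z) (g z) (Σ[ L ] f) (Σ[ L ] g))

Σ-nonzero : ∀ L (f : W → ℤ) → Σ[ L ] f ≢ + 0 → ∃ λ z → z ∈ L × f z ≢ + 0
Σ-nonzero [] f ne = ⊥-elim (ne refl)
Σ-nonzero (z ∷ L) f ne with f z ℤ.≟ + 0
... | no q = z , here refl , q
... | yes q = let (y , i , p) = Σ-nonzero L f (λ r → ne (cong₂ _+ℤ_ q r)) in y , there i , p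

-- The Hecke algebra

-- An element of the Hecke algebra, in the basis T_x normalised by (T_s - v)(T_s + v^-1) = 0:
-- F x n is the coefficient of v^n T_x.  Finite support is not imposed.
F : Set
F = W → ℤ → ℤ

infix 4 _≐_
record _≐_ (X Y : F) : Set where
  constructor mk≐
  field at : ∀ x n → X x n ≡ Y x n
open _≐_ public

≐-refl : ∀ {X} → X ≐ X
≐-refl = mk≐ λ _ _ → refl

≐-sym : ∀ {X Y} → X ≐ Y → Y ≐ X
≐-sym p = mk≐ λ x n → sym (at p x n)

infixr 2 _∙_
_∙_ : ∀ {X Y Z} → X ≐ Y → Y ≐ Z → X ≐ Z
p ∙ q = mk≐ λ x n → trans (at p x n) (at q x n)

0F : F
0F _ _ = + 0

infixl 6 _+F_
_+F_ : F → F → F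
(X +F Y) x n = X x n +ℤ Y x n

infixr 7 _•_
_•_ : ℤ → F → F
(c • X) x n = c *ℤ X x n

-- Multiplication by v^(-k).
sh : ℤ → F → F
sh k X x n = X x (n +ℤ k)

+F-cong : ∀ {X X′ Y Y′} → X ≐ X′ → Y ≐ Y′ → X +F Y ≐ X′ +F Y′
+F-cong p q = mk≐ λ x n → cong₂ _+ℤ_ (at p x n) (at q x n)

•-cong : ∀ c {X X′} → X ≐ X′ → c • X ≐ c • X′
•-cong c p = mk≐ λ x n → cong (c *ℤ_) (at p x n)

sh-cong : ∀ k {X X′} → X ≐ X′ → sh k X ≐ sh k X′
sh-cong k p = mk≐ λ x n → at p x (n +ℤ k)

sh-sh : ∀ j k X → sh j (sh k X) ≐ sh (j +ℤ k) X
sh-sh j k X = mk≐ λ x n → cong (X x) (ℤₚ.+-assoc n j k)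

opaque
  -- The coefficient sequence of 1 in Z[v , v^-1].
  unit : ℤ → ℤ
  unit (+ zero) = + 1
  unit _ = + 0

  unit-0 : unit (+ 0) ≡ + 1
  unit-0 = refl

  unit-≢0 : ∀ {n} → n ≢ + 0 → unit n ≡ + 0
  unit-≢0 {+ zero} p = ⊥-elim (p refl)
  unit-≢0 {+ suc n} p = refl
  unit-≢0 { -[1+ n ]} p = refl

  δ : W → F
  δ y x n = if x == y then unit n else + 0

  δ-same : ∀ y n → δ y y n ≡ unit n
  δ-same y n rewrite ==-refl y = refl

  δ-diff : ∀ {x y} n → x ≢ y → δ y x n ≡ + 0
  δ-diff n p rewrite ≢⇒==false p = refl

δ-act : ∀ σ y x n → δ y (act σ x) n ≡ δ (act σ y) x n
δ-act σ y x n with act σ x ≟W y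
... | yes refl = trans (δ-same (act σ x) n) (sym (trans (cong (λ z → δ z x n) (act² σ x)) (δ-same x n)))
... | no p = trans (δ-diff n p) (sym (δ-diff n (λ q → p (trans (cong (act σ) q) (act² σ y)))))

-- C_s T_x is T_(sx) + v^-1 T_x if sx > x and T_(sx) + v T_x if sx < x; this is the resulting shift
-- of the diagonal coefficient.
η : Op → W → ℤ
η σ x = if dn σ x then - (+ 1) else + 1

η-up : ∀ {σ x} → dn σ x ≡ false → η σ x ≡ + 1
η-up p rewrite p = refl

η-dn : ∀ {σ x} → dn σ x ≡ true → η σ x ≡ - (+ 1)
η-dn p rewrite p = refl

η-act : ∀ σ x → η σ (act σ x) ≡ - η σ x
η-act σ x with step σ x
... | up p q _ rewrite p | q = refl
... | down p q _ rewrite p | q = refl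

-- Multiplication by the Kazhdan-Lusztig generator C_s = T_s + v^-1, on the left or on the right.
C : Op → F → F
C σ X x n = X (act σ x) n +ℤ X x (n +ℤ η σ x)

record Linear (Φ : F → F) : Set where
  field
    l-cong : ∀ {X Y} → X ≐ Y → Φ X ≐ Φ Y
    l-+ : ∀ X Y → Φ (X +F Y) ≐ Φ X +F Φ Y
    l-• : ∀ c X → Φ (c • X) ≐ c • Φ X
    l-sh : ∀ k X → Φ (sh k X) ≐ sh k (Φ X)
open Linear public

private
  distr : ∀ c p q → c *ℤ p +ℤ c *ℤ q ≡ c *ℤ (p +ℤ q)
  distr = solve-∀

C-linear : ∀ σ → Linear (C σ)
C-linear σ = record
  { l-cong = λ p → mk≐ λ x n → cong₂ _+ℤ_ (at p _ _) (at p _ _)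
  ; l-+ = λ X Y → mk≐ λ x n → +-interchange (X (act σ x) n) (Y (act σ x) n) (X x (n +ℤ η σ x)) (Y x (n +ℤ η σ x))
  ; l-• = λ c X → mk≐ λ x n → distr c (X (act σ x) n) (X x (n +ℤ η σ x))
  ; l-sh = λ k X → mk≐ λ x n → cong (λ m → X (act σ x) (n +ℤ k) +ℤ X x m) (+-swapʳ n (η σ x) k)
  }

id-linear : Linear (λ X → X)
id-linear = record { l-cong = λ p → p ; l-+ = λ _ _ → ≐-refl ; l-• = λ _ _ → ≐-refl ; l-sh = λ _ _ → ≐-refl }

∘-linear : ∀ {Φ Ψ} → Linear Φ → Linear Ψ → Linear (λ X → Φ (Ψ X))
∘-linear {Φ} {Ψ} f g = record
  { l-cong = λ p → l-cong f (l-cong g p)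
  ; l-+ = λ X Y → l-cong f (l-+ g X Y) ∙ l-+ f (Ψ X) (Ψ Y)
  ; l-• = λ c X → l-cong f (l-• g c X) ∙ l-• f c (Ψ X)
  ; l-sh = λ k X → l-cong f (l-sh g k X) ∙ l-sh f k (Ψ X)
  }

C² : ∀ σ X → C σ (C σ X) ≐ sh (+ 1) (C σ X) +F sh (- (+ 1)) (C σ X)
C² σ X = mk≐ go
  where
  arr-up : ∀ p q u v → p +ℤ q +ℤ (u +ℤ v) ≡ u +ℤ v +ℤ (q +ℤ p)
  arr-up = solve-∀
  arr-dn : ∀ p q u v → p +ℤ q +ℤ (u +ℤ v) ≡ q +ℤ p +ℤ (u +ℤ v)
  arr-dn = solve-∀
  unfold : ∀ x n {k} → η σ x ≡ k → C σ (C σ X) x n ≡ X x n +ℤ X (act σ x) (n +ℤ - k) +ℤ (X (act σ x) (n +ℤ k) +ℤ X x (n +ℤ k +ℤ k))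
  unfold x n {k} q = cong₂ _+ℤ_
    (cong₂ _+ℤ_ (cong (λ z → X z n) (act² σ x)) (cong (λ j → X (act σ x) (n +ℤ j)) (trans (η-act σ x) (cong -_ q))))
    (cong (λ j → X (act σ x) (n +ℤ j) +ℤ X x (n +ℤ j +ℤ j)) q)
  unfold′ : ∀ x n {k} → η σ x ≡ k → (sh (+ 1) (C σ X) +F sh (- (+ 1)) (C σ X)) x n
    ≡ X (act σ x) (n +ℤ + 1) +ℤ X x (n +ℤ + 1 +ℤ k) +ℤ (X (act σ x) (n +ℤ - (+ 1)) +ℤ X x (n +ℤ - (+ 1) +ℤ k))
  unfold′ x n q = cong (λ j → X (act σ x) (n +ℤ + 1) +ℤ X x (n +ℤ + 1 +ℤ j) +ℤ (X (act σ x) (n +ℤ - (+ 1)) +ℤ X x (n +ℤ - (+ 1) +ℤ j))) q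
  go : ∀ x n → C σ (C σ X) x n ≡ (sh (+ 1) (C σ X) +F sh (- (+ 1)) (C σ X)) x n
  go x n with step σ x
  ... | up p _ _ = trans (unfold x n (η-up {σ} {x} p)) (trans
        (trans (arr-up (X x n) (X (act σ x) (n +ℤ - (+ 1))) (X (act σ x) (n +ℤ + 1)) (X x (n +ℤ + 1 +ℤ + 1)))
          (cong (λ m → X (act σ x) (n +ℤ + 1) +ℤ X x (n +ℤ + 1 +ℤ + 1) +ℤ (X (act σ x) (n +ℤ - (+ 1)) +ℤ X x m)) (sym (+-cancel n (- (+ 1))))))
        (sym (unfold′ x n (η-up {σ} {x} p))))
  ... | down p _ _ = trans (unfold x n (η-dn {σ} {x} p)) (trans
        (trans (arr-dn (X x n) (X (act σ x) (n +ℤ + 1)) (X (act σ x) (n +ℤ - (+ 1))) (X x (n +ℤ - (+ 1) +ℤ - (+ 1))))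
          (cong (λ m → X (act σ x) (n +ℤ + 1) +ℤ X x m +ℤ (X (act σ x) (n +ℤ - (+ 1)) +ℤ X x (n +ℤ - (+ 1) +ℤ - (+ 1)))) (sym (+-cancel n (+ 1)))))
        (sym (unfold′ x n (η-dn {σ} {x} p))))

-- This takes the place of associativity of the Hecke algebra. If gx and xh differ, neither
-- multiplication disturbs the descent of the other, by `crossˡ` and `crossʳ`; if gx = xh, the two
-- shifts coincide.
C-comm : ∀ g h X → C (left , g) (C (right , h) X) ≐ C (right , h) (C (left , g) X)
C-comm g h X = mk≐ go
  where
  L R : Op
  L = left , g
  R = right , h
  four : ∀ {p q u v p′ q′ u′ v′} → p ≡ p′ → q ≡ u′ → u ≡ q′ → v ≡ v′ → p +ℤ q +ℤ (u +ℤ v) ≡ p′ +ℤ q′ +ℤ (u′ +ℤ v′)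
  four {p} {q} {u} {v} refl refl refl refl = +-interchange p q u v
  four′ : ∀ {p q u v p′ q′ u′ v′} → p ≡ p′ → q ≡ q′ → u ≡ u′ → v ≡ v′ → p +ℤ q +ℤ (u +ℤ v) ≡ p′ +ℤ q′ +ℤ (u′ +ℤ v′)
  four′ refl refl refl refl = refl
  go : ∀ x n → C L (C R X) x n ≡ C R (C L X) x n
  go x n with act L x ≟W act R x
  ... | no p = four (cong (λ z → X z n) (sym (act-comm g h x)))
        (cong (λ k → X (act L x) (n +ℤ k)) (cong (λ d → if d then - (+ 1) else + 1) dnR))
        (cong (λ k → X (act R x) (n +ℤ k)) (cong (λ d → if d then - (+ 1) else + 1) (sym dnL)))
        (cong (X x) (+-swapʳ n (η L x) (η R x)))
    where
    dnR : dn R (act L x) ≡ dn R x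
    dnR with dn R (act L x) 𝔹ₚ.≟ dn R x
    ... | yes q = q
    ... | no q = ⊥-elim (p (crossʳ g h x q))
    dnL : dn L (act R x) ≡ dn L x
    dnL with dn L (act R x) 𝔹ₚ.≟ dn L x
    ... | yes q = q
    ... | no q = ⊥-elim (p (crossˡ g h x q))
  ... | yes p = four′ (cong (λ z → X z n) (sym (act-comm g h x)))
        (cong₂ (λ z k → X z (n +ℤ k)) p η₁) (cong₂ (λ z k → X z (n +ℤ k)) (sym p) (sym η₂)) (cong (X x) (+-swapʳ n (η L x) (η R x)))
    where
    same : dn L x ≡ dn R x
    same = dn-cong {L} {R} {x} p
    η₀ : η L x ≡ η R x
    η₀ = cong (λ d → if d then - (+ 1) else + 1) same
    η₁ : η R (act L x) ≡ η L (act R x)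
    η₁ = trans (cong (η R) p) (trans (η-act R x) (trans (cong -_ (sym η₀)) (trans (sym (η-act L x)) (cong (η L) p))))
    η₂ : η R x ≡ η L x
    η₂ = sym η₀

C-δ : ∀ σ y → C σ (δ y) ≐ δ (act σ y) +F sh (η σ y) (δ y)
C-δ σ y = mk≐ λ x n → cong₂ _+ℤ_ (δ-act σ y x n) (go x n)
  where
  go : ∀ x n → δ y x (n +ℤ η σ x) ≡ δ y x (n +ℤ η σ y)
  go x n with x ≟W y
  ... | yes refl = refl
  ... | no p = trans (δ-diff _ p) (sym (δ-diff _ p))

-- T_s = C_s - v^-1 and its inverse C_s - v.
Tm Tp : Op → F → F
Tm σ X = C σ X +F (- (+ 1)) • sh (+ 1) X
Tp σ X = C σ X +F (- (+ 1)) • sh (- (+ 1)) X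

private
  part-linear : ∀ k → Linear (λ X → (- (+ 1)) • sh k X)
  part-linear k = record
    { l-cong = λ p → •-cong (- (+ 1)) (sh-cong k p)
    ; l-+ = λ X Y → mk≐ λ x n → ℤₚ.*-distribˡ-+ (- (+ 1)) (X x (n +ℤ k)) (Y x (n +ℤ k))
    ; l-• = λ c X → mk≐ λ x n → lem c (X x (n +ℤ k))
    ; l-sh = λ j X → mk≐ λ x n → cong (λ m → - (+ 1) *ℤ X x m) (+-swapʳ n k j)
    }
    where
    lem : ∀ c p → - (+ 1) *ℤ (c *ℤ p) ≡ c *ℤ (- (+ 1) *ℤ p)
    lem = solve-∀

+-linear : ∀ {Φ Ψ} → Linear Φ → Linear Ψ → Linear (λ X → Φ X +F Ψ X)
+-linear {Φ} {Ψ} f g = record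
  { l-cong = λ p → +F-cong (l-cong f p) (l-cong g p)
  ; l-+ = λ X Y → +F-cong (l-+ f X Y) (l-+ g X Y) ∙ mk≐ (λ x n → +-interchange (Φ X x n) (Φ Y x n) (Ψ X x n) (Ψ Y x n))
  ; l-• = λ c X → +F-cong (l-• f c X) (l-• g c X) ∙ mk≐ (λ x n → distr c (Φ X x n) (Ψ X x n))
  ; l-sh = λ k X → +F-cong (l-sh f k X) (l-sh g k X)
  }

Tm-linear : ∀ σ → Linear (Tm σ)
Tm-linear σ = +-linear (C-linear σ) (part-linear (+ 1))

Tp-linear : ∀ σ → Linear (Tp σ)
Tp-linear σ = +-linear (C-linear σ) (part-linear (- (+ 1)))

module _ (g h : Gen) (j k : ℤ) where
  private
    L R : F → F
    L X = C (left , g) X +F (- (+ 1)) • sh j X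
    R X = C (right , h) X +F (- (+ 1)) • sh k X
  -- The parameters j and k cover T_s (value 1) and its inverse (value -1) at once.
  shifted-comm : ∀ X → L (R X) ≐ R (L X)
  shifted-comm X = mk≐ λ x n → begin
    L (R X) x n
      ≡⟨ cong (_+ℤ (- (+ 1)) *ℤ (C (right , h) X x (n +ℤ j) +ℤ - (+ 1) *ℤ X x (n +ℤ j +ℤ k)))
           (trans (at (l-+ CL (C (right , h) X) ((- (+ 1)) • sh k X)) x n)
             (cong₂ _+ℤ_ (at (C-comm g h X) x n) (at (l-• CL (- (+ 1)) (sh k X) ∙ •-cong (- (+ 1)) (l-sh CL k X)) x n))) ⟩
    C (right , h) (C (left , g) X) x n +ℤ - (+ 1) *ℤ C (left , g) X x (n +ℤ k)
      +ℤ - (+ 1) *ℤ (C (right , h) X x (n +ℤ j) +ℤ - (+ 1) *ℤ X x (n +ℤ j +ℤ k))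
      ≡⟨ cong (λ m → C (right , h) (C (left , g) X) x n +ℤ - (+ 1) *ℤ C (left , g) X x (n +ℤ k)
           +ℤ - (+ 1) *ℤ (C (right , h) X x (n +ℤ j) +ℤ - (+ 1) *ℤ X x m)) (+-swapʳ n j k) ⟩
    C (right , h) (C (left , g) X) x n +ℤ - (+ 1) *ℤ C (left , g) X x (n +ℤ k)
      +ℤ - (+ 1) *ℤ (C (right , h) X x (n +ℤ j) +ℤ - (+ 1) *ℤ X x (n +ℤ k +ℤ j))
      ≡⟨ arr (C (right , h) (C (left , g) X) x n) (C (left , g) X x (n +ℤ k)) (C (right , h) X x (n +ℤ j)) (X x (n +ℤ k +ℤ j)) ⟩
    C (right , h) (C (left , g) X) x n +ℤ - (+ 1) *ℤ C (right , h) X x (n +ℤ j)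
      +ℤ - (+ 1) *ℤ (C (left , g) X x (n +ℤ k) +ℤ - (+ 1) *ℤ X x (n +ℤ k +ℤ j))
      ≡⟨ cong (_+ℤ (- (+ 1)) *ℤ (C (left , g) X x (n +ℤ k) +ℤ - (+ 1) *ℤ X x (n +ℤ k +ℤ j)))
           (sym (trans (at (l-+ CR (C (left , g) X) ((- (+ 1)) • sh j X)) x n)
             (cong (C (right , h) (C (left , g) X) x n +ℤ_) (at (l-• CR (- (+ 1)) (sh j X) ∙ •-cong (- (+ 1)) (l-sh CR j X)) x n)))) ⟩
    R (L X) x n ∎
    where
    CL = C-linear (left , g)
    CR = C-linear (right , h)
    arr : ∀ p q u v → p +ℤ - (+ 1) *ℤ q +ℤ - (+ 1) *ℤ (u +ℤ - (+ 1) *ℤ v) ≡ p +ℤ - (+ 1) *ℤ u +ℤ - (+ 1) *ℤ (q +ℤ - (+ 1) *ℤ v)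
    arr = solve-∀

private
  quad : ∀ σ j → (j ≡ + 1 ⊎ j ≡ - (+ 1)) → ∀ X → C σ (C σ X +F (- (+ 1)) • sh (- j) X) +F (- (+ 1)) • sh j (C σ X +F (- (+ 1)) • sh (- j) X) ≐ X
  quad σ j jj X = mk≐ λ x n → begin
    C σ (C σ X +F (- (+ 1)) • sh (- j) X) x n +ℤ - (+ 1) *ℤ (C σ X x (n +ℤ j) +ℤ - (+ 1) *ℤ X x (n +ℤ j +ℤ - j))
      ≡⟨ cong₂ (λ p q → p +ℤ - (+ 1) *ℤ (C σ X x (n +ℤ j) +ℤ - (+ 1) *ℤ X x q))
           (trans (at (l-+ (C-linear σ) (C σ X) ((- (+ 1)) • sh (- j) X)) x n)
             (cong₂ _+ℤ_ (at (C² σ X) x n) (at (l-• (C-linear σ) (- (+ 1)) (sh (- j) X) ∙ •-cong (- (+ 1)) (l-sh (C-linear σ) (- j) X)) x n)))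
           (+-cancel n j) ⟩
    C σ X x (n +ℤ + 1) +ℤ C σ X x (n +ℤ - (+ 1)) +ℤ - (+ 1) *ℤ C σ X x (n +ℤ - j) +ℤ - (+ 1) *ℤ (C σ X x (n +ℤ j) +ℤ - (+ 1) *ℤ X x n)
      ≡⟨ fin jj x n ⟩
    X x n ∎
    where
    a1 : ∀ p q y → p +ℤ q +ℤ - (+ 1) *ℤ q +ℤ - (+ 1) *ℤ (p +ℤ - (+ 1) *ℤ y) ≡ y
    a1 = solve-∀
    a2 : ∀ p q y → p +ℤ q +ℤ - (+ 1) *ℤ p +ℤ - (+ 1) *ℤ (q +ℤ - (+ 1) *ℤ y) ≡ y
    a2 = solve-∀
    fin : (j ≡ + 1 ⊎ j ≡ - (+ 1)) → ∀ x n →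
      C σ X x (n +ℤ + 1) +ℤ C σ X x (n +ℤ - (+ 1)) +ℤ - (+ 1) *ℤ C σ X x (n +ℤ - j) +ℤ - (+ 1) *ℤ (C σ X x (n +ℤ j) +ℤ - (+ 1) *ℤ X x n) ≡ X x n
    fin (inj₁ refl) x n = a1 (C σ X x (n +ℤ + 1)) (C σ X x (n +ℤ - (+ 1))) (X x n)
    fin (inj₂ refl) x n = a2 (C σ X x (n +ℤ + 1)) (C σ X x (n +ℤ - (+ 1))) (X x n)

Tm-Tp : ∀ σ X → Tm σ (Tp σ X) ≐ X
Tm-Tp σ X = quad σ (+ 1) (inj₁ refl) X

Tp-Tm : ∀ σ X → Tp σ (Tm σ X) ≐ X
Tp-Tm σ X = quad σ (- (+ 1)) (inj₂ refl) X

Tm-δ : ∀ σ y → dn σ y ≡ false → Tm σ (δ y) ≐ δ (act σ y)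
Tm-δ σ y d = mk≐ λ x n → trans (cong (_+ℤ - (+ 1) *ℤ δ y x (n +ℤ + 1)) (trans (at (C-δ σ y) x n) (cong (λ k → δ (act σ y) x n +ℤ δ y x (n +ℤ k)) (η-up {σ} {y} d))))
                               (+-cancel₁ (δ (act σ y) x n) (δ y x (n +ℤ + 1)))

-- The bar involution

-- Formal sums are kept because the bar involution acts on the exponents of a finite expansion, and
-- elements of `F` need not have one.
Comb : Set
Comb = List (ℤ × W × ℤ)

-- The sum of the terms c v^k b_y.
comb : (W → F) → Comb → F
comb b [] = 0F
comb b ((c , y , k) ∷ L) = c • sh (- k) (b y) +F comb b L

linear-0 : ∀ {Φ} → Linear Φ → Φ 0F ≐ 0F
linear-0 l = l-cong l (mk≐ λ _ _ → refl) ∙ l-• l (+ 0) 0F ∙ mk≐ (λ _ _ → refl)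

linear-comb : ∀ {Φ} → Linear Φ → ∀ b L → Φ (comb b L) ≐ comb (λ y → Φ (b y)) L
linear-comb l b [] = linear-0 l
linear-comb l b ((c , y , k) ∷ L) = l-+ l (c • sh (- k) (b y)) (comb b L) ∙
  +F-cong (l-• l c (sh (- k) (b y)) ∙ •-cong c (l-sh l (- k) (b y))) (linear-comb l b L)

comb-cong : ∀ {b b′ : W → F} → (∀ y → b y ≐ b′ y) → ∀ L → comb b L ≐ comb b′ L
comb-cong h [] = ≐-refl
comb-cong h ((c , y , k) ∷ L) = +F-cong (•-cong c (sh-cong (- k) (h y))) (comb-cong h L)

comb-++ : ∀ b L M → comb b (L ++ M) ≐ comb b L +F comb b M
comb-++ b [] M = mk≐ λ x n → sym (ℤₚ.+-identityˡ (comb b M x n))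
comb-++ b ((c , y , k) ∷ L) M = mk≐ λ x n →
  trans (cong ((c • sh (- k) (b y)) x n +ℤ_) (at (comb-++ b L M) x n)) (sym (ℤₚ.+-assoc ((c • sh (- k) (b y)) x n) (comb b L x n) (comb b M x n)))

scale : ℤ → Comb → Comb
scale d [] = []
scale d ((c , y , k) ∷ L) = (d *ℤ c , y , k) ∷ scale d L

comb-scale : ∀ b d L → comb b (scale d L) ≐ d • comb b L
comb-scale b d [] = mk≐ λ x n → sym (ℤₚ.*-zeroʳ d)
comb-scale b d ((c , y , k) ∷ L) = mk≐ λ x n →
  trans (cong ((d *ℤ c) *ℤ b y x (n +ℤ - k) +ℤ_) (at (comb-scale b d L) x n)) (lem d c (b y x (n +ℤ - k)) (comb b L x n))
  where
  lem : ∀ d c p q → d *ℤ c *ℤ p +ℤ d *ℤ q ≡ d *ℤ (c *ℤ p +ℤ q)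
  lem = solve-∀

shiftC : ℤ → Comb → Comb
shiftC j [] = []
shiftC j ((c , y , k) ∷ L) = (c , y , k +ℤ j) ∷ shiftC j L

comb-shift : ∀ b j L → comb b (shiftC j L) ≐ sh (- j) (comb b L)
comb-shift b j [] = ≐-refl
comb-shift b j ((c , y , k) ∷ L) = +F-cong (mk≐ λ x n → cong (λ m → c *ℤ b y x m) (lem n k j)) (comb-shift b j L)
  where
  lem : ∀ n k j → n +ℤ - (k +ℤ j) ≡ n +ℤ - j +ℤ - k
  lem = solve-∀

applyC : Op → Comb → Comb
applyC σ [] = []
applyC σ ((c , y , k) ∷ L) = (c , act σ y , k) ∷ (c , y , k +ℤ - η σ y) ∷ applyC σ L

comb-applyC : ∀ σ b → (∀ y → C σ (b y) ≐ b (act σ y) +F sh (η σ y) (b y)) → ∀ L → comb b (applyC σ L) ≐ C σ (comb b L)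
comb-applyC σ b h L = mk≐ (λ x n → trans (go L x n) (sym (at (linear-comb (C-linear σ) b L) x n)))
  where
  lem : ∀ c p q r → c *ℤ p +ℤ (c *ℤ q +ℤ r) ≡ c *ℤ (p +ℤ q) +ℤ r
  lem = solve-∀
  idx : ∀ n k j → n +ℤ - (k +ℤ - j) ≡ n +ℤ - k +ℤ j
  idx = solve-∀
  go : ∀ L x n → comb b (applyC σ L) x n ≡ comb (λ y → C σ (b y)) L x n
  go [] x n = refl
  go ((c , y , k) ∷ L) x n = begin
    c *ℤ b (act σ y) x (n +ℤ - k) +ℤ (c *ℤ b y x (n +ℤ - (k +ℤ - η σ y)) +ℤ comb b (applyC σ L) x n)
      ≡⟨ cong₂ (λ m z → c *ℤ b (act σ y) x (n +ℤ - k) +ℤ (c *ℤ b y x m +ℤ z)) (idx n k (η σ y)) (go L x n) ⟩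
    c *ℤ b (act σ y) x (n +ℤ - k) +ℤ (c *ℤ b y x (n +ℤ - k +ℤ η σ y) +ℤ comb (λ y → C σ (b y)) L x n)
      ≡⟨ lem c (b (act σ y) x (n +ℤ - k)) (b y x (n +ℤ - k +ℤ η σ y)) (comb (λ y → C σ (b y)) L x n) ⟩
    c *ℤ (b (act σ y) x (n +ℤ - k) +ℤ b y x (n +ℤ - k +ℤ η σ y)) +ℤ comb (λ y → C σ (b y)) L x n
      ≡⟨ cong (λ z → c *ℤ z +ℤ comb (λ y → C σ (b y)) L x n) (sym (at (h y) x (n +ℤ - k))) ⟩
    c *ℤ C σ (b y) x (n +ℤ - k) +ℤ comb (λ y → C σ (b y)) L x n ∎

Fin : F → Set
Fin X = Σ Comb λ L → X ≐ comb δ L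

Fin-δ : ∀ y → Fin (δ y)
Fin-δ y = (+ 1 , y , + 0) ∷ [] , mk≐ λ x n → sym (trans (ℤₚ.+-identityʳ _) (trans (ℤₚ.*-identityˡ _) (cong (δ y x) (ℤₚ.+-identityʳ n))))

Fin-Tp : ∀ σ {X} → Fin X → Fin (Tp σ X)
Fin-Tp σ {X} (L , p) = applyC σ L ++ scale (- (+ 1)) (shiftC (+ 1) L) ,
  (+F-cong (l-cong (C-linear σ) p ∙ ≐-sym (comb-applyC σ δ (C-δ σ) L))
          (•-cong (- (+ 1)) (sh-cong (- (+ 1)) p ∙ ≐-sym (comb-shift δ (+ 1) L)) ∙ ≐-sym (comb-scale δ (- (+ 1)) (shiftC (+ 1) L)))
  ∙ ≐-sym (comb-++ δ (applyC σ L) (scale (- (+ 1)) (shiftC (+ 1) L))))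

Linear-agree : ∀ {Φ Ψ} → Linear Φ → Linear Ψ → (∀ z → Φ (δ z) ≐ Ψ (δ z)) → ∀ {X} → Fin X → Φ X ≐ Ψ X
Linear-agree l m h (L , p) = l-cong l p ∙ linear-comb l δ L ∙ comb-cong h L ∙ ≐-sym (linear-comb m δ L) ∙ l-cong m (≐-sym p)

ops : (Gen → F → F) → List Gen → F → F
ops f [] X = X
ops f (g ∷ A) X = f g (ops f A X)

ops-linear : ∀ {f} → (∀ g → Linear (f g)) → ∀ A → Linear (ops f A)
ops-linear l [] = id-linear
ops-linear l (g ∷ A) = ∘-linear (l g) (ops-linear l A)

ops-++ : ∀ f A B X → ops f (A ++ B) X ≡ ops f A (ops f B X)
ops-++ f [] B X = refl
ops-++ f (g ∷ A) B X = cong (f g) (ops-++ f A B X)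

ops-comm : ∀ {f} {Ψ : F → F} → (∀ g → Linear (f g)) → (∀ g X → f g (Ψ X) ≐ Ψ (f g X)) → ∀ A X → ops f A (Ψ X) ≐ Ψ (ops f A X)
ops-comm l h [] X = ≐-refl
ops-comm {f} l h (g ∷ A) X = l-cong (l g) (ops-comm l h A X) ∙ h g (ops f A X)

ML MR PL PR : Gen → F → F
ML g = Tm (left , g)
MR g = Tm (right , g)
PL g = Tp (left , g)
PR g = Tp (right , g)

opaque
  unfolding act
  dn-reduced : ∀ g A → Reduced (g ∷ A) → dn (left , g) (eval A) ≡ false
  dn-reduced g A red with step (left , g) (eval A)
  ... | up p _ _ = p
  ... | down _ _ q = ⊥-elim (ℕₚ.<-asym (Reduced-up g A red) (ℕₚ.≤-reflexive (sym q)))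

  reduced-cons : ∀ g A → Reduced A → dn (left , g) (eval A) ≡ false → Reduced (g ∷ A)
  reduced-cons g A red d = trans (up⇒len (left , g) (eval A) d) (cong suc red)

  act-eval : ∀ g A → act (left , g) (eval A) ≡ eval (g ∷ A)
  act-eval g A = refl

  act-snoc : ∀ g A → eval (A ++ g ∷ []) ≡ act (right , g) (eval A)
  act-snoc g A = eval-snoc A g

  inv-gen : ∀ g A → inv (eval (g ∷ A)) ≡ act (right , g) (inv (eval A))
  inv-gen g A = inv-act-left g (eval A)

ML-word : ∀ A → Reduced A → ops ML A (δ e) ≐ δ (eval A)
ML-word [] red = ≐-refl
ML-word (g ∷ A) red = l-cong (Tm-linear (left , g)) (ML-word A (Reduced-tail g A red))
  ∙ Tm-δ (left , g) (eval A) (dn-reduced g A red) ∙ mk≐ (λ x n → cong (λ z → δ z x n) (act-eval g A))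

MR-word : ∀ A → Reduced A → ops MR A (δ e) ≐ δ (inv (eval A))
MR-word [] red = mk≐ λ x n → cong (λ z → δ z x n) (sym (trans (inv-eval []) refl))
MR-word (g ∷ A) red = l-cong (Tm-linear (right , g)) (MR-word A (Reduced-tail g A red))
  ∙ Tm-δ (right , g) (inv (eval A)) d ∙ mk≐ (λ x n → cong (λ z → δ z x n) (sym (inv-gen g A)))
  where
  d : dn (right , g) (inv (eval A)) ≡ false
  d = trans (dn-right-inv g (inv (eval A))) (trans (cong (dn (left , g)) (inv-inv (eval A))) (dn-reduced g A red))

ML-MR : ∀ A B X → ops ML A (ops MR B X) ≐ ops MR B (ops ML A X)
ML-MR A [] X = ≐-refl
ML-MR A (h ∷ B) X = ops-comm {ML} {MR h} (λ g → Tm-linear (left , g)) (λ g Y → shifted-comm g h (+ 1) (+ 1) Y) A (ops MR B X)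
  ∙ l-cong (Tm-linear (right , h)) (ML-MR A B X)

-- Since left and right operators commute, a product of left operators is determined by its value at 1.
ML-independent : ∀ A B → Reduced A → Reduced B → eval A ≡ eval B → ∀ {X} → Fin X → ops ML A X ≐ ops ML B X
ML-independent A B redA redB q = Linear-agree (ops-linear (λ g → Tm-linear (left , g)) A) (ops-linear (λ g → Tm-linear (left , g)) B) on-δ
  where
  side : ∀ A z → Reduced A → ops ML A (δ z) ≐ ops MR (redWord (inv z)) (δ (eval A))
  side A z red = l-cong (ops-linear (λ g → Tm-linear (left , g)) A) (≐-sym (MR-word Z (redWord-reduced (inv z)) ∙ mk≐ (λ x n → cong (λ y → δ y x n) (trans (cong inv (eval-redWord (inv z))) (inv-inv z)))))
    ∙ ML-MR A Z (δ e) ∙ l-cong (ops-linear (λ g → Tm-linear (right , g)) Z) (ML-word A red)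
    where
    Z : List Gen
    Z = redWord (inv z)
  on-δ : ∀ z → ops ML A (δ z) ≐ ops ML B (δ z)
  on-δ z = side A z redA ∙ l-cong (ops-linear (λ g → Tm-linear (right , g)) (redWord (inv z))) (mk≐ λ x n → cong (λ y → δ y x n) q) ∙ ≐-sym (side B z redB)

Reduced-reverse : ∀ A → Reduced A → Reduced (reverse A)
Reduced-reverse A red = trans (cong len (sym (inv-eval A))) (trans (len-inv (eval A)) (trans red (sym (Listₚ.length-reverse A))))

ops-reverse : ∀ f g A X → ops f (reverse (g ∷ A)) X ≡ ops f (reverse A) (f g X)
ops-reverse f g A X = trans (cong (λ B → ops f B X) (Listₚ.unfold-reverse g A)) (ops-++ f (reverse A) (g ∷ []) X)

≡⇒≐ : ∀ {X Y} → X ≡ Y → X ≐ Y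
≡⇒≐ refl = ≐-refl

ML-PL : ∀ A X → ops ML (reverse A) (ops PL A X) ≐ X
ML-PL [] X = ≐-refl
ML-PL (g ∷ A) X = ≡⇒≐ (ops-reverse ML g A (PL g (ops PL A X)))
  ∙ l-cong (ops-linear (λ g → Tm-linear (left , g)) (reverse A)) (Tm-Tp (left , g) (ops PL A X)) ∙ ML-PL A X

PL-ML : ∀ A X → ops PL A (ops ML (reverse A) X) ≐ X
PL-ML [] X = ≐-refl
PL-ML (g ∷ A) X = l-cong (ops-linear (λ g → Tp-linear (left , g)) (g ∷ A)) (≡⇒≐ (ops-reverse ML g A X))
  ∙ l-cong (Tp-linear (left , g)) (PL-ML A (ML g X)) ∙ Tp-Tm (left , g) X

PL-fin : ∀ A → Fin (ops PL A (δ e))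
PL-fin [] = Fin-δ e
PL-fin (g ∷ A) = Fin-Tp (left , g) (PL-fin A)

-- `ops PL A` inverts `ops ML (reverse A)`, so independence of the reduced word passes from the T_s
-- to their inverses.
PL-independent : ∀ A B → Reduced A → Reduced B → eval A ≡ eval B → ops PL A (δ e) ≐ ops PL B (δ e)
PL-independent A B redA redB q =
  l-cong (ops-linear (λ g → Tp-linear (left , g)) A) (≐-sym key) ∙ PL-ML A (ops PL B (δ e))
  where
  rev : eval (reverse A) ≡ eval (reverse B)
  rev = trans (sym (inv-eval A)) (trans (cong inv q) (inv-eval B))
  key : ops ML (reverse A) (ops PL B (δ e)) ≐ δ e
  key = ML-independent (reverse A) (reverse B) (Reduced-reverse A redA) (Reduced-reverse B redB) rev (PL-fin B) ∙ ML-PL B (δ e)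

-- The bar involute of T_y.
barT : W → F
barT y = ops PL (redWord y) (δ e)

barT-word : ∀ A → Reduced A → barT (eval A) ≐ ops PL A (δ e)
barT-word A red = PL-independent (redWord (eval A)) A (redWord-reduced (eval A)) red (eval-redWord (eval A))

PL-PR : ∀ A h X → ops PL A (PR h X) ≐ PR h (ops PL A X)
PL-PR A h X = ops-comm {PL} {PR h} (λ g → Tp-linear (left , g)) (λ g Y → shifted-comm g h (- (+ 1)) (- (+ 1)) Y) A X

η-e : ∀ σ → η σ e ≡ + 1
η-e σ with step σ e
... | up p _ _ = η-up {σ} {e} p
... | down _ _ q = ⊥-elim (ℕₚ.0≢1+n (trans (sym len-e) q))

PL-PR-e : ∀ h → PR h (δ e) ≐ PL h (δ e)
PL-PR-e h = +F-cong (C-δ (right , h) e ∙ +F-cong (mk≐ λ x n → cong (λ z → δ z x n) (sym (act-e h))) (mk≐ λ x n → cong (λ k → δ e x (n +ℤ k)) (trans (η-e (right , h)) (sym (η-e (left , h)))))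
  ∙ ≐-sym (C-δ (left , h) e)) ≐-refl

Tp-barT : ∀ σ y → dn σ y ≡ false → Tp σ (barT y) ≐ barT (act σ y)
Tp-barT (left , g) y d = ≐-sym (≡⇒≐ (cong barT (trans (cong (act (left , g)) (sym (eval-redWord y))) (act-eval g (redWord y))))
  ∙ barT-word (g ∷ redWord y) (reduced-cons g (redWord y) (redWord-reduced y) (trans (cong (dn (left , g)) (eval-redWord y)) d)))
Tp-barT (right , h) y d = ≐-sym (PL-PR A h (δ e)) ∙ l-cong (ops-linear (λ g → Tp-linear (left , g)) A) (PL-PR-e h)
  ∙ ≡⇒≐ (sym (ops-++ PL A (h ∷ []) (δ e))) ∙ ≐-sym (barT-word (A ++ h ∷ []) red) ∙ ≡⇒≐ (cong barT ev)
  where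
  A : List Gen
  A = redWord y
  ev : eval (A ++ h ∷ []) ≡ act (right , h) y
  ev = trans (act-snoc h A) (cong (act (right , h)) (eval-redWord y))
  red : Reduced (A ++ h ∷ [])
  red = trans (cong len ev) (trans (up⇒len (right , h) y d) (sym (length-snoc A h)))

-- The image of `C-δ` under the bar involution: C_s is fixed and the shift changes sign.
C-barT : ∀ σ y → C σ (barT y) ≐ barT (act σ y) +F sh (- η σ y) (barT y)
C-barT σ y with step σ y
... | up p _ _ = mk≐ λ x n → begin
    C σ (barT y) x n
      ≡⟨ lem (C σ (barT y) x n) (barT y x (n +ℤ - (+ 1))) ⟩
    Tp σ (barT y) x n +ℤ barT y x (n +ℤ - (+ 1))
      ≡⟨ cong₂ (λ u k → u +ℤ barT y x (n +ℤ - k)) (at (Tp-barT σ y p) x n) (sym (η-up {σ} {y} p)) ⟩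
    barT (act σ y) x n +ℤ barT y x (n +ℤ - η σ y) ∎
  where
  lem : ∀ p q → p ≡ p +ℤ - (+ 1) *ℤ q +ℤ q
  lem = solve-∀
... | down p p′ _ = mk≐ λ x n → begin
    C σ (barT y) x n
      ≡⟨ at (l-cong (C-linear σ) (≐-sym y≐)) x n ⟩
    C σ (Tp σ Z) x n
      ≡⟨ at (l-+ (C-linear σ) (C σ Z) (- (+ 1) • sh (- (+ 1)) Z)) x n ⟩
    C σ (C σ Z) x n +ℤ C σ (- (+ 1) • sh (- (+ 1)) Z) x n
      ≡⟨ cong₂ _+ℤ_ (at (C² σ Z) x n) (at (l-• (C-linear σ) (- (+ 1)) (sh (- (+ 1)) Z) ∙ •-cong (- (+ 1)) (l-sh (C-linear σ) (- (+ 1)) Z)) x n) ⟩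
    C σ Z x (n +ℤ + 1) +ℤ C σ Z x (n +ℤ - (+ 1)) +ℤ - (+ 1) *ℤ C σ Z x (n +ℤ - (+ 1))
      ≡⟨ +-cancel₁ (C σ Z x (n +ℤ + 1)) (C σ Z x (n +ℤ - (+ 1))) ⟩
    C σ Z x (n +ℤ + 1)
      ≡⟨ lem′ (C σ Z x (n +ℤ + 1)) (Z x n) ⟩
    Z x n +ℤ (C σ Z x (n +ℤ + 1) +ℤ - (+ 1) *ℤ Z x n)
      ≡⟨ cong (λ m → Z x n +ℤ (C σ Z x (n +ℤ + 1) +ℤ - (+ 1) *ℤ Z x m)) (sym (+-cancel n (+ 1))) ⟩
    Z x n +ℤ Tp σ Z x (n +ℤ + 1)
      ≡⟨ cong (Z x n +ℤ_) (at y≐ x (n +ℤ + 1)) ⟩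
    Z x n +ℤ barT y x (n +ℤ + 1)
      ≡⟨ cong (λ k → Z x n +ℤ barT y x (n +ℤ - k)) (sym (η-dn {σ} {y} p)) ⟩
    Z x n +ℤ barT y x (n +ℤ - η σ y) ∎
  where
  Z : F
  Z = barT (act σ y)
  y≐ : Tp σ Z ≐ barT y
  y≐ = Tp-barT σ (act σ y) p′ ∙ ≡⇒≐ (cong barT (act² σ y))
  lem′ : ∀ p q → p ≡ q +ℤ (p +ℤ - (+ 1) *ℤ q)
  lem′ = solve-∀

-- Uniqueness of bar-invariant elements

-- The bar involute of T_y is T_y plus terms at strictly shorter elements. This triangularity with
-- respect to length drives the uniqueness argument.
PL-support : ∀ A → Reduced A → ∀ x n → x ≢ eval A → length A ≤ len x → ops PL A (δ e) x n ≡ + 0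
PL-support [] red x n p le = δ-diff n p
PL-support (g ∷ A) red x n p le = begin
  X (act σ x) n +ℤ X x (n +ℤ η σ x) +ℤ - (+ 1) *ℤ X x (n +ℤ - (+ 1))
    ≡⟨ cong₂ (λ u v → u +ℤ v +ℤ - (+ 1) *ℤ X x (n +ℤ - (+ 1))) below (here0 (n +ℤ η σ x)) ⟩
  + 0 +ℤ + 0 +ℤ - (+ 1) *ℤ X x (n +ℤ - (+ 1))
    ≡⟨ cong (λ u → + 0 +ℤ + 0 +ℤ - (+ 1) *ℤ u) (here0 (n +ℤ - (+ 1))) ⟩
  + 0 ∎
  where
  σ : Op
  σ = left , g
  X : F
  X = ops PL A (δ e)
  redA : Reduced A
  redA = Reduced-tail g A red
  below : X (act σ x) n ≡ + 0
  below = PL-support A redA (act σ x) n (λ q → p (trans (act-swap σ q) (act-eval g A))) bound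
    where
    bound : length A ≤ len (act σ x)
    bound with step σ x
    ... | up _ _ q = ℕₚ.≤-trans (ℕₚ.≤-trans (ℕₚ.n≤1+n (length A)) le) (ℕₚ.≤-trans (ℕₚ.n≤1+n (len x)) (ℕₚ.≤-reflexive (sym q)))
    ... | down _ _ q = ℕₚ.≤-pred (ℕₚ.≤-trans le (ℕₚ.≤-reflexive q))
  here0 : ∀ m → X x m ≡ + 0
  here0 m = PL-support A redA x m (λ q → ℕₚ.<-irrefl (sym (trans (cong len q) redA)) le) (ℕₚ.≤-trans (ℕₚ.n≤1+n (length A)) le)

PL-top : ∀ A → Reduced A → ∀ n → ops PL A (δ e) (eval A) n ≡ unit n
PL-top [] red n = δ-same e n
PL-top (g ∷ A) red n = begin
  X (act σ (eval (g ∷ A))) n +ℤ X (eval (g ∷ A)) (n +ℤ η σ (eval (g ∷ A))) +ℤ - (+ 1) *ℤ X (eval (g ∷ A)) (n +ℤ - (+ 1))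
    ≡⟨ cong₂ (λ z k → X z n +ℤ X (eval (g ∷ A)) (n +ℤ k) +ℤ - (+ 1) *ℤ X (eval (g ∷ A)) (n +ℤ - (+ 1)))
         (sym (act-swap σ (act-eval g A))) (η-dn {σ} {eval (g ∷ A)} d) ⟩
  X (eval A) n +ℤ X (eval (g ∷ A)) (n +ℤ - (+ 1)) +ℤ - (+ 1) *ℤ X (eval (g ∷ A)) (n +ℤ - (+ 1))
    ≡⟨ +-cancel₁ (X (eval A) n) (X (eval (g ∷ A)) (n +ℤ - (+ 1))) ⟩
  X (eval A) n
    ≡⟨ PL-top A (Reduced-tail g A red) n ⟩
  unit n ∎
  where
  σ : Op
  σ = left , g
  X : F
  X = ops PL A (δ e)
  d : dn σ (eval (g ∷ A)) ≡ true
  d = trans (cong (dn σ) (sym (act-eval g A))) (trans (dn-act σ (eval A)) (cong not (dn-reduced g A red)))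

barT-support : ∀ y x n → x ≢ y → len y ≤ len x → barT y x n ≡ + 0
barT-support y x n p le = PL-support (redWord y) (redWord-reduced y) x n (λ q → p (trans q (eval-redWord y))) le

barT-top : ∀ y n → barT y y n ≡ unit n
barT-top y n = trans (cong (λ z → barT y z n) (sym (eval-redWord y))) (PL-top (redWord y) (redWord-reduced y) n)

barL : Comb → Comb
barL [] = []
barL ((c , y , k) ∷ L) = (c , y , - k) ∷ barL L

-- Bar-invariance, witnessed by an expansion that still sums to X after every v^k is replaced by
-- v^(-k) and every T_y by its bar involute. The witness replaces an involution on all of `F`.
record Inv (X : F) : Set where
  constructor mkInv
  field
    terms : Comb
    expansion : X ≐ comb δ terms
    bar-expansion : X ≐ comb barT (barL terms)

Inv-cong : ∀ {X Y} → X ≐ Y → Inv X → Inv Y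
Inv-cong p (mkInv L q q′) = mkInv L (≐-sym p ∙ q) (≐-sym p ∙ q′)

Inv-δ : Inv (δ e)
Inv-δ = mkInv ((+ 1 , e , + 0) ∷ []) (single δ) (≐-sym (barT-word [] len-e) ∙ single barT)
  where
  single : ∀ b → b e ≐ comb b ((+ 1 , e , + 0) ∷ [])
  single b = mk≐ λ x n → sym (trans (ℤₚ.+-identityʳ _) (trans (ℤₚ.*-identityˡ _) (cong (b e x) (ℤₚ.+-identityʳ n))))

barL-++ : ∀ L M → barL (L ++ M) ≡ barL L ++ barL M
barL-++ [] M = refl
barL-++ (_ ∷ L) M = cong (_ ∷_) (barL-++ L M)

barL-scale : ∀ d L → barL (scale d L) ≡ scale d (barL L)
barL-scale d [] = refl
barL-scale d (_ ∷ L) = cong (_ ∷_) (barL-scale d L)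

barL-shift : ∀ j L → barL (shiftC j L) ≡ shiftC (- j) (barL L)
barL-shift j [] = refl
barL-shift j ((c , y , k) ∷ L) = cong₂ (λ m M → (c , y , m) ∷ M) (ℤₚ.neg-distrib-+ k j) (barL-shift j L)

Inv-+ : ∀ {X Y} → Inv X → Inv Y → Inv (X +F Y)
Inv-+ (mkInv L p p′) (mkInv M q q′) = mkInv (L ++ M)
  (+F-cong p q ∙ ≐-sym (comb-++ δ L M))
  (+F-cong p′ q′ ∙ ≐-sym (comb-++ barT (barL L) (barL M)) ∙ ≡⇒≐ (cong (comb barT) (sym (barL-++ L M))))

Inv-• : ∀ c {X} → Inv X → Inv (c • X)
Inv-• c (mkInv L p p′) = mkInv (scale c L)
  (•-cong c p ∙ ≐-sym (comb-scale δ c L))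
  (•-cong c p′ ∙ ≐-sym (comb-scale barT c (barL L)) ∙ ≡⇒≐ (cong (comb barT) (sym (barL-scale c L))))

[2]_ : F → F
[2] X = sh (+ 1) X +F sh (- (+ 1)) X

Inv-[2] : ∀ {X} → Inv X → Inv ([2] X)
Inv-[2] {X} (mkInv L p p′) = mkInv (shiftC (- (+ 1)) L ++ shiftC (+ 1) L)
  (+F-cong (sh-cong (+ 1) p ∙ ≐-sym (comb-shift δ (- (+ 1)) L)) (sh-cong (- (+ 1)) p ∙ ≐-sym (comb-shift δ (+ 1) L))
    ∙ ≐-sym (comb-++ δ (shiftC (- (+ 1)) L) (shiftC (+ 1) L)))
  (mk≐ (λ x n → ℤₚ.+-comm (X x (n +ℤ + 1)) (X x (n +ℤ - (+ 1))))
    ∙ +F-cong (sh-cong (- (+ 1)) p′ ∙ ≐-sym (comb-shift barT (+ 1) (barL L))) (sh-cong (+ 1) p′ ∙ ≐-sym (comb-shift barT (- (+ 1)) (barL L)))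
    ∙ ≐-sym (comb-++ barT (shiftC (+ 1) (barL L)) (shiftC (- (+ 1)) (barL L)))
    ∙ ≡⇒≐ (cong (comb barT) (sym (trans (barL-++ (shiftC (- (+ 1)) L) (shiftC (+ 1) L)) (cong₂ _++_ (barL-shift (- (+ 1)) L) (barL-shift (+ 1) L))))))

Inv-C : ∀ σ {X} → Inv X → Inv (C σ X)
Inv-C σ {X} (mkInv L p p′) = mkInv (applyC σ L)
  (l-cong (C-linear σ) p ∙ ≐-sym (comb-applyC σ δ (C-δ σ) L))
  (l-cong (C-linear σ) p′ ∙ linear-comb (C-linear σ) barT (barL L) ∙ mk≐ (go L))
  where
  lem : ∀ c p q r → c *ℤ (p +ℤ q) +ℤ r ≡ c *ℤ p +ℤ (c *ℤ q +ℤ r)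
  lem = solve-∀
  idx : ∀ n k j → n +ℤ - (- k) +ℤ - j ≡ n +ℤ - (- (k +ℤ - j))
  idx = solve-∀
  go : ∀ L x n → comb (λ y → C σ (barT y)) (barL L) x n ≡ comb barT (barL (applyC σ L)) x n
  go [] x n = refl
  go ((c , y , k) ∷ L) x n = begin
    c *ℤ C σ (barT y) x m +ℤ comb (λ y → C σ (barT y)) (barL L) x n
      ≡⟨ cong₂ (λ u v → c *ℤ u +ℤ v) (at (C-barT σ y) x m) (go L x n) ⟩
    c *ℤ (barT (act σ y) x m +ℤ barT y x (m +ℤ - η σ y)) +ℤ comb barT (barL (applyC σ L)) x n
      ≡⟨ lem c (barT (act σ y) x m) (barT y x (m +ℤ - η σ y)) (comb barT (barL (applyC σ L)) x n) ⟩
    c *ℤ barT (act σ y) x m +ℤ (c *ℤ barT y x (m +ℤ - η σ y) +ℤ comb barT (barL (applyC σ L)) x n)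
      ≡⟨ cong (λ i → c *ℤ barT (act σ y) x m +ℤ (c *ℤ barT y x i +ℤ comb barT (barL (applyC σ L)) x n)) (idx n k (η σ y)) ⟩
    comb barT (barL (applyC σ ((c , y , k) ∷ L))) x n ∎
    where
    m : ℤ
    m = n +ℤ - (- k)

-- The linear extension of h from the terms v^k T_y to formal sums; any coefficient of either
-- expansion of an invariant element has this form.
pair : (W → ℤ → ℤ) → Comb → ℤ
pair h [] = + 0
pair h ((c , y , k) ∷ L) = c *ℤ h y k +ℤ pair h L

pair-sub : ∀ h h′ L → pair (λ y k → h y k +ℤ - h′ y k) L ≡ pair h L +ℤ - pair h′ L
pair-sub h h′ [] = refl
pair-sub h h′ ((c , y , k) ∷ L) =
  trans (cong (c *ℤ (h y k +ℤ - h′ y k) +ℤ_) (pair-sub h h′ L)) (lem c (h y k) (h′ y k) (pair h L) (pair h′ L))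
  where
  lem : ∀ c p q u v → c *ℤ (p +ℤ - q) +ℤ (u +ℤ - v) ≡ c *ℤ p +ℤ u +ℤ - (c *ℤ q +ℤ v)
  lem = solve-∀

comb-pair : ∀ b L x n → comb b L x n ≡ pair (λ y k → b y x (n +ℤ - k)) L
comb-pair b [] x n = refl
comb-pair b ((c , y , k) ∷ L) x n = cong (c *ℤ b y x (n +ℤ - k) +ℤ_) (comb-pair b L x n)

comb-bar-pair : ∀ b L x n → comb b (barL L) x n ≡ pair (λ y k → b y x (n +ℤ k)) L
comb-bar-pair b [] x n = refl
comb-bar-pair b ((c , y , k) ∷ L) x n =
  cong₂ (λ m z → c *ℤ b y x (n +ℤ m) +ℤ z) (ℤₚ.neg-involutive k) (comb-bar-pair b L x n)

private
  -- A Kronecker delta: `pair (key y k) L` is the coefficient of v^k T_y once the like terms of L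
  -- are collected.
  key : W → ℤ → W → ℤ → ℤ
  key y k y′ k′ = δ y′ y (k +ℤ - k′)

  key-same : ∀ y k → key y k y k ≡ + 1
  key-same y k = trans (δ-same y _) (trans (cong unit (ℤₚ.+-inverseʳ k)) unit-0)

  key-diff : ∀ {y k y′ k′} → ¬ (y ≡ y′ × k ≡ k′) → key y k y′ k′ ≡ + 0
  key-diff {y} {k} {y′} {k′} p with y ≟W y′
  ... | no q = δ-diff _ q
  ... | yes refl = trans (δ-same y _) (unit-≢0 (λ q → p (refl , ℤₚ.i-j≡0⇒i≡j k k′ q)))

  remove : W → ℤ → Comb → Comb
  remove y k [] = []
  remove y k ((c , y′ , k′) ∷ L) with y ≟W y′ | k ≟ℤ k′
  ... | yes _ | yes _ = remove y k L
  ... | yes _ | no _ = (c , y′ , k′) ∷ remove y k L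
  ... | no _ | _ = (c , y′ , k′) ∷ remove y k L

  remove-length : ∀ y k L → length (remove y k L) ≤ length L
  remove-length y k [] = z≤n
  remove-length y k ((c , y′ , k′) ∷ L) with y ≟W y′ | k ≟ℤ k′
  ... | yes _ | yes _ = ℕₚ.m≤n⇒m≤1+n (remove-length y k L)
  ... | yes _ | no _ = s≤s (remove-length y k L)
  ... | no _ | _ = s≤s (remove-length y k L)

  remove-head : ∀ c y k L → length (remove y k ((c , y , k) ∷ L)) ≤ length L
  remove-head c y k L with y ≟W y | k ≟ℤ k
  ... | yes _ | yes _ = remove-length y k L
  ... | yes _ | no q = ⊥-elim (q refl)
  ... | no q | _ = ⊥-elim (q refl)

  other : ∀ h y k c y′ k′ L → ¬ (y ≡ y′ × k ≡ k′) → pair h L ≡ pair (key y k) L *ℤ h y k +ℤ pair h (remove y k L) →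
    c *ℤ h y′ k′ +ℤ pair h L ≡ (c *ℤ key y k y′ k′ +ℤ pair (key y k) L) *ℤ h y k +ℤ (c *ℤ h y′ k′ +ℤ pair h (remove y k L))
  other h y k c y′ k′ L p ih = trans (cong (c *ℤ h y′ k′ +ℤ_) ih)
    (trans (lem c (h y′ k′) (pair (key y k) L) (h y k) (pair h (remove y k L)))
      (cong (λ u → (c *ℤ u +ℤ pair (key y k) L) *ℤ h y k +ℤ (c *ℤ h y′ k′ +ℤ pair h (remove y k L))) (sym (key-diff p))))
    where
    lem : ∀ c p q h r → c *ℤ p +ℤ (q *ℤ h +ℤ r) ≡ (c *ℤ + 0 +ℤ q) *ℤ h +ℤ (c *ℤ p +ℤ r)
    lem = solve-∀

  split-off : ∀ h y k L → pair h L ≡ pair (key y k) L *ℤ h y k +ℤ pair h (remove y k L)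
  split-off h y k [] = refl
  split-off h y k ((c , y′ , k′) ∷ L) with y ≟W y′ | k ≟ℤ k′
  ... | yes refl | yes refl = begin
    c *ℤ h y k +ℤ pair h L
      ≡⟨ cong (c *ℤ h y k +ℤ_) (split-off h y k L) ⟩
    c *ℤ h y k +ℤ (pair (key y k) L *ℤ h y k +ℤ pair h (remove y k L))
      ≡⟨ lem c (h y k) (pair (key y k) L) (pair h (remove y k L)) ⟩
    (c *ℤ + 1 +ℤ pair (key y k) L) *ℤ h y k +ℤ pair h (remove y k L)
      ≡⟨ cong (λ u → (c *ℤ u +ℤ pair (key y k) L) *ℤ h y k +ℤ pair h (remove y k L)) (sym (key-same y k)) ⟩
    (c *ℤ key y k y k +ℤ pair (key y k) L) *ℤ h y k +ℤ pair h (remove y k L) ∎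
    where
    lem : ∀ c p q u → c *ℤ p +ℤ (q *ℤ p +ℤ u) ≡ (c *ℤ + 1 +ℤ q) *ℤ p +ℤ u
    lem = solve-∀
  ... | yes _ | no q = other h y k c y′ k′ L (λ (_ , z) → q z) (split-off h y k L)
  ... | no q | _ = other h y k c y′ k′ L (λ (z , _) → q z) (split-off h y k L)

  -- Formal sums may repeat terms that cancel, so h is controlled only where the collected
  -- coefficient is nonzero. All copies of the head term are removed together, and m bounds the
  -- length because `remove` is not a structural tail.
  regroup : ∀ m h L → length L ≤ m → (∀ y k → pair (key y k) L ≢ + 0 → h y k ≡ + 0) → pair h L ≡ + 0
  regroup m h [] le van = refl
  regroup (suc m) h L@((c , y , k) ∷ L′) (s≤s le) van = begin
    pair h L                                                ≡⟨ split-off h y k L ⟩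
    pair (key y k) L *ℤ h y k +ℤ pair h (remove y k L)      ≡⟨ cong₂ _+ℤ_ first rest ⟩
    + 0 ∎
    where
    first : pair (key y k) L *ℤ h y k ≡ + 0
    first with pair (key y k) L ≟ℤ + 0
    ... | yes q = cong (_*ℤ h y k) q
    ... | no q = trans (cong (pair (key y k) L *ℤ_) (van y k q)) (ℤₚ.*-zeroʳ (pair (key y k) L))
    van′ : ∀ y′ k′ → pair (key y′ k′) (remove y k L) ≢ + 0 → h y′ k′ ≡ + 0
    van′ y′ k′ ne = van y′ k′ (λ z → ne (removed z))
      where
      diff : pair (key y′ k′) L ≡ + 0 → ¬ (y′ ≡ y × k′ ≡ k) → pair (key y′ k′) (remove y k L) ≡ + 0
      diff z p = trans (trans (sym (ℤₚ.+-identityˡ _)) (sym (trans (split-off (key y′ k′) y k L)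
        (cong (_+ℤ pair (key y′ k′) (remove y k L)) (trans (cong (pair (key y k) L *ℤ_) (key-diff p)) (ℤₚ.*-zeroʳ (pair (key y k) L))))))) z
      removed : pair (key y′ k′) L ≡ + 0 → pair (key y′ k′) (remove y k L) ≡ + 0
      removed z with y′ ≟W y | k′ ≟ℤ k
      ... | yes refl | yes refl = lem (pair (key y k) L) (pair (key y k) (remove y k L))
            (trans (split-off (key y k) y k L) (cong (λ u → pair (key y k) L *ℤ u +ℤ pair (key y k) (remove y k L)) (key-same y k)))
        where
        lem : ∀ p q → p ≡ p *ℤ + 1 +ℤ q → q ≡ + 0
        lem p q eq = trans (lem′ p q) (trans (cong (_+ℤ - p) (sym eq)) (ℤₚ.+-inverseʳ p))
          where
          lem′ : ∀ p q → q ≡ p *ℤ + 1 +ℤ q +ℤ - p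
          lem′ = solve-∀
      ... | yes _ | no q = diff z (λ (_ , w) → q w)
      ... | no q | _ = diff z (λ (w , _) → q w)
    rest : pair h (remove y k L) ≡ + 0
    rest = regroup m h (remove y k L) (ℕₚ.≤-trans (remove-head c y k L′) le) van′

  unit-neg : ∀ n → unit (- n) ≡ unit n
  unit-neg (+ zero) = refl
  unit-neg (+ suc n) = trans (unit-≢0 (λ ())) (sym (unit-≢0 (λ ())))
  unit-neg -[1+ n ] = trans (unit-≢0 (λ ())) (sym (unit-≢0 (λ ())))

-- At a maximal element x of the support only barT x contributes to the bar expansion.
Inv-top : ∀ {X} → Inv X → ∀ x → (∀ y n → len x < len y → X y n ≡ + 0) → ∀ n → X x n ≡ X x (- n)
Inv-top {X} (mkInv L p p′) x above n = ℤₚ.i-j≡0⇒i≡j _ _ (begin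
  X x n +ℤ - X x (- n)
    ≡⟨ cong₂ (λ u v → u +ℤ - v) (trans (at p′ x n) (comb-bar-pair barT L x n)) (trans (at p x (- n)) (comb-pair δ L x (- n))) ⟩
  pair (λ y k → barT y x (n +ℤ k)) L +ℤ - pair (λ y k → δ y x (- n +ℤ - k)) L
    ≡⟨ sym (pair-sub (λ y k → barT y x (n +ℤ k)) (λ y k → δ y x (- n +ℤ - k)) L) ⟩
  pair (λ y k → barT y x (n +ℤ k) +ℤ - δ y x (- n +ℤ - k)) L
    ≡⟨ regroup (length L) _ L ℕₚ.≤-refl van ⟩
  + 0 ∎)
  where
  van : ∀ y k → pair (key y k) L ≢ + 0 → barT y x (n +ℤ k) +ℤ - δ y x (- n +ℤ - k) ≡ + 0
  van y k ne with x ≟W y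
  ... | yes refl = trans (cong₂ (λ u v → u +ℤ - v) (barT-top x (n +ℤ k))
          (trans (δ-same x _) (trans (cong unit (sym (ℤₚ.neg-distrib-+ n k))) (unit-neg (n +ℤ k))))) (ℤₚ.+-inverseʳ (unit (n +ℤ k)))
  ... | no q = cong₂ (λ u v → u +ℤ - v) (barT-support y x (n +ℤ k) q le) (δ-diff _ q)
    where
    le : len y ≤ len x
    le with len x ℕₚ.<? len y
    ... | yes lt = ⊥-elim (ne (trans (sym (comb-pair δ L y k)) (trans (sym (at p y k)) (above y k lt))))
    ... | no nlt = ℕₚ.≮⇒≥ nlt

private
  maxLen : Comb → ℕ
  maxLen [] = 0
  maxLen ((_ , y , _) ∷ L) = len y ⊔ maxLen L

  comb-bounded : ∀ L x n → maxLen L < len x → comb δ L x n ≡ + 0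
  comb-bounded [] x n lt = refl
  comb-bounded ((c , y , k) ∷ L) x n lt = cong₂ _+ℤ_
    (trans (cong (c *ℤ_) (δ-diff _ (λ { refl → ℕₚ.<-irrefl refl (ℕₚ.≤-<-trans (ℕₚ.m≤m⊔n (len y) (maxLen L)) lt) }))) (ℤₚ.*-zeroʳ c))
    (comb-bounded L x n (ℕₚ.≤-<-trans (ℕₚ.m≤n⊔m (len y) (maxLen L)) lt))

-- Descending induction on length, starting above the longest term of the expansion: once X vanishes
-- on all longer elements, `Inv-top` equates the degrees n and -n, so the negative degrees vanish
-- with the others.
Inv-negative⇒0 : ∀ {X} → Inv X → (∀ x n → + 0 ≤ℤ n → X x n ≡ + 0) → X ≐ 0F
Inv-negative⇒0 {X} i@(mkInv L p _) neg = mk≐ λ x n → go (suc N) x n (s≤s (ℕₚ.m≤m+n N (len x)))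
  where
  N : ℕ
  N = maxLen L
  go : ∀ j x n → N < j ℕ.+ len x → X x n ≡ + 0
  go zero x n lt = trans (at p x n) (comb-bounded L x n lt)
  go (suc j) x n lt with ℤₚ.≤-total (+ 0) n
  ... | inj₁ le = neg x n le
  ... | inj₂ le = trans (Inv-top i x above n) (neg x (- n) (ℤₚ.neg-mono-≤ le))
    where
    above : ∀ y m → len x < len y → X y m ≡ + 0
    above y m l = go j y m (ℕₚ.<-≤-trans lt (ℕₚ.≤-trans (ℕₚ.≤-reflexive (sym (ℕₚ.+-suc j (len x)))) (ℕₚ.+-monoʳ-≤ j l)))

-- The Kazhdan-Lusztig basis

-- The conditions that pin down C_w; `Spec` adds the facts on support and parity that link C_w to
-- polynomials in q.
record IsKL (w : W) (X : F) : Set where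
  field
    inv-X : Inv X
    top-X : ∀ n → X w n ≡ unit n
    neg-X : ∀ x n → x ≢ w → + 0 ≤ℤ n → X x n ≡ + 0
open IsKL public

IsKL-unique : ∀ {w X Y} → IsKL w X → IsKL w Y → X ≐ Y
IsKL-unique {w} {X} {Y} p q = mk≐ λ x n → ℤₚ.i-j≡0⇒i≡j (X x n) (Y x n)
  (trans (cong (X x n +ℤ_) (sym (ℤₚ.-1*i≡-i (Y x n)))) (at zero′ x n))
  where
  nonneg-part : ∀ x n → + 0 ≤ℤ n → (X +F (- (+ 1)) • Y) x n ≡ + 0
  nonneg-part x n le with x ≟W w
  ... | no ne = cong₂ (λ u v → u +ℤ - (+ 1) *ℤ v) (neg-X p x n ne le) (neg-X q x n ne le)
  ... | yes refl = trans (cong₂ (λ u v → u +ℤ - (+ 1) *ℤ v) (top-X p n) (top-X q n)) (lem (unit n))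
    where
    lem : ∀ u → u +ℤ - (+ 1) *ℤ u ≡ + 0
    lem = solve-∀
  zero′ : X +F (- (+ 1)) • Y ≐ 0F
  zero′ = Inv-negative⇒0 (Inv-+ (inv-X p) (Inv-• (- (+ 1)) (inv-X q))) nonneg-part

-- In `deg`, i is the exponent of q = v^2: the coefficient of T_x is v^(l(x)-l(w)) times a
-- polynomial in q.
record Spec (w : W) (X : F) : Set where
  field
    isKL : IsKL w X
    supp : ∀ x n → X x n ≢ + 0 → x ≼ w
    deg : ∀ x n → X x n ≢ + 0 → ∃ λ i → n +ℤ + len w ≡ + (i ℕ.+ i ℕ.+ len x)
open Spec public

supp0 : ∀ {w X} → Spec w X → ∀ x n → ¬ x ≼ w → X x n ≡ + 0
supp0 {X = X} S x n p with X x n ≟ℤ + 0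
... | yes q = q
... | no q = ⊥-elim (p (supp S x n q))

coefOf : Op → W → (W → F) → W → ℤ
coefOf σ v c z = if not (z == v) ∧ dn σ z then c v z (- (+ 1)) else + 0

correction : Op → W → (W → F) → F
correction σ v c x n = Σ[ interval v ] λ z → coefOf σ v c z *ℤ c z x n

kl-step : Op → W → (W → F) → F
kl-step σ v c = C σ (c v) +F (- (+ 1)) • correction σ v c

coefOf-up : ∀ σ v c z → dn σ z ≡ false → coefOf σ v c z ≡ + 0
coefOf-up σ v c z p rewrite p with z == v
... | true = refl
... | false = refl

coefOf-dn : ∀ σ v c z → z ≢ v → dn σ z ≡ true → coefOf σ v c z ≡ c v z (- (+ 1))
coefOf-dn σ v c z ne p rewrite p | ≢⇒==false ne = refl

coefOf-≢0 : ∀ σ v c z → coefOf σ v c z ≢ + 0 → dn σ z ≡ true × c v z (- (+ 1)) ≢ + 0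
coefOf-≢0 σ v c z ne with z == v | dn σ z
... | true | _ = ⊥-elim (ne refl)
... | false | true = refl , ne
... | false | false = ⊥-elim (ne refl)

*-≢0 : ∀ {p q} → p *ℤ q ≢ + 0 → p ≢ + 0 × q ≢ + 0
*-≢0 {p} {q} ne = (λ z → ne (cong (_*ℤ q) z)) , (λ z → ne (trans (cong (p *ℤ_) z) (ℤₚ.*-zeroʳ p)))

Inv-Σ : ∀ L (k : W → ℤ) (c : W → F) → (∀ z → z ∈ L → Inv (c z)) → Inv (λ x n → Σ[ L ] λ z → k z *ℤ c z x n)
Inv-Σ [] k c h = Inv-cong (mk≐ λ x n → refl) (Inv-• (+ 0) Inv-δ)
Inv-Σ (z ∷ L) k c h = Inv-+ (Inv-• (k z) (h z (here refl))) (Inv-Σ L k c (λ y i → h y (there i)))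

-- The family c is arbitrary, so that the argument serves both the recursion with fuel and,
-- afterwards, the basis itself on either side.
module KLStep (σ : Op) (v : W) (c : W → F) (v-up : dn σ v ≡ false) (S : ∀ z → z ≼ v → Spec z (c z)) where

  private
    w : W
    w = act σ v
    Sv : Spec v (c v)
    Sv = S v ≼-refl
    len-w : len w ≡ suc (len v)
    len-w = up⇒len σ v v-up
    w⋠ : ∀ {z} → z ≼ v → ¬ w ≼ z
    w⋠ p q = ℕₚ.<-irrefl refl (ℕₚ.≤-trans (ℕₚ.≤-reflexive (sym len-w)) (ℕₚ.≤-trans (≼-len q) (≼-len p)))

    corr-at : ∀ x n → + 0 ≤ℤ n → correction σ v c x n ≡ coefOf σ v c x *ℤ c x x n
    corr-at x n le = Σ-interval-single v x (λ z → coefOf σ v c z *ℤ c z x n)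
      (λ z p ne → trans (cong (coefOf σ v c z *ℤ_) (neg-X (isKL (S z p)) x n (λ q → ne (sym q)) le)) (ℤₚ.*-zeroʳ (coefOf σ v c z)))
      (λ p → cong (_*ℤ c x x n) (coef0 p))
      where
      coef0 : ¬ x ≼ v → coefOf σ v c x ≡ + 0
      coef0 p with coefOf σ v c x ≟ℤ + 0
      ... | yes q = q
      ... | no q = ⊥-elim (p (supp Sv x _ (proj₂ (coefOf-≢0 σ v c x q))))

    inv′ : Inv (kl-step σ v c)
    inv′ = Inv-+ (Inv-C σ (inv-X (isKL Sv)))
      (Inv-• (- (+ 1)) (Inv-Σ (interval v) (coefOf σ v c) c (λ z i → inv-X (isKL (S z (∈-interval⇒≼ v i))))))

    top′ : ∀ n → kl-step σ v c w n ≡ unit n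
    top′ n = begin
      c v (act σ w) n +ℤ c v w (n +ℤ η σ w) +ℤ - (+ 1) *ℤ correction σ v c w n
        ≡⟨ cong₂ (λ p q → p +ℤ q +ℤ - (+ 1) *ℤ correction σ v c w n)
             (trans (cong (λ z → c v z n) (act² σ v)) (top-X (isKL Sv) n)) (supp0 Sv w _ (w⋠ ≼-refl)) ⟩
      unit n +ℤ + 0 +ℤ - (+ 1) *ℤ correction σ v c w n
        ≡⟨ cong (λ q → unit n +ℤ + 0 +ℤ - (+ 1) *ℤ q) (Σ-zero (interval v) (λ z i → trans
             (cong (coefOf σ v c z *ℤ_) (supp0 (S z (∈-interval⇒≼ v i)) w n (w⋠ (∈-interval⇒≼ v i)))) (ℤₚ.*-zeroʳ (coefOf σ v c z)))) ⟩
      unit n +ℤ + 0 +ℤ + 0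
        ≡⟨ trans (ℤₚ.+-identityʳ _) (ℤₚ.+-identityʳ (unit n)) ⟩
      unit n ∎

    -- If σx < x, the diagonal term of C_σ raises degrees by one, so degree 0 at x receives the
    -- coefficient of v^-1 in C_v. Subtracting that multiple of C_x removes exactly this; other C_z
    -- contribute nothing at x in degrees at least 0.
    neg′ : ∀ x n → x ≢ w → + 0 ≤ℤ n → kl-step σ v c x n ≡ + 0
    neg′ x n ne le with step σ x
    ... | up p _ _ = begin
        c v (act σ x) n +ℤ c v x (n +ℤ η σ x) +ℤ - (+ 1) *ℤ correction σ v c x n
          ≡⟨ cong (λ k → c v (act σ x) n +ℤ c v x (n +ℤ k) +ℤ - (+ 1) *ℤ correction σ v c x n) (η-up {σ} {x} p) ⟩
        c v (act σ x) n +ℤ c v x (n +ℤ + 1) +ℤ - (+ 1) *ℤ correction σ v c x n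
          ≡⟨ cong₂ (λ a b → a +ℤ b +ℤ - (+ 1) *ℤ correction σ v c x n)
               (neg-X (isKL Sv) (act σ x) n (λ q → ne (act-swap σ q)) le) at-x ⟩
        + 0 +ℤ + 0 +ℤ - (+ 1) *ℤ correction σ v c x n
          ≡⟨ cong (λ q → + 0 +ℤ + 0 +ℤ - (+ 1) *ℤ q) (trans (corr-at x n le) (cong (_*ℤ c x x n) (coefOf-up σ v c x p))) ⟩
        + 0 ∎
      where
      le+1 : + 0 ≤ℤ n +ℤ + 1
      le+1 = ℤₚ.≤-trans le (ℤₚ.i≤i+j n (+ 1))
      at-x : c v x (n +ℤ + 1) ≡ + 0
      at-x with x ≟W v
      ... | no q = neg-X (isKL Sv) x _ q le+1
      ... | yes refl = trans (top-X (isKL Sv) _) (unit-≢0 (pos+1 n le))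
        where
        pos+1 : ∀ n → + 0 ≤ℤ n → n +ℤ + 1 ≢ + 0
        pos+1 (+ m) _ q = ℕₚ.1+n≢0 (trans (ℕₚ.+-comm 1 m) (ℤₚ.+-injective q))
    ... | down p _ _ = begin
        c v (act σ x) n +ℤ c v x (n +ℤ η σ x) +ℤ - (+ 1) *ℤ correction σ v c x n
          ≡⟨ cong₂ (λ k q → c v (act σ x) n +ℤ c v x (n +ℤ k) +ℤ - (+ 1) *ℤ q) (η-dn {σ} {x} p) corr ⟩
        c v (act σ x) n +ℤ c v x (n +ℤ - (+ 1)) +ℤ - (+ 1) *ℤ (c v x (- (+ 1)) *ℤ c x x n)
          ≡⟨ cong (λ a → a +ℤ c v x (n +ℤ - (+ 1)) +ℤ - (+ 1) *ℤ (c v x (- (+ 1)) *ℤ c x x n)) (neg-X (isKL Sv) (act σ x) n (λ q → ne (act-swap σ q)) le) ⟩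
        + 0 +ℤ c v x (n +ℤ - (+ 1)) +ℤ - (+ 1) *ℤ (c v x (- (+ 1)) *ℤ c x x n)
          ≡⟨ fin n le ⟩
        + 0 ∎
      where
      x≢v : x ≢ v
      x≢v q = true≢false (trans (sym p) (trans (cong (dn σ) q) v-up))
      corr : correction σ v c x n ≡ c v x (- (+ 1)) *ℤ c x x n
      corr = trans (corr-at x n le) (cong (_*ℤ c x x n) (coefOf-dn σ v c x x≢v p))
      fin : ∀ n → + 0 ≤ℤ n → + 0 +ℤ c v x (n +ℤ - (+ 1)) +ℤ - (+ 1) *ℤ (c v x (- (+ 1)) *ℤ c x x n) ≡ + 0
      fin n le with c v x (- (+ 1)) ≟ℤ + 0
      ... | yes z = trans (cong₂ (λ a b → + 0 +ℤ a +ℤ - (+ 1) *ℤ (b *ℤ c x x n)) (prev n le) z) refl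
        where
        prev : ∀ n → + 0 ≤ℤ n → c v x (n +ℤ - (+ 1)) ≡ + 0
        prev (+ zero) _ = z
        prev (+ suc m) _ = neg-X (isKL Sv) x _ x≢v (+≤+ z≤n)
      ... | no z = trans (cong (λ u → + 0 +ℤ c v x (n +ℤ - (+ 1)) +ℤ - (+ 1) *ℤ (c v x (- (+ 1)) *ℤ u)) (top-X (isKL (S x (supp Sv x _ z))) n)) (prev n le)
        where
        lem : ∀ p → + 0 +ℤ p +ℤ - (+ 1) *ℤ (p *ℤ + 1) ≡ + 0
        lem = solve-∀
        prev : ∀ n → + 0 ≤ℤ n → + 0 +ℤ c v x (n +ℤ - (+ 1)) +ℤ - (+ 1) *ℤ (c v x (- (+ 1)) *ℤ unit n) ≡ + 0
        prev (+ zero) _ = trans (cong (λ u → + 0 +ℤ c v x (- (+ 1)) +ℤ - (+ 1) *ℤ (c v x (- (+ 1)) *ℤ u)) unit-0) (lem (c v x (- (+ 1))))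
        prev (+ suc m) _ = cong₂ (λ a b → + 0 +ℤ a +ℤ - (+ 1) *ℤ b)
          (neg-X (isKL Sv) x (+ m) x≢v (+≤+ z≤n)) (trans (cong (c v x (- (+ 1)) *ℤ_) (unit-≢0 (λ ()))) (ℤₚ.*-zeroʳ (c v x (- (+ 1)))))

  kl-step-isKL : IsKL w (kl-step σ v c)
  kl-step-isKL = record { inv-X = inv′ ; top-X = top′ ; neg-X = neg′ }

private
  +-≢0 : ∀ {p q} → p +ℤ q ≢ + 0 → p ≢ + 0 ⊎ q ≢ + 0
  +-≢0 {p} {q} ne with p ≟ℤ + 0
  ... | no z = inj₁ z
  ... | yes z = inj₂ (λ y → ne (cong₂ _+ℤ_ z y))

  kl-step-≢0 : ∀ σ v c x n → kl-step σ v c x n ≢ + 0 →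
    c v (act σ x) n ≢ + 0 ⊎ c v x (n +ℤ η σ x) ≢ + 0 ⊎ (∃ λ z → z ≼ v × coefOf σ v c z ≢ + 0 × c z x n ≢ + 0)
  kl-step-≢0 σ v c x n ne with +-≢0 ne
  ... | inj₁ p with +-≢0 p
  ...   | inj₁ q = inj₁ q
  ...   | inj₂ q = inj₂ (inj₁ q)
  kl-step-≢0 σ v c x n ne | inj₂ p with Σ-nonzero (interval v) _ (proj₂ (*-≢0 { - (+ 1)} p))
  ...   | z , i , q = inj₂ (inj₂ (z , ∈-interval⇒≼ v i , *-≢0 q))

-- Support and parity are followed through left multiplication, the one by which the recursion
-- proceeds.
module KLStepLeft (g : Gen) (v : W) (c : W → F) (v-up : dn (left , g) v ≡ false) (S : ∀ z → z ≼ v → Spec z (c z)) where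
  private
    σ : Op
    σ = left , g
    w : W
    w = act σ v
    Sv : Spec v (c v)
    Sv = S v ≼-refl
    len-w : len w ≡ suc (len v)
    len-w = up⇒len σ v v-up
    up-≼ : ∀ {x} → x ≼ v → x ≼ w
    up-≼ p = proj₁ (≼-act g p v-up)

    supp′ : ∀ x n → kl-step σ v c x n ≢ + 0 → x ≼ w
    supp′ x n ne with kl-step-≢0 σ v c x n ne
    ... | inj₁ p = subst (_≼ w) (act² σ x) (proj₂ (≼-act g (supp Sv (act σ x) n p) v-up))
    ... | inj₂ (inj₁ p) = up-≼ (supp Sv x _ p)
    ... | inj₂ (inj₂ (z , q , _ , p)) = up-≼ (≼-trans (supp (S z q) x n p) q)

    to-w : ∀ n k → n +ℤ + len v ≡ + k → n +ℤ + len w ≡ + suc k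
    to-w n k p = begin
      n +ℤ + len w             ≡⟨ cong (λ l → n +ℤ + l) len-w ⟩
      n +ℤ (+ 1 +ℤ + len v)    ≡⟨ lem n (+ len v) ⟩
      + 1 +ℤ (n +ℤ + len v)    ≡⟨ cong (+ 1 +ℤ_) p ⟩
      + suc k ∎
      where
      lem : ∀ n l → n +ℤ (+ 1 +ℤ l) ≡ + 1 +ℤ (n +ℤ l)
      lem = solve-∀

    double-suc : ∀ i l → suc (suc (i ℕ.+ i ℕ.+ l)) ≡ suc i ℕ.+ suc i ℕ.+ l
    double-suc i l = cong (λ k → suc k ℕ.+ l) (sym (ℕₚ.+-suc i i))

    deg′ : ∀ x n → kl-step σ v c x n ≢ + 0 → ∃ λ i → n +ℤ + len w ≡ + (i ℕ.+ i ℕ.+ len x)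
    deg′ x n ne with kl-step-≢0 σ v c x n ne | step σ x
    ... | inj₁ p | up _ _ q = let (i , ρ) = deg Sv (act σ x) n p in
      suc i , trans (to-w n _ ρ) (cong +_ (trans (cong suc (trans (cong (i ℕ.+ i ℕ.+_) q) (ℕₚ.+-suc (i ℕ.+ i) (len x)))) (double-suc i (len x))))
    ... | inj₁ p | down _ _ q = let (i , ρ) = deg Sv (act σ x) n p in
      i , trans (to-w n _ ρ) (cong +_ (trans (sym (ℕₚ.+-suc (i ℕ.+ i) (len (act σ x)))) (cong (i ℕ.+ i ℕ.+_) (sym q))))
    ... | inj₂ (inj₁ p) | up d _ _ = let (i , ρ) = deg Sv x _ p in
      i , (begin
        n +ℤ + len w                ≡⟨ cong (λ l → n +ℤ + l) len-w ⟩
        n +ℤ (+ 1 +ℤ + len v)       ≡⟨ sym (ℤₚ.+-assoc n (+ 1) (+ len v)) ⟩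
        n +ℤ + 1 +ℤ + len v         ≡⟨ cong (λ k → n +ℤ k +ℤ + len v) (sym (η-up {σ} {x} d)) ⟩
        n +ℤ η σ x +ℤ + len v       ≡⟨ ρ ⟩
        + (i ℕ.+ i ℕ.+ len x) ∎)
    ... | inj₂ (inj₁ p) | down d _ _ = let (i , ρ) = deg Sv x _ p in
      suc i , (begin
        n +ℤ + len w                              ≡⟨ cong (λ l → n +ℤ + l) len-w ⟩
        n +ℤ (+ 1 +ℤ + len v)                     ≡⟨ lem n (+ len v) ⟩
        + 2 +ℤ (n +ℤ - (+ 1) +ℤ + len v)          ≡⟨ cong (λ k → + 2 +ℤ (n +ℤ k +ℤ + len v)) (sym (η-dn {σ} {x} d)) ⟩
        + 2 +ℤ (n +ℤ η σ x +ℤ + len v)            ≡⟨ cong (+ 2 +ℤ_) ρ ⟩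
        + suc (suc (i ℕ.+ i ℕ.+ len x))           ≡⟨ cong +_ (double-suc i (len x)) ⟩
        + (suc i ℕ.+ suc i ℕ.+ len x) ∎)
      where
      lem : ∀ n l → n +ℤ (+ 1 +ℤ l) ≡ + 2 +ℤ (n +ℤ - (+ 1) +ℤ l)
      lem = solve-∀
    ... | inj₂ (inj₂ (z , z≼ , q , p)) | _ =
      let (i , ρ) = deg (S z z≼) x n p
          (j , u) = deg Sv z _ (proj₂ (coefOf-≢0 σ v c z q)) in
      suc j ℕ.+ i , (begin
        n +ℤ + len w
          ≡⟨ cong (λ l → n +ℤ + l) len-w ⟩
        n +ℤ (+ 1 +ℤ + len v)
          ≡⟨ lem n (+ len v) ⟩
        n +ℤ (+ 2 +ℤ (- (+ 1) +ℤ + len v))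
          ≡⟨ cong (λ k → n +ℤ (+ 2 +ℤ k)) u ⟩
        n +ℤ (+ 2 +ℤ (+ j +ℤ + j +ℤ + len z))
          ≡⟨ lem₂ n (+ j) (+ len z) ⟩
        + 2 +ℤ (+ j +ℤ + j) +ℤ (n +ℤ + len z)
          ≡⟨ cong (+ 2 +ℤ (+ j +ℤ + j) +ℤ_) ρ ⟩
        + 2 +ℤ (+ j +ℤ + j) +ℤ (+ i +ℤ + i +ℤ + len x)
          ≡⟨ lem₃ (+ j) (+ i) (+ len x) ⟩
        + 1 +ℤ + j +ℤ + i +ℤ (+ 1 +ℤ + j +ℤ + i) +ℤ + len x ∎)
      where
      lem : ∀ n l → n +ℤ (+ 1 +ℤ l) ≡ n +ℤ (+ 2 +ℤ (- (+ 1) +ℤ l))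
      lem = solve-∀
      lem₂ : ∀ n j l → n +ℤ (+ 2 +ℤ (j +ℤ j +ℤ l)) ≡ + 2 +ℤ (j +ℤ j) +ℤ (n +ℤ l)
      lem₂ = solve-∀
      lem₃ : ∀ j i l → + 2 +ℤ (j +ℤ j) +ℤ (i +ℤ i +ℤ l) ≡ + 1 +ℤ j +ℤ i +ℤ (+ 1 +ℤ j +ℤ i) +ℤ l
      lem₃ = solve-∀

  kl-step-spec : Spec w (kl-step σ v c)
  kl-step-spec = record { isKL = KLStep.kl-step-isKL σ v c v-up S ; supp = supp′ ; deg = deg′ }

-- The recursion for P carried out in the Hecke algebra, with the same fuel; it yields C_w as soon
-- as n exceeds l(w).
K : ℕ → W → F
body : ℕ → List Gen → F
K zero w = 0F
K (suc n) w = body n (redWord w)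
body n [] = δ e
body n (g ∷ A) = kl-step (left , g) (eval A) (K n)

δ-spec : Spec e (δ e)
δ-spec = record
  { isKL = record { inv-X = Inv-δ ; top-X = δ-same e ; neg-X = λ x n ne _ → δ-diff n ne }
  ; supp = λ x n ne → subst (_≼ e) (sym (≡e x n ne)) ≼-refl
  ; deg = λ x n ne → 0 , trans (cong (λ l → n +ℤ + l) len-e) (trans (ℤₚ.+-identityʳ n) (trans (≡0 x n ne) (sym (trans (cong (λ z → + len z) (≡e x n ne)) (cong +_ len-e))))) }
  where
  ≡e : ∀ x n → δ e x n ≢ + 0 → x ≡ e
  ≡e x n ne with x ≟W e
  ... | yes q = q
  ... | no q = ⊥-elim (ne (δ-diff n q))
  ≡0 : ∀ x n → δ e x n ≢ + 0 → n ≡ + 0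
  ≡0 x n ne with n ≟ℤ + 0
  ... | yes q = q
  ... | no q = ⊥-elim (ne (trans (cong (λ z → δ e z n) (≡e x n ne)) (trans (δ-same e n) (unit-≢0 q))))

K-spec : ∀ n w → len w < n → Spec w (K n w)
body-spec : ∀ n A → Reduced A → len (eval A) ≤ n → Spec (eval A) (body n A)
K-spec (suc n) w (s≤s le) = subst (λ z → Spec z (body n (redWord w))) (eval-redWord w)
  (body-spec n (redWord w) (redWord-reduced w) (subst (λ z → len z ≤ n) (sym (eval-redWord w)) le))
body-spec n [] red le = δ-spec
body-spec n (g ∷ A) red le = subst (λ z → Spec z (kl-step (left , g) (eval A) (K n))) (act-eval g A)
  (KLStepLeft.kl-step-spec g (eval A) (K n) (dn-reduced g A red)
    (λ z p → K-spec n z (ℕₚ.≤-<-trans (≼-len p) (ℕₚ.<-≤-trans (Reduced-up g A red) le))))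

opaque
  KL : W → F
  KL w = K (suc (len w)) w

  KL-spec : ∀ w → Spec w (KL w)
  KL-spec w = K-spec (suc (len w)) w ℕₚ.≤-refl

KL-isKL : ∀ w → IsKL w (KL w)
KL-isKL w = isKL (KL-spec w)

-- The construction multiplies on the left; uniqueness gives the product formula on the right as
-- well.
KL-product : ∀ σ v → dn σ v ≡ false → KL (act σ v) ≐ kl-step σ v KL
KL-product σ v p = IsKL-unique (KL-isKL (act σ v)) (KLStep.kl-step-isKL σ v KL p (λ z _ → KL-spec z))

dn-dec : ∀ σ z → dn σ z ≡ false ⊎ dn σ z ≡ true
dn-dec σ z with dn σ z
... | false = inj₁ refl
... | true = inj₂ refl

private
  C-correction : ∀ σ v → (∀ z → z ≼ v → dn σ z ≡ true → C σ (KL z) ≐ [2] KL z) → C σ (correction σ v KL) ≐ [2] correction σ v KL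
  C-correction σ v h = mk≐ λ x n → trans (sym (Σ-+ (interval v) _ _)) (trans (Σ-cong∈ (interval v) (go x n)) (Σ-+ (interval v) _ _))
    where
    go : ∀ x n z → z ∈ interval v →
      coefOf σ v KL z *ℤ KL z (act σ x) n +ℤ coefOf σ v KL z *ℤ KL z x (n +ℤ η σ x)
      ≡ coefOf σ v KL z *ℤ KL z x (n +ℤ + 1) +ℤ coefOf σ v KL z *ℤ KL z x (n +ℤ - (+ 1))
    go x n z i = cases (dn-dec σ z)
      where
      k : ℤ
      k = coefOf σ v KL z
      cases : dn σ z ≡ false ⊎ dn σ z ≡ true → k *ℤ KL z (act σ x) n +ℤ k *ℤ KL z x (n +ℤ η σ x) ≡ k *ℤ KL z x (n +ℤ + 1) +ℤ k *ℤ KL z x (n +ℤ - (+ 1))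
      cases (inj₁ p) = trans (cong (λ k → k *ℤ KL z (act σ x) n +ℤ k *ℤ KL z x (n +ℤ η σ x)) k0) (sym (cong (λ k → k *ℤ KL z x (n +ℤ + 1) +ℤ k *ℤ KL z x (n +ℤ - (+ 1))) k0))
        where
        k0 : k ≡ + 0
        k0 = coefOf-up σ v KL z p
      cases (inj₂ p) = trans (sym (ℤₚ.*-distribˡ-+ k (KL z (act σ x) n) (KL z x (n +ℤ η σ x))))
        (trans (cong (k *ℤ_) (at (h z (∈-interval⇒≼ v i) p) x n)) (ℤₚ.*-distribˡ-+ k (KL z x (n +ℤ + 1)) (KL z x (n +ℤ - (+ 1)))))

  [2]-linear : Linear [2]_
  [2]-linear = +-linear (sh-linear (+ 1)) (sh-linear (- (+ 1)))
    where
    sh-linear : ∀ k → Linear (sh k)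
    sh-linear k = record { l-cong = sh-cong k ; l-+ = λ _ _ → ≐-refl ; l-• = λ _ _ → ≐-refl
      ; l-sh = λ j X → mk≐ λ x n → cong (X x) (+-swapʳ n k j) }

-- Induction on length: C_w is C_σ C_v minus multiples of C_z with σz < z, and C_σ acts as v + v^-1
-- on C_σ C_v by the quadratic relation and on each C_z by induction.
KL-descent : ∀ σ w → dn σ w ≡ true → C σ (KL w) ≐ [2] KL w
KL-descent σ w = go (len w) w ℕₚ.≤-refl
  where
  go : ∀ m w → len w ≤ m → dn σ w ≡ true → C σ (KL w) ≐ [2] KL w
  go m w le d = l-cong (C-linear σ) w≐ ∙ l-+ (C-linear σ) (C σ (KL v)) (- (+ 1) • correction σ v KL)
    ∙ +F-cong (C² σ (KL v)) (l-• (C-linear σ) (- (+ 1)) (correction σ v KL) ∙ •-cong (- (+ 1)) (C-correction σ v (below m le)) ∙ ≐-sym (l-• [2]-linear (- (+ 1)) (correction σ v KL)))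
    ∙ ≐-sym (l-+ [2]-linear (C σ (KL v)) (- (+ 1) • correction σ v KL)) ∙ l-cong [2]-linear (≐-sym w≐)
    where
    v : W
    v = act σ w
    v-up : dn σ v ≡ false
    v-up = trans (dn-act σ w) (cong not d)
    w≐ : KL w ≐ kl-step σ v KL
    w≐ = ≡⇒≐ (cong KL (sym (act² σ w))) ∙ KL-product σ v v-up
    below : ∀ m → len w ≤ m → ∀ z → z ≼ v → dn σ z ≡ true → C σ (KL z) ≐ [2] KL z
    below zero le z p dz = ⊥-elim (ℕₚ.n≮0 (subst (_≤ 0) (dn⇒len σ w d) le))
    below (suc m) le z p dz = go m z (ℕₚ.≤-trans (≼-len p) (ℕₚ.≤-pred (subst (_≤ suc m) (dn⇒len σ w d) le))) dz

private
  cancelʳ : ∀ p {q q′} → q +ℤ p ≡ q′ +ℤ p → q ≡ q′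
  cancelʳ p {q} {q′} eq = trans (sym (+-cancel q p)) (trans (cong (_+ℤ - p) eq) (+-cancel q′ p))

-- P_{sx,w} = P_{x,w} when sw < w.
KL-shift : ∀ σ w x n → dn σ w ≡ true → KL w (act σ x) n ≡ KL w x (n +ℤ - η σ x)
KL-shift σ w x n d with step σ x | at (KL-descent σ w d) x n
... | up p _ _ | q = cancelʳ (KL w x (n +ℤ + 1)) (begin
    KL w (act σ x) n +ℤ KL w x (n +ℤ + 1)              ≡⟨ cong (λ k → KL w (act σ x) n +ℤ KL w x (n +ℤ k)) (sym (η-up {σ} {x} p)) ⟩
    KL w (act σ x) n +ℤ KL w x (n +ℤ η σ x)            ≡⟨ q ⟩
    KL w x (n +ℤ + 1) +ℤ KL w x (n +ℤ - (+ 1))         ≡⟨ ℤₚ.+-comm (KL w x (n +ℤ + 1)) _ ⟩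
    KL w x (n +ℤ - (+ 1)) +ℤ KL w x (n +ℤ + 1)         ≡⟨ cong (λ k → KL w x (n +ℤ - k) +ℤ KL w x (n +ℤ + 1)) (sym (η-up {σ} {x} p)) ⟩
    KL w x (n +ℤ - η σ x) +ℤ KL w x (n +ℤ + 1) ∎)
... | down p _ _ | q = cancelʳ (KL w x (n +ℤ - (+ 1))) (begin
    KL w (act σ x) n +ℤ KL w x (n +ℤ - (+ 1))          ≡⟨ cong (λ k → KL w (act σ x) n +ℤ KL w x (n +ℤ k)) (sym (η-dn {σ} {x} p)) ⟩
    KL w (act σ x) n +ℤ KL w x (n +ℤ η σ x)            ≡⟨ q ⟩
    KL w x (n +ℤ + 1) +ℤ KL w x (n +ℤ - (+ 1))         ≡⟨ cong (λ k → KL w x (n +ℤ - k) +ℤ KL w x (n +ℤ - (+ 1))) (sym (η-dn {σ} {x} p)) ⟩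
    KL w x (n +ℤ - η σ x) +ℤ KL w x (n +ℤ - (+ 1)) ∎)

-- Comparison with the recursion for P

coeff-⊕ : ∀ p q i → coeff (p ⊕ q) i ≡ coeff p i +ℤ coeff q i
coeff-⊕ [] q i = sym (ℤₚ.+-identityˡ (coeff q i))
coeff-⊕ (x ∷ p) [] i = sym (ℤₚ.+-identityʳ (coeff (x ∷ p) i))
coeff-⊕ (x ∷ p) (y ∷ q) zero = refl
coeff-⊕ (x ∷ p) (y ∷ q) (suc i) = coeff-⊕ p q i

coeff-scale : ∀ c p i → coeff (scaleP c p) i ≡ c *ℤ coeff p i
coeff-scale c [] i = sym (ℤₚ.*-zeroʳ c)
coeff-scale c (x ∷ p) zero = refl
coeff-scale c (x ∷ p) (suc i) = coeff-scale c p i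

coeff-sum : ∀ (f : W → Poly) L i → coeff (foldr (λ z acc → f z ⊕ acc) [] L) i ≡ Σ[ L ] λ z → coeff (f z) i
coeff-sum f [] i = refl
coeff-sum f (z ∷ L) i = trans (coeff-⊕ (f z) _ i) (cong (coeff (f z) i +ℤ_) (coeff-sum f L i))

if-true : ∀ {A : Set} {b} {x y : A} → b ≡ true → (if b then x else y) ≡ x
if-true refl = refl

if-false : ∀ {A : Set} {b} {x y : A} → b ≡ false → (if b then x else y) ≡ y
if-false refl = refl

opaque
  -- `belowList` and `len` unfold to `redWord`; under opaque names they survive the rewriting of
  -- `redWord w` in `KLf-unfold`.
  bel : W → List W
  bel w = belowList w

  bel-≡ : ∀ w → belowList w ≡ bel w
  bel-≡ w = refl

  ln : W → ℕ
  ln w = len w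

  ln-≡ : ∀ w → len w ≡ ln w
  ln-≡ w = refl

summandOf : ℕ → W → W → Gen → ℕ → W → Poly
summandOf n x v g l z =
  if not (z == v) ∧ inLᵇ g z
  then scaleP (- muFrom (KLf n z v) z v) (shiftP ((l ∸ len z) / 2) (KLf n x z))
  else []

recursion : ℕ → W → W → Gen → List W → ℕ → Poly
recursion n x v g B l =
  if memᵇ x B
  then ((if inLᵇ g x then KLf n (gen g · x) v else shiftP 1 (KLf n (gen g · x) v))
        ⊕ (if inLᵇ g x then shiftP 1 (KLf n x v) else KLf n x v))
       ⊕ foldr (λ z acc → summandOf n x v g l z ⊕ acc) [] (interval v)
  else []

KLf-unfold : ∀ n x w g A → redWord w ≡ g ∷ A → KLf (suc n) x w ≡ recursion n x (eval A) g (bel w) (ln w)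
KLf-unfold n x w g A eq rewrite eq = cong₂ (recursion n x (eval A) g) (bel-≡ w) (ln-≡ w)

KLf-unfold-e : ∀ n x w → redWord w ≡ [] → KLf (suc n) x w ≡ (if x == e then + 1 ∷ [] else [])
KLf-unfold-e n x w eq rewrite eq = refl

-- The v-degree of the term q^i of P_{x,w} in C_w.
vdeg : ℕ → W → W → ℤ
vdeg i x w = + i +ℤ + i +ℤ + len x +ℤ - (+ len w)

Matches : ℕ → W → Set
Matches n w = ∀ x i → coeff (KLf n x w) i ≡ KL w x (vdeg i x w)

KL-deg0 : ∀ w x m → (∀ i → m +ℤ + len w ≢ + i +ℤ + i +ℤ + len x) → KL w x m ≡ + 0
KL-deg0 w x m h with KL w x m ≟ℤ + 0
... | yes q = q
... | no q = let (i , p) = deg (KL-spec w) x m q in ⊥-elim (h i p)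

coeff-shift : ∀ n w → Matches n w → ∀ x d i → coeff (shiftP d (KLf n x w)) i ≡ KL w x (vdeg i x w +ℤ - (+ d +ℤ + d))
coeff-shift n w M x zero i = trans (M x i) (cong (KL w x) (sym (ℤₚ.+-identityʳ (vdeg i x w))))
-- The shifted polynomial has no constant term; in C_w a nonzero coefficient here would need a
-- negative exponent of q, which `deg` excludes.
coeff-shift n w M x (suc d) zero = sym (KL-deg0 w x _ (λ i q → bad i (trans (lem (+ d) (+ len x) (+ len w)) (cong (λ u → u +ℤ - (+ len x)) q))))
  where
  lem : ∀ d x w → - (+ 1 +ℤ d +ℤ (+ 1 +ℤ d)) ≡ + 0 +ℤ + 0 +ℤ x +ℤ - w +ℤ - (+ 1 +ℤ d +ℤ (+ 1 +ℤ d)) +ℤ w +ℤ - x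
  lem = solve-∀
  canc : ∀ i x → i +ℤ i +ℤ x +ℤ - x ≡ i +ℤ i
  canc = solve-∀
  bad : ∀ i → - (+ (suc d ℕ.+ suc d)) ≢ + i +ℤ + i +ℤ + len x +ℤ - (+ len x)
  bad i q = contra (trans q (canc (+ i) (+ len x)))
    where
    contra : - (+ (suc d ℕ.+ suc d)) ≢ + (i ℕ.+ i)
    contra ()
coeff-shift n w M x (suc d) (suc i) = trans (coeff-shift n w M x d i) (cong (KL w x) (lem (+ i) (+ d) (+ len x) (+ len w)))
  where
  lem : ∀ i d x w → i +ℤ i +ℤ x +ℤ - w +ℤ - (d +ℤ d) ≡ + 1 +ℤ i +ℤ (+ 1 +ℤ i) +ℤ x +ℤ - w +ℤ - (+ 1 +ℤ d +ℤ (+ 1 +ℤ d))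
  lem = solve-∀

private
  odd-half : ∀ m → m % 2 ≡ 1 → m ≡ suc (((m ∸ 1) / 2) ℕ.+ ((m ∸ 1) / 2))
  odd-half m q = trans m≡ (cong suc (cong₂ ℕ._+_ half half))
    where
    m≡ : m ≡ suc (m / 2 ℕ.+ m / 2)
    m≡ = trans (m≡m%n+[m/n]*n m 2) (cong₂ ℕ._+_ q (trans (ℕₚ.*-comm (m / 2) 2) (cong (m / 2 ℕ.+_) (ℕₚ.+-identityʳ (m / 2)))))
    half : m / 2 ≡ (m ∸ 1) / 2
    half = sym (trans (cong (λ k → (k ∸ 1) / 2) (trans (m≡m%n+[m/n]*n m 2) (cong (ℕ._+ m / 2 ℕ.* 2) q))) (m*n/n≡m (m / 2) 2))

  double-odd : ∀ i → suc (i ℕ.+ i) % 2 ≡ 1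
  double-odd i = trans (cong (λ k → suc (i ℕ.+ k) % 2) (sym (ℕₚ.+-identityʳ i))) (trans (cong (λ k → suc k % 2) (ℕₚ.*-comm 2 i)) ([m+kn]%n≡m%n 1 i 2))

  double-half : ∀ i → (i ℕ.+ i) / 2 ≡ i
  double-half i = trans (cong (_/ 2) (trans (cong (i ℕ.+_) (sym (ℕₚ.+-identityʳ i))) (ℕₚ.*-comm 2 i))) (m*n/n≡m i 2)


KL-odd : ∀ v z → KL v z (- (+ 1)) ≢ + 0 → ∃ λ j → len v ≡ suc (j ℕ.+ j) ℕ.+ len z
KL-odd v z ne with deg (KL-spec v) z _ ne
... | j , p = j , ℤₚ.+-injective (trans (lem (+ len v)) (cong (+ 1 +ℤ_) p))
  where
  lem : ∀ l → l ≡ + 1 +ℤ (- (+ 1) +ℤ l)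
  lem = solve-∀

KL-self : ∀ v → KL v v (- (+ 1)) ≡ + 0
KL-self v = trans (top-X (KL-isKL v) (- (+ 1))) (unit-≢0 (λ ()))

-- The tests in `muFrom` for order, distinctness and parity hold whenever the coefficient of v^-1 is
-- nonzero, so a failed test returns the right value 0.
muFrom-KL : ∀ n v → Matches n v → ∀ z → muFrom (KLf n z v) z v ≡ KL v z (- (+ 1))
muFrom-KL n v M z = cases (G 𝔹ₚ.≟ true)
  where
  G : Bool
  G = (memᵇ z (belowList v) ∧ not (z == v)) ∧ ((len v ∸ len z) % 2 ≡ᵇ 1)
  index : G ≡ true → vdeg ((len v ∸ len z ∸ 1) / 2) z v ≡ - (+ 1)
  index g = trans (cong (λ l → + k +ℤ + k +ℤ + len z +ℤ - (+ l)) len≡) (lem (+ k) (+ len z))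
    where
    k : ℕ
    k = (len v ∸ len z ∸ 1) / 2
    odd : len v ∸ len z ≡ suc (k ℕ.+ k)
    odd = odd-half (len v ∸ len z) (ℕₚ.≡ᵇ⇒≡ _ 1 (subst T (sym (proj₂ (∧-elim g))) _))
    len≡ : len v ≡ suc (k ℕ.+ k) ℕ.+ len z
    len≡ = trans (sym (ℕₚ.m∸n+n≡m (≼-len {z} {v} (memᵇ⇒≼ {z} {v} (proj₁ (∧-elim (proj₁ (∧-elim g)))))))) (cong (ℕ._+ len z) odd)
    lem : ∀ k z → k +ℤ k +ℤ z +ℤ - (+ 1 +ℤ (k +ℤ k) +ℤ z) ≡ - (+ 1)
    lem = solve-∀
  cases : Dec (G ≡ true) → muFrom (KLf n z v) z v ≡ KL v z (- (+ 1))
  cases (yes g) = trans (if-true g) (trans (M z _) (cong (KL v z) (index g)))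
  cases (no g) = trans (if-false (𝔹ₚ.¬-not g)) (sym zero′)
    where
    zero′ : KL v z (- (+ 1)) ≡ + 0
    zero′ with KL v z (- (+ 1)) ≟ℤ + 0
    ... | yes q = q
    ... | no q = ⊥-elim (g (cong₂ _∧_ (cong₂ _∧_ (≼⇒memᵇ (supp (KL-spec v) z _ q))
            (cong not (≢⇒==false (λ { refl → q (KL-self v) })))) odd))
      where
      odd : ((len v ∸ len z) % 2 ≡ᵇ 1) ≡ true
      odd = let (j , p) = KL-odd v z q in
        cong (_≡ᵇ 1) (trans (cong (λ l → (l ∸ len z) % 2) p) (trans (cong (_% 2) (ℕₚ.m+n∸n≡m (suc (j ℕ.+ j)) (len z))) (double-odd j)))

private
  module Step-matches (n : ℕ) (g : Gen) (v : W) (v-up : dn (left , g) v ≡ false) (M : ∀ z → z ≼ v → Matches n z) where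
    σ : Op
    σ = left , g
    w : W
    w = act σ v
    len-w : len w ≡ suc (len v)
    len-w = up⇒len σ v v-up

    summand-matches : ∀ x i z → z ≼ v → coeff (summandOf n x v g (len w) z) i ≡ - (+ 1) *ℤ (coefOf σ v KL z *ℤ KL z x (vdeg i x w))
    summand-matches x i z p = cases (not (z == v) ∧ inLᵇ g z) refl
      where
      coef-eq : ∀ b → not (z == v) ∧ inLᵇ g z ≡ b → coefOf σ v KL z ≡ (if b then KL v z (- (+ 1)) else + 0)
      coef-eq b q = cong (λ d → if d then KL v z (- (+ 1)) else + 0) (trans (cong (not (z == v) ∧_) (sym (inLᵇ-dn g z))) q)
      -- The rounded quotient is exact because a nonzero μ(z , v) makes l(w) - l(z) even; if μ(z ,
      -- v) = 0 the summand vanishes anyway.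
      half : ∀ k → KL v z (- (+ 1)) ≢ + 0 → (len w ∸ len z) / 2 ≡ k → vdeg i x z +ℤ - (+ k +ℤ + k) ≡ vdeg i x w
      half k ne q = let (j , p) = KL-odd v z ne
                        lw : len w ≡ suc j ℕ.+ suc j ℕ.+ len z
                        lw = trans len-w (trans (cong suc p) (cong (λ m → suc m ℕ.+ len z) (sym (ℕₚ.+-suc j j))))
                        k≡ : k ≡ suc j
                        k≡ = trans (sym q) (trans (cong (λ l → (l ∸ len z) / 2) lw) (trans (cong (_/ 2) (ℕₚ.m+n∸n≡m (suc j ℕ.+ suc j) (len z))) (double-half (suc j))))
        in trans (cong (λ k → vdeg i x z +ℤ - (+ k +ℤ + k)) k≡) (trans (lem (+ i) (+ len x) (+ len z) (+ suc j)) (cong (λ l → + i +ℤ + i +ℤ + len x +ℤ - (+ l)) (sym lw)))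
        where
        lem : ∀ i x z j → i +ℤ i +ℤ x +ℤ - z +ℤ - (j +ℤ j) ≡ i +ℤ i +ℤ x +ℤ - (j +ℤ j +ℤ z)
        lem = solve-∀
      cases : ∀ b → not (z == v) ∧ inLᵇ g z ≡ b → coeff (summandOf n x v g (len w) z) i ≡ - (+ 1) *ℤ (coefOf σ v KL z *ℤ KL z x (vdeg i x w))
      cases false q = trans (cong (λ p → coeff p i) (if-false q)) (cong (λ c → - (+ 1) *ℤ (c *ℤ KL z x (vdeg i x w))) (sym (coef-eq false q)))
      cases true q = begin
        coeff (summandOf n x v g (len w) z) i
          ≡⟨ cong (λ p → coeff p i) (if-true q) ⟩
        coeff (scaleP (- muFrom (KLf n z v) z v) (shiftP ((len w ∸ len z) / 2) (KLf n x z))) i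
          ≡⟨ coeff-scale (- muFrom (KLf n z v) z v) (shiftP ((len w ∸ len z) / 2) (KLf n x z)) i ⟩
        - muFrom (KLf n z v) z v *ℤ coeff (shiftP ((len w ∸ len z) / 2) (KLf n x z)) i
          ≡⟨ cong₂ (λ m c → - m *ℤ c) (muFrom-KL n v (M v ≼-refl) z) (coeff-shift n z (M z p) x ((len w ∸ len z) / 2) i) ⟩
        - KL v z (- (+ 1)) *ℤ KL z x (vdeg i x z +ℤ - (+ ((len w ∸ len z) / 2) +ℤ + ((len w ∸ len z) / 2)))
          ≡⟨ fin (KL v z (- (+ 1)) ≟ℤ + 0) ⟩
        - (+ 1) *ℤ (KL v z (- (+ 1)) *ℤ KL z x (vdeg i x w))
          ≡⟨ cong (λ c → - (+ 1) *ℤ (c *ℤ KL z x (vdeg i x w))) (sym (coef-eq true q)) ⟩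
        - (+ 1) *ℤ (coefOf σ v KL z *ℤ KL z x (vdeg i x w)) ∎
        where
        lem : ∀ p q → - p *ℤ q ≡ - (+ 1) *ℤ (p *ℤ q)
        lem = solve-∀
        N : ℤ
        N = vdeg i x z +ℤ - (+ ((len w ∸ len z) / 2) +ℤ + ((len w ∸ len z) / 2))
        fin : Dec (KL v z (- (+ 1)) ≡ + 0) → - KL v z (- (+ 1)) *ℤ KL z x N ≡ - (+ 1) *ℤ (KL v z (- (+ 1)) *ℤ KL z x (vdeg i x w))
        fin (yes q) = trans (cong (λ c → - c *ℤ KL z x N) q) (sym (cong (λ c → - (+ 1) *ℤ (c *ℤ KL z x (vdeg i x w))) q))
        fin (no q) = trans (lem (KL v z (- (+ 1))) (KL z x N)) (cong (λ m → - (+ 1) *ℤ (KL v z (- (+ 1)) *ℤ KL z x m)) (half _ q refl))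

    sum-matches : ∀ x i → coeff (foldr (λ z acc → summandOf n x v g (len w) z ⊕ acc) [] (interval v)) i ≡ - (+ 1) *ℤ correction σ v KL x (vdeg i x w)
    sum-matches x i = trans (coeff-sum (summandOf n x v g (len w)) (interval v) i)
      (trans (Σ-cong∈ (interval v) (λ z j → summand-matches x i z (∈-interval⇒≼ v j))) (scale-out (interval v)))
      where
      scale-out : ∀ L → Σ[ L ] (λ z → - (+ 1) *ℤ (coefOf σ v KL z *ℤ KL z x (vdeg i x w))) ≡ - (+ 1) *ℤ Σ[ L ] (λ z → coefOf σ v KL z *ℤ KL z x (vdeg i x w))
      scale-out [] = refl
      scale-out (z ∷ L) = trans (cong (- (+ 1) *ℤ (coefOf σ v KL z *ℤ KL z x (vdeg i x w)) +ℤ_) (scale-out L)) (sym (ℤₚ.*-distribˡ-+ (- (+ 1)) (coefOf σ v KL z *ℤ KL z x (vdeg i x w)) _))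

    first-terms : ∀ x i → (y : W) → y ≡ act σ x →
      coeff (if inLᵇ g x then KLf n y v else shiftP 1 (KLf n y v)) i +ℤ coeff (if inLᵇ g x then shiftP 1 (KLf n x v) else KLf n x v) i
      ≡ C σ (KL v) x (vdeg i x w)
    first-terms x i y refl with step σ x
    ... | down d _ q = cong₂ _+ℤ_
          (trans (cong (λ p → coeff p i) (if-true d′)) (trans (M v ≼-refl y i) (cong (KL v y) (begin
            + i +ℤ + i +ℤ + len y +ℤ - (+ len v)                      ≡⟨ lem (+ i) (+ len y) (+ len v) ⟩
            + i +ℤ + i +ℤ (+ 1 +ℤ + len y) +ℤ - (+ 1 +ℤ + len v)      ≡⟨ cong₂ (λ a b → + i +ℤ + i +ℤ + a +ℤ - (+ b)) (sym q) (sym len-w) ⟩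
            vdeg i x w ∎))))
          (trans (cong (λ p → coeff p i) (if-true d′)) (trans (coeff-shift n v (M v ≼-refl) x 1 i) (cong (KL v x) (begin
            + i +ℤ + i +ℤ + len x +ℤ - (+ len v) +ℤ - (+ 2)            ≡⟨ lem₂ (+ i) (+ len x) (+ len v) ⟩
            + i +ℤ + i +ℤ + len x +ℤ - (+ 1 +ℤ + len v) +ℤ - (+ 1)     ≡⟨ cong₂ (λ b k → + i +ℤ + i +ℤ + len x +ℤ - (+ b) +ℤ k) (sym len-w) (sym (η-dn {σ} {x} d)) ⟩
            vdeg i x w +ℤ η σ x ∎))))
      where
      d′ : inLᵇ g x ≡ true
      d′ = trans (inLᵇ-dn g x) d
      lem : ∀ i y v → i +ℤ i +ℤ y +ℤ - v ≡ i +ℤ i +ℤ (+ 1 +ℤ y) +ℤ - (+ 1 +ℤ v)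
      lem = solve-∀
      lem₂ : ∀ i x v → i +ℤ i +ℤ x +ℤ - v +ℤ - (+ 2) ≡ i +ℤ i +ℤ x +ℤ - (+ 1 +ℤ v) +ℤ - (+ 1)
      lem₂ = solve-∀
    ... | up d _ q = cong₂ _+ℤ_
          (trans (cong (λ p → coeff p i) (if-false d′)) (trans (coeff-shift n v (M v ≼-refl) y 1 i) (cong (KL v y) (begin
            + i +ℤ + i +ℤ + len y +ℤ - (+ len v) +ℤ - (+ 2)            ≡⟨ cong (λ a → + i +ℤ + i +ℤ + a +ℤ - (+ len v) +ℤ - (+ 2)) q ⟩
            + i +ℤ + i +ℤ (+ 1 +ℤ + len x) +ℤ - (+ len v) +ℤ - (+ 2)   ≡⟨ lem (+ i) (+ len x) (+ len v) ⟩
            + i +ℤ + i +ℤ + len x +ℤ - (+ 1 +ℤ + len v)                ≡⟨ cong (λ b → + i +ℤ + i +ℤ + len x +ℤ - (+ b)) (sym len-w) ⟩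
            vdeg i x w ∎))))
          (trans (cong (λ p → coeff p i) (if-false d′)) (trans (M v ≼-refl x i) (cong (KL v x) (begin
            + i +ℤ + i +ℤ + len x +ℤ - (+ len v)                       ≡⟨ lem₂ (+ i) (+ len x) (+ len v) ⟩
            + i +ℤ + i +ℤ + len x +ℤ - (+ 1 +ℤ + len v) +ℤ + 1         ≡⟨ cong₂ (λ b k → + i +ℤ + i +ℤ + len x +ℤ - (+ b) +ℤ k) (sym len-w) (sym (η-up {σ} {x} d)) ⟩
            vdeg i x w +ℤ η σ x ∎))))
      where
      d′ : inLᵇ g x ≡ false
      d′ = trans (inLᵇ-dn g x) d
      lem : ∀ i x v → i +ℤ i +ℤ (+ 1 +ℤ x) +ℤ - v +ℤ - (+ 2) ≡ i +ℤ i +ℤ x +ℤ - (+ 1 +ℤ v)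
      lem = solve-∀
      lem₂ : ∀ i x v → i +ℤ i +ℤ x +ℤ - v ≡ i +ℤ i +ℤ x +ℤ - (+ 1 +ℤ v) +ℤ + 1
      lem₂ = solve-∀

    recursion-matches : ∀ x i → coeff (recursion n x v g (belowList w) (len w)) i ≡ KL w x (vdeg i x w)
    recursion-matches x i = cases (memᵇ x (belowList w)) refl
      where
      cases : ∀ b → memᵇ x (belowList w) ≡ b → coeff (recursion n x v g (belowList w) (len w)) i ≡ KL w x (vdeg i x w)
      cases false q = trans (cong (λ p → coeff p i) (if-false q)) (sym (supp0 (KL-spec w) x _ (λ p → true≢false (trans (sym (≼⇒memᵇ p)) q))))
      cases true q = trans (cong (λ p → coeff p i) (if-true q)) (trans (coeff-⊕ (A ⊕ B) D i) (trans (cong (_+ℤ coeff D i) (coeff-⊕ A B i))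
        (trans (cong₂ _+ℤ_ (first-terms x i (gen g · x) (sym (act-left g x))) (sum-matches x i)) (sym (at (KL-product σ v v-up) x (vdeg i x w))))))
        where
        A B D : Poly
        A = if inLᵇ g x then KLf n (gen g · x) v else shiftP 1 (KLf n (gen g · x) v)
        B = if inLᵇ g x then shiftP 1 (KLf n x v) else KLf n x v
        D = foldr (λ z acc → summandOf n x v g (len w) z ⊕ acc) [] (interval v)

KL-e : KL e ≐ δ e
KL-e = IsKL-unique (KL-isKL e) (isKL δ-spec)

matches : ∀ n w → len w < n → Matches n w
matches (suc n) w (s≤s le) = cases (redWord w) refl
  where
  cases : ∀ A → redWord w ≡ A → Matches (suc n) w
  cases [] q x i = trans (cong (λ p → coeff p i) (KLf-unfold-e n x w q)) (trans (at-e (x ≟W e)) (sym (trans (cong (λ z → KL z x (vdeg i x z)) w≡e) (at KL-e x _))))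
    where
    w≡e : w ≡ e
    w≡e = trans (sym (eval-redWord w)) (cong eval q)
    at-e : Dec (x ≡ e) → coeff (if x == e then + 1 ∷ [] else []) i ≡ δ e x (vdeg i x e)
    at-e (no p) = trans (cong (λ p → coeff p i) (if-false (≢⇒==false p))) (sym (δ-diff _ p))
    at-e (yes refl) = trans (cong (λ p → coeff p i) (if-true {b = e == e} {x = + 1 ∷ []} {y = []} (==-refl e))) (trans (unit-coeff i) (sym (trans (δ-same e _) (cong unit (lem (+ i) (+ len e))))))
      where
      lem : ∀ i l → i +ℤ i +ℤ l +ℤ - l ≡ i +ℤ i
      lem = solve-∀
      unit-coeff : ∀ i → coeff (+ 1 ∷ []) i ≡ unit (+ i +ℤ + i)
      unit-coeff zero = sym unit-0
      unit-coeff (suc i) = sym (unit-≢0 (λ ()))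
  cases (g ∷ A) q x i = trans (cong (λ p → coeff p i) (trans (KLf-unfold n x w g A q) (sym (cong₂ (recursion n x (eval A) g) (bel-≡ w) (ln-≡ w)))))
    (subst (λ z → coeff (recursion n x (eval A) g (belowList z) (len z)) i ≡ KL z x (vdeg i x z)) w≡
      (Step-matches.recursion-matches n g (eval A) d (λ z p → matches n z (ℕₚ.≤-<-trans (≼-len p) (ℕₚ.<-≤-trans lt le))) x i))
    where
    red : Reduced (g ∷ A)
    red = subst Reduced q (redWord-reduced w)
    d : dn (left , g) (eval A) ≡ false
    d = dn-reduced g A red
    w≡ : act (left , g) (eval A) ≡ w
    w≡ = trans (act-eval g A) (trans (cong eval (sym q)) (eval-redWord w))
    lt : len (eval A) < len w
    lt = subst (λ z → len (eval A) < len z) w≡ (ℕₚ.≤-reflexive (sym (up⇒len (left , g) (eval A) d)))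

μ-KL : ∀ x w → μ x w ≡ KL w x (- (+ 1))
μ-KL x w = muFrom-KL (suc (len w)) w (matches (suc (len w)) w ℕₚ.≤-refl) x

-- Cells and strings

KL-mu : ∀ σ w x → dn σ w ≡ true → dn σ x ≡ false → KL w x (- (+ 1)) ≡ KL w (act σ x) (+ 0)
KL-mu σ w x d u = sym (trans (KL-shift σ w x (+ 0) d) (cong (λ k → KL w x (+ 0 +ℤ - k)) (η-up {σ} {x} u)))

KL-mu₂ : ∀ σ w x → dn σ w ≡ true → dn σ x ≡ false → KL w x (- (+ 2)) ≡ KL w (act σ x) (- (+ 1))
KL-mu₂ σ w x d u = sym (trans (KL-shift σ w x (- (+ 1)) d) (cong (λ k → KL w x (- (+ 1) +ℤ - k)) (η-up {σ} {x} u)))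

KL-at-0 : ∀ w x → x ≢ w → KL w x (+ 0) ≡ + 0
KL-at-0 w x ne = neg-X (KL-isKL w) x (+ 0) ne (+≤+ z≤n)

KL-top-0 : ∀ w → KL w w (+ 0) ≡ + 1
KL-top-0 w = trans (top-X (KL-isKL w) (+ 0)) unit-0

-- The coefficient of v^-1 at x equals that of v^0 at σx, and C_w has degree 0 only at w.
KL-edge : ∀ σ w x → dn σ w ≡ true → dn σ x ≡ false → KL w x (- (+ 1)) ≢ + 0 → act σ x ≡ w
KL-edge σ w x d u ne with act σ x ≟W w
... | yes q = q
... | no q = ⊥-elim (ne (trans (KL-mu σ w x d u) (KL-at-0 w (act σ x) q)))

KL-0-unless-≼ : ∀ w x n → ¬ x ≼ w → KL w x n ≡ + 0
KL-0-unless-≼ w = supp0 (KL-spec w)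

-- If the conclusion failed, KL-edge would make x and y differ by τ, respectively by σ, and then by both.
module _ (σ τ : Op)
         (cross : ∀ w → dn σ (act τ w) ≢ dn σ w → act σ w ≡ act τ w)
         (cross′ : ∀ w → dn τ (act σ w) ≢ dn τ w → act σ w ≡ act τ w) where

  edge-descent : ∀ {x y} → Edge x y → dn σ x ≡ true → dn σ y ≡ false → dn τ y ≡ true → dn τ x ≡ true
  edge-descent {x} {y} ed dσx uσy dτy = cases (dn-dec τ x) ed
    where
    cases : dn τ x ≡ false ⊎ dn τ x ≡ true → Edge x y → dn τ x ≡ true
    cases (inj₂ q) _ = q
    cases (inj₁ uτx) (inj₁ ne) = ⊥-elim (true≢false (trans (sym dσx) (trans (dn-cong {σ} {τ} {x} same) uτx)))
      where
      xτ≡y : act τ x ≡ y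
      xτ≡y = KL-edge τ y x dτy uτx (λ z → ne (trans (μ-KL x y) z))
      same : act σ x ≡ act τ x
      same = cross x (λ q → true≢false (trans (sym dσx) (trans (sym q) (trans (cong (dn σ) xτ≡y) uσy))))
    cases (inj₁ uτx) (inj₂ ne) = ⊥-elim (true≢false (trans (sym dτy) (trans (sym (dn-cong {σ} {τ} {y} same)) uσy)))
      where
      σy≡x : act σ y ≡ x
      σy≡x = KL-edge σ x y dσx uσy (λ z → ne (trans (μ-KL y x) z))
      same : act σ y ≡ act τ y
      same = cross′ y (λ q → true≢false (trans (sym (trans q dτy)) (trans (cong (dn τ) σy≡x) uτx)))

¬⇒false : ∀ {b} → b ≢ true → b ≡ false
¬⇒false = 𝔹ₚ.¬-not

≤L⇒right-descents : ∀ {x y} → x ≤L y → ∀ h → dn (right , h) y ≡ true → dn (right , h) x ≡ true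
≤L⇒right-descents ≤L-refl h d = d
≤L⇒right-descents {x} (≤L-step {y = y} ed (g , i , ¬i) p) h d =
  edge-descent (left , g) (right , h) (crossˡ g h) (crossʳ g h) ed (InL⇒dn g x i) (¬⇒false (λ q → ¬i (dn⇒InL g y q))) (≤L⇒right-descents p h d)

≤R⇒left-descents : ∀ {x y} → x ≤R y → ∀ g → dn (left , g) y ≡ true → dn (left , g) x ≡ true
≤R⇒left-descents ≤R-refl g d = d
≤R⇒left-descents {x} (≤R-step {y = y} ed (h , i , ¬i) p) g d =
  edge-descent (right , h) (left , g) (λ w q → sym (crossʳ g h w q)) (λ w q → sym (crossˡ g h w q)) ed
    (InR⇒dn h x i) (¬⇒false (λ q → ¬i (dn⇒InR h y q))) (≤R⇒left-descents p g d)

true-iff : ∀ {a b : Bool} → (a ≡ true → b ≡ true) → (b ≡ true → a ≡ true) → a ≡ b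
true-iff {true} f g = sym (f refl)
true-iff {false} {false} f g = refl
true-iff {false} {true} f g = g refl

∼L⇒right-descents : ∀ {x y} → x ∼L y → ∀ h → dn (right , h) x ≡ dn (right , h) y
∼L⇒right-descents (p , q) h = true-iff (≤L⇒right-descents q h) (≤L⇒right-descents p h)

∼R⇒left-descents : ∀ {x y} → x ∼R y → ∀ g → dn (left , g) x ≡ dn (left , g) y
∼R⇒left-descents (p , q) g = true-iff (≤R⇒left-descents q g) (≤R⇒left-descents p g)

-- Coefficients of v^-1 along strings

product-at : ∀ σ v x n → dn σ v ≡ false → dn σ x ≡ true →
  KL (act σ v) x n ≡ KL v (act σ x) n +ℤ KL v x (n +ℤ - (+ 1)) +ℤ - (+ 1) *ℤ correction σ v KL x n
product-at σ v x n u d = trans (at (KL-product σ v u) x n) (cong (λ k → KL v (act σ x) n +ℤ KL v x (n +ℤ k) +ℤ - (+ 1) *ℤ correction σ v KL x n) (η-dn {σ} {x} d))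

private
  term-0 : ∀ σ v z x → (dn σ z ≡ true → KL v z (- (+ 1)) ≢ + 0 → KL z x (- (+ 1)) ≢ + 0 → ⊥) → coefOf σ v KL z *ℤ KL z x (- (+ 1)) ≡ + 0
  term-0 σ v z x h with coefOf σ v KL z *ℤ KL z x (- (+ 1)) ≟ℤ + 0
  ... | yes q = q
  ... | no q = let (p , q′) = *-≢0 q ; (d , ne) = coefOf-≢0 σ v KL z p in ⊥-elim (h d ne q′)

  up≢dn : ∀ {σ x y} → dn σ x ≡ false → dn σ y ≡ true → x ≢ y
  up≢dn u d refl = true≢false (trans (sym d) u)

-- Evaluating C_σ C_y at σu: only the term C_{σy} contributes.
string-step₁ : ∀ σ α β u y →
  dn α y ≡ true → dn β y ≡ true → dn σ y ≡ false → dn σ (act α y) ≡ false →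
  dn σ u ≡ false → dn α (act σ u) ≡ false → dn σ (act α (act σ u)) ≡ false → dn β (act α (act σ u)) ≡ false →
  KL (act σ y) (act σ u) (- (+ 1)) ≡ KL y u (- (+ 1)) +ℤ KL y (act β (act α (act σ u))) (+ 0)
string-step₁ σ α β u y αy βy σy σαy σu ασu σασu βασu = begin
  KL (act σ y) x (- (+ 1))
    ≡⟨ product-at σ y x (- (+ 1)) σy (trans (dn-act σ u) (cong not σu)) ⟩
  KL y (act σ x) (- (+ 1)) +ℤ KL y x (- (+ 2)) +ℤ - (+ 1) *ℤ correction σ y KL x (- (+ 1))
    -- α and β are descents of y, while x and αx ascend under them, so degree -2 at x equals degree
    -- 0 at βαx. This term is nonzero only for y = βαx.
    ≡⟨ cong₂ (λ a b → a +ℤ b +ℤ - (+ 1) *ℤ correction σ y KL x (- (+ 1))) (cong (λ z → KL y z (- (+ 1))) (act² σ u))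
         (trans (KL-mu₂ α y x αy ασu) (KL-mu β y (act α x) βy βασu)) ⟩
  KL y u (- (+ 1)) +ℤ KL y (act β (act α x)) (+ 0) +ℤ - (+ 1) *ℤ correction σ y KL x (- (+ 1))
    ≡⟨ cong (λ c → KL y u (- (+ 1)) +ℤ KL y (act β (act α x)) (+ 0) +ℤ - (+ 1) *ℤ c) (Σ-zero (interval y) (λ z _ → term-0 σ y z x (no-term z))) ⟩
  KL y u (- (+ 1)) +ℤ KL y (act β (act α x)) (+ 0) +ℤ + 0
    ≡⟨ ℤₚ.+-identityʳ _ ⟩
  KL y u (- (+ 1)) +ℤ KL y (act β (act α x)) (+ 0) ∎
  where
  x : W
  x = act σ u
  no-term : ∀ z → dn σ z ≡ true → KL y z (- (+ 1)) ≢ + 0 → KL z x (- (+ 1)) ≢ + 0 → ⊥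
  -- By `KL-edge`, z is αy if α is an ascent of z and αx otherwise; σ is an ascent of both.
  no-term z d n₁ n₂ with dn-dec α z
  ... | inj₁ up-z = up≢dn {σ} σαy d (trans (cong (act α) (sym (KL-edge α y z αy up-z n₁))) (act² α z))
  ... | inj₂ dn-z = up≢dn {σ} σασu d (KL-edge α z x dn-z ασu n₂)

-- Evaluating C_α C_{σy} at ασu: besides C_{ασy} exactly C_y and C_{σασu} contribute.
string-step₂ : ∀ σ α β u y →
  dn α y ≡ true → dn β y ≡ true → dn σ y ≡ false → dn α (act σ y) ≡ false →
  dn α (act σ u) ≡ false → dn σ (act α (act σ u)) ≡ false → dn β (act α (act σ u)) ≡ false →
  dn α (act σ (act α (act σ u))) ≡ true →
  KL (act α (act σ y)) (act α (act σ u)) (- (+ 1)) ≡ KL (act σ y) (act σ u) (- (+ 1)) +ℤ - KL y (act β (act α (act σ u))) (+ 0)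
string-step₂ σ α β u y αy βy σy ασy ασu σασu βασu ασασu = begin
  KL (act α v) x (- (+ 1))
    ≡⟨ product-at α v x (- (+ 1)) ασy (trans (dn-act α (act σ u)) (cong not ασu)) ⟩
  KL v (act α x) (- (+ 1)) +ℤ KL v x (- (+ 2)) +ℤ - (+ 1) *ℤ correction α v KL x (- (+ 1))
    ≡⟨ cong₂ (λ a b → a +ℤ b +ℤ - (+ 1) *ℤ correction α v KL x (- (+ 1))) (cong (λ z → KL v z (- (+ 1))) (act² α (act σ u)))
         (KL-mu₂ σ v x σv σασu) ⟩
  KL v (act σ u) (- (+ 1)) +ℤ KL v z₁ (- (+ 1)) +ℤ - (+ 1) *ℤ correction α v KL x (- (+ 1))
    ≡⟨ cong (λ c → KL v (act σ u) (- (+ 1)) +ℤ KL v z₁ (- (+ 1)) +ℤ - (+ 1) *ℤ c) corr ⟩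
  KL v (act σ u) (- (+ 1)) +ℤ KL v z₁ (- (+ 1)) +ℤ - (+ 1) *ℤ (KL v z₁ (- (+ 1)) +ℤ KL y (act β x) (+ 0))
    ≡⟨ lem (KL v (act σ u) (- (+ 1))) (KL v z₁ (- (+ 1))) (KL y (act β x) (+ 0)) ⟩
  KL v (act σ u) (- (+ 1)) +ℤ - KL y (act β x) (+ 0) ∎
  where
  v x z₁ : W
  v = act σ y
  x = act α (act σ u)
  z₁ = act σ x
  lem : ∀ p q k → p +ℤ q +ℤ - (+ 1) *ℤ (q +ℤ k) ≡ p +ℤ - k
  lem = solve-∀
  σv : dn σ v ≡ true
  σv = trans (dn-act σ y) (cong not σy)
  σz₁ : dn σ z₁ ≡ true
  σz₁ = trans (dn-act σ x) (cong not σασu)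
  -- The correction is split by whether σ is a descent of z. If so, `KL-edge` for C_z forces z = σx,
  -- whose term cancels the degree -2 part of the product; if not, `KL-edge` for C_v forces z = y.
  f f₁ f₂ : W → ℤ
  f z = coefOf α v KL z *ℤ KL z x (- (+ 1))
  f₁ z = if dn σ z then f z else + 0
  f₂ z = if dn σ z then + 0 else f z
  f-split : ∀ z → f z ≡ f₁ z +ℤ f₂ z
  f-split z with dn σ z
  ... | true = sym (ℤₚ.+-identityʳ (f z))
  ... | false = sym (ℤₚ.+-identityˡ (f z))
  f-≼ : ∀ z → ¬ z ≼ v → f z ≡ + 0
  f-≼ z p = term-0 α v z x (λ _ ne _ → ne (KL-0-unless-≼ v z _ p))
  f₁-single : ∀ z → z ≢ z₁ → f₁ z ≡ + 0
  f₁-single z ne with dn σ z in eq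
  ... | false = refl
  ... | true = term-0 α v z x (λ _ _ n₂ → ne (sym (KL-edge σ z x eq σασu n₂)))
  f₂-single : ∀ z → z ≢ y → f₂ z ≡ + 0
  f₂-single z ne with dn σ z in eq
  ... | true = refl
  ... | false = term-0 α v z x (λ _ n₁ _ → ne (act-injective σ (KL-edge σ v z σv eq n₁)))
  coef-at : ∀ z → dn α z ≡ true → coefOf α v KL z ≡ KL v z (- (+ 1))
  coef-at z d = cases (z ≟W v)
    where
    cases : Dec (z ≡ v) → coefOf α v KL z ≡ KL v z (- (+ 1))
    vanish : z ≡ v → coefOf α v KL z ≡ + 0
    vanish q = cong (λ b → if not b ∧ dn α z then KL v z (- (+ 1)) else + 0) (trans (cong (_== v) q) (==-refl v))
    cases (no ne) = coefOf-dn α v KL z ne d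
    cases (yes q) = trans (vanish q) (sym (trans (cong (λ z → KL v z (- (+ 1))) q) (KL-self v)))
  at-z₁ : f₁ z₁ ≡ KL v z₁ (- (+ 1))
  at-z₁ = trans (if-true σz₁) (trans (cong₂ _*ℤ_ (coef-at z₁ ασασu) (trans (KL-mu σ z₁ x σz₁ σασu) (KL-top-0 z₁))) (ℤₚ.*-identityʳ _))
  at-y : f₂ y ≡ KL y (act β x) (+ 0)
  at-y = trans (if-false σy) (trans (cong₂ _*ℤ_ (trans (coef-at y αy) (trans (KL-mu σ v y σv σy) (KL-top-0 v))) (KL-mu β y x βy βασu)) (ℤₚ.*-identityˡ _))
  corr : correction α v KL x (- (+ 1)) ≡ KL v z₁ (- (+ 1)) +ℤ KL y (act β x) (+ 0)
  corr = trans (trans (Σ-cong∈ (interval v) (λ z _ → f-split z)) (Σ-+ (interval v) f₁ f₂))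
    (cong₂ _+ℤ_
      (trans (Σ-interval-single v z₁ f₁ (λ z _ → f₁-single z) (λ p → trans (if-true σz₁) (f-≼ z₁ p))) at-z₁)
      (trans (Σ-interval-single v y f₂ (λ z _ → f₂-single z) (λ p → trans (if-false σy) (f-≼ y p))) at-y))

-- The elements of c_2

opaque
  unfolding act
  private
    eval-cons : ∀ g A w → eval (g ∷ A) · w ≡ gen g · (eval A · w)
    eval-cons g A w = sym (gen-assoc g (eval A) w)

    four : ∀ a b c d w → act (left , a) (act (left , b) (act (left , c) (act (left , d) w))) ≡ eval (a ∷ b ∷ c ∷ d ∷ []) · w
    four a b c d w = sym (begin
      eval (a ∷ b ∷ c ∷ d ∷ []) · w                    ≡⟨ eval-cons a (b ∷ c ∷ d ∷ []) w ⟩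
      gen a · (eval (b ∷ c ∷ d ∷ []) · w)              ≡⟨ cong (gen a ·_) (eval-cons b (c ∷ d ∷ []) w) ⟩
      gen a · (gen b · (eval (c ∷ d ∷ []) · w))        ≡⟨ cong (λ z → gen a · (gen b · z)) (eval-cons c (d ∷ []) w) ⟩
      gen a · (gen b · (gen c · (eval (d ∷ []) · w)))  ≡⟨ cong (λ z → gen a · (gen b · (gen c · z))) (eval-cons d [] w) ⟩
      gen a · (gen b · (gen c · (gen d · (e · w))))    ≡⟨ cong (λ z → gen a · (gen b · (gen c · (gen d · z)))) (·-identityˡ w) ⟩
      gen a · (gen b · (gen c · (gen d · w))) ∎)

    two : ∀ a b w → act (left , a) (act (left , b) w) ≡ eval (a ∷ b ∷ []) · w
    two a b w = sym (begin
      eval (a ∷ b ∷ []) · w        ≡⟨ eval-cons a (b ∷ []) w ⟩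
      gen a · (eval (b ∷ []) · w)  ≡⟨ cong (gen a ·_) (eval-cons b [] w) ⟩
      gen a · (gen b · (e · w))    ≡⟨ cong (λ z → gen a · (gen b · z)) (·-identityˡ w) ⟩
      gen a · (gen b · w) ∎)

  -- Both sides are a product of a closed element with w, and the two closed elements agree by
  -- evaluation.
  braid-rs-left : ∀ w → act (left , s) (act (left , r) (act (left , s) (act (left , r) w))) ≡ act (left , r) (act (left , s) (act (left , r) (act (left , s) w)))
  braid-rs-left w = trans (four s r s r w) (sym (four r s r s w))

  braid-ts-left : ∀ w → act (left , s) (act (left , t) (act (left , s) (act (left , t) w))) ≡ act (left , t) (act (left , s) (act (left , t) (act (left , s) w)))
  braid-ts-left w = trans (four s t s t w) (sym (four t s t s w))

  comm-left : ∀ w → act (left , t) (act (left , r) w) ≡ act (left , r) (act (left , t) w)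
  comm-left w = trans (two t r w) (sym (two r t w))

inv-injective : ∀ {u v} → inv u ≡ inv v → u ≡ v
inv-injective {u} {v} q = trans (sym (inv-inv u)) (trans (cong inv q) (inv-inv v))

flip-act : ∀ g w v → inv w ≡ v → inv (act (right , g) w) ≡ act (left , g) v
flip-act g w v q = trans (inv-act-right g w) (cong (act (left , g)) q)

flip-act′ : ∀ g w v → inv w ≡ v → inv (act (left , g) w) ≡ act (right , g) v
flip-act′ g w v q = trans (inv-act-left g w) (cong (act (right , g)) q)

private
  flip₂ : ∀ a b w → inv (act (right , a) (act (right , b) w)) ≡ act (left , a) (act (left , b) (inv w))
  flip₂ a b w = flip-act a _ _ (flip-act b w _ refl)

  flip₄ : ∀ a b c d w → inv (act (right , a) (act (right , b) (act (right , c) (act (right , d) w)))) ≡ act (left , a) (act (left , b) (act (left , c) (act (left , d) (inv w))))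
  flip₄ a b c d w = flip-act a _ _ (flip-act b _ _ (flip₂ c d w))

braid : ∀ sd g → (g ≡ r ⊎ g ≡ t) → ∀ w → act (sd , s) (act (sd , g) (act (sd , s) (act (sd , g) w))) ≡ act (sd , g) (act (sd , s) (act (sd , g) (act (sd , s) w)))
braid left .r (inj₁ refl) w = braid-rs-left w
braid left .t (inj₂ refl) w = braid-ts-left w
braid right .r (inj₁ refl) w = inv-injective (trans (flip₄ s r s r w) (trans (braid-rs-left (inv w)) (sym (flip₄ r s r s w))))
braid right .t (inj₂ refl) w = inv-injective (trans (flip₄ s t s t w) (trans (braid-ts-left (inv w)) (sym (flip₄ t s t s w))))

comm-rt : ∀ sd w → act (sd , t) (act (sd , r) w) ≡ act (sd , r) (act (sd , t) w)
comm-rt left w = comm-left w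
comm-rt right w = inv-injective (trans (flip₂ t r w) (trans (comm-left (inv w)) (sym (flip₂ r t w))))

-- The descents, on one side, of the elements u = r t (s r t)^m b and of their neighbours.
record Shape (sd : Side) (u : W) : Set where
  field
    rD : dn (sd , r) u ≡ true
    tD : dn (sd , t) u ≡ true
    sU : dn (sd , s) u ≡ false
    rsU : dn (sd , r) (act (sd , s) u) ≡ false
    tsU : dn (sd , t) (act (sd , s) u) ≡ false
    srsU : dn (sd , s) (act (sd , r) (act (sd , s) u)) ≡ false
    stsU : dn (sd , s) (act (sd , t) (act (sd , s) u)) ≡ false
    trsU : dn (sd , t) (act (sd , r) (act (sd , s) u)) ≡ false
    rtsU : dn (sd , r) (act (sd , t) (act (sd , s) u)) ≡ false
    srU : dn (sd , s) (act (sd , r) u) ≡ false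
open Shape public

len-act≤ : ∀ σ w → len (act σ w) ≤ suc (len w)
len-act≤ σ w with step σ w
... | up _ _ q = ℕₚ.≤-reflexive q
... | down _ _ q = ℕₚ.≤-trans (ℕₚ.n≤1+n _) (ℕₚ.≤-trans (ℕₚ.≤-reflexive (sym q)) (ℕₚ.n≤1+n _))

-- By the braid relation, multiplying the long element by g gives s g s (g u), whose length is at
-- most l(gu) + 3 = l(u) + 2, whereas s g s u has length l(u) + 3.
braid-descent : ∀ sd g → (g ≡ r ⊎ g ≡ t) → ∀ u → dn (sd , g) u ≡ true → dn (sd , s) u ≡ false →
  dn (sd , g) (act (sd , s) u) ≡ false → dn (sd , s) (act (sd , g) (act (sd , s) u)) ≡ false →
  dn (sd , g) (act (sd , s) (act (sd , g) (act (sd , s) u))) ≡ true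
braid-descent sd g gg u d u₁ u₂ u₃ = len<⇒dn α (act σ (act α (act σ u))) (ℕₚ.<-≤-trans (s≤s shorter) (ℕₚ.≤-reflexive (sym long)))
  where
  σ α : Op
  σ = sd , s
  α = sd , g
  u′ : W
  u′ = act α u
  long : len (act σ (act α (act σ u))) ≡ 3 ℕ.+ len u
  long = trans (up⇒len σ (act α (act σ u)) u₃) (cong suc (trans (up⇒len α (act σ u) u₂) (cong suc (up⇒len σ u u₁))))
  eq : act α (act σ (act α (act σ u))) ≡ act σ (act α (act σ u′))
  eq = sym (braid sd g gg u)
  shorter : len (act α (act σ (act α (act σ u)))) ≤ 2 ℕ.+ len u
  shorter = ℕₚ.≤-trans (ℕₚ.≤-reflexive (cong len eq)) (ℕₚ.≤-trans (len-act≤ σ (act α (act σ u′)))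
    (s≤s (ℕₚ.≤-trans (len-act≤ α (act σ u′)) (s≤s (ℕₚ.≤-trans (len-act≤ σ u′) (ℕₚ.≤-reflexive (sym (dn⇒len α u d))))))))

data Factor : Set where
  F0 Fs Ft Fr : Factor

fac : Side → Factor → W → W
fac sd F0 w = w
fac sd Fs w = act (sd , s) w
fac sd Ft w = act (sd , t) (act (sd , s) w)
fac sd Fr w = act (sd , r) (act (sd , s) w)

isS : Factor → ℤ
isS Fs = + 1
isS _ = + 0

-- Passing from u to su adds the second term, and passing on to rsu or tsu takes it away again; so
-- only the factor s retains it.
string-formula : ∀ sd u y → Shape sd u → Shape sd y → ∀ a →
  KL (fac sd a y) (fac sd a u) (- (+ 1)) ≡ KL y u (- (+ 1)) +ℤ isS a *ℤ KL y (act (sd , t) (act (sd , r) (act (sd , s) u))) (+ 0)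
string-formula sd u y U Y F0 = sym (ℤₚ.+-identityʳ _)
string-formula sd u y U Y Fs = trans
  (string-step₁ (sd , s) (sd , r) (sd , t) u y (rD Y) (tD Y) (sU Y) (srU Y) (sU U) (rsU U) (srsU U) (trsU U))
  (cong (KL y u (- (+ 1)) +ℤ_) (sym (ℤₚ.*-identityˡ _)))
string-formula sd u y U Y Fr = trans
  (string-step₂ (sd , s) (sd , r) (sd , t) u y (rD Y) (tD Y) (sU Y) (rsU Y) (rsU U) (srsU U) (trsU U)
    (braid-descent sd r (inj₁ refl) u (rD U) (sU U) (rsU U) (srsU U)))
  (trans (cong (_+ℤ - k) (string-step₁ (sd , s) (sd , r) (sd , t) u y (rD Y) (tD Y) (sU Y) (srU Y) (sU U) (rsU U) (srsU U) (trsU U)))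
    (lem (KL y u (- (+ 1))) k))
  where
  k : ℤ
  k = KL y (act (sd , t) (act (sd , r) (act (sd , s) u))) (+ 0)
  lem : ∀ p q → p +ℤ q +ℤ - q ≡ p +ℤ + 0
  lem = solve-∀
string-formula sd u y U Y Ft = trans
  (string-step₂ (sd , s) (sd , t) (sd , r) u y (tD Y) (rD Y) (sU Y) (tsU Y) (tsU U) (stsU U) (rtsU U)
    (braid-descent sd t (inj₂ refl) u (tD U) (sU U) (tsU U) (stsU U)))
  (trans (cong₂ (λ m j → m +ℤ - j) (string-step₁ (sd , s) (sd , r) (sd , t) u y (rD Y) (tD Y) (sU Y) (srU Y) (sU U) (rsU U) (srsU U) (trsU U))
           (cong (λ z → KL y z (+ 0)) (sym (comm-rt sd (act (sd , s) u)))))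
    (lem (KL y u (- (+ 1))) k))
  where
  k : ℤ
  k = KL y (act (sd , t) (act (sd , r) (act (sd , s) u))) (+ 0)
  lem : ∀ p q → p +ℤ q +ℤ - q ≡ p +ℤ + 0
  lem = solve-∀

-- xw m is the element r t (s r t)^m.
xw : ℕ → W
xw zero = act (left , r) (act (left , t) e)
xw (suc m) = act (left , r) (act (left , t) (act (left , s) (xw m)))

el : Factor → ℕ → Factor → W
el a m b = fac left a (fac right b (xw m))

rep : ℕ → List Gen
rep m = concat (replicate m (s ∷ r ∷ t ∷ []))

lword rword : Factor → List Gen
lword F0 = []
lword Fs = s ∷ []
lword Ft = t ∷ s ∷ []
lword Fr = r ∷ s ∷ []
rword F0 = []
rword Fs = s ∷ []
rword Ft = s ∷ t ∷ []
rword Fr = s ∷ r ∷ []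

opaque
  unfolding act
  eval-xw : ∀ m → eval (r ∷ t ∷ rep m) ≡ xw m
  eval-xw zero = refl
  eval-xw (suc m) = cong (λ z → gen r · (gen t · (gen s · z))) (eval-xw m)

  private
    eval-snoc₂ : ∀ A g h → eval (A ++ g ∷ h ∷ []) ≡ act (right , h) (act (right , g) (eval A))
    eval-snoc₂ A g h = trans (cong eval (sym (Listₚ.++-assoc A (g ∷ []) (h ∷ []))))
      (trans (eval-snoc (A ++ g ∷ []) h) (cong (_· gen h) (eval-snoc A g)))

  eval-right : ∀ A b → eval (A ++ rword b) ≡ fac right b (eval A)
  eval-right A F0 = cong eval (Listₚ.++-identityʳ A)
  eval-right A Fs = eval-snoc A s
  eval-right A Ft = eval-snoc₂ A s t
  eval-right A Fr = eval-snoc₂ A s r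

  eval-left : ∀ a A → eval (lword a ++ A) ≡ fac left a (eval A)
  eval-left F0 A = refl
  eval-left Fs A = refl
  eval-left Ft A = refl
  eval-left Fr A = refl

word : ℕ → Factor → List Gen
word m b = r ∷ t ∷ (rep m ++ rword b)

eval-word : ∀ m b → eval (word m b) ≡ fac right b (xw m)
eval-word m b = trans (eval-right (r ∷ t ∷ rep m) b) (cong (fac right b) (eval-xw m))

eval-c2word : ∀ a m b → eval (c2word (lword a) m (rword b)) ≡ el a m b
eval-c2word a m b = trans (eval-left a (word m b)) (cong (fac left a) (eval-word m b))

private
  -- Each period s r t of the word carries these roots to one of the families treated here, with
  -- constants that never cross zero. The signs therefore persist for every m.
  pos₁ : ∀ m k b → pos (pulls (e⁻ , + k) (rep m ++ rword b)) ≡ true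
  pos₁ zero k F0 = refl
  pos₁ zero k Fs = refl
  pos₁ zero k Ft = refl
  pos₁ zero k Fr = refl
  pos₁ (suc m) k b = pos₁ m (suc k) b

  pos₂ : ∀ m b → pos (pulls (d⁺ , + 0) (rep m ++ rword b)) ≡ true
  pos₂′ : ∀ m b → pos (pulls (d⁻ , + 0) (rep m ++ rword b)) ≡ true
  pos₂ zero F0 = refl
  pos₂ zero Fs = refl
  pos₂ zero Ft = refl
  pos₂ zero Fr = refl
  pos₂ (suc m) b = pos₂′ m b
  pos₂′ zero F0 = refl
  pos₂′ zero Fs = refl
  pos₂′ zero Ft = refl
  pos₂′ zero Fr = refl
  pos₂′ (suc m) b = pos₂ m b

  pos₃ : ∀ m k b → pos (pulls (y⁺ , + k) (rep m ++ rword b)) ≡ true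
  pos₃′ : ∀ m k b → pos (pulls (x⁻ , + k) (rep m ++ rword b)) ≡ true
  pos₃ zero k F0 = refl
  pos₃ zero k Fs = refl
  pos₃ zero k Ft = refl
  pos₃ zero k Fr = refl
  pos₃ (suc m) k b = pos₃′ m (suc k) b
  pos₃′ zero k F0 = refl
  pos₃′ zero k Fs = refl
  pos₃′ zero k Ft = refl
  pos₃′ zero k Fr = refl
  pos₃′ (suc m) k b = pos₃ m (suc k) b

  neg₁ : ∀ m k b → pos (pulls (x⁺ , -[1+ k ]) (rep m ++ rword b)) ≡ false
  neg₁′ : ∀ m k b → pos (pulls (y⁻ , -[1+ k ]) (rep m ++ rword b)) ≡ false
  neg₁ zero k F0 = refl
  neg₁ zero k Fs = refl
  neg₁ zero k Ft = refl
  neg₁ zero k Fr = refl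
  neg₁ (suc m) k b = neg₁′ m (suc k) b
  neg₁′ zero k F0 = refl
  neg₁′ zero k Fs = refl
  neg₁′ zero k Ft = refl
  neg₁′ zero k Fr = refl
  neg₁′ (suc m) k b = neg₁ m (suc k) b

dn-word : ∀ g A b → pos (pulls (simple g) A) ≡ not b → dn (left , g) (eval A) ≡ b
dn-word g A b p = trans (dn-posAt g (eval A)) (trans (cong not (trans (sym (pos-pulls A (simple g))) p)) (𝔹ₚ.not-involutive b))

private
  dn₁ : ∀ g h A b → pos (pulls (simple g) (h ∷ A)) ≡ not b → dn (left , g) (act (left , h) (eval A)) ≡ b
  dn₁ g h A b p = trans (cong (dn (left , g)) (act-eval h A)) (dn-word g (h ∷ A) b p)

  dn₂ : ∀ g h k A b → pos (pulls (simple g) (h ∷ k ∷ A)) ≡ not b → dn (left , g) (act (left , h) (act (left , k) (eval A))) ≡ b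
  dn₂ g h k A b p = trans (cong (λ z → dn (left , g) (act (left , h) z)) (act-eval k A)) (dn₁ g h (k ∷ A) b p)

shape-word : ∀ m b → Shape left (eval (word m b))
shape-word m b = record
  { rD = dn-word r A true (neg₁ m 0 b)
  ; tD = dn-word t A true (neg₁′ m 0 b)
  ; sU = dn-word s A false (pos₁ m 0 b)
  ; rsU = dn₁ r s A false (pos₃ m 1 b)
  ; tsU = dn₁ t s A false (pos₃′ m 1 b)
  ; srsU = dn₂ s r s A false (pos₂ m b)
  ; stsU = dn₂ s t s A false (pos₂′ m b)
  ; trsU = dn₂ t r s A false (pos₃′ m 1 b)
  ; rtsU = dn₂ r t s A false (pos₃ m 1 b)
  ; srU = dn₁ s r A false (pos₂ m b)
  }
  where
  A : List Gen
  A = word m b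

shape-left : ∀ m b → Shape left (fac right b (xw m))
shape-left m b = subst (Shape left) (eval-word m b) (shape-word m b)

fac-commˡ : ∀ g b w → act (left , g) (fac right b w) ≡ fac right b (act (left , g) w)
fac-commˡ g F0 w = refl
fac-commˡ g Fs w = act-comm g s w
fac-commˡ g Ft w = trans (act-comm g t _) (cong (act (right , t)) (act-comm g s w))
fac-commˡ g Fr w = trans (act-comm g r _) (cong (act (right , r)) (act-comm g s w))

fac-comm : ∀ a b w → fac left a (fac right b w) ≡ fac right b (fac left a w)
fac-comm F0 b w = refl
fac-comm Fs b w = fac-commˡ s b w
fac-comm Ft b w = trans (cong (act (left , t)) (fac-commˡ s b w)) (fac-commˡ t b (act (left , s) w))
fac-comm Fr b w = trans (cong (act (left , r)) (fac-commˡ s b w)) (fac-commˡ r b (act (left , s) w))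

rts : Side → W → W
rts sd w = act (sd , r) (act (sd , t) (act (sd , s) w))

private
  rts-comm : ∀ w → rts left (rts right w) ≡ rts right (rts left w)
  rts-comm w = begin
    rts left (rts right w)
      ≡⟨ cong (λ z → act (left , r) (act (left , t) z)) (through s w) ⟩
    act (left , r) (act (left , t) (rts right (act (left , s) w)))
      ≡⟨ cong (act (left , r)) (through t (act (left , s) w)) ⟩
    act (left , r) (rts right (act (left , t) (act (left , s) w)))
      ≡⟨ through r (act (left , t) (act (left , s) w)) ⟩
    rts right (rts left w) ∎
    where
    through : ∀ g w → act (left , g) (rts right w) ≡ rts right (act (left , g) w)
    through g w = trans (act-comm g r _) (cong (act (right , r)) (trans (act-comm g t _) (cong (act (right , t)) (act-comm g s w))))

opaque
  unfolding act
  private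
    palindrome₀ : rts left (act (left , r) (act (left , t) e)) ≡ rts right (act (left , r) (act (left , t) e))
    palindrome₀ = refl

-- Left and right multiplication commute, so only m = 0 has to be evaluated. It makes every `xw m`
-- its own inverse, which carries the descents from the left to the right.
palindrome : ∀ m → rts left (xw m) ≡ rts right (xw m)
palindrome zero = palindrome₀
palindrome (suc m) = trans (cong (rts left) (palindrome m)) (rts-comm (xw m))

inv-e : inv e ≡ e
inv-e = inv-eval []

inv-xw : ∀ m → inv (xw m) ≡ xw m
inv-xw zero = trans (flip-act′ r _ _ (flip-act′ t e e inv-e)) (trans (cong (act (right , r)) (sym (act-e t)))
  (trans (sym (act-comm t r e)) (trans (cong (act (left , t)) (sym (act-e r))) (comm-rt left e))))
inv-xw (suc m) = trans (flip-act′ r _ _ (flip-act′ t _ _ (flip-act′ s _ _ (inv-xw m)))) (sym (palindrome m))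

inv-fac-right : ∀ b w v → inv w ≡ v → inv (fac right b w) ≡ fac left b v
inv-fac-right F0 w v q = q
inv-fac-right Fs w v q = flip-act s w v q
inv-fac-right Ft w v q = flip-act t _ _ (flip-act s w v q)
inv-fac-right Fr w v q = flip-act r _ _ (flip-act s w v q)

inv-fac-left : ∀ a w v → inv w ≡ v → inv (fac left a w) ≡ fac right a v
inv-fac-left F0 w v q = q
inv-fac-left Fs w v q = flip-act′ s w v q
inv-fac-left Ft w v q = flip-act′ t _ _ (flip-act′ s w v q)
inv-fac-left Fr w v q = flip-act′ r _ _ (flip-act′ s w v q)

inv-el : ∀ a m b → inv (el a m b) ≡ el b m a
inv-el a m b = trans (inv-fac-left a _ _ (inv-fac-right b _ _ (inv-xw m))) (sym (fac-comm b a (xw m)))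

shape-right : ∀ m → Shape right (xw m)
shape-right m = record
  { rD = flip r _ _ (inv-xw m) (rD S) ; tD = flip t _ _ (inv-xw m) (tD S) ; sU = flip s _ _ (inv-xw m) (sU S)
  ; rsU = flip r _ _ i₁ (rsU S) ; tsU = flip t _ _ i₁ (tsU S)
  ; srsU = flip s _ _ (flip-act r _ _ i₁) (srsU S) ; stsU = flip s _ _ (flip-act t _ _ i₁) (stsU S)
  ; trsU = flip t _ _ (flip-act r _ _ i₁) (trsU S) ; rtsU = flip r _ _ (flip-act t _ _ i₁) (rtsU S)
  ; srU = flip s _ _ (flip-act r _ _ (inv-xw m)) (srU S) }
  where
  S : Shape left (xw m)
  S = shape-left m F0
  i₁ : inv (act (right , s) (xw m)) ≡ act (left , s) (xw m)
  i₁ = flip-act s _ _ (inv-xw m)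
  flip : ∀ g w v {b} → inv w ≡ v → dn (left , g) v ≡ b → dn (right , g) w ≡ b
  flip g w v q p = trans (dn-right-inv g w) (trans (cong (dn (left , g)) q) p)

next-right : ∀ m → act (right , t) (act (right , r) (act (right , s) (xw m))) ≡ xw (suc m)
next-right m = trans (comm-rt right _) (sym (palindrome m))

next-left : ∀ m b → act (left , t) (act (left , r) (act (left , s) (fac right b (xw m)))) ≡ fac right b (xw (suc m))
next-left m b = trans (comm-rt left _) (trans (cong (λ z → act (left , r) (act (left , t) z)) (fac-commˡ s b (xw m)))
  (trans (cong (act (left , r)) (fac-commˡ t b _)) (fac-commˡ r b _)))

flen : Factor → ℕ
flen F0 = 0
flen Fs = 1
flen Ft = 2
flen Fr = 2

fac-len : ∀ sd u → Shape sd u → ∀ a → len (fac sd a u) ≡ flen a ℕ.+ len u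
fac-len sd u U F0 = refl
fac-len sd u U Fs = up⇒len (sd , s) u (sU U)
fac-len sd u U Ft = trans (up⇒len (sd , t) _ (tsU U)) (cong suc (up⇒len (sd , s) u (sU U)))
fac-len sd u U Fr = trans (up⇒len (sd , r) _ (rsU U)) (cong suc (up⇒len (sd , s) u (sU U)))

len-xw : ∀ m → len (xw m) ≡ 3 ℕ.* m ℕ.+ 2
len-xw zero = trans (up⇒len (left , r) _ (trans (cong (dn (left , r)) (act-eval t [])) (dn-word r (t ∷ []) false refl)))
  (cong suc (trans (up⇒len (left , t) e (dn-word t [] false refl)) (cong suc len-e)))
len-xw (suc m) = trans (up⇒len (left , r) _ (rtsU S)) (trans (cong suc (trans (up⇒len (left , t) _ (tsU S)) (cong suc (trans (up⇒len (left , s) _ (sU S)) (cong suc (len-xw m))))))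
  (cong (ℕ._+ 2) (sym (ℕₚ.*-suc 3 m))))
  where
  S : Shape left (xw m)
  S = shape-left m F0

len-el : ∀ a m b → len (el a m b) ≡ flen a ℕ.+ (flen b ℕ.+ (3 ℕ.* m ℕ.+ 2))
len-el a m b = trans (fac-len left _ (shape-left m b) a) (cong (flen a ℕ.+_) (trans (fac-len right _ (shape-right m) b) (cong (flen b ℕ.+_) (len-xw m))))

descents : Factor → Gen → Bool
descents F0 r = true
descents F0 s = false
descents F0 t = true
descents Fs r = false
descents Fs s = true
descents Fs t = false
descents Ft r = false
descents Ft s = false
descents Ft t = true
descents Fr r = true
descents Fr s = false
descents Fr t = false

-- The four sets are {r , t}, {s}, {t} and {r}; through them the cells determine the outer factors.
descents-injective : ∀ a b → (∀ g → descents a g ≡ descents b g) → a ≡ b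
descents-injective F0 F0 h = refl
descents-injective F0 Fs h with () ← h r
descents-injective F0 Ft h with () ← h r
descents-injective F0 Fr h with () ← h t
descents-injective Fs F0 h with () ← h r
descents-injective Fs Fs h = refl
descents-injective Fs Ft h with () ← h s
descents-injective Fs Fr h with () ← h s
descents-injective Ft F0 h with () ← h r
descents-injective Ft Fs h with () ← h s
descents-injective Ft Ft h = refl
descents-injective Ft Fr h with () ← h r
descents-injective Fr F0 h with () ← h t
descents-injective Fr Fs h with () ← h s
descents-injective Fr Ft h with () ← h r
descents-injective Fr Fr h = refl

fac-descents : ∀ sd u → Shape sd u → ∀ a g → dn (sd , g) (fac sd a u) ≡ descents a g
fac-descents sd u U F0 r = rD U
fac-descents sd u U F0 s = sU U
fac-descents sd u U F0 t = tD U
fac-descents sd u U Fs r = rsU U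
fac-descents sd u U Fs s = trans (dn-act (sd , s) u) (cong not (sU U))
fac-descents sd u U Fs t = tsU U
fac-descents sd u U Ft r = rtsU U
fac-descents sd u U Ft s = stsU U
fac-descents sd u U Ft t = trans (dn-act (sd , t) _) (cong not (tsU U))
fac-descents sd u U Fr r = trans (dn-act (sd , r) _) (cong not (rsU U))
fac-descents sd u U Fr s = srsU U
fac-descents sd u U Fr t = trsU U

el-left-descents : ∀ a m b g → dn (left , g) (el a m b) ≡ descents a g
el-left-descents a m b g = fac-descents left _ (shape-left m b) a g

el-right-descents : ∀ a m b g → dn (right , g) (el a m b) ≡ descents b g
el-right-descents a m b g = trans (dn-right-inv g (el a m b)) (trans (cong (dn (left , g)) (inv-el a m b)) (el-left-descents b m a g))

-- Indicators of rectangles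

-- A record, so that p can be inferred by unification; an equation on `nonneg p` would compute away.
record Nn (p : ℤ) : Set where
  constructor nn
  field is-nonneg : nonneg p ≡ true
open Nn public

private
  nonneg⇒≤ : ∀ {p} → nonneg p ≡ true → + 0 ≤ℤ p
  nonneg⇒≤ {+ _} _ = +≤+ z≤n

Nn-+ : ∀ {p q} → Nn p → Nn q → Nn (p +ℤ q)
Nn-+ (nn a) (nn b) = nn (≤⇒nonneg (ℤₚ.+-mono-≤ (nonneg⇒≤ a) (nonneg⇒≤ b)))

by : ∀ {p q} → p ≡ q → Nn p → Nn q
by refl h = h

Nn-ℕ : ∀ n → Nn (+ n)
Nn-ℕ n = nn refl

Nn? : ∀ p → Nn p ⊎ Nn (- p +ℤ - (+ 1))
Nn? (+ n) = inj₁ (nn refl)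
Nn? -[1+ n ] = inj₂ (nn refl)

¬Nn-neg : ∀ {n} → ¬ Nn -[1+ n ]
¬Nn-neg (nn ())

-- The gain of one unit for odd numbers, by which the parity of X - Y sharpens inequalities.
Nn-odd : ∀ h → Nn (h +ℤ h +ℤ + 1) → Nn (h +ℤ h)
Nn-odd (+ n) _ = nn refl
Nn-odd -[1+ n ] (nn ())

private
  center : Point
  center = + 1 , + 0

opaque
  unfolding act
  -- The position of the vertex z (1/2 , 0), relative to (1/2 , 0) and in half units.
  cX cY : W → ℤ
  cX z = proj₁ ((+ 2 ⊙ z) center) +ℤ - (+ 1)
  cY z = proj₂ ((+ 2 ⊙ z) center)

  private
    pos-gen : ∀ g z → (+ 2 ⊙ act (left , g) z) center ≡ genAct (+ 2) g ((+ 2 ⊙ z) center)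
    pos-gen g z = trans (cong (λ w → (+ 2 ⊙ w) center) (act-left g z)) (⊙-gen (+ 2) g z center)

  cX-e : cX e ≡ + 0
  cX-e = refl

  cY-e : cY e ≡ + 0
  cY-e = refl

  cX-r : ∀ z → cX (act (left , r) z) ≡ - cX z
  cX-r z = trans (cong (λ p → proj₁ p +ℤ - (+ 1)) (pos-gen r z)) (lem (proj₁ ((+ 2 ⊙ z) center)))
    where
    lem : ∀ x → + 2 +ℤ - x +ℤ - (+ 1) ≡ - (x +ℤ - (+ 1))
    lem = solve-∀

  cY-r : ∀ z → cY (act (left , r) z) ≡ cY z
  cY-r z = cong proj₂ (pos-gen r z)

  cX-t : ∀ z → cX (act (left , t) z) ≡ cX z
  cX-t z = cong (λ p → proj₁ p +ℤ - (+ 1)) (pos-gen t z)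

  cY-t : ∀ z → cY (act (left , t) z) ≡ - cY z
  cY-t z = cong proj₂ (pos-gen t z)

  cX-s : ∀ z → cX (act (left , s) z) ≡ cY z +ℤ - (+ 1)
  cX-s z = cong (λ p → proj₁ p +ℤ - (+ 1)) (pos-gen s z)

  cY-s : ∀ z → cY (act (left , s) z) ≡ cX z +ℤ + 1
  cY-s z = trans (cong proj₂ (pos-gen s z)) (lem (proj₁ ((+ 2 ⊙ z) center)))
    where
    lem : ∀ x → x ≡ x +ℤ - (+ 1) +ℤ + 1
    lem = solve-∀

  private
    sgn-0 : ∀ b → sgn b (+ 0) ≡ + 0
    sgn-0 true = refl
    sgn-0 false = refl

  c-parity : ∀ z → ∃ λ h → cX z ≡ cY z +ℤ (h +ℤ h)
  c-parity (mkW false false n₂ a b) = a +ℤ - b , trans (lem a b) (cong (λ z → z +ℤ + 2 *ℤ b +ℤ (a +ℤ - b +ℤ (a +ℤ - b))) (sym (sgn-0 n₂)))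
    where lem : ∀ a b → + 1 +ℤ + 2 *ℤ a +ℤ - (+ 1) ≡ + 0 +ℤ + 2 *ℤ b +ℤ (a +ℤ - b +ℤ (a +ℤ - b))
          lem = solve-∀
  c-parity (mkW false true n₂ a b) = a +ℤ - b +ℤ - (+ 1) ,
    trans (lem a b) (cong (λ z → z +ℤ + 2 *ℤ b +ℤ (a +ℤ - b +ℤ - (+ 1) +ℤ (a +ℤ - b +ℤ - (+ 1)))) (sym (sgn-0 n₂)))
    where lem : ∀ a b → - (+ 1) +ℤ + 2 *ℤ a +ℤ - (+ 1) ≡ + 0 +ℤ + 2 *ℤ b +ℤ (a +ℤ - b +ℤ - (+ 1) +ℤ (a +ℤ - b +ℤ - (+ 1)))
          lem = solve-∀
  c-parity (mkW true n₁ false a b) = a +ℤ - b +ℤ - (+ 1) , trans (cong (λ z → z +ℤ + 2 *ℤ a +ℤ - (+ 1)) (sgn-0 n₁)) (lem a b)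
    where lem : ∀ a b → + 0 +ℤ + 2 *ℤ a +ℤ - (+ 1) ≡ + 1 +ℤ + 2 *ℤ b +ℤ (a +ℤ - b +ℤ - (+ 1) +ℤ (a +ℤ - b +ℤ - (+ 1)))
          lem = solve-∀
  c-parity (mkW true n₁ true a b) = a +ℤ - b , trans (cong (λ z → z +ℤ + 2 *ℤ a +ℤ - (+ 1)) (sgn-0 n₁)) (lem a b)
    where lem : ∀ a b → + 0 +ℤ + 2 *ℤ a +ℤ - (+ 1) ≡ - (+ 1) +ℤ + 2 *ℤ b +ℤ (a +ℤ - b +ℤ (a +ℤ - b))
          lem = solve-∀

  private
    -- A negative root is ≤ 0 on the closed fundamental alcove, hence at (1/2 , 0).
    root-nonpos : ∀ β → pos β ≡ false → Nn (- value (+ 2) β center)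
    root-nonpos (x⁺ , -[1+ n ]) _ = by (lem -[1+ n ]) (Nn-+ (Nn-ℕ n) (Nn-ℕ n))
      where lem : ∀ k → - (+ 1) +ℤ - k +ℤ (- (+ 1) +ℤ - k) ≡ - (+ 1 +ℤ + 1 +ℤ + 2 *ℤ k)
            lem = solve-∀
    root-nonpos (x⁻ , -[1+ n ]) _ = by (lem -[1+ n ]) (Nn-+ (Nn-ℕ (suc n)) (Nn-ℕ (suc n)))
      where lem : ∀ k → - k +ℤ - k ≡ - (- (+ 1) +ℤ - (+ 1) +ℤ (+ 2 +ℤ + 2 *ℤ k))
            lem = solve-∀
    root-nonpos (y⁺ , -[1+ n ]) _ = by (lem -[1+ n ]) (Nn-+ (Nn-ℕ (suc n)) (Nn-ℕ (suc n)))
      where lem : ∀ k → - k +ℤ - k ≡ - (+ 0 +ℤ + 0 +ℤ + 2 *ℤ k)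
            lem = solve-∀
    root-nonpos (y⁻ , -[1+ n ]) _ = by (lem -[1+ n ]) (Nn-+ (Nn-ℕ n) (Nn-ℕ n))
      where lem : ∀ k → - (+ 1) +ℤ - k +ℤ (- (+ 1) +ℤ - k) ≡ - (+ 0 +ℤ + 0 +ℤ (+ 2 +ℤ + 2 *ℤ k))
            lem = solve-∀
    root-nonpos (d⁺ , -[1+ n ]) _ = by (lem -[1+ n ]) (Nn-+ (Nn-ℕ n) (Nn-ℕ (suc n)))
      where lem : ∀ k → - (+ 1) +ℤ - k +ℤ - k ≡ - (+ 1 +ℤ + 0 +ℤ + 2 *ℤ k)
            lem = solve-∀
    root-nonpos (d⁻ , -[1+ n ]) _ = by (lem -[1+ n ]) (Nn-+ (Nn-ℕ n) (Nn-ℕ (suc n)))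
      where lem : ∀ k → - (+ 1) +ℤ - k +ℤ - k ≡ - (- (+ 1) +ℤ + 0 +ℤ (+ 2 +ℤ + 2 *ℤ k))
            lem = solve-∀
    root-nonpos (e⁺ , -[1+ n ]) _ = by (lem -[1+ n ]) (Nn-+ (Nn-ℕ n) (Nn-ℕ (suc n)))
      where lem : ∀ k → - (+ 1) +ℤ - k +ℤ - k ≡ - (+ 1 +ℤ + 0 +ℤ + 2 *ℤ k)
            lem = solve-∀
    root-nonpos (e⁻ , -[1+ n ]) _ = by (lem -[1+ n ]) (Nn-+ (Nn-ℕ n) (Nn-ℕ (suc n)))
      where lem : ∀ k → - (+ 1) +ℤ - k +ℤ - k ≡ - (+ 0 +ℤ - (+ 1) +ℤ (+ 2 +ℤ + 2 *ℤ k))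
            lem = solve-∀

    descent-value : ∀ g z → dn (left , g) z ≡ true → Nn (- value (+ 2) (simple g) ((+ 2 ⊙ z) center))
    descent-value g z d = by (cong -_ (trans (value-pulls (+ 2) A (simple g) center) (cong (λ w → value (+ 2) (simple g) ((+ 2 ⊙ w) center)) (eval-someWord z))))
      (root-nonpos (pulls (simple g) A) (trans (pos-pulls A (simple g)) (trans (cong (posAt (simple g)) (eval-someWord z)) (InL⇒posAt g z (dn⇒InL g z d)))))
      where
      A : List Gen
      A = someWord z

    halve : ∀ p → Nn (p +ℤ p) → Nn p
    halve (+ n) _ = nn refl
    halve -[1+ n ] (nn ())

  dn-r : ∀ z → dn (left , r) z ≡ true → Nn (cX z)
  dn-r z d = halve _ (by (lem (proj₁ ((+ 2 ⊙ z) center))) (descent-value r z d))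
    where
    lem : ∀ x → - (- x +ℤ - x +ℤ + 2) ≡ x +ℤ - (+ 1) +ℤ (x +ℤ - (+ 1))
    lem = solve-∀

  dn-t : ∀ z → dn (left , t) z ≡ true → Nn (- cY z)
  dn-t z d = halve _ (by (lem (cY z)) (descent-value t z d))
    where
    lem : ∀ y → - (y +ℤ y +ℤ + 0) ≡ - y +ℤ - y
    lem = solve-∀

  dn-s : ∀ z → dn (left , s) z ≡ true → Nn (cY z +ℤ - cX z +ℤ - (+ 1))
  dn-s z d = by (lem (proj₁ ((+ 2 ⊙ z) center)) (cY z)) (descent-value s z d)
    where
    lem : ∀ x y → - (x +ℤ - y +ℤ + 0) ≡ y +ℤ - (x +ℤ - (+ 1)) +ℤ - (+ 1)
    lem = solve-∀

  -- The stabiliser of the vertex (1/2 , 0) is <r,t>; a linear part that swaps the coordinates would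
  -- make X odd.
  cX≡0×cY≡0 : ∀ z → cX z ≡ + 0 → cY z ≡ + 0 →
    z ≡ e ⊎ z ≡ act (left , t) e ⊎ z ≡ act (left , r) e ⊎ z ≡ act (left , r) (act (left , t) e)
  cX≡0×cY≡0 (mkW true n₁ n₂ a b) p q = ⊥-elim (odd a (trans (cong (λ z → z +ℤ + 2 *ℤ a +ℤ - (+ 1)) (sym (sgn-0 n₁))) p))
    where
    dbl : ∀ a → + 0 +ℤ + 2 *ℤ a +ℤ - (+ 1) ≡ a +ℤ - (+ 1) +ℤ (a +ℤ - (+ 1)) +ℤ + 1
    dbl = solve-∀
    odd : ∀ a → + 0 +ℤ + 2 *ℤ a +ℤ - (+ 1) ≢ + 0
    odd a z = contra (a +ℤ - (+ 1)) (trans (sym (dbl a)) z)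
      where
      contra : ∀ k → k +ℤ k +ℤ + 1 ≢ + 0
      contra (+ n) z = ℕₚ.1+n≢0 (trans (ℕₚ.+-comm 1 (n ℕ.+ n)) (ℤₚ.+-injective z))
      contra -[1+ n ] ()
  cX≡0×cY≡0 (mkW false n₁ n₂ a b) p q = by-signs n₁ n₂ (dbl0 b (trans (lemY n₂ b) q)) p
    where
    lemY : ∀ n b → b +ℤ b ≡ sgn n (+ 0) +ℤ + 2 *ℤ b
    lemY n b = trans (l b) (cong (_+ℤ + 2 *ℤ b) (sym (sgn-0 n)))
      where l : ∀ b → b +ℤ b ≡ + 0 +ℤ + 2 *ℤ b
            l = solve-∀
    dbl0 : ∀ k → k +ℤ k ≡ + 0 → k ≡ + 0
    dbl0 (+ zero) _ = refl
    dbl0 (+ suc n) ()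
    dbl0 -[1+ n ] ()
    a≡0 : + 1 +ℤ + 2 *ℤ a +ℤ - (+ 1) ≡ + 0 → a ≡ + 0
    a≡0 z = dbl0 a (trans (l a) z)
      where l : ∀ a → a +ℤ a ≡ + 1 +ℤ + 2 *ℤ a +ℤ - (+ 1)
            l = solve-∀
    a≡1 : - (+ 1) +ℤ + 2 *ℤ a +ℤ - (+ 1) ≡ + 0 → a ≡ + 1
    a≡1 z = trans (l′ a) (cong (_+ℤ + 1) (dbl0 (a +ℤ - (+ 1)) (trans (l a) z)))
      where l : ∀ a → a +ℤ - (+ 1) +ℤ (a +ℤ - (+ 1)) ≡ - (+ 1) +ℤ + 2 *ℤ a +ℤ - (+ 1)
            l = solve-∀
            l′ : ∀ a → a ≡ a +ℤ - (+ 1) +ℤ + 1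
            l′ = solve-∀
    by-signs : ∀ n₁ n₂ → b ≡ + 0 → sgn n₁ (+ 1) +ℤ + 2 *ℤ a +ℤ - (+ 1) ≡ + 0 →
      mkW false n₁ n₂ a b ≡ e ⊎ mkW false n₁ n₂ a b ≡ act (left , t) e ⊎ mkW false n₁ n₂ a b ≡ act (left , r) e ⊎ mkW false n₁ n₂ a b ≡ act (left , r) (act (left , t) e)
    by-signs false false b0 p = inj₁ (≡W (a≡0 p) b0)
    by-signs false true b0 p = inj₂ (inj₁ (≡W (a≡0 p) b0))
    by-signs true false b0 p = inj₂ (inj₂ (inj₁ (≡W (a≡1 p) b0)))
    by-signs true true b0 p = inj₂ (inj₂ (inj₂ (≡W (a≡1 p) b0)))

-- The rectangle -a ≤ X ≤ b, -c ≤ Y ≤ d.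
record Rect (a b c d X Y : ℤ) : Set where
  constructor rc
  field
    ra : Nn (X +ℤ a)
    rb : Nn (b +ℤ - X)
    rc′ : Nn (Y +ℤ c)
    rd : Nn (d +ℤ - Y)

rect : ℤ → ℤ → ℤ → ℤ → W → Bool
rect a b c d z = (nonneg (cX z +ℤ a) ∧ nonneg (b +ℤ - cX z)) ∧ (nonneg (cY z +ℤ c) ∧ nonneg (d +ℤ - cY z))

rect⇒ : ∀ {a b c d} z → rect a b c d z ≡ true → Rect a b c d (cX z) (cY z)
rect⇒ {a} {b} {c} {d} z q with nonneg (cX z +ℤ a) in p₁ | nonneg (b +ℤ - cX z) in p₂ | nonneg (cY z +ℤ c) in p₃ | nonneg (d +ℤ - cY z) in p₄
rect⇒ z refl | true | true | true | true = rc (nn p₁) (nn p₂) (nn p₃) (nn p₄)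

⇒rect : ∀ {a b c d} z → Rect a b c d (cX z) (cY z) → rect a b c d z ≡ true
⇒rect z (rc (nn p) (nn q) (nn u) (nn v)) = cong₂ _∧_ (cong₂ _∧_ p q) (cong₂ _∧_ u v)

-- The sum of v^l(z) T_z over z in A.
I : (W → Bool) → F
I A z n = if A z then unit (n +ℤ - (+ len z)) else + 0

-- Here B = A ∩ gA and D = A ∪ gA.
C-indicator : ∀ g (A B D : W → Bool) →
  (∀ z → B z ≡ A z ∧ A (act (left , g) z)) → (∀ z → D z ≡ A z ∨ A (act (left , g) z)) →
  (∀ z → dn (left , g) z ≡ true → A z ≡ true → A (act (left , g) z) ≡ true) →
  C (left , g) (I A) ≐ sh (- (+ 1)) (I B) +F sh (+ 1) (I D)
C-indicator g A B D hB hD low = mk≐ λ z n → go z n (step σ z)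
  where
  σ : Op
  σ = left , g
  U : ℤ → Bool → ℤ
  U k b = if b then unit k else + 0
  U-true : ∀ {j k} b → j ≡ k → U j b ≡ U k b
  U-true b refl = refl
  combine-dn : ∀ p q a b → (a ≡ true → b ≡ true) → U p b +ℤ U q a ≡ U q (a ∧ b) +ℤ U p (a ∨ b)
  combine-dn p q true b h rewrite h refl = ℤₚ.+-comm (unit p) (unit q)
  combine-dn p q false b h = ℤₚ.+-comm (U p b) (+ 0)
  combine-up : ∀ p q a b → (b ≡ true → a ≡ true) → U q b +ℤ U p a ≡ U q (a ∧ b) +ℤ U p (a ∨ b)
  combine-up p q true b h = refl
  combine-up p q false true h = ⊥-elim (true≢false (sym (h refl)))
  combine-up p q false false h = refl
  go : ∀ z n → Step σ z → C σ (I A) z n ≡ (sh (- (+ 1)) (I B) +F sh (+ 1) (I D)) z n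
  go z n (down d _ q) = begin
    U (n +ℤ - (+ len (act σ z))) (A (act σ z)) +ℤ U (n +ℤ η σ z +ℤ - (+ len z)) (A z)
      ≡⟨ cong₂ _+ℤ_ (U-true (A (act σ z)) (trans (lem n (+ len (act σ z))) (cong (λ l → n +ℤ + 1 +ℤ - (+ l)) (sym q))))
           (cong (λ k → U (n +ℤ k +ℤ - (+ len z)) (A z)) (η-dn {σ} {z} d)) ⟩
    U p (A (act σ z)) +ℤ U u (A z)
      ≡⟨ combine-dn p u (A z) (A (act σ z)) (low z d) ⟩
    U u (A z ∧ A (act σ z)) +ℤ U p (A z ∨ A (act σ z))
      ≡⟨ cong₂ (λ a b → U u a +ℤ U p b) (sym (hB z)) (sym (hD z)) ⟩
    U u (B z) +ℤ U p (D z) ∎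
    where
    p u : ℤ
    p = n +ℤ + 1 +ℤ - (+ len z)
    u = n +ℤ - (+ 1) +ℤ - (+ len z)
    lem : ∀ n l → n +ℤ - l ≡ n +ℤ + 1 +ℤ - (+ 1 +ℤ l)
    lem = solve-∀
  go z n (up d d′ q) = begin
    U (n +ℤ - (+ len (act σ z))) (A (act σ z)) +ℤ U (n +ℤ η σ z +ℤ - (+ len z)) (A z)
      ≡⟨ cong₂ _+ℤ_ (U-true (A (act σ z)) (trans (cong (λ l → n +ℤ - (+ l)) q) (lem n (+ len z))))
           (cong (λ k → U (n +ℤ k +ℤ - (+ len z)) (A z)) (η-up {σ} {z} d)) ⟩
    U u (A (act σ z)) +ℤ U p (A z)
      ≡⟨ combine-up p u (A z) (A (act σ z)) (λ h → trans (cong A (sym (act² σ z))) (low (act σ z) d′ h)) ⟩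
    U u (A z ∧ A (act σ z)) +ℤ U p (A z ∨ A (act σ z))
      ≡⟨ cong₂ (λ a b → U u a +ℤ U p b) (sym (hB z)) (sym (hD z)) ⟩
    U u (B z) +ℤ U p (D z) ∎
    where
    p u : ℤ
    p = n +ℤ + 1 +ℤ - (+ len z)
    u = n +ℤ - (+ 1) +ℤ - (+ len z)
    lem : ∀ n l → n +ℤ - (+ 1 +ℤ l) ≡ n +ℤ - (+ 1) +ℤ - l
    lem = solve-∀

R : ℤ → ℤ → ℤ → ℤ → F
R a b c d = I (rect a b c d)

private
  ∧-intro : ∀ {a b : Bool} → a ≡ true → b ≡ true → a ∧ b ≡ true
  ∧-intro refl refl = refl
  ∨-introʳ : ∀ {a b : Bool} → b ≡ true → a ∨ b ≡ true
  ∨-introʳ {a} refl = 𝔹ₚ.∨-zeroʳ a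
  ∨-introˡ : ∀ {a b : Bool} → a ≡ true → a ∨ b ≡ true
  ∨-introˡ refl = refl

-- `C-indicator` turned into inequalities: (f , h) is the action of g on (X , Y), P is what a
-- descent implies, and the rectangles indexed 1 and 2 are the intersection and the union. Parity is
-- supplied where the union has to be covered, since its corners may be missing.
C-rect : ∀ g (f h : ℤ → ℤ → ℤ) → (∀ z → cX (act (left , g) z) ≡ f (cX z) (cY z)) → (∀ z → cY (act (left , g) z) ≡ h (cX z) (cY z)) →
  (P : ℤ → ℤ → Set) → (∀ z → dn (left , g) z ≡ true → P (cX z) (cY z)) →
  ∀ {a b c d} {a₁ b₁ c₁ d₁} {a₂ b₂ c₂ d₂} →
  (∀ {X Y} → Rect a₁ b₁ c₁ d₁ X Y → Rect a b c d X Y × Rect a b c d (f X Y) (h X Y)) →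
  (∀ {X Y} → Rect a b c d X Y → Rect a b c d (f X Y) (h X Y) → Rect a₁ b₁ c₁ d₁ X Y) →
  (∀ {X Y} → (∃ λ k → X ≡ Y +ℤ (k +ℤ k)) → Rect a₂ b₂ c₂ d₂ X Y → Rect a b c d X Y ⊎ Rect a b c d (f X Y) (h X Y)) →
  (∀ {X Y} → Rect a b c d X Y → Rect a₂ b₂ c₂ d₂ X Y) →
  (∀ {X Y} → Rect a b c d (f X Y) (h X Y) → Rect a₂ b₂ c₂ d₂ X Y) →
  (∀ {X Y} → P X Y → Rect a b c d X Y → Rect a b c d (f X Y) (h X Y)) →
  C (left , g) (R a b c d) ≐ sh (- (+ 1)) (R a₁ b₁ c₁ d₁) +F sh (+ 1) (R a₂ b₂ c₂ d₂)
C-rect g f h hX hY P hP {a} {b} {c} {d} {a₁} {b₁} {c₁} {d₁} {a₂} {b₂} {c₂} {d₂} i₁ i₂ u₁ u₂ u₃ lo =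
  C-indicator g (rect a b c d) (rect a₁ b₁ c₁ d₁) (rect a₂ b₂ c₂ d₂)
    (λ z → true-iff (λ q → let (p , p′) = i₁ (rect⇒ z q) in ∧-intro (⇒rect z p) (to z p′))
                    (λ q → let (p , p′) = ∧-elim q in ⇒rect z (i₂ (rect⇒ z p) (from z p′))))
    (λ z → true-iff (λ q → cases z (u₁ (c-parity z) (rect⇒ z q))) (λ q → back z (∨-elim q)))
    (λ z d q → to z (lo (hP z d) (rect⇒ z q)))
  where
  to : ∀ z → Rect a b c d (f (cX z) (cY z)) (h (cX z) (cY z)) → rect a b c d (act (left , g) z) ≡ true
  to z q = ⇒rect (act (left , g) z) (subst₂ (Rect a b c d) (sym (hX z)) (sym (hY z)) q)
  from : ∀ z → rect a b c d (act (left , g) z) ≡ true → Rect a b c d (f (cX z) (cY z)) (h (cX z) (cY z))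
  from z q = subst₂ (Rect a b c d) (hX z) (hY z) (rect⇒ (act (left , g) z) q)
  cases : ∀ z → Rect a b c d (cX z) (cY z) ⊎ Rect a b c d (f (cX z) (cY z)) (h (cX z) (cY z)) → rect a b c d z ∨ rect a b c d (act (left , g) z) ≡ true
  cases z (inj₁ p) = ∨-introˡ (⇒rect z p)
  cases z (inj₂ p) = ∨-introʳ {rect a b c d z} (to z p)
  back : ∀ z → rect a b c d z ≡ true ⊎ rect a b c d (act (left , g) z) ≡ true → rect a₂ b₂ c₂ d₂ z ≡ true
  back z (inj₁ p) = ⇒rect z (u₂ (rect⇒ z p))
  back z (inj₂ p) = ⇒rect z (u₃ (from z p))

C-r-rect : ∀ a b c d → Nn (a +ℤ - b) → Nn b → C (left , r) (R a b c d) ≐ sh (- (+ 1)) (R b b c d) +F sh (+ 1) (R a a c d)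
C-r-rect a b c d a≥b b≥0 = C-rect r (λ X Y → - X) (λ X Y → Y) cX-r cY-r (λ X Y → Nn X) dn-r {a} {b} {c} {d} {b} {b} {c} {d} {a} {a} {c} {d}
  (λ { {X} (rc p q u v) → rc (by (l₁ X a b) (Nn-+ p a≥b)) q u v , rc (by (l₂ X a b) (Nn-+ q a≥b)) (by (l₃ X b) p) u v })
  (λ { {X} (rc p q u v) (rc p′ q′ _ _) → rc (by (sym (l₃ X b)) q′) q u v })
  (λ { {X} _ (rc p q u v) → split X p q u v (Nn? (b +ℤ - X)) })
  (λ { {X} (rc p q u v) → rc p (by (l₄ X a b) (Nn-+ q a≥b)) u v })
  (λ { {X} (rc p q u v) → rc (by (l₅ X a b) (Nn-+ q a≥b)) (by (l₆ X a) p) u v })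
  (λ { {X} n (rc p q u v) → rc (by (l₂ X a b) (Nn-+ q a≥b)) (by (l₇ X b) (Nn-+ (Nn-+ n n) q)) u v })
  where
  l₁ : ∀ X a b → X +ℤ b +ℤ (a +ℤ - b) ≡ X +ℤ a
  l₁ = solve-∀
  l₂ : ∀ X a b → b +ℤ - X +ℤ (a +ℤ - b) ≡ - X +ℤ a
  l₂ = solve-∀
  l₃ : ∀ X b → X +ℤ b ≡ b +ℤ - (- X)
  l₃ = solve-∀
  l₄ : ∀ X a b → b +ℤ - X +ℤ (a +ℤ - b) ≡ a +ℤ - X
  l₄ = solve-∀
  l₅ : ∀ X a b → b +ℤ - (- X) +ℤ (a +ℤ - b) ≡ X +ℤ a
  l₅ = solve-∀
  l₆ : ∀ X a → - X +ℤ a ≡ a +ℤ - X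
  l₆ = solve-∀
  l₇ : ∀ X b → X +ℤ X +ℤ (b +ℤ - X) ≡ b +ℤ - (- X)
  l₇ = solve-∀
  l₈ : ∀ X b → - (b +ℤ - X) +ℤ - (+ 1) +ℤ (b +ℤ b +ℤ + 1) ≡ b +ℤ - (- X)
  l₈ = solve-∀
  split : ∀ X {Y} → Nn (X +ℤ a) → Nn (a +ℤ - X) → Nn (Y +ℤ c) → Nn (d +ℤ - Y) → Nn (b +ℤ - X) ⊎ Nn (- (b +ℤ - X) +ℤ - (+ 1)) →
    Rect a b c d X Y ⊎ Rect a b c d (- X) Y
  split X p q u v (inj₁ h) = inj₁ (rc p h u v)
  split X p q u v (inj₂ h) = inj₂ (rc (by (sym (l₆ X a)) q) (by (l₈ X b) (Nn-+ h (Nn-+ (Nn-+ b≥0 b≥0) (Nn-ℕ 1)))) u v)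

C-t-rect : ∀ a b c d → Nn (d +ℤ - c) → Nn c → C (left , t) (R a b c d) ≐ sh (- (+ 1)) (R a b c c) +F sh (+ 1) (R a b d d)
C-t-rect a b c d d≥c c≥0 = C-rect t (λ X Y → X) (λ X Y → - Y) cX-t cY-t (λ X Y → Nn (- Y)) dn-t {a} {b} {c} {d} {a} {b} {c} {c} {a} {b} {d} {d}
  (λ { {_} {Y} (rc p q u v) → rc p q u (by (l₁ Y c d) (Nn-+ v d≥c)) , rc p q (by (l₆ Y c) v) (by (l₂ Y c d) (Nn-+ u d≥c)) })
  (λ { {_} {Y} (rc p q u v) (rc _ _ u′ v′) → rc p q u (by (sym (l₆ Y c)) u′) })
  (λ { {_} {Y} _ (rc p q u v) → split Y p q u v (Nn? (Y +ℤ c)) })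
  (λ { {_} {Y} (rc p q u v) → rc p q (by (l₄ Y c d) (Nn-+ u d≥c)) v })
  (λ { {_} {Y} (rc p q u v) → rc p q (by (l₅ Y d) v) (by (l₃ Y c d) (Nn-+ u d≥c)) })
  (λ { {_} {Y} n (rc p q u v) → rc p q (by (l₇ Y c) (Nn-+ (Nn-+ n n) u)) (by (l₂ Y c d) (Nn-+ u d≥c)) })
  where
  l₁ : ∀ Y c d → c +ℤ - Y +ℤ (d +ℤ - c) ≡ d +ℤ - Y
  l₁ = solve-∀
  l₂ : ∀ Y c d → Y +ℤ c +ℤ (d +ℤ - c) ≡ d +ℤ - (- Y)
  l₂ = solve-∀
  l₃ : ∀ Y c d → - Y +ℤ c +ℤ (d +ℤ - c) ≡ d +ℤ - Y
  l₃ = solve-∀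
  l₄ : ∀ Y c d → Y +ℤ c +ℤ (d +ℤ - c) ≡ Y +ℤ d
  l₄ = solve-∀
  l₅ : ∀ Y d → d +ℤ - (- Y) ≡ Y +ℤ d
  l₅ = solve-∀
  l₆ : ∀ Y c → c +ℤ - Y ≡ - Y +ℤ c
  l₆ = solve-∀
  l₇ : ∀ Y c → - Y +ℤ - Y +ℤ (Y +ℤ c) ≡ - Y +ℤ c
  l₇ = solve-∀
  l₈ : ∀ Y c → - (Y +ℤ c) +ℤ - (+ 1) +ℤ (c +ℤ c +ℤ + 1) ≡ - Y +ℤ c
  l₈ = solve-∀
  split : ∀ Y {X} → Nn (X +ℤ a) → Nn (b +ℤ - X) → Nn (Y +ℤ d) → Nn (d +ℤ - Y) → Nn (Y +ℤ c) ⊎ Nn (- (Y +ℤ c) +ℤ - (+ 1)) →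
    Rect a b c d X Y ⊎ Rect a b c d X (- Y)
  split Y p q u v (inj₁ h) = inj₁ (rc p q h v)
  split Y p q u v (inj₂ h) = inj₂ (rc p q (by (l₈ Y c) (Nn-+ h (Nn-+ (Nn-+ c≥0 c≥0) (Nn-ℕ 1)))) (by (sym (l₅ Y d)) u))

-- The hypotheses say that a - c and d - b are 0 or 1. Then the rectangle and its image under s are
-- offset by at most one unit, and their union misses at most corner points of the larger rectangle,
-- where X - Y is odd.
C-s-rect : ∀ a b c d → Nn (c +ℤ + 1 +ℤ - a) → Nn (b +ℤ + 1 +ℤ - d) → Nn (a +ℤ - c) → Nn (d +ℤ - b) →
  C (left , s) (R a b c d) ≐ sh (- (+ 1)) (R a (d +ℤ - (+ 1)) (a +ℤ - (+ 1)) d) +F sh (+ 1) (R (c +ℤ + 1) b c (b +ℤ + 1))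
C-s-rect a b c d h₁ h₂ h₃ h₄ = C-rect s (λ X Y → Y +ℤ - (+ 1)) (λ X Y → X +ℤ + 1) cX-s cY-s (λ X Y → Nn (Y +ℤ - X +ℤ - (+ 1))) dn-s
  {a} {b} {c} {d} {a} {d +ℤ - (+ 1)} {a +ℤ - (+ 1)} {d} {c +ℤ + 1} {b} {c} {b +ℤ + 1}
  (λ { {X} {Y} (rc p q u v) → rc p (by (l₁ X b d) (Nn-+ q h₂)) (by (l₂ Y a c) (Nn-+ u h₁)) v ,
                              rc (by (l₃ Y a) u) (by (l₄ Y b d) (Nn-+ v h₂)) (by (l₅ X a c) (Nn-+ p h₁)) (by (l₆ X d) q) })
  (λ { {X} {Y} (rc p q u v) (rc p′ q′ u′ v′) → rc p (by (sym (l₆ X d)) v′) (by (sym (l₃ Y a)) p′) v })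
  (λ { {X} {Y} (k , par) (rc p q u v) → split X Y k par p q u v (Nn? (X +ℤ a)) (Nn? (d +ℤ - Y)) })
  (λ { {X} {Y} (rc p q u v) → rc (by (l₇ X a c) (Nn-+ p h₁)) q u (by (l₈ Y b d) (Nn-+ v h₂)) })
  (λ { {X} {Y} (rc p q u v) → rc (by (l₉ X c) u) (by (l₁₀ X b d) (Nn-+ v h₂)) (by (l₁₁ Y a c) (Nn-+ p h₁)) (by (l₁₂ Y b) q) })
  (λ { {X} {Y} n (rc p q u v) → rc (by (l₁₃ X Y a) (Nn-+ n p)) (by (l₄ Y b d) (Nn-+ v h₂)) (by (l₅ X a c) (Nn-+ p h₁)) (by (l₁₄ X Y d) (Nn-+ n v)) })
  where
  l₁ : ∀ X b d → d +ℤ - (+ 1) +ℤ - X +ℤ (b +ℤ + 1 +ℤ - d) ≡ b +ℤ - X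
  l₁ = solve-∀
  l₂ : ∀ Y a c → Y +ℤ (a +ℤ - (+ 1)) +ℤ (c +ℤ + 1 +ℤ - a) ≡ Y +ℤ c
  l₂ = solve-∀
  l₃ : ∀ Y a → Y +ℤ (a +ℤ - (+ 1)) ≡ Y +ℤ - (+ 1) +ℤ a
  l₃ = solve-∀
  l₄ : ∀ Y b d → d +ℤ - Y +ℤ (b +ℤ + 1 +ℤ - d) ≡ b +ℤ - (Y +ℤ - (+ 1))
  l₄ = solve-∀
  l₅ : ∀ X a c → X +ℤ a +ℤ (c +ℤ + 1 +ℤ - a) ≡ X +ℤ + 1 +ℤ c
  l₅ = solve-∀
  l₆ : ∀ X d → d +ℤ - (+ 1) +ℤ - X ≡ d +ℤ - (X +ℤ + 1)
  l₆ = solve-∀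
  l₇ : ∀ X a c → X +ℤ a +ℤ (c +ℤ + 1 +ℤ - a) ≡ X +ℤ (c +ℤ + 1)
  l₇ = solve-∀
  l₈ : ∀ Y b d → d +ℤ - Y +ℤ (b +ℤ + 1 +ℤ - d) ≡ b +ℤ + 1 +ℤ - Y
  l₈ = solve-∀
  l₉ : ∀ X c → X +ℤ + 1 +ℤ c ≡ X +ℤ (c +ℤ + 1)
  l₉ = solve-∀
  l₁₀ : ∀ X b d → d +ℤ - (X +ℤ + 1) +ℤ (b +ℤ + 1 +ℤ - d) ≡ b +ℤ - X
  l₁₀ = solve-∀
  l₁₁ : ∀ Y a c → Y +ℤ - (+ 1) +ℤ a +ℤ (c +ℤ + 1 +ℤ - a) ≡ Y +ℤ c
  l₁₁ = solve-∀
  l₁₂ : ∀ Y b → b +ℤ - (Y +ℤ - (+ 1)) ≡ b +ℤ + 1 +ℤ - Y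
  l₁₂ = solve-∀
  l₁₃ : ∀ X Y a → Y +ℤ - X +ℤ - (+ 1) +ℤ (X +ℤ a) ≡ Y +ℤ - (+ 1) +ℤ a
  l₁₃ = solve-∀
  l₁₄ : ∀ X Y d → Y +ℤ - X +ℤ - (+ 1) +ℤ (d +ℤ - Y) ≡ d +ℤ - (X +ℤ + 1)
  l₁₄ = solve-∀
  -- Outside A a point of the union lies on its left or top edge, where parity excludes the corner.
  split : ∀ X Y k → X ≡ Y +ℤ (k +ℤ k) → Nn (X +ℤ (c +ℤ + 1)) → Nn (b +ℤ - X) → Nn (Y +ℤ c) → Nn (b +ℤ + 1 +ℤ - Y) →
    Nn (X +ℤ a) ⊎ Nn (- (X +ℤ a) +ℤ - (+ 1)) → Nn (d +ℤ - Y) ⊎ Nn (- (d +ℤ - Y) +ℤ - (+ 1)) →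
    Rect a b c d X Y ⊎ Rect a b c d (Y +ℤ - (+ 1)) (X +ℤ + 1)
  split X Y k refl p q u v (inj₁ x) (inj₁ y) = inj₁ (rc x q u y)
  split X Y k refl p q u v (inj₂ x) _ = inj₂ (rc (by (m₁ Y a c) (Nn-+ Yc h₃)) (by (sym (l₁₂ Y b)) v) (by (sym (l₉ X c)) p)
    (by (m₂ Y k b c d) (Nn-+ (Nn-+ (Nn-+ h₄ v) Yc) X≤)))
    where
    m₃ : ∀ X a c → - (X +ℤ a) +ℤ - (+ 1) +ℤ (a +ℤ - c) ≡ - (X +ℤ (c +ℤ + 1))
    m₃ = solve-∀
    X≤ : Nn (- (X +ℤ (c +ℤ + 1)))
    X≤ = by (m₃ X a c) (Nn-+ x h₃)
    m₁ : ∀ Y a c → Y +ℤ c +ℤ - (+ 1) +ℤ (a +ℤ - c) ≡ Y +ℤ - (+ 1) +ℤ a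
    m₁ = solve-∀
    m₂ : ∀ Y k b c d → d +ℤ - b +ℤ (b +ℤ + 1 +ℤ - Y) +ℤ (Y +ℤ c +ℤ - (+ 1)) +ℤ - (Y +ℤ (k +ℤ k) +ℤ (c +ℤ + 1)) ≡ d +ℤ - (Y +ℤ (k +ℤ k) +ℤ + 1)
    m₂ = solve-∀
    odd : Nn ((- k +ℤ - (+ 1)) +ℤ (- k +ℤ - (+ 1)) +ℤ + 1)
    odd = by (m₄ Y k c) (Nn-+ u X≤)
      where
      m₄ : ∀ Y k c → Y +ℤ c +ℤ - (Y +ℤ (k +ℤ k) +ℤ (c +ℤ + 1)) ≡ (- k +ℤ - (+ 1)) +ℤ (- k +ℤ - (+ 1)) +ℤ + 1
      m₄ = solve-∀
    Yc : Nn (Y +ℤ c +ℤ - (+ 1))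
    Yc = by (m₅ Y k c) (Nn-+ p (Nn-odd (- k +ℤ - (+ 1)) odd))
      where
      m₅ : ∀ Y k c → Y +ℤ (k +ℤ k) +ℤ (c +ℤ + 1) +ℤ (- k +ℤ - (+ 1) +ℤ (- k +ℤ - (+ 1))) ≡ Y +ℤ c +ℤ - (+ 1)
      m₅ = solve-∀
  split X Y k refl p q u v (inj₁ x) (inj₂ y) = inj₂ (rc (by (m₁ Y k a b) (Nn-+ (Nn-+ q x) Y≥)) (by (sym (l₁₂ Y b)) v) (by (sym (l₉ X c)) p)
    (by (m₂ Y k b d) (Nn-+ (Nn-+ h₄ v) (Nn-odd (- k +ℤ - (+ 1)) odd))))
    where
    Y≥ : Nn (Y +ℤ - b +ℤ - (+ 1))
    Y≥ = by (m₃ Y b d) (Nn-+ y h₄)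
      where
      m₃ : ∀ Y b d → - (d +ℤ - Y) +ℤ - (+ 1) +ℤ (d +ℤ - b) ≡ Y +ℤ - b +ℤ - (+ 1)
      m₃ = solve-∀
    m₁ : ∀ Y k a b → b +ℤ - (Y +ℤ (k +ℤ k)) +ℤ (Y +ℤ (k +ℤ k) +ℤ a) +ℤ (Y +ℤ - b +ℤ - (+ 1)) ≡ Y +ℤ - (+ 1) +ℤ a
    m₁ = solve-∀
    odd : Nn ((- k +ℤ - (+ 1)) +ℤ (- k +ℤ - (+ 1)) +ℤ + 1)
    odd = by (m₄ Y k b) (Nn-+ q Y≥)
      where
      m₄ : ∀ Y k b → b +ℤ - (Y +ℤ (k +ℤ k)) +ℤ (Y +ℤ - b +ℤ - (+ 1)) ≡ (- k +ℤ - (+ 1)) +ℤ (- k +ℤ - (+ 1)) +ℤ + 1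
      m₄ = solve-∀
    m₂ : ∀ Y k b d → d +ℤ - b +ℤ (b +ℤ + 1 +ℤ - Y) +ℤ (- k +ℤ - (+ 1) +ℤ (- k +ℤ - (+ 1))) ≡ d +ℤ - (Y +ℤ (k +ℤ k) +ℤ + 1)
    m₂ = solve-∀

-- Squares and their recursions

R-cong : ∀ {a b c d a′ b′ c′ d′} → a ≡ a′ → b ≡ b′ → c ≡ c′ → d ≡ d′ → R a b c d ≐ R a′ b′ c′ d′
R-cong refl refl refl refl = ≐-refl

I-cong : ∀ A B → (∀ z → A z ≡ B z) → I A ≐ I B
I-cong A B h = mk≐ λ z n → cong (λ b → if b then unit (n +ℤ - (+ len z)) else + 0) (h z)

R-empty : ∀ a b c d → (∀ {X Y} → (∃ λ k → X ≡ Y +ℤ (k +ℤ k)) → ¬ Rect a b c d X Y) → R a b c d ≐ 0F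
R-empty a b c d h = I-cong (rect a b c d) (λ _ → false) (λ z → ¬⇒false (λ q → h (c-parity z) (rect⇒ z q))) ∙ mk≐ (λ _ _ → refl)

-- Stable sets: `Sq`, `Hq` and `Wq` under r and t, `Tq` under s, `Zt` under s and t, `Zr` under s
-- and r. `Zt n` and `Zr n` are squares of the same size as `Sq n`, centred at (-1 , 0) and (0 , 1),
-- the fixed points of <s,t> and <s,r>.
Sq Tq Zt Zr Hq Wq : ℕ → F
Sq n = R (+ n) (+ n) (+ n) (+ n)
Tq n = R (+ suc n) (+ n) (+ n) (+ suc n)
Zt n = R (+ suc n) (+ n +ℤ - (+ 1)) (+ n) (+ n)
Zr n = R (+ n) (+ n) (+ n +ℤ - (+ 1)) (+ suc n)
Hq n = R (+ n) (+ n) (+ suc n) (+ suc n)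
Wq n = R (+ suc n) (+ suc n) (+ n) (+ n)

private
  n+1 : ∀ n → + n +ℤ + 1 ≡ + suc n
  n+1 n = cong +_ (ℕₚ.+-comm n 1)

  k0 : ∀ x → Nn (x +ℤ - x)
  k0 x = by (sym (ℤₚ.+-inverseʳ x)) (Nn-ℕ 0)
  k1 : ∀ x → Nn (x +ℤ + 1 +ℤ - x)
  k1 x = by (lem x) (Nn-ℕ 1)
    where lem : ∀ x → + 1 ≡ x +ℤ + 1 +ℤ - x
          lem = solve-∀
  k2 : ∀ x → Nn (x +ℤ + 1 +ℤ - (+ 1 +ℤ x))
  k2 x = by (lem x) (Nn-ℕ 0)
    where lem : ∀ x → + 0 ≡ x +ℤ + 1 +ℤ - (+ 1 +ℤ x)
          lem = solve-∀
  k3 : ∀ x → Nn (+ 1 +ℤ x +ℤ - x)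
  k3 x = by (lem x) (Nn-ℕ 1)
    where lem : ∀ x → + 1 ≡ + 1 +ℤ x +ℤ - x
          lem = solve-∀

  no-half : ∀ k → + 1 ≢ k +ℤ k
  no-half (+ zero) ()
  no-half (+ suc n) q = ℕₚ.0≢1+n (trans (ℕₚ.suc-injective (ℤₚ.+-injective q)) (ℕₚ.+-suc n n))
  no-half -[1+ n ] ()

  sum0 : ∀ {n p} → Nn p → p ≡ -[1+ n ] → ⊥
  sum0 h refl = ¬Nn-neg h

↓_ ↑_ : F → F
↓ X = sh (- (+ 1)) X
↑ X = sh (+ 1) X

-- `Tq (n - 1)`, the rectangle for -1 being empty.
Tq⁻ : ℕ → F
Tq⁻ zero = 0F
Tq⁻ (suc n) = Tq n

C-s-Sq : ∀ n → C (left , s) (Sq n) ≐ ↓ Tq⁻ n +F ↑ Tq n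
C-s-Sq n = C-s-rect (+ n) (+ n) (+ n) (+ n) (k1 (+ n)) (k1 (+ n)) (k0 (+ n)) (k0 (+ n))
  ∙ +F-cong (sh-cong (- (+ 1)) (first n)) (sh-cong (+ 1) (R-cong (n+1 n) (refl {x = + n}) (refl {x = + n}) (n+1 n)))
  where
  first : ∀ n → R (+ n) (+ n +ℤ - (+ 1)) (+ n +ℤ - (+ 1)) (+ n) ≐ Tq⁻ n
  first zero = R-empty (+ 0) (- (+ 1)) (- (+ 1)) (+ 0) (λ { {X} _ (rc p q _ _) → sum0 (Nn-+ p q) (lem X) })
    where lem : ∀ X → X +ℤ + 0 +ℤ (- (+ 1) +ℤ - X) ≡ - (+ 1)
          lem = solve-∀
  first (suc n) = ≐-refl

C-r-Tq : ∀ n → C (left , r) (Tq n) ≐ ↓ R (+ n) (+ n) (+ n) (+ suc n) +F ↑ R (+ suc n) (+ suc n) (+ n) (+ suc n)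
C-r-Tq n = C-r-rect (+ suc n) (+ n) (+ n) (+ suc n) (k3 (+ n)) (Nn-ℕ n)

C-t-Tq : ∀ n → C (left , t) (Tq n) ≐ ↓ R (+ suc n) (+ n) (+ n) (+ n) +F ↑ R (+ suc n) (+ n) (+ suc n) (+ suc n)
C-t-Tq n = C-t-rect (+ suc n) (+ n) (+ n) (+ suc n) (k3 (+ n)) (Nn-ℕ n)

module _ {Φ : F → F} (l : Linear Φ) where
  linear-pair : ∀ X Y → Φ (↓ X +F ↑ Y) ≐ ↓ Φ X +F ↑ Φ Y
  linear-pair X Y = l-+ l (↓ X) (↑ Y) ∙ +F-cong (l-sh l (- (+ 1)) X) (l-sh l (+ 1) Y)

private
  four-terms : ∀ A B D E → ↓ (↓ A +F ↑ B) +F ↑ (↓ D +F ↑ E) ≐ sh (- (+ 2)) A +F (B +F D) +F sh (+ 2) E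
  four-terms A B D E = mk≐ λ x n → trans
    (cong₂ _+ℤ_ (cong₂ _+ℤ_ (cong (A x) (ℤₚ.+-assoc n (- (+ 1)) (- (+ 1)))) (cong (B x) (+-cancel n (- (+ 1))))) (cong₂ _+ℤ_ (cong (D x) (+-cancel n (+ 1))) (cong (E x) (ℤₚ.+-assoc n (+ 1) (+ 1)))))
    (lem (A x (n +ℤ - (+ 2))) (B x n) (D x n) (E x (n +ℤ + 2)))
    where
    lem : ∀ a b d e → a +ℤ b +ℤ (d +ℤ e) ≡ a +ℤ (b +ℤ d) +ℤ e
    lem = solve-∀

C-tr-Tq : ∀ n → C (left , t) (C (left , r) (Tq n)) ≐ sh (- (+ 2)) (Sq n) +F (Hq n +F Wq n) +F sh (+ 2) (Sq (suc n))
C-tr-Tq n = l-cong lt (C-r-Tq n) ∙ linear-pair lt (R (+ n) (+ n) (+ n) (+ suc n)) (R (+ suc n) (+ suc n) (+ n) (+ suc n))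
  ∙ +F-cong (sh-cong (- (+ 1)) (C-t-rect (+ n) (+ n) (+ n) (+ suc n) (k3 (+ n)) (Nn-ℕ n)))
            (sh-cong (+ 1) (C-t-rect (+ suc n) (+ suc n) (+ n) (+ suc n) (k3 (+ n)) (Nn-ℕ n)))
  ∙ four-terms (Sq n) (Hq n) (Wq n) (Sq (suc n))
  where lt = C-linear (left , t)

C-st-Tq : ∀ n → C (left , s) (C (left , t) (Tq n)) ≐ sh (- (+ 2)) (Zt n) +F (Tq n +F Tq n) +F sh (+ 2) (Zt (suc n))
C-st-Tq n = l-cong ls (C-t-Tq n) ∙ linear-pair ls (R (+ suc n) (+ n) (+ n) (+ n)) (R (+ suc n) (+ n) (+ suc n) (+ suc n))
  ∙ +F-cong (sh-cong (- (+ 1)) (C-s-rect (+ suc n) (+ n) (+ n) (+ n) (k2 (+ n)) (k1 (+ n)) (k3 (+ n)) (k0 (+ n))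
                        ∙ +F-cong (≐-refl {↓ Zt n}) (sh-cong (+ 1) (R-cong (n+1 n) (refl {x = + n}) (refl {x = + n}) (n+1 n)))))
            (sh-cong (+ 1) (C-s-rect (+ suc n) (+ n) (+ suc n) (+ suc n) (k1 (+ suc n)) (k2 (+ n)) (k0 (+ suc n)) (k3 (+ n))
                        ∙ +F-cong (≐-refl {↓ Tq n}) (sh-cong (+ 1) (R-cong (n+1 (suc n)) (refl {x = + n}) (refl {x = + suc n}) (n+1 n)))))
  ∙ four-terms (Zt n) (Tq n) (Tq n) (Zt (suc n))
  where ls = C-linear (left , s)

C-sr-Tq : ∀ n → C (left , s) (C (left , r) (Tq n)) ≐ sh (- (+ 2)) (Zr n) +F (Tq n +F Tq n) +F sh (+ 2) (Zr (suc n))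
C-sr-Tq n = l-cong ls (C-r-Tq n) ∙ linear-pair ls (R (+ n) (+ n) (+ n) (+ suc n)) (R (+ suc n) (+ suc n) (+ n) (+ suc n))
  ∙ +F-cong (sh-cong (- (+ 1)) (C-s-rect (+ n) (+ n) (+ n) (+ suc n) (k1 (+ n)) (k2 (+ n)) (k0 (+ n)) (k3 (+ n))
                        ∙ +F-cong (≐-refl {↓ Zr n}) (sh-cong (+ 1) (R-cong (n+1 n) (refl {x = + n}) (refl {x = + n}) (n+1 n)))))
            (sh-cong (+ 1) (C-s-rect (+ suc n) (+ suc n) (+ n) (+ suc n) (k2 (+ n)) (k1 (+ suc n)) (k3 (+ n)) (k0 (+ suc n))
                        ∙ +F-cong (≐-refl {↓ Tq n}) (sh-cong (+ 1) (R-cong (n+1 n) (refl {x = + suc n}) (refl {x = + n}) (n+1 (suc n))))))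
  ∙ four-terms (Zr n) (Tq n) (Tq n) (Zr (suc n))
  where ls = C-linear (left , s)

private
  squeeze : ∀ p → Nn p → Nn (- p) → p ≡ + 0
  squeeze (+ zero) _ _ = refl
  squeeze (+ suc n) _ (nn ())
  squeeze -[1+ n ] (nn ()) _

private
  parity-clash : ∀ X Y k → X ≡ Y +ℤ (k +ℤ k) → Y +ℤ - X ≡ + 1 → ⊥
  parity-clash X Y k eq d = no-half (- k) (trans (sym d) (trans (cong (λ x → Y +ℤ - x) eq) (lem Y k)))
    where lem : ∀ Y k → Y +ℤ - (Y +ℤ (k +ℤ k)) ≡ - k +ℤ - k
          lem = solve-∀

-- The rectangle is the single point (-1 , 0), where X - Y is odd.
Zt-0 : Zt 0 ≐ 0F
Zt-0 = R-empty (+ 1) (- (+ 1)) (+ 0) (+ 0) (λ { {X} {Y} (k , eq) (rc p q u v) → parity-clash X Y k eq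
  (trans (lem X Y) (cong₂ (λ a b → b +ℤ + 1 +ℤ - a) (squeeze (X +ℤ + 1) p (by (l₁ X) q)) (squeeze (Y +ℤ + 0) u (by (l₂ Y) v)))) })
  where
  l₁ : ∀ X → - (+ 1) +ℤ - X ≡ - (X +ℤ + 1)
  l₁ = solve-∀
  l₂ : ∀ Y → + 0 +ℤ - Y ≡ - (Y +ℤ + 0)
  l₂ = solve-∀
  lem : ∀ X Y → Y +ℤ - X ≡ Y +ℤ + 0 +ℤ + 1 +ℤ - (X +ℤ + 1)
  lem = solve-∀

-- The rectangle is the single point (0 , 1), again of the wrong parity.
Zr-0 : Zr 0 ≐ 0F
Zr-0 = R-empty (+ 0) (+ 0) (- (+ 1)) (+ 1) (λ { {X} {Y} (k , eq) (rc p q u v) → parity-clash X Y k eq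
  (trans (lem X Y) (cong₂ (λ a b → b +ℤ + 1 +ℤ - a) (squeeze (X +ℤ + 0) p (by (l₁ X) q)) (squeeze (Y +ℤ - (+ 1)) u (by (l₂ Y) v)))) })
  where
  l₁ : ∀ X → + 0 +ℤ - X ≡ - (X +ℤ + 0)
  l₁ = solve-∀
  l₂ : ∀ Y → + 1 +ℤ - Y ≡ - (Y +ℤ - (+ 1))
  l₂ = solve-∀
  lem : ∀ X Y → Y +ℤ - X ≡ Y +ℤ - (+ 1) +ℤ + 1 +ℤ - (X +ℤ + 0)
  lem = solve-∀

private
  small : ∀ k → Nn (k +ℤ k +ℤ + 1) → Nn (+ 1 +ℤ - (k +ℤ k)) → k ≡ + 0
  small (+ zero) _ _ = refl
  small (+ suc n) _ h = ⊥-elim (sum0 h (cong (λ m → + 1 +ℤ -[1+ m ]) (ℕₚ.+-suc n n)))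
  small -[1+ n ] (nn ()) _

  corner : ∀ {a b c d a′ b′ c′ d′} →
    (∀ {X Y} → (∃ λ k → X ≡ Y +ℤ (k +ℤ k)) → Rect a b c d X Y → Rect a′ b′ c′ d′ X Y) →
    (∀ {X Y} → Rect a′ b′ c′ d′ X Y → Rect a b c d X Y) → R a b c d ≐ R a′ b′ c′ d′
  corner {a} {b} {c} {d} {a′} {b′} {c′} {d′} f g = I-cong (rect a b c d) (rect a′ b′ c′ d′)
    (λ z → true-iff (λ q → ⇒rect z (f (c-parity z) (rect⇒ z q))) (λ q → ⇒rect z (g (rect⇒ z q))))

private
  even-small : ∀ X Y k → X ≡ Y +ℤ (k +ℤ k) → X ≡ + 0 → Nn (Y +ℤ + 1) → Nn (+ 1 +ℤ - Y) → Y ≡ + 0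
  even-small X Y k eq X0 u v = trans Y≡ (cong (λ h → h +ℤ h) (small (- k) (by (cong (_+ℤ + 1) Y≡) u) (by (cong (λ y → + 1 +ℤ - y) Y≡) v)))
    where
    lem : ∀ Y k → Y ≡ Y +ℤ (k +ℤ k) +ℤ (- k +ℤ - k)
    lem = solve-∀
    Y≡ : Y ≡ - k +ℤ - k
    Y≡ = trans (lem Y k) (trans (cong (_+ℤ (- k +ℤ - k)) (trans (sym eq) X0)) (ℤₚ.+-identityˡ _))

  widen⁺ : ∀ Y → Y +ℤ + 0 +ℤ + 1 ≡ Y +ℤ + 1
  widen⁺ = solve-∀
  widen⁻ : ∀ Y → + 0 +ℤ - Y +ℤ + 1 ≡ + 1 +ℤ - Y
  widen⁻ = solve-∀

zero-of : ∀ X → Nn (X +ℤ + 0) → Nn (+ 0 +ℤ - X) → X ≡ + 0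
zero-of X p q = squeeze X (by (ℤₚ.+-identityʳ X) p) (by (ℤₚ.+-identityˡ (- X)) q)
of-zero : ∀ {X} → X ≡ + 0 → Nn (X +ℤ + 0) × Nn (+ 0 +ℤ - X)
of-zero refl = Nn-ℕ 0 , Nn-ℕ 0

-- With X = 0, parity leaves only Y = 0 in the range |Y| ≤ 1.
Hq-0 : Hq 0 ≐ Sq 0
Hq-0 = corner {+ 0} {+ 0} {+ 1} {+ 1} {+ 0} {+ 0} {+ 0} {+ 0}
  (λ { {X} {Y} (k , eq) (rc p q u v) → let (u′ , v′) = of-zero (even-small X Y k eq (zero-of X p q) u v) in rc p q u′ v′ })
  (λ { {X} {Y} (rc p q u v) → rc p q (by (widen⁺ Y) (Nn-+ u (Nn-ℕ 1))) (by (widen⁻ Y) (Nn-+ v (Nn-ℕ 1))) })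

Wq-0 : Wq 0 ≐ Sq 0
Wq-0 = corner {+ 1} {+ 1} {+ 0} {+ 0} {+ 0} {+ 0} {+ 0} {+ 0}
  (λ { {X} {Y} (k , eq) (rc p q u v) → let (p′ , q′) = of-zero (even-small Y X (- k) (trans (lem Y k) (cong (_+ℤ (- k +ℤ - k)) (sym eq))) (zero-of Y u v) p q) in rc p′ q′ u v })
  (λ { {X} {Y} (rc p q u v) → rc (by (widen⁺ X) (Nn-+ p (Nn-ℕ 1))) (by (widen⁻ X) (Nn-+ q (Nn-ℕ 1))) u v })
  where
  lem : ∀ Y k → Y ≡ Y +ℤ (k +ℤ k) +ℤ (- k +ℤ - k)
  lem = solve-∀

-- Together with `C-t-Zr` this names the terms in `Hq` and `Wq` left over in `Φ₂-Sq-suc` as products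
-- of elements whose invariance can be proved.
C-r-Zt : ∀ n → C (left , r) (Zt (suc n)) ≐ ↓ Hq n +F ↑ Wq (suc n)
C-r-Zt n = C-r-rect (+ suc (suc n)) (+ n) (+ suc n) (+ suc n) (by (lem (+ n)) (Nn-ℕ 2)) (Nn-ℕ n)
  where lem : ∀ x → + 2 ≡ + 2 +ℤ x +ℤ - x
        lem = solve-∀

C-t-Zr : ∀ n → C (left , t) (Zr (suc n)) ≐ ↓ Wq n +F ↑ Hq (suc n)
C-t-Zr n = C-t-rect (+ suc n) (+ suc n) (+ n) (+ suc (suc n)) (by (lem (+ n)) (Nn-ℕ 2)) (Nn-ℕ n)
  where lem : ∀ x → + 2 ≡ + 2 +ℤ x +ℤ - x
        lem = solve-∀

-- For g = r or t, composing with C_g gives C_s C_g C_s C_g - 2 C_s C_g, the Kazhdan-Lusztig element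
-- of the longest element of <s,g>. On elements with g as descent, C_g is only a factor v + v^-1,
-- and κ divides it out.
κ : Gen → F → F
κ g X = C (left , s) (C (left , g) (C (left , s) X)) +F (- (+ 2)) • C (left , s) X

•-linear : ∀ c {Φ} → Linear Φ → Linear (λ X → c • Φ X)
•-linear c {Φ} l = record
  { l-cong = λ p → •-cong c (l-cong l p)
  ; l-+ = λ X Y → •-cong c (l-+ l X Y) ∙ mk≐ (λ x n → ℤₚ.*-distribˡ-+ c (Φ X x n) (Φ Y x n))
  ; l-• = λ d X → •-cong c (l-• l d X) ∙ mk≐ (λ x n → lem c d (Φ X x n))
  ; l-sh = λ k X → •-cong c (l-sh l k X) }
  where
  lem : ∀ c d p → c *ℤ (d *ℤ p) ≡ d *ℤ (c *ℤ p)
  lem = solve-∀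

κ-linear : ∀ g → Linear (κ g)
κ-linear g = +-linear (∘-linear (C-linear (left , s)) (∘-linear (C-linear (left , g)) (C-linear (left , s)))) (•-linear (- (+ 2)) (C-linear (left , s)))

Φ₂ : F → F
Φ₂ X = C (left , t) (C (left , r) (C (left , s) X))

Φ₂-linear : Linear Φ₂
Φ₂-linear = ∘-linear (C-linear (left , t)) (∘-linear (C-linear (left , r)) (C-linear (left , s)))

module KappaSquare (g : Gen) (Z : ℕ → F)
  (C-sg : ∀ n → C (left , s) (C (left , g) (Tq n)) ≐ sh (- (+ 2)) (Z n) +F (Tq n +F Tq n) +F sh (+ 2) (Z (suc n))) where

  private
    Ψ : F → F
    Ψ X = C (left , s) (C (left , g) X)
    Ψ-linear : Linear Ψ
    Ψ-linear = ∘-linear (C-linear (left , s)) (C-linear (left , g))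

  -- The doubled `Tq` terms in `C-sg` are exactly what subtracting 2 C_s cancels, which explains
  -- that coefficient.
  κ-Sq-suc : ∀ n → κ g (Sq (suc n)) ≐ sh (+ 3) (Z (2 ℕ.+ n)) +F [2] Z (1 ℕ.+ n) +F sh (- (+ 3)) (Z n)
  κ-Sq-suc n = +F-cong (l-cong Ψ-linear (C-s-Sq (suc n)) ∙ linear-pair Ψ-linear (Tq n) (Tq (suc n)) ∙ +F-cong (sh-cong _ (C-sg n)) (sh-cong _ (C-sg (suc n))))
      (•-cong (- (+ 2)) (C-s-Sq (suc n)))
    ∙ mk≐ λ x m → trans
        (cong₂ _+ℤ_ (cong₂ _+ℤ_
            (cong₂ (λ i j → Z n x i +ℤ (Tq n x (m +ℤ - (+ 1)) +ℤ Tq n x (m +ℤ - (+ 1))) +ℤ Z (suc n) x j) (ℤₚ.+-assoc m (- (+ 1)) (- (+ 2))) (ℤₚ.+-assoc m (- (+ 1)) (+ 2)))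
            (cong₂ (λ i j → Z (suc n) x i +ℤ (Tq (suc n) x (m +ℤ + 1) +ℤ Tq (suc n) x (m +ℤ + 1)) +ℤ Z (2 ℕ.+ n) x j) (ℤₚ.+-assoc m (+ 1) (- (+ 2))) (ℤₚ.+-assoc m (+ 1) (+ 2)))) refl)
        (lem (Z n x (m +ℤ - (+ 3))) (Tq n x (m +ℤ - (+ 1))) (Z (suc n) x (m +ℤ + 1)) (Z (suc n) x (m +ℤ - (+ 1))) (Tq (suc n) x (m +ℤ + 1)) (Z (2 ℕ.+ n) x (m +ℤ + 3)))
    where
    lem : ∀ z t z₁ z₂ t′ z₃ → z +ℤ (t +ℤ t) +ℤ z₁ +ℤ (z₂ +ℤ (t′ +ℤ t′) +ℤ z₃) +ℤ - (+ 2) *ℤ (t +ℤ t′) ≡ z₃ +ℤ (z₁ +ℤ z₂) +ℤ z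
    lem = solve-∀

  κ-Sq-0 : Z 0 ≐ 0F → κ g (Sq 0) ≐ sh (+ 3) (Z 1)
  κ-Sq-0 Z0 = +F-cong (l-cong Ψ-linear (C-s-Sq 0) ∙ linear-pair Ψ-linear 0F (Tq 0) ∙ +F-cong (sh-cong (- (+ 1)) (linear-0 Ψ-linear)) (sh-cong _ (C-sg 0)))
      (•-cong (- (+ 2)) (C-s-Sq 0))
    ∙ mk≐ λ x m → trans
        (cong₂ (λ z i → + 0 +ℤ (z +ℤ (Tq 0 x (m +ℤ + 1) +ℤ Tq 0 x (m +ℤ + 1)) +ℤ Z 1 x i) +ℤ - (+ 2) *ℤ (+ 0 +ℤ Tq 0 x (m +ℤ + 1)))
          (at Z0 x (m +ℤ + 1 +ℤ - (+ 2))) (ℤₚ.+-assoc m (+ 1) (+ 2)))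
        (lem (Tq 0 x (m +ℤ + 1)) (Z 1 x (m +ℤ + 3)))
    where
    lem : ∀ t z → + 0 +ℤ (+ 0 +ℤ (t +ℤ t) +ℤ z) +ℤ - (+ 2) *ℤ (+ 0 +ℤ t) ≡ z
    lem = solve-∀

Eq : ℕ → F
Eq n = C (left , r) (Zt n) +F C (left , t) (Zr n)

Φ₂-Sq-suc : ∀ n → Φ₂ (Sq (suc n)) ≐ sh (+ 3) (Sq (2 ℕ.+ n)) +F [2] Sq (1 ℕ.+ n) +F sh (- (+ 3)) (Sq n) +F Eq (suc n)
Φ₂-Sq-suc n = l-cong Ψ-linear (C-s-Sq (suc n)) ∙ linear-pair Ψ-linear (Tq n) (Tq (suc n)) ∙ +F-cong (sh-cong _ (C-tr-Tq n)) (sh-cong _ (C-tr-Tq (suc n)))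
  ∙ mk≐ (λ x m → trans
      (cong₂ _+ℤ_
        (cong₂ (λ i j → Sq n x i +ℤ (Hq n x (m +ℤ - (+ 1)) +ℤ Wq n x (m +ℤ - (+ 1))) +ℤ Sq (suc n) x j) (ℤₚ.+-assoc m (- (+ 1)) (- (+ 2))) (ℤₚ.+-assoc m (- (+ 1)) (+ 2)))
        (cong₂ (λ i j → Sq (suc n) x i +ℤ (Hq (suc n) x (m +ℤ + 1) +ℤ Wq (suc n) x (m +ℤ + 1)) +ℤ Sq (2 ℕ.+ n) x j) (ℤₚ.+-assoc m (+ 1) (- (+ 2))) (ℤₚ.+-assoc m (+ 1) (+ 2))))
      (lem (Sq n x (m +ℤ - (+ 3))) (Hq n x (m +ℤ - (+ 1))) (Wq n x (m +ℤ - (+ 1))) (Sq (suc n) x (m +ℤ + 1)) (Sq (suc n) x (m +ℤ - (+ 1)))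
        (Hq (suc n) x (m +ℤ + 1)) (Wq (suc n) x (m +ℤ + 1)) (Sq (2 ℕ.+ n) x (m +ℤ + 3))))
  ∙ +F-cong (≐-refl {sh (+ 3) (Sq (2 ℕ.+ n)) +F [2] Sq (1 ℕ.+ n) +F sh (- (+ 3)) (Sq n)}) (+F-cong (≐-sym (C-r-Zt n)) (≐-sym (C-t-Zr n)))
  where
  Ψ-linear : Linear (λ X → C (left , t) (C (left , r) X))
  Ψ-linear = ∘-linear (C-linear (left , t)) (C-linear (left , r))
  lem : ∀ z h w s₁ s₂ h′ w′ z₃ → z +ℤ (h +ℤ w) +ℤ s₁ +ℤ (s₂ +ℤ (h′ +ℤ w′) +ℤ z₃) ≡ z₃ +ℤ (s₁ +ℤ s₂) +ℤ z +ℤ (h +ℤ w′ +ℤ (w +ℤ h′))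
  lem = solve-∀

-- Here `Hq 0` and `Wq 0` collapse to `Sq 0`. The stray term `↑ Sq 0` is why C_(x_n) is a sum over
-- several squares: it supplies the smaller square in `fam Sq 2`.
Φ₂-Sq-0 : Φ₂ (Sq 0) ≐ sh (+ 3) (Sq 1) +F [2] Sq 0 +F ↑ Sq 0
Φ₂-Sq-0 = l-cong Ψ-linear (C-s-Sq 0) ∙ linear-pair Ψ-linear 0F (Tq 0)
  ∙ +F-cong (sh-cong (- (+ 1)) (linear-0 Ψ-linear)) (sh-cong _ (C-tr-Tq 0 ∙ +F-cong (+F-cong (≐-refl {sh (- (+ 2)) (Sq 0)}) (+F-cong Hq-0 Wq-0)) (≐-refl {sh (+ 2) (Sq 1)})))
  ∙ mk≐ λ x m → trans
      (cong₂ (λ i j → + 0 +ℤ (Sq 0 x i +ℤ (Sq 0 x (m +ℤ + 1) +ℤ Sq 0 x (m +ℤ + 1)) +ℤ Sq 1 x j)) (ℤₚ.+-assoc m (+ 1) (- (+ 2))) (ℤₚ.+-assoc m (+ 1) (+ 2)))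
      (lem (Sq 0 x (m +ℤ - (+ 1))) (Sq 0 x (m +ℤ + 1)) (Sq 1 x (m +ℤ + 3)))
  where
  Ψ-linear : Linear (λ X → C (left , t) (C (left , r) X))
  Ψ-linear = ∘-linear (C-linear (left , t)) (C-linear (left , r))
  lem : ∀ p q u → + 0 +ℤ (p +ℤ (q +ℤ q) +ℤ u) ≡ u +ℤ (q +ℤ p) +ℤ q
  lem = solve-∀

-- The length of r t (s r t)^n.
ex : ℕ → ℕ
ex zero = 2
ex (suc n) = 3 ℕ.+ ex n

-- fam P (n + 1) is the sum of v^(-i - ex (n - i)) P (n - i) over i ≤ n; fam Sq (n + 1) turns out to be C_w for w = xw n.
fam : (ℕ → F) → ℕ → F
fam P zero = 0F
fam P (suc n) = ↑ fam P n +F sh (+ ex n) (P n)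

fam-linear : ∀ {Φ} → Linear Φ → ∀ P n → Φ (fam P n) ≐ fam (λ k → Φ (P k)) n
fam-linear l P zero = linear-0 l
fam-linear l P (suc n) = l-+ l _ _ ∙ +F-cong (l-sh l _ _ ∙ sh-cong _ (fam-linear l P n)) (l-sh l _ _)

fam-+ : ∀ P Q n → fam (λ k → P k +F Q k) n ≐ fam P n +F fam Q n
fam-+ P Q zero = ≐-refl
fam-+ P Q (suc n) = mk≐ λ x m → trans (cong (_+ℤ (P n x (m +ℤ + ex n) +ℤ Q n x (m +ℤ + ex n))) (at (fam-+ P Q n) x (m +ℤ + 1)))
  (+-interchange (fam P n x (m +ℤ + 1)) (fam Q n x (m +ℤ + 1)) (P n x (m +ℤ + ex n)) (Q n x (m +ℤ + ex n)))

-- The shifts by 3 in `step′` match ex (n + 1) = 3 + ex n, so the weights of `fam` turn the relation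
-- between single squares into one between sums without powers of v beyond v + v^-1. The boundary
-- behaviour is confined to `start`.
module Recurrence (Θ : F → F) (l : Linear Θ) (P E : ℕ → F)
  (step′ : ∀ n → Θ (Sq (suc n)) ≐ sh (+ 3) (P (2 ℕ.+ n)) +F [2] P (1 ℕ.+ n) +F sh (- (+ 3)) (P n) +F E (suc n))
  (start : Θ (fam Sq 1) ≐ fam P 2 +F [2] fam P 1 +F fam P 0 +F fam E 1) where

  recurrence : ∀ n → Θ (fam Sq (suc n)) ≐ fam P (2 ℕ.+ n) +F [2] fam P (1 ℕ.+ n) +F fam P n +F fam E (suc n)
  recurrence zero = start
  recurrence (suc n) = l-+ l (↑ fam Sq (suc n)) (sh (+ ex (suc n)) (Sq (suc n)))
    ∙ +F-cong (l-sh l (+ 1) (fam Sq (suc n)) ∙ sh-cong _ (recurrence n)) (l-sh l (+ ex (suc n)) (Sq (suc n)) ∙ sh-cong _ (step′ n))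
    ∙ mk≐ λ x m → trans
        (cong (A x m +ℤ_)
          (cong (λ i → P (2 ℕ.+ n) x (m +ℤ + ex (suc n) +ℤ + 3) +ℤ (P (suc n) x (m +ℤ + ex (suc n) +ℤ + 1) +ℤ P (suc n) x (m +ℤ + ex (suc n) +ℤ - (+ 1))) +ℤ P n x i +ℤ E (suc n) x (m +ℤ + ex (suc n))) (i₁ m (+ ex n))
          ))
        (trans (cong₂ (λ i j → A x m +ℤ (P (2 ℕ.+ n) x i +ℤ j +ℤ P n x (m +ℤ + ex n) +ℤ E (suc n) x (m +ℤ + ex (suc n)))) (i₂ m (+ ex (suc n)))
                 (cong₂ (λ i j → P (suc n) x i +ℤ P (suc n) x j) (+-swapʳ m (+ ex (suc n)) (+ 1)) (+-swapʳ m (+ ex (suc n)) (- (+ 1)))))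
          (trans (cong (λ i → fam P (2 ℕ.+ n) x (m +ℤ + 1) +ℤ (fam P (suc n) x (m +ℤ + 1 +ℤ + 1) +ℤ fam P (suc n) x i) +ℤ fam P n x (m +ℤ + 1) +ℤ fam E (suc n) x (m +ℤ + 1)
                +ℤ (P (2 ℕ.+ n) x (m +ℤ + ex (2 ℕ.+ n)) +ℤ (P (suc n) x (m +ℤ + 1 +ℤ + ex (suc n)) +ℤ P (suc n) x (m +ℤ - (+ 1) +ℤ + ex (suc n))) +ℤ P n x (m +ℤ + ex n) +ℤ E (suc n) x (m +ℤ + ex (suc n)))) (+-swapʳ m (+ 1) (- (+ 1))))
            (lem (fam P (2 ℕ.+ n) x (m +ℤ + 1)) (fam P (suc n) x (m +ℤ + 1 +ℤ + 1)) (fam P (suc n) x (m +ℤ - (+ 1) +ℤ + 1)) (fam P n x (m +ℤ + 1)) (fam E (suc n) x (m +ℤ + 1))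
              (P (2 ℕ.+ n) x (m +ℤ + ex (2 ℕ.+ n))) (P (suc n) x (m +ℤ + 1 +ℤ + ex (suc n))) (P (suc n) x (m +ℤ - (+ 1) +ℤ + ex (suc n))) (P n x (m +ℤ + ex n)) (E (suc n) x (m +ℤ + ex (suc n))))))
    where
    A : W → ℤ → ℤ
    A x m = fam P (2 ℕ.+ n) x (m +ℤ + 1) +ℤ (fam P (suc n) x (m +ℤ + 1 +ℤ + 1) +ℤ fam P (suc n) x (m +ℤ + 1 +ℤ - (+ 1))) +ℤ fam P n x (m +ℤ + 1) +ℤ fam E (suc n) x (m +ℤ + 1)
    i₁ : ∀ m k → m +ℤ (+ 3 +ℤ k) +ℤ - (+ 3) ≡ m +ℤ k
    i₁ = solve-∀
    i₂ : ∀ m k → m +ℤ k +ℤ + 3 ≡ m +ℤ (+ 3 +ℤ k)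
    i₂ = solve-∀
    lem : ∀ f₂ f₁ g₁ f₀ e p₂ p₁ q₁ p₀ e′ → f₂ +ℤ (f₁ +ℤ g₁) +ℤ f₀ +ℤ e +ℤ (p₂ +ℤ (p₁ +ℤ q₁) +ℤ p₀ +ℤ e′)
      ≡ f₂ +ℤ p₂ +ℤ (f₁ +ℤ p₁ +ℤ (g₁ +ℤ q₁)) +ℤ (f₀ +ℤ p₀) +ℤ (e +ℤ e′)
    lem = solve-∀

-- Bar-invariance of the sums of squares

Inv-0 : Inv 0F
Inv-0 = Inv-cong (mk≐ λ _ _ → refl) (Inv-• (+ 0) Inv-δ)

private
  isolate : ∀ {X A B C D} → X ≐ A +F B +F C +F D → Inv X → Inv B → Inv C → Inv D → Inv A
  isolate {X} {A} {B} {C} {D} p iX iB iC iD =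
    Inv-cong (mk≐ λ x n → trans (cong (λ u → u +ℤ - (+ 1) *ℤ (B x n +ℤ C x n +ℤ D x n)) (at p x n)) (lem (A x n) (B x n) (C x n) (D x n)))
      (Inv-+ iX (Inv-• (- (+ 1)) (Inv-+ (Inv-+ iB iC) iD)))
    where
    lem : ∀ a b c d → a +ℤ b +ℤ c +ℤ d +ℤ - (+ 1) *ℤ (b +ℤ c +ℤ d) ≡ a
    lem = solve-∀

0F-fam : ∀ n → fam (λ _ → 0F) n ≐ 0F
0F-fam zero = ≐-refl
0F-fam (suc n) = mk≐ λ x m → trans (cong (_+ℤ + 0) (at (0F-fam n) x (m +ℤ + 1))) refl

fam-1 : ∀ P → fam P 1 ≐ sh (+ 2) (P 0)
fam-1 P = mk≐ λ x m → ℤₚ.+-identityˡ (P 0 x (m +ℤ + 2))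

-- In terms of d_n = fam Sq (n + 1) and b_n = fam Z (n + 1): κ d_n = b_(n+1) + [2] b_n + b_(n-1).
module KappaRecurrence (g : Gen) (Z : ℕ → F) (Z0 : Z 0 ≐ 0F)
  (C-sg : ∀ n → C (left , s) (C (left , g) (Tq n)) ≐ sh (- (+ 2)) (Z n) +F (Tq n +F Tq n) +F sh (+ 2) (Z (suc n))) where

  fam-Z-1 : fam Z 1 ≐ 0F
  fam-Z-1 = fam-1 Z ∙ sh-cong (+ 2) Z0

  private
    lem : ∀ z → z ≡ + 0 +ℤ z +ℤ (+ 0 +ℤ + 0) +ℤ + 0 +ℤ + 0
    lem = solve-∀
    start : κ g (fam Sq 1) ≐ fam Z 2 +F [2] fam Z 1 +F fam Z 0 +F fam (λ _ → 0F) 1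
    start = l-cong (κ-linear g) (fam-1 Sq) ∙ l-sh (κ-linear g) (+ 2) (Sq 0) ∙ sh-cong (+ 2) (KappaSquare.κ-Sq-0 g Z C-sg Z0)
      ∙ mk≐ (λ x m → trans (cong (Z 1 x) (ℤₚ.+-assoc m (+ 2) (+ 3))) (trans (lem (Z 1 x (m +ℤ + 5)))
          (sym (cong₂ (λ u v → u +ℤ Z 1 x (m +ℤ + 5) +ℤ (u +ℤ v) +ℤ + 0 +ℤ + 0) (at fam-Z-1 x (m +ℤ + 1)) (at fam-Z-1 x (m +ℤ - (+ 1)))))))

  open Recurrence (κ g) (κ-linear g) Z (λ _ → 0F)
    (λ n → KappaSquare.κ-Sq-suc g Z C-sg n ∙ mk≐ (λ x m → sym (ℤₚ.+-identityʳ _))) start public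

module Kt = KappaRecurrence t Zt Zt-0 C-st-Tq
module Kr = KappaRecurrence r Zr Zr-0 C-sr-Tq

private
  start₂ : Φ₂ (fam Sq 1) ≐ fam Sq 2 +F [2] fam Sq 1 +F fam Sq 0 +F fam Eq 1
  start₂ = l-cong Φ₂-linear (fam-1 Sq) ∙ l-sh Φ₂-linear (+ 2) (Sq 0) ∙ sh-cong (+ 2) Φ₂-Sq-0
    ∙ mk≐ λ x m → trans (cong₂ (λ i j → Sq 1 x i +ℤ (Sq 0 x j +ℤ Sq 0 x (m +ℤ + 2 +ℤ - (+ 1))) +ℤ Sq 0 x j) (ℤₚ.+-assoc m (+ 2) (+ 3)) (+-swapʳ m (+ 2) (+ 1)))
        (trans (cong (λ j → Sq 1 x (m +ℤ + 5) +ℤ (Sq 0 x (m +ℤ + 1 +ℤ + 2) +ℤ Sq 0 x j) +ℤ Sq 0 x (m +ℤ + 1 +ℤ + 2)) (+-swapʳ m (+ 2) (- (+ 1))))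
          (trans (lem (Sq 1 x (m +ℤ + 5)) (Sq 0 x (m +ℤ + 1 +ℤ + 2)) (Sq 0 x (m +ℤ - (+ 1) +ℤ + 2)))
            (cong (λ e → + 0 +ℤ Sq 0 x (m +ℤ + 1 +ℤ + 2) +ℤ Sq 1 x (m +ℤ + 5) +ℤ (+ 0 +ℤ Sq 0 x (m +ℤ + 1 +ℤ + 2) +ℤ (+ 0 +ℤ Sq 0 x (m +ℤ - (+ 1) +ℤ + 2))) +ℤ + 0 +ℤ e)
              (sym (at E0 x m)))))
    where
    E0 : fam Eq 1 ≐ 0F
    E0 = fam-1 Eq ∙ sh-cong (+ 2) {Eq 0} {0F} (+F-cong (l-cong (C-linear (left , r)) Zt-0 ∙ linear-0 (C-linear (left , r))) (l-cong (C-linear (left , t)) Zr-0 ∙ linear-0 (C-linear (left , t))) ∙ mk≐ (λ _ _ → refl))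
    lem : ∀ a b c → a +ℤ (b +ℤ c) +ℤ b ≡ + 0 +ℤ b +ℤ a +ℤ (+ 0 +ℤ b +ℤ (+ 0 +ℤ c)) +ℤ + 0 +ℤ + 0
    lem = solve-∀

open Recurrence Φ₂ Φ₂-linear Sq Eq Φ₂-Sq-suc start₂ using () renaming (recurrence to Φ₂-recurrence)

private
  indicator-e : I (λ z → z == e) ≐ δ e
  indicator-e = mk≐ λ z n → cases z n (z ≟W e)
    where
    cases : ∀ z n → Dec (z ≡ e) → I (λ z → z == e) z n ≡ δ e z n
    cases z n (no p) = trans (if-false (≢⇒==false p)) (sym (δ-diff n p))
    cases z n (yes p) = trans (if-true (trans (cong (_== e) p) (==-refl e)))
      (trans (cong unit (trans (cong (λ l → n +ℤ - (+ l)) (trans (cong len p) len-e)) (ℤₚ.+-identityʳ n)))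
        (sym (trans (cong (λ x → δ e x n) p) (δ-same e n))))

  te : W
  te = act (left , t) e

  -- The set {e , t}, through which <r,t> is built up from {e}: C_t enlarges {e} to it, and C_r
  -- enlarges it to <r,t>.
  A₁ : W → Bool
  A₁ z = (z == e) ∨ (z == te)

  dn-t-e : dn (left , t) e ≡ false
  dn-t-e = dn-word t [] false refl

  dn-r-e : dn (left , r) e ≡ false
  dn-r-e = dn-word r [] false refl

  dn-r-te : dn (left , r) te ≡ false
  dn-r-te = trans (cong (dn (left , r)) (act-eval t [])) (dn-word r (t ∷ []) false refl)

  ==-≡ : ∀ {x y} → x ≡ y → (x == y) ≡ true
  ==-≡ {x} refl = ==-refl x

  A₁-cases : ∀ z → A₁ z ≡ true → z ≡ e ⊎ z ≡ te
  A₁-cases z q = Data.Sum.map (==⇒≡ {z} {e}) (==⇒≡ {z} {te}) (∨-elim {z == e} {z == te} q)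
    where import Data.Sum

  A₁-e : ∀ z → z ≡ e → A₁ z ≡ true
  A₁-e z p = cong (_∨ (z == te)) (==-≡ p)

  A₁-te : ∀ z → z ≡ te → A₁ z ≡ true
  A₁-te z p = trans (cong ((z == e) ∨_) (==-≡ p)) (𝔹ₚ.∨-zeroʳ (z == e))

  A₁-up : ∀ z → A₁ z ≡ true → dn (left , r) z ≡ false
  A₁-up z q = cases (A₁-cases z q)
    where
    cases : z ≡ e ⊎ z ≡ te → dn (left , r) z ≡ false
    cases (inj₁ p) = trans (cong (dn (left , r)) p) dn-r-e
    cases (inj₂ p) = trans (cong (dn (left , r)) p) dn-r-te

  false-from : ∀ {b : Bool} → ¬ (b ≡ true) → false ≡ b
  false-from p = sym (¬⇒false p)

  I-false : I (λ _ → false) ≐ 0F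
  I-false = mk≐ λ _ _ → refl

  clash : ∀ {σ z} → dn σ z ≡ false → dn σ (act σ z) ≡ false → ⊥
  clash {σ} {z} p q = true≢false (trans (sym (trans (dn-act σ z) (cong not p))) q)

  C-t-δ : C (left , t) (δ e) ≐ ↑ I A₁
  C-t-δ = l-cong (C-linear (left , t)) (≐-sym indicator-e)
    ∙ C-indicator t (λ z → z == e) (λ _ → false) A₁ inter union low
    ∙ +F-cong (sh-cong (- (+ 1)) I-false) (≐-refl {↑ I A₁}) ∙ mk≐ (λ x n → ℤₚ.+-identityˡ _)
    where
    inter : ∀ z → false ≡ (z == e) ∧ (act (left , t) z == e)
    inter z = false-from (λ q → let (p , p′) = ∧-elim {z == e} q in
      clash {left , t} {z} (trans (cong (dn (left , t)) (==⇒≡ {z} {e} p)) dn-t-e) (trans (cong (dn (left , t)) (==⇒≡ {act (left , t) z} {e} p′)) dn-t-e))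
    union : ∀ z → A₁ z ≡ (z == e) ∨ (act (left , t) z == e)
    union z = cong ((z == e) ∨_) (true-iff (λ q → ==-≡ (sym (act-swap (left , t) (sym (==⇒≡ {z} {te} q))))) (λ q → ==-≡ (act-swap (left , t) (==⇒≡ {act (left , t) z} {e} q))))
    low : ∀ z → dn (left , t) z ≡ true → (z == e) ≡ true → (act (left , t) z == e) ≡ true
    low z d q = ⊥-elim (true≢false (trans (sym d) (trans (cong (dn (left , t)) (==⇒≡ {z} {e} q)) dn-t-e)))

Origin : W → Set
Origin z = cX z ≡ + 0 × cY z ≡ + 0

Origin-r : ∀ z → Origin z → Origin (act (left , r) z)
Origin-r z (p , q) = trans (cX-r z) (cong -_ p) , trans (cY-r z) q

Origin-t : ∀ z → Origin z → Origin (act (left , t) z)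
Origin-t z (p , q) = trans (cX-t z) p , trans (cY-t z) (cong -_ q)

Origin-e : Origin e
Origin-e = cX-e , cY-e

private
  rect0⇒ : ∀ z → rect (+ 0) (+ 0) (+ 0) (+ 0) z ≡ true → Origin z
  rect0⇒ z q = let (rc p p′ u u′) = rect⇒ {+ 0} {+ 0} {+ 0} {+ 0} z q in zero-of (cX z) p p′ , zero-of (cY z) u u′

  ⇒rect0 : ∀ z → Origin z → rect (+ 0) (+ 0) (+ 0) (+ 0) z ≡ true
  ⇒rect0 z (p , q) = ⇒rect {+ 0} {+ 0} {+ 0} {+ 0} z
    (rc (proj₁ (of-zero p)) (proj₂ (of-zero p)) (proj₁ (of-zero q)) (proj₂ (of-zero q)))

  A₁-Origin : ∀ z → A₁ z ≡ true → Origin z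
  A₁-Origin z q = cases (A₁-cases z q)
    where
    cases : z ≡ e ⊎ z ≡ te → Origin z
    cases (inj₁ p) = subst Origin (sym p) Origin-e
    cases (inj₂ p) = subst Origin (sym p) (Origin-t e Origin-e)

  C-r-A₁ : C (left , r) (I A₁) ≐ ↑ Sq 0
  C-r-A₁ = C-indicator r A₁ (λ _ → false) (rect (+ 0) (+ 0) (+ 0) (+ 0)) inter union low
    ∙ +F-cong (sh-cong (- (+ 1)) I-false) (≐-refl {↑ Sq 0}) ∙ mk≐ (λ x n → ℤₚ.+-identityˡ _)
    where
    inter : ∀ z → false ≡ A₁ z ∧ A₁ (act (left , r) z)
    inter z = false-from (λ q → let (p , p′) = ∧-elim {A₁ z} q in clash {left , r} {z} (A₁-up z p) (A₁-up _ p′))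
    low : ∀ z → dn (left , r) z ≡ true → A₁ z ≡ true → A₁ (act (left , r) z) ≡ true
    low z d q = ⊥-elim (true≢false (trans (sym d) (A₁-up z q)))
    union : ∀ z → rect (+ 0) (+ 0) (+ 0) (+ 0) z ≡ A₁ z ∨ A₁ (act (left , r) z)
    union z = true-iff (λ q → let (p , p′) = rect0⇒ z q in cases (cX≡0×cY≡0 z p p′)) (λ q → ⇒rect0 z (back (∨-elim {A₁ z} q)))
      where
      cases : z ≡ e ⊎ z ≡ te ⊎ z ≡ act (left , r) e ⊎ z ≡ act (left , r) te → A₁ z ∨ A₁ (act (left , r) z) ≡ true
      cases (inj₁ p) = cong (_∨ A₁ (act (left , r) z)) (A₁-e z p)
      cases (inj₂ (inj₁ p)) = cong (_∨ A₁ (act (left , r) z)) (A₁-te z p)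
      cases (inj₂ (inj₂ (inj₁ p))) = trans (cong (A₁ z ∨_) (A₁-e _ (sym (act-swap (left , r) (sym p))))) (𝔹ₚ.∨-zeroʳ (A₁ z))
      cases (inj₂ (inj₂ (inj₂ p))) = trans (cong (A₁ z ∨_) (A₁-te _ (sym (act-swap (left , r) (sym p))))) (𝔹ₚ.∨-zeroʳ (A₁ z))
      back : A₁ z ≡ true ⊎ A₁ (act (left , r) z) ≡ true → Origin z
      back (inj₁ q) = A₁-Origin z q
      back (inj₂ q) = subst Origin (act² (left , r) z) (Origin-r _ (A₁-Origin _ q))

-- The points over the origin form <r,t>, so this element is C_r C_t.
Inv-fam-Sq-1 : Inv (fam Sq 1)
Inv-fam-Sq-1 = Inv-cong (l-cong (C-linear (left , r)) C-t-δ ∙ l-sh (C-linear (left , r)) (+ 1) (I A₁) ∙ sh-cong (+ 1) C-r-A₁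
    ∙ sh-sh (+ 1) (+ 1) (Sq 0) ∙ ≐-sym (fam-1 Sq))
  (Inv-C (left , r) (Inv-C (left , t) Inv-δ))

-- Each recurrence is of second order and is solved for its highest member, so two consecutive
-- members are carried. The next sum of `Sq` uses the current sums of `Zt` and `Zr`, whose
-- successors in turn use the current sum of `Sq`.
Inv-families : ∀ n → Inv (fam Sq n) × Inv (fam Sq (suc n)) × Inv (fam Zt n) × Inv (fam Zt (suc n)) × Inv (fam Zr n) × Inv (fam Zr (suc n))
Inv-families zero = Inv-0 , Inv-fam-Sq-1 , Inv-0 , Inv-cong (≐-sym Kt.fam-Z-1) Inv-0 , Inv-0 , Inv-cong (≐-sym Kr.fam-Z-1) Inv-0
Inv-families (suc n) =
  let (d₀ , d₁ , b₀ , b₁ , c₀ , c₁) = Inv-families n in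
  d₁ , isolate (Φ₂-recurrence n) (Inv-C (left , t) (Inv-C (left , r) (Inv-C (left , s) d₁))) (Inv-[2] d₁) d₀
         (Inv-cong (≐-sym (fam-+ (λ k → C (left , r) (Zt k)) (λ k → C (left , t) (Zr k)) (suc n)
                    ∙ +F-cong (≐-sym (fam-linear (C-linear (left , r)) Zt (suc n))) (≐-sym (fam-linear (C-linear (left , t)) Zr (suc n)))))
           (Inv-+ (Inv-C (left , r) b₁) (Inv-C (left , t) c₁))) ,
  b₁ , isolate (Kt.recurrence n) (Inv-κ t d₁) (Inv-[2] b₁) b₀ (Inv-cong (≐-sym (0F-fam (suc n))) Inv-0) ,
  c₁ , isolate (Kr.recurrence n) (Inv-κ r d₁) (Inv-[2] c₁) c₀ (Inv-cong (≐-sym (0F-fam (suc n))) Inv-0)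
  where
  Inv-κ : ∀ g {X} → Inv X → Inv (κ g X)
  Inv-κ g i = Inv-+ (Inv-C (left , s) (Inv-C (left , g) (Inv-C (left , s) i))) (Inv-• (- (+ 2)) (Inv-C (left , s) i))

-- Lengths of the elements of a square

InSq : ℕ → W → Set
InSq n z = Rect (+ n) (+ n) (+ n) (+ n) (cX z) (cY z)

private
  reflect₁ : ∀ x n → n +ℤ - x ≡ - x +ℤ n
  reflect₁ = solve-∀
  reflect₂ : ∀ x n → x +ℤ n ≡ n +ℤ - (- x)
  reflect₂ = solve-∀

InSq-r : ∀ n z → InSq n z → InSq n (act (left , r) z)
InSq-r n z (rc p q u v) = subst₂ (Rect (+ n) (+ n) (+ n) (+ n)) (sym (cX-r z)) (sym (cY-r z)) (rc (by (reflect₁ (cX z) (+ n)) q) (by (reflect₂ (cX z) (+ n)) p) u v)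

InSq-t : ∀ n z → InSq n z → InSq n (act (left , t) z)
InSq-t n z (rc p q u v) = subst₂ (Rect (+ n) (+ n) (+ n) (+ n)) (sym (cX-t z)) (sym (cY-t z)) (rc p q (by (reflect₁ (cY z) (+ n)) v) (by (reflect₂ (cY z) (+ n)) u))

InSq-s : ∀ n z → InSq n z → InSq (suc n) (act (left , s) z)
InSq-s n z (rc p q u v) = subst₂ (Rect (+ suc n) (+ suc n) (+ suc n) (+ suc n)) (sym (cX-s z)) (sym (cY-s z))
  (rc (by (l₁ (cY z) (+ n)) u) (by (l₂ (cY z) (+ n)) (Nn-+ v (Nn-ℕ 2))) (by (l₃ (cX z) (+ n)) (Nn-+ p (Nn-ℕ 2))) (by (l₄ (cX z) (+ n)) q))
  where
  l₁ : ∀ y n → y +ℤ n ≡ y +ℤ - (+ 1) +ℤ (+ 1 +ℤ n)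
  l₁ = solve-∀
  l₂ : ∀ y n → n +ℤ - y +ℤ + 2 ≡ + 1 +ℤ n +ℤ - (y +ℤ - (+ 1))
  l₂ = solve-∀
  l₃ : ∀ x n → x +ℤ n +ℤ + 2 ≡ x +ℤ + 1 +ℤ (+ 1 +ℤ n)
  l₃ = solve-∀
  l₄ : ∀ x n → n +ℤ - x ≡ + 1 +ℤ n +ℤ - (x +ℤ + 1)
  l₄ = solve-∀

InSq-xw : ∀ n → InSq n (xw n)
InSq-xw zero = rect⇒ {+ 0} {+ 0} {+ 0} {+ 0} (xw 0) (⇒rect0 (xw 0) (Origin-r _ (Origin-t e Origin-e)))
InSq-xw (suc n) = InSq-r (suc n) _ (InSq-t (suc n) _ (InSq-s n (xw n) (InSq-xw n)))

private
  -- A descent gives Y - X ≥ 1, and equal parity improves this to 2. The extra unit is what moves a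
  -- point from the square n + 1 into the square n.
  gap : ∀ z → dn (left , s) z ≡ true → Nn (cY z +ℤ - cX z +ℤ - (+ 2))
  gap z d = go (c-parity z)
    where
    l₁ : ∀ Y k → Y +ℤ - (Y +ℤ (k +ℤ k)) +ℤ - (+ 1) ≡ (- k +ℤ - (+ 1)) +ℤ (- k +ℤ - (+ 1)) +ℤ + 1
    l₁ = solve-∀
    l₂ : ∀ Y k → - k +ℤ - (+ 1) +ℤ (- k +ℤ - (+ 1)) ≡ Y +ℤ - (Y +ℤ (k +ℤ k)) +ℤ - (+ 2)
    l₂ = solve-∀
    go : (∃ λ k → cX z ≡ cY z +ℤ (k +ℤ k)) → Nn (cY z +ℤ - cX z +ℤ - (+ 2))
    go (k , p) = by (trans (l₂ (cY z) k) (cong (λ x → cY z +ℤ - x +ℤ - (+ 2)) (sym p)))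
      (Nn-odd (- k +ℤ - (+ 1)) (by (trans (cong (λ x → cY z +ℤ - x +ℤ - (+ 1)) p) (l₁ (cY z) k)) (dn-s z d)))

InSq-s-dn : ∀ n z → InSq (suc n) z → dn (left , s) z ≡ true → InSq n (act (left , s) z)
InSq-s-dn n z (rc p q u v) d = subst₂ (Rect (+ n) (+ n) (+ n) (+ n)) (sym (cX-s z)) (sym (cY-s z))
  (rc (by (l₁ (cX z) (cY z) (+ n)) (Nn-+ (gap z d) p)) (by (l₂ (cY z) (+ n)) v) (by (l₃ (cX z) (+ n)) p) (by (l₄ (cX z) (cY z) (+ n)) (Nn-+ (gap z d) v)))
  where
  l₁ : ∀ x y n → y +ℤ - x +ℤ - (+ 2) +ℤ (x +ℤ (+ 1 +ℤ n)) ≡ y +ℤ - (+ 1) +ℤ n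
  l₁ = solve-∀
  l₂ : ∀ y n → + 1 +ℤ n +ℤ - y ≡ n +ℤ - (y +ℤ - (+ 1))
  l₂ = solve-∀
  l₃ : ∀ x n → x +ℤ (+ 1 +ℤ n) ≡ x +ℤ + 1 +ℤ n
  l₃ = solve-∀
  l₄ : ∀ x y n → y +ℤ - x +ℤ - (+ 2) +ℤ (+ 1 +ℤ n +ℤ - y) ≡ n +ℤ - (x +ℤ + 1)
  l₄ = solve-∀

InSq-0-s : ∀ z → InSq 0 z → dn (left , s) z ≡ false
InSq-0-s z (rc p q u v) = ¬⇒false (λ d → ¬Nn-neg (by (lem (cX z) (cY z)) (Nn-+ (Nn-+ (gap z d) p) v)))
  where
  lem : ∀ x y → y +ℤ - x +ℤ - (+ 2) +ℤ (x +ℤ + 0) +ℤ (+ 0 +ℤ - y) ≡ - (+ 2)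
  lem = solve-∀

-- `core` is the shortest element of <r,t> z. The field `full` keeps the case of equality, from
-- which the longest element of a square is identified.
record Stripped (z : W) : Set where
  field
    core : W
    no-r : dn (left , r) core ≡ false
    no-t : dn (left , t) core ≡ false
    len-core : len z ≤ 2 + len core
    full : len z ≡ 2 + len core → z ≡ act (left , r) (act (left , t) core)
    core-sq : ∀ n → InSq n z → InSq n core

strip : ∀ z → Stripped z
strip z = byR (step (left , r) z)
  where
  no-full : ∀ {a k} → a ≤ suc k → a ≢ 2 + k
  no-full {k = k} le eq = ℕₚ.<-irrefl refl (subst (_≤ suc k) eq le)
  -- As r and t commute, removing t cannot create a descent r: otherwise ry would have length at
  -- most l(y) - 1.
  r-after-t : ∀ y → dn (left , r) y ≡ false → dn (left , t) y ≡ true → dn (left , r) (act (left , t) y) ≡ false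
  r-after-t y nr dt = ¬⇒false λ d → ℕₚ.<-irrefl refl (ℕₚ.≤-trans (ℕₚ.n≤1+n (suc ℓ)) (bound d))
    where
    ℓ : ℕ
    ℓ = len (act (left , r) (act (left , t) y))
    bound : dn (left , r) (act (left , t) y) ≡ true → suc (suc ℓ) ≤ ℓ
    bound d = ℕₚ.≤-trans (ℕₚ.≤-reflexive (sym (trans (dn⇒len (left , t) y dt) (cong suc (dn⇒len (left , r) _ d)))))
      (ℕₚ.≤-pred (ℕₚ.≤-trans (ℕₚ.≤-reflexive (sym (up⇒len (left , r) y nr)))
        (ℕₚ.≤-trans (ℕₚ.≤-trans (ℕₚ.≤-reflexive (cong len (sym (act² (left , t) (act (left , r) y))))) (len-act≤ (left , t) _))
          (s≤s (ℕₚ.≤-reflexive (cong len (comm-rt left y)))))))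
  byR : Step (left , r) z → Stripped z
  byR (down d d′ q) = byT (step (left , t) y)
    where
    y : W
    y = act (left , r) z
    byT : Step (left , t) y → Stripped z
    byT (down e e′ p) = record
      { core = act (left , t) y ; no-r = r-after-t y d′ e ; no-t = e′
      ; len-core = ℕₚ.≤-reflexive (trans q (cong suc p))
      ; full = λ _ → trans (sym (act² (left , r) z)) (cong (act (left , r)) (sym (act² (left , t) y)))
      ; core-sq = λ n h → InSq-t n y (InSq-r n z h) }
    byT (up e _ _) = record
      { core = y ; no-r = d′ ; no-t = e ; len-core = ℕₚ.≤-trans (ℕₚ.≤-reflexive q) (ℕₚ.n≤1+n _)
      ; full = λ h → ⊥-elim (no-full (ℕₚ.≤-reflexive q) h) ; core-sq = λ n h → InSq-r n z h }
  byR (up d _ _) = byT (step (left , t) z)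
    where
    byT : Step (left , t) z → Stripped z
    byT (down e e′ p) = record
      { core = act (left , t) z ; no-r = r-after-t z d e ; no-t = e′ ; len-core = ℕₚ.≤-trans (ℕₚ.≤-reflexive p) (ℕₚ.n≤1+n _)
      ; full = λ h → ⊥-elim (no-full (ℕₚ.≤-reflexive p) h) ; core-sq = λ n h → InSq-t n z h }
    byT (up e _ _) = record
      { core = z ; no-r = d ; no-t = e ; len-core = ℕₚ.≤-trans (ℕₚ.n≤1+n _) (ℕₚ.n≤1+n _)
      ; full = λ h → ⊥-elim (no-full (ℕₚ.n≤1+n _) h) ; core-sq = λ n h → h }

has-descent : ∀ z → z ≡ e ⊎ ∃ λ g → dn (left , g) z ≡ true
has-descent z = go (redWord z) (eval-redWord z) (redWord-reduced z)
  where
  go : ∀ A → eval A ≡ z → Reduced A → z ≡ e ⊎ ∃ λ g → dn (left , g) z ≡ true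
  go [] p _ = inj₁ (sym p)
  go (g ∷ A) p red = inj₂ (g , trans (cong (dn (left , g)) (trans (sym p) (sym (act-eval g A)))) (trans (dn-act (left , g) (eval A)) (cong not (dn-reduced g A red))))

-- Stripping r and t removes at most two letters and stays in the square; a further descent can only
-- be s, and it leads into the next smaller square. So each unit of n costs at most three letters,
-- and equality throughout spells r t s at every level.
square-bound : ∀ n z → InSq n z → len z ≤ ex n × (len z ≡ ex n → z ≡ xw n)
square-bound n z h = go n h (has-descent core)
  where
  open Stripped (strip z)
  2≤ex : ∀ n → 2 ≤ ex n
  2≤ex zero = ℕₚ.≤-refl
  2≤ex (suc n) = ℕₚ.≤-trans (2≤ex n) (ℕₚ.m≤n+m (ex n) 3)
  go : ∀ n → InSq n z → core ≡ e ⊎ (∃ λ g → dn (left , g) core ≡ true) → len z ≤ ex n × (len z ≡ ex n → z ≡ xw n)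
  go n h (inj₁ p) = ℕₚ.≤-trans le2 (2≤ex n) , eq n
    where
    len0 : len core ≡ 0
    len0 = trans (cong len p) len-e
    le2 : len z ≤ 2
    le2 = ℕₚ.≤-trans len-core (ℕₚ.≤-reflexive (cong (λ k → 2 + k) len0))
    eq : ∀ n → len z ≡ ex n → z ≡ xw n
    eq zero q = trans (full (trans q (cong (λ k → 2 + k) (sym len0)))) (cong (λ w → act (left , r) (act (left , t) w)) p)
    eq (suc n) q = ⊥-elim (ℕₚ.<-irrefl refl (ℕₚ.≤-trans (ℕₚ.≤-trans (s≤s (s≤s (s≤s z≤n))) (ℕₚ.≤-reflexive (sym q))) le2))
  go n h (inj₂ (r , d)) = ⊥-elim (true≢false (trans (sym d) no-r))
  go n h (inj₂ (t , d)) = ⊥-elim (true≢false (trans (sym d) no-t))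
  go zero h (inj₂ (s , d)) = ⊥-elim (true≢false (trans (sym d) (InSq-0-s core (core-sq 0 h))))
  go (suc n) h (inj₂ (s , d)) = le , eq
    where
    y : W
    y = act (left , s) core
    ih : len y ≤ ex n × (len y ≡ ex n → y ≡ xw n)
    ih = square-bound n y (InSq-s-dn n core (core-sq (suc n) h) d)
    lc : len core ≡ suc (len y)
    lc = dn⇒len (left , s) core d
    le₃ : len z ≤ 3 + len y
    le₃ = ℕₚ.≤-trans len-core (ℕₚ.≤-reflexive (cong (λ k → 2 + k) lc))
    le : len z ≤ 3 + ex n
    le = ℕₚ.≤-trans le₃ (ℕₚ.+-monoʳ-≤ 3 (proj₁ ih))
    eq : len z ≡ 3 + ex n → z ≡ xw (suc n)
    eq q = trans (full (trans q (trans (cong (λ k → 3 + k) (sym ly)) (cong (λ k → 2 + k) (sym lc)))))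
      (cong (λ w → act (left , r) (act (left , t) w)) (trans (act-swap (left , s) refl) (cong (act (left , s)) (proj₂ ih ly))))
      where
      ly : len y ≡ ex n
      ly = ℕₚ.≤-antisym (proj₁ ih) (ℕₚ.+-cancelˡ-≤ 3 (ex n) (len y) (ℕₚ.≤-trans (ℕₚ.≤-reflexive (sym q)) le₃))

ex-3n+2 : ∀ n → ex n ≡ 3 ℕ.* n + 2
ex-3n+2 zero = refl
ex-3n+2 (suc n) = trans (cong (λ k → 3 + k) (ex-3n+2 n)) (cong (λ k → k + 2) (sym (ℕₚ.*-suc 3 n)))

len-xw-ex : ∀ n → len (xw n) ≡ ex n
len-xw-ex n = trans (len-xw n) (sym (ex-3n+2 n))

Sq-cases : ∀ n x k → (InSq n x → unit (k +ℤ - (+ len x)) ≡ + 0) → Sq n x k ≡ + 0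
Sq-cases n x k h = cases (rect (+ n) (+ n) (+ n) (+ n) x) refl
  where
  cases : ∀ b → rect (+ n) (+ n) (+ n) (+ n) x ≡ b → Sq n x k ≡ + 0
  cases false q = if-false q
  cases true q = trans (if-true q) (h (rect⇒ {+ n} {+ n} {+ n} {+ n} x q))

-- In the weighted square k the element T_x has degree l(x) - ex k, at most 0 by `square-bound` and
-- 0 only at `xw k`. The smaller squares carry a further negative power of v.
fam-Sq-nonneg : ∀ n x m → ¬ (m ≡ 0 × x ≡ xw n) → fam Sq (suc n) x (+ m) ≡ + 0
fam-Sq-nonneg n x m ne = cong₂ _+ℤ_ (first n) (Sq-cases n x (+ m +ℤ + ex n) (λ h → unit-≢0 (λ z → ne (zero-case h z))))
  where
  first : ∀ n → fam Sq n x (+ m +ℤ + 1) ≡ + 0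
  first zero = refl
  first (suc n) = fam-Sq-nonneg n x (m + 1) (λ (p , _) → ℕₚ.1+n≢0 (trans (ℕₚ.+-comm 1 m) p))
  zero-case : InSq n x → + m +ℤ + ex n +ℤ - (+ len x) ≡ + 0 → m ≡ 0 × x ≡ xw n
  zero-case h z = m0 , proj₂ (square-bound n x h) (trans (sym sum) (cong (λ k → k + ex n) m0))
    where
    sum : m + ex n ≡ len x
    sum = ℤₚ.+-injective (ℤₚ.i-j≡0⇒i≡j (+ (m + ex n)) (+ len x) z)
    m0 : m ≡ 0
    m0 = ℕₚ.n≤0⇒n≡0 (ℕₚ.+-cancelʳ-≤ (ex n) m 0 (ℕₚ.≤-trans (ℕₚ.≤-reflexive sum) (proj₁ (square-bound n x h))))

-- The coefficients μ on c_2

ex-injective : ∀ m n → ex m ≡ ex n → m ≡ n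
ex-injective zero zero q = refl
ex-injective (suc m) (suc n) q = cong suc (ex-injective m n (ℕₚ.+-cancelˡ-≡ 3 (ex m) (ex n) q))
ex-injective zero (suc n) ()
ex-injective (suc m) zero ()

-- All values of `ex` are 2 modulo 3.
ex-mod3 : ∀ m n → suc (ex m) ≢ ex n
ex-mod3 (suc m) (suc n) q = ex-mod3 m n (ℕₚ.+-cancelˡ-≡ 3 (suc (ex m)) (ex n) q)
ex-mod3 zero (suc zero) ()
ex-mod3 zero (suc (suc n)) ()
ex-mod3 (suc m) zero ()

private
  InSq-len : ∀ k n → InSq k (xw n) → n ≤ k
  InSq-len k n h = ex-reflects n k (ℕₚ.≤-trans (ℕₚ.≤-reflexive (sym (len-xw-ex n))) (proj₁ (square-bound k (xw n) h)))
    where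
    ex-reflects : ∀ n k → ex n ≤ ex k → n ≤ k
    ex-reflects zero k le = z≤n
    ex-reflects (suc n) zero (s≤s (s≤s ()))
    ex-reflects (suc n) (suc k) le = s≤s (ex-reflects n k (ℕₚ.+-cancelˡ-≤ 3 (ex n) (ex k) le))

  fam-Sq-above : ∀ k n → k ≤ n → ∀ m → fam Sq k (xw n) m ≡ + 0
  fam-Sq-above zero n le m = refl
  fam-Sq-above (suc k) n le m = cong₂ _+ℤ_ (fam-Sq-above k n (ℕₚ.≤-trans (ℕₚ.n≤1+n k) le) (m +ℤ + 1))
    (Sq-cases k (xw n) (m +ℤ + ex k) (λ h → ⊥-elim (ℕₚ.<-irrefl refl (ℕₚ.≤-trans le (InSq-len k n h)))))

xw-isKL : ∀ n → IsKL (xw n) (fam Sq (suc n))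
xw-isKL n = record
  { inv-X = proj₁ (proj₂ (Inv-families n))
  ; top-X = λ m → trans (cong₂ _+ℤ_ (fam-Sq-above n n ℕₚ.≤-refl (m +ℤ + 1)) (top m)) (ℤₚ.+-identityˡ (unit m))
  ; neg-X = λ { x (+ m) ne _ → fam-Sq-nonneg n x m (λ (_ , q) → ne q) }
  }
  where
  top : ∀ m → Sq n (xw n) (m +ℤ + ex n) ≡ unit m
  top m = trans (if-true (⇒rect {+ n} {+ n} {+ n} {+ n} (xw n) (InSq-xw n)))
    (cong unit (trans (cong (λ l → m +ℤ + ex n +ℤ - (+ l)) (len-xw-ex n)) (+-cancel m (+ ex n))))

KL-xw : ∀ n → KL (xw n) ≐ fam Sq (suc n)
KL-xw n = IsKL-unique (KL-isKL (xw n)) (xw-isKL n)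

ι : ℕ → ℕ → ℤ
ι m n with suc m ℕ.≟ n
... | yes _ = + 1
... | no _ = + 0

ι-yes : ∀ {m n} → n ≡ suc m → ι m n ≡ + 1
ι-yes {m} refl with suc m ℕ.≟ suc m
... | yes _ = refl
... | no p = ⊥-elim (p refl)

ι-no : ∀ {m n} → n ≢ suc m → ι m n ≡ + 0
ι-no {m} {n} p with suc m ℕ.≟ n
... | yes q = ⊥-elim (p (sym q))
... | no _ = refl

KL-fac-0 : ∀ b m n → KL (fac right b (xw n)) (fac right b (xw (suc m))) (+ 0) ≡ ι m n
KL-fac-0 b m n with suc m ℕ.≟ n
... | yes refl = KL-top-0 (fac right b (xw (suc m)))
... | no p = KL-at-0 _ _ (λ q → p (ex-injective (suc m) n (ℕₚ.+-cancelˡ-≡ (flen b) (ex (suc m)) (ex n)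
    (trans (sym (lengths (suc m))) (trans (cong len q) (lengths n))))))
  where
  lengths : ∀ k → len (fac right b (xw k)) ≡ flen b + ex k
  lengths k = trans (fac-len right (xw k) (shape-right k) b) (cong (λ l → flen b + l) (len-xw-ex k))

-- At `xw m` the largest square has degree divisible by 3 and misses -1. The other squares form v^-1
-- times `fam Sq n`, whose degree 0 part is concentrated at `xw (n - 1)`.
KL-xw-minus-1 : ∀ m n → KL (xw n) (xw m) (- (+ 1)) ≡ ι m n
KL-xw-minus-1 m n = trans (at (KL-xw n) (xw m) (- (+ 1)))
  (trans (cong (fam Sq n (xw m) (+ 0) +ℤ_) (Sq-cases n (xw m) (- (+ 1) +ℤ + ex n) (λ _ → unit-≢0 last)))
    (trans (ℤₚ.+-identityʳ _) (first n)))
  where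
  last : - (+ 1) +ℤ + ex n +ℤ - (+ len (xw m)) ≢ + 0
  last q = ex-mod3 m n (trans (cong suc (sym (len-xw-ex m))) (sym (ℤₚ.+-injective (trans (lem (+ ex n)) (cong (+ 1 +ℤ_) (ℤₚ.i-j≡0⇒i≡j (- (+ 1) +ℤ + ex n) (+ len (xw m)) q))))))
    where
    lem : ∀ k → k ≡ + 1 +ℤ (- (+ 1) +ℤ k)
    lem = solve-∀
  first : ∀ n → fam Sq n (xw m) (+ 0) ≡ ι m n
  first zero = sym (ι-no {m} {0} (λ ()))
  first (suc n) = cases (m ℕ.≟ n)
    where
    cases : Dec (m ≡ n) → fam Sq (suc n) (xw m) (+ 0) ≡ ι m (suc n)
    cases (yes p) = trans (cong (λ k → fam Sq (suc n) (xw k) (+ 0)) p) (trans (top-X (xw-isKL n) (+ 0)) (trans unit-0 (sym (ι-yes (cong suc (sym p))))))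
    cases (no p) = trans (fam-Sq-nonneg n (xw m) 0 (λ (_ , q) → p (ex-injective m n (trans (sym (len-xw-ex m)) (trans (cong len q) (len-xw-ex n))))))
      (sym (ι-no {m} {suc n} (λ q → p (ℕₚ.suc-injective (sym q)))))

μ-el : ∀ a b m n → μ (el a m b) (el a n b) ≡ ι m n +ℤ isS b *ℤ ι m n +ℤ isS a *ℤ ι m n
μ-el a b m n = begin
  μ (el a m b) (el a n b)
    ≡⟨ μ-KL (el a m b) (el a n b) ⟩
  KL (el a n b) (el a m b) (- (+ 1))
    ≡⟨ string-formula left u y (shape-left m b) (shape-left n b) a ⟩
  KL y u (- (+ 1)) +ℤ isS a *ℤ KL y (act (left , t) (act (left , r) (act (left , s) u))) (+ 0)
    ≡⟨ cong₂ (λ p q → p +ℤ isS a *ℤ q) (string-formula right (xw m) (xw n) (shape-right m) (shape-right n) b)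
         (trans (cong (λ z → KL y z (+ 0)) (next-left m b)) (KL-fac-0 b m n)) ⟩
  KL (xw n) (xw m) (- (+ 1)) +ℤ isS b *ℤ KL (xw n) (act (right , t) (act (right , r) (act (right , s) (xw m)))) (+ 0) +ℤ isS a *ℤ ι m n
    ≡⟨ cong₂ (λ p q → p +ℤ isS b *ℤ q +ℤ isS a *ℤ ι m n) (KL-xw-minus-1 m n)
         (trans (cong (λ z → KL (xw n) z (+ 0)) (next-right m)) (KL-fac-0 F0 m n)) ⟩
  ι m n +ℤ isS b *ℤ ι m n +ℤ isS a *ℤ ι m n ∎
  where
  u y : W
  u = fac right b (xw m)
  y = fac right b (xw n)

record InEl (w : W) : Set where
  constructor inEl
  field
    leftFactor rightFactor : Factor
    exponent : ℕ
    decomposition : w ≡ el leftFactor exponent rightFactor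

InC2⇒InEl : ∀ {w} → InC2 w → InEl w
InC2⇒InEl {w} (A , B , m , p , q , eq) = go (left-factor p) (right-factor q)
  where
  left-factor : ∀ {A} → A ∈ leftFactors → ∃ λ a → lword a ≡ A
  left-factor (here refl) = F0 , refl
  left-factor (there (here refl)) = Fs , refl
  left-factor (there (there (here refl))) = Ft , refl
  left-factor (there (there (there (here refl)))) = Fr , refl
  right-factor : ∀ {B} → B ∈ rightFactors → ∃ λ b → rword b ≡ B
  right-factor (here refl) = F0 , refl
  right-factor (there (here refl)) = Fs , refl
  right-factor (there (there (here refl))) = Ft , refl
  right-factor (there (there (there (here refl)))) = Fr , refl
  go : (∃ λ a → lword a ≡ A) → (∃ λ b → rword b ≡ B) → InEl w
  go (a , qa) (b , qb) = inEl a b m (trans eq (trans (cong₂ (λ A B → eval (c2word A m B)) (sym qa) (sym qb)) (eval-c2word a m b)))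

isS-descent : ∀ a → descents a s ≡ true → isS a ≡ + 1
isS-descent Fs _ = refl

isS-ascent : ∀ a → descents a s ≡ false → isS a ≡ + 0
isS-ascent F0 _ = refl
isS-ascent Ft _ = refl
isS-ascent Fr _ = refl

Predicted : ℤ → W → W → Set
Predicted k u w = (len w ≡ len u + 3 → μ u w ≡ k) × (len w ≢ len u + 3 → μ u w ≡ + 0)

predicted : ∀ k a b m n → + 1 +ℤ isS b +ℤ isS a ≡ k → Predicted k (el a m b) (el a n b)
predicted k a b m n q = (λ l → trans formula (trans (cong (λ i → i *ℤ k) (ι-yes (forward l))) (ℤₚ.*-identityˡ k))) ,
                        (λ l → trans formula (cong (λ i → i *ℤ k) (ι-no {m} {n} (λ p → l (backward p)))))
  where
  lem : ∀ i x y → i +ℤ y *ℤ i +ℤ x *ℤ i ≡ i *ℤ (+ 1 +ℤ y +ℤ x)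
  lem = solve-∀
  formula : μ (el a m b) (el a n b) ≡ ι m n *ℤ k
  formula = trans (μ-el a b m n) (trans (lem (ι m n) (isS a) (isS b)) (cong (ι m n *ℤ_) q))
  L : ℕ → ℕ
  L k = flen a + (flen b + ex k)
  len-L : ∀ k → len (el a k b) ≡ L k
  len-L k = trans (len-el a k b) (cong (λ l → flen a + (flen b + l)) (sym (ex-3n+2 k)))
  L-suc : ∀ k → L (suc k) ≡ L k + 3
  L-suc k = trans (cong (λ l → flen a + (flen b + l)) (ℕₚ.+-comm 3 (ex k))) (trans (cong (λ l → flen a + l) (sym (ℕₚ.+-assoc (flen b) (ex k) 3))) (sym (ℕₚ.+-assoc (flen a) (flen b + ex k) 3)))
  forward : len (el a n b) ≡ len (el a m b) + 3 → n ≡ suc m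
  forward l = ex-injective n (suc m) (ℕₚ.+-cancelˡ-≡ (flen b) (ex n) (ex (suc m)) (ℕₚ.+-cancelˡ-≡ (flen a) (flen b + ex n) (flen b + ex (suc m))
    (trans (sym (len-L n)) (trans l (trans (cong (λ l → l + 3) (len-L m)) (sym (L-suc m)))))))
  backward : n ≡ suc m → len (el a n b) ≡ len (el a m b) + 3
  backward p = trans (len-L n) (trans (cong L p) (trans (L-suc m) (cong (λ l → l + 3) (sym (len-L m)))))

Claim : W → W → Set
Claim u w = ((¬ InL s u × ¬ InR s u) → Predicted (+ 1) u w)
  × (((InL s u × ¬ InR s u) ⊎ (InR s u × ¬ InL s u)) → Predicted (+ 2) u w)
  × ((InL s u × InR s u) → Predicted (+ 3) u w)

claim-el : ∀ a b m n → Claim (el a m b) (el a n b)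
claim-el a b m n =
  (λ (p , q) → predicted (+ 1) a b m n (cong₂ (λ y x → + 1 +ℤ y +ℤ x) (noR q) (noL p))) ,
  (λ { (inj₁ (p , q)) → predicted (+ 2) a b m n (cong₂ (λ y x → + 1 +ℤ y +ℤ x) (noR q) (yesL p))
     ; (inj₂ (p , q)) → predicted (+ 2) a b m n (cong₂ (λ y x → + 1 +ℤ y +ℤ x) (yesR p) (noL q)) }) ,
  (λ (p , q) → predicted (+ 3) a b m n (cong₂ (λ y x → + 1 +ℤ y +ℤ x) (yesR q) (yesL p)))
  where
  u : W
  u = el a m b
  yesL : InL s u → isS a ≡ + 1
  yesL p = isS-descent a (trans (sym (el-left-descents a m b s)) (InL⇒dn s u p))
  noL : ¬ InL s u → isS a ≡ + 0
  noL p = isS-ascent a (trans (sym (el-left-descents a m b s)) (¬⇒false (λ d → p (dn⇒InL s u d))))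
  yesR : InR s u → isS b ≡ + 1
  yesR p = isS-descent b (trans (sym (el-right-descents a m b s)) (InR⇒dn s u p))
  noR : ¬ InR s u → isS b ≡ + 0
  noR p = isS-ascent b (trans (sym (el-right-descents a m b s)) (¬⇒false (λ d → p (dn⇒InR s u d))))

theorem5p7 : (u w : W) → InC2 u → InC2 w → u <B w → u ∼L w → u ∼R w →
    ((¬ InL s u × ¬ InR s u) →
    (len w ≡ len u + 3 → μ u w ≡ + 1) × (len w ≢ len u + 3 → μ u w ≡ + 0))
    × (((InL s u × ¬ InR s u) ⊎ (InR s u × ¬ InL s u)) →
    (len w ≡ len u + 3 → μ u w ≡ + 2) × (len w ≢ len u + 3 → μ u w ≡ + 0))
    × ((InL s u × InR s u) →
    (len w ≡ len u + 3 → μ u w ≡ + 3) × (len w ≢ len u + 3 → μ u w ≡ + 0))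
theorem5p7 u w u∈ w∈ _ u∼Lw u∼Rw = go (InC2⇒InEl u∈) (InC2⇒InEl w∈)
  where
  go : InEl u → InEl w → Claim u w
  go (inEl a b m pu) (inEl a′ b′ n pw) = subst₂ Claim (sym pu) (sym (trans pw (cong₂ (λ a b → el a n b) (sym a≡) (sym b≡)))) (claim-el a b m n)
    where
    -- ~_R preserves left descent sets, which determine the left factor; `b≡` is the mirror
    -- statement for ~_L.
    a≡ : a ≡ a′
    a≡ = descents-injective a a′ (λ g → trans (sym (el-left-descents a m b g))
      (trans (cong (dn (left , g)) (sym pu)) (trans (∼R⇒left-descents u∼Rw g) (trans (cong (dn (left , g)) pw) (el-left-descents a′ n b′ g)))))
    b≡ : b ≡ b′
    b≡ = descents-injective b b′ (λ g → trans (sym (el-right-descents a m b g))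
      (trans (cong (dn (right , g)) (sym pu)) (trans (∼L⇒right-descents u∼Lw g) (trans (cong (dn (right , g)) pw) (el-right-descents a′ n b′ g)))))
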